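{- All of the following tuples are universal: $(9,1,4,2,3,1)$, $(9,3,9,1,3,1)$, $(9,5,4,2,4,2)$, $(9,5,5,3,5,1)$, $(9,5,8,4,2,0)$, $(9,5,9,3,3,1)$, $(9,7,4,2,4,2)$, $(9,7,5,3,5,1)$, $(9,7,8,4,2,0)$, $(9,c,3,1,3,1)$ for $c\in\{1,5,7\}$, and $(10,6,10,2,6,4)$.
   Context: For $a_1,b_1,c_1$ positive integers and $a_2,b_2,c_2$ integers with $a_1-a_2$, $b_1-b_2$, $c_1-c_2$ all even, the tuple $(a_1,a_2,b_1,b_2,c_1,c_2)$ is called universal if every nonnegative integer $n$ can be written as $\frac{x(a_1x+a_2)}2+\frac{y(b_1y+b_2)}2+\frac{z(c_1z+c_2)}2$ with $x,y,z\in\mathbb{Z}$. -}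

module Defs where

open import Data.Nat using (ℕ; suc)
open import Data.Integer using (ℤ; +_; _+_; _*_; _-_)
open import Data.Product using (Σ; ∃; _×_; _,_)
open import Relation.Binary.PropositionalEquality using (_≡_)

-- Twice the generalized polygonal value: x (a₁ x + a₂)
-- (the paper's term is x(a₁x+a₂)/2, an integer when a₁ ≡ a₂ mod 2).
twiceTerm : ℤ → ℤ → ℤ → ℤ
twiceTerm a₁ a₂ x = x * (a₁ * x + a₂)

EvenDiff : ℤ → ℤ → Set
EvenDiff u v = Σ ℤ λ k → u - v ≡ (+ 2) * k

-- Representability of n by the ternary sum:
-- n = x(a₁x+a₂)/2 + y(b₁y+b₂)/2 + z(c₁z+c₂)/2, stated after multiplying by 2.
Represents : ℕ → ℤ → ℕ → ℤ → ℕ → ℤ → ℕ → Set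
Represents a₁ a₂ b₁ b₂ c₁ c₂ n =
  Σ ℤ λ x → Σ ℤ λ y → Σ ℤ λ z →
    (+ 2) * (+ n) ≡ twiceTerm (+ a₁) a₂ x + twiceTerm (+ b₁) b₂ y + twiceTerm (+ c₁) c₂ z

Universal : ℕ → ℤ → ℕ → ℤ → ℕ → ℤ → Set
Universal a₁ a₂ b₁ b₂ c₁ c₂ =
  (Σ ℕ λ a → a₁ ≡ suc a) × (Σ ℕ λ b → b₁ ≡ suc b) × (Σ ℕ λ c → c₁ ≡ suc c) ×
  EvenDiff (+ a₁) a₂ × EvenDiff (+ b₁) b₂ × EvenDiff (+ c₁) c₂ ×
  ((n : ℕ) → Represents a₁ a₂ b₁ b₂ c₁ c₂ n)

-- Completing squares turns a representation by one of the tuples into a representation of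
-- N = 72 n + k (or 12 n + 10) by x² + y² + z², x² + 3 y² + 3 z² or x² + y² + 3 z² with congruence
-- conditions on the variables; these are met by changing signs and by automorphs such as
-- (x, y) ↦ ((x + 3 y)/2, (x - y)/2) of x² + 3 y².
--
-- For the three forms, N may be taken squarefree.  Let D = N or 3 N.  If -D is a square modulo some
-- a > 0 whose Legendre symbols at the primes dividing N are suitably prescribed, then N is
-- represented by a ternary lattice of determinant 1 or 3, which reduction theory identifies.
--
-- Such an a is found without primes in arithmetic progressions.  Let χ be the product of the
-- Legendre symbols at the primes of D (times a character modulo 8 if D is even), and
-- R(a) = Σ_{t ∣ a} χ(t).  Then R ≥ 0, R ≥ 1 on squares, and R(a) ≠ 0 forces every prime q of the
-- squarefree part of a prime to D to have χ(q) = 1, which by reciprocity makes -D a square modulo q.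
-- Weight R(a) by X ∸ a, for a ≤ X, and by the factors c² + ε c detecting the prescribed values ε of
-- the symbols c (all but one, as their product is determined).  Expanding these factors, the term
-- with only squares is at least of order X √X since R ≥ 1 on squares, while Dirichlet's hyperbola
-- method bounds every other term by O(X).  Hence the sum does not vanish for large X.

module Submission where

open import Data.Nat as ℕ using (ℕ; zero; suc; z≤n; s≤s; z<s; s<s; NonZero)
import Data.Nat.Properties as ℕₚ
import Data.Nat.DivMod as ℕᵐ
import Data.Nat.Divisibility as ℕᵈ
open import Data.Nat.Primality as ℙ using (Prime)
open import Data.Nat.Induction using (<-wellFounded)
open import Induction.WellFounded using (Acc; acc)
open import Data.Integer as ℤ using (ℤ; +_; -[1+_]; _+_; _*_; _-_; -_; 0ℤ; 1ℤ; -1ℤ; _^_; _≤_; _<_; +≤+) renaming (∣_∣ to abs)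
import Data.Integer.Properties as ℤₚ
import Data.Integer.DivMod as ℤᵐ
open import Data.Integer.Divisibility.Signed as ℤᵈ using (_∣_; divides; quotient)
open import Data.Integer.Tactic.RingSolver using (solve-∀)
import Data.Nat.Tactic.RingSolver as ℕSolver
open import Algebra.Structures using (IsCommutativeMonoid)
open import Data.Nat.Coprimality as Coprimality using (Coprime)
open import Data.Nat.GCD using (module Bézout)
open import Data.Fin as Fin using (Fin)
import Data.Fin.Properties as Finₚ
open import Data.List using (List; []; _∷_)
open import Data.List.Relation.Unary.All as All using (All; []; _∷_)
open import Data.Product using (Σ; ∃; _×_; _,_; proj₁; proj₂)
open import Data.Sum using (_⊎_; inj₁; inj₂)
open import Data.Empty using (⊥; ⊥-elim)
open import Data.Unit using (⊤; tt)
open import Relation.Nullary using (¬_; Dec; yes; no)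
open import Relation.Nullary.Decidable using (from-yes; from-no; _→-dec_; _×-dec_; ¬?)
open import Relation.Binary.PropositionalEquality
open import Data.Nat.Primality.Factorisation using (PrimeFactorisation; factorise)
open import Data.Nat.ListAction using (product)
open import Data.List.Relation.Unary.AllPairs using (AllPairs; []; _∷_)
open import Defs

-- Finite sums and products

choose : ∀ {ℓ} {P : Set ℓ} {A : Set} → Dec P → A → A → A
choose (yes _) a b = a
choose (no  _) a b = b

choose-yes : ∀ {ℓ} {P : Set ℓ} {A : Set} {a b : A} (d : Dec P) → P → choose d a b ≡ a
choose-yes (yes _) _ = refl
choose-yes (no ¬p) p = ⊥-elim (¬p p)

choose-no : ∀ {ℓ} {P : Set ℓ} {A : Set} {a b : A} (d : Dec P) → ¬ P → choose d a b ≡ b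
choose-no (yes p) ¬p = ⊥-elim (¬p p)
choose-no (no _)  _  = refl

module Big {A : Set} {_∙_ : A → A → A} {ε : A} (M : IsCommutativeMonoid _≡_ _∙_ ε) where
  open IsCommutativeMonoid M using (assoc; comm; identityˡ; identityʳ)
  open ≡-Reasoning

  big : ℕ → (ℕ → A) → A
  big zero    f = ε
  big (suc n) f = big n f ∙ f n

  big-cong : ∀ n {f g} → (∀ i → i ℕ.< n → f i ≡ g i) → big n f ≡ big n g
  big-cong zero    h = refl
  big-cong (suc n) h = cong₂ _∙_ (big-cong n λ i i<n → h i (ℕₚ.m<n⇒m<1+n i<n)) (h n ℕₚ.≤-refl)

  big-ε : ∀ n → big n (λ _ → ε) ≡ ε
  big-ε zero    = refl
  big-ε (suc n) = trans (identityʳ _) (big-ε n)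

  interchange : ∀ a b c d → (a ∙ b) ∙ (c ∙ d) ≡ (a ∙ c) ∙ (b ∙ d)
  interchange a b c d = begin
    (a ∙ b) ∙ (c ∙ d) ≡⟨ assoc a b (c ∙ d) ⟩
    a ∙ (b ∙ (c ∙ d)) ≡⟨ cong (a ∙_) (sym (assoc b c d)) ⟩
    a ∙ ((b ∙ c) ∙ d) ≡⟨ cong (λ z → a ∙ (z ∙ d)) (comm b c) ⟩
    a ∙ ((c ∙ b) ∙ d) ≡⟨ cong (a ∙_) (assoc c b d) ⟩
    a ∙ (c ∙ (b ∙ d)) ≡⟨ sym (assoc a c (b ∙ d)) ⟩
    (a ∙ c) ∙ (b ∙ d) ∎

  big-∙ : ∀ n f g → big n (λ i → f i ∙ g i) ≡ big n f ∙ big n g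
  big-∙ zero    f g = sym (identityʳ ε)
  big-∙ (suc n) f g = trans (cong (_∙ (f n ∙ g n)) (big-∙ n f g)) (interchange _ _ _ _)

  big-swap : ∀ m n (f : ℕ → ℕ → A) → big m (λ i → big n (f i)) ≡ big n (λ j → big m (λ i → f i j))
  big-swap zero    n f = sym (big-ε n)
  big-swap (suc m) n f = trans (cong (_∙ big n (f m)) (big-swap m n f)) (sym (big-∙ n _ _))

  big-++ : ∀ m n f → big (m ℕ.+ n) f ≡ big m f ∙ big n (λ i → f (m ℕ.+ i))
  big-++ m zero    f rewrite ℕₚ.+-identityʳ m = sym (identityʳ _)
  big-++ m (suc n) f rewrite ℕₚ.+-suc m n = trans (cong (_∙ f (m ℕ.+ n)) (big-++ m n f)) (assoc _ _ _)

  big-head : ∀ n f → big (suc n) f ≡ f 0 ∙ big n (λ i → f (suc i))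
  big-head n f = trans (big-++ 1 n f) (cong (_∙ big n (λ i → f (suc i))) (identityˡ _))

  only : ℕ → A → ℕ → A
  only k a i = choose (i ℕ.≟ k) a ε

  only-≡ : ∀ k a → only k a k ≡ a
  only-≡ k a = choose-yes (k ℕ.≟ k) refl

  only-≢ : ∀ {k i} a → i ≢ k → only k a i ≡ ε
  only-≢ {k} {i} a i≢k = choose-no (i ℕ.≟ k) i≢k

  big-trivial : ∀ n {f} → (∀ i → i ℕ.< n → f i ≡ ε) → big n f ≡ ε
  big-trivial n h = trans (big-cong n h) (big-ε n)

  big-single : ∀ n {f} k → k ℕ.< n → (∀ i → i ℕ.< n → i ≢ k → f i ≡ ε) → big n f ≡ f k
  big-single (suc n) {f} k k<1+n h with k ℕ.≟ n
  ... | yes refl = trans (cong (_∙ f n) (big-trivial n λ i i<n → h i (ℕₚ.m<n⇒m<1+n i<n) (ℕₚ.<⇒≢ i<n))) (identityˡ _)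
  ... | no  k≢n  = trans (cong (big n f ∙_) (h n ℕₚ.≤-refl (≢-sym k≢n)))
                  (trans (identityʳ _) (big-single n k (ℕₚ.≤∧≢⇒< (ℕₚ.≤-pred k<1+n) k≢n)
                            λ i i<n → h i (ℕₚ.m<n⇒m<1+n i<n)))

  big-only : ∀ n k a → k ℕ.< n → big n (only k a) ≡ a
  big-only n k a k<n = trans (big-single n k k<n λ i _ → only-≢ a) (only-≡ k a)

  big-reindex : ∀ n (g : ℕ → A) (σ τ : ℕ → ℕ) →
                (∀ i → i ℕ.< n → σ i ℕ.< n) → (∀ i → i ℕ.< n → τ i ℕ.< n) →
                (∀ i → i ℕ.< n → τ (σ i) ≡ i) → (∀ i → i ℕ.< n → σ (τ i) ≡ i) →
                big n (λ i → g (σ i)) ≡ big n g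
  big-reindex n g σ τ σ< τ< τσ στ = begin
    big n (λ i → g (σ i))
      ≡⟨ big-cong n (λ i i<n → sym (big-only n (σ i) (g (σ i)) (σ< i i<n))) ⟩
    big n (λ i → big n (λ j → only (σ i) (g (σ i)) j))
      ≡⟨ big-swap n n _ ⟩
    big n (λ j → big n (λ i → only (σ i) (g (σ i)) j))
      ≡⟨ big-cong n inner ⟩
    big n g ∎
    where
    inner : ∀ j → j ℕ.< n → big n (λ i → only (σ i) (g (σ i)) j) ≡ g j
    inner j j<n = begin
      big n (λ i → only (σ i) (g (σ i)) j)
        ≡⟨ big-single n (τ j) (τ< j j<n) (λ i i<n i≢τj → only-≢ _ λ j≡σi → i≢τj (trans (sym (τσ i i<n)) (cong τ (sym j≡σi)))) ⟩
      only (σ (τ j)) (g (σ (τ j))) j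
        ≡⟨ cong (λ k → only k (g k) j) (στ j j<n) ⟩
      only j (g j) j
        ≡⟨ only-≡ j (g j) ⟩
      g j ∎

  big-reverse : ∀ n (g : ℕ → A) → big n (λ i → g (n ℕ.∸ suc i)) ≡ big n g
  big-reverse n g = big-reindex n g r r r< r< rr rr
    where
    r : ℕ → ℕ
    r i = n ℕ.∸ suc i
    r< : ∀ i → i ℕ.< n → r i ℕ.< n
    r< i i<n = ℕₚ.∸-monoʳ-< {n} {suc i} {0} z<s i<n
    rr : ∀ i → i ℕ.< n → r (r i) ≡ i
    rr i i<n = trans (cong (n ℕ.∸_) (sym (ℕₚ.+-∸-assoc 1 i<n))) (ℕₚ.m∸[m∸n]≡n (ℕₚ.<⇒≤ i<n))

open Big ℤₚ.+-0-isCommutativeMonoid public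
  renaming (big to ∑; big-cong to ∑-cong; big-ε to ∑-0; big-∙ to ∑-+; big-swap to ∑-swap; big-++ to ∑-++;
            big-head to ∑-head; big-trivial to ∑-trivial; big-single to ∑-single; big-reindex to ∑-reindex)
  using ()
open Big ℤₚ.*-1-isCommutativeMonoid public
  renaming (big to ∏; big-cong to ∏-cong; big-∙ to ∏-*; big-swap to ∏-swap;
            big-head to ∏-head; big-trivial to ∏-trivial; big-single to ∏-single; big-reindex to ∏-reindex;
            big-reverse to ∏-reverse)
  using ()

∑-*ˡ : ∀ n c f → ∑ n (λ i → c * f i) ≡ c * ∑ n f
∑-*ˡ zero    c f = sym (ℤₚ.*-zeroʳ c)
∑-*ˡ (suc n) c f = trans (cong (_+ c * f n) (∑-*ˡ n c f)) (sym (ℤₚ.*-distribˡ-+ c _ _))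

∑-*ʳ : ∀ n c f → ∑ n (λ i → f i * c) ≡ ∑ n f * c
∑-*ʳ n c f = trans (∑-cong n λ i _ → ℤₚ.*-comm (f i) c) (trans (∑-*ˡ n c f) (ℤₚ.*-comm c _))

∑-mono : ∀ n {f g} → (∀ i → i ℕ.< n → f i ≤ g i) → ∑ n f ≤ ∑ n g
∑-mono zero    h = ℤₚ.≤-refl
∑-mono (suc n) h = ℤₚ.+-mono-≤ (∑-mono n λ i i<n → h i (ℕₚ.m<n⇒m<1+n i<n)) (h n ℕₚ.≤-refl)

∑-const : ∀ n c → ∑ n (λ _ → c) ≡ + n * c
∑-const zero    c = sym (ℤₚ.*-zeroˡ c)
∑-const (suc n) c = trans (cong (_+ c) (∑-const n c)) (step (+ n) c)
  where
  step : ∀ n c → n * c + c ≡ (1ℤ + n) * c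
  step = solve-∀

∑-bound : ∀ n {f} B → (∀ i → i ℕ.< n → abs (f i) ℕ.≤ B) → abs (∑ n f) ℕ.≤ n ℕ.* B
∑-bound zero        B h = z≤n
∑-bound (suc n) {f} B h = ℕₚ.≤-trans (ℤₚ.∣i+j∣≤∣i∣+∣j∣ (∑ n f) (f n))
  (ℕₚ.≤-trans (ℕₚ.+-mono-≤ (∑-bound n B λ i i<n → h i (ℕₚ.m<n⇒m<1+n i<n)) (h n ℕₚ.≤-refl))
              (ℕₚ.≤-reflexive (ℕₚ.+-comm (n ℕ.* B) B)))

∏-const : ∀ n c → ∏ n (λ _ → c) ≡ c ^ n
∏-const zero    c = refl
∏-const (suc n) c = trans (cong (_* c) (∏-const n c)) (ℤₚ.*-comm (c ^ n) c)

-- Legendre symbols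

+∸ : ∀ {m n} → n ℕ.≤ m → + (m ℕ.∸ n) ≡ + m - + n
+∸ {m} {n} n≤m = sym (trans (ℤₚ.m-n≡m⊖n m n) (ℤₚ.⊖-≥ n≤m))

small-∣⇒≡0 : ∀ {p z} → + p ∣ z → abs z ℕ.< p → z ≡ 0ℤ
small-∣⇒≡0 {p} {z} p∣z ∣z∣<p with abs z in eq
... | zero  = ℤₚ.∣i∣≡0⇒i≡0 eq
... | suc k = ⊥-elim (ℕᵈ.>⇒∤ ∣z∣<p (subst (p ℕᵈ.∣_) eq (ℤᵈ.∣⇒∣ᵤ p∣z)))

∣-resp : ∀ {k a b} → a ≡ b → k ∣ a → k ∣ b
∣-resp refl d = d

module Mod (m : ℤ) where
  infix 4 _≅_
  record _≅_ (a b : ℤ) : Set where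
    constructor mod
    field difference : m ∣ a - b
  open _≅_ public

  ≅-reflexive : ∀ {a b} → a ≡ b → a ≅ b
  ≅-reflexive {a} refl = mod (divides 0ℤ (trans (ℤₚ.+-inverseʳ a) (sym (ℤₚ.*-zeroˡ m))))

  ≅-sym : ∀ {a b} → a ≅ b → b ≅ a
  ≅-sym {a} {b} (mod d) = mod (∣-resp (eq a b) (ℤᵈ.∣m⇒∣-m d))
    where
    eq : ∀ a b → - (a - b) ≡ b - a
    eq = solve-∀

  ≅-trans : ∀ {a b c} → a ≅ b → b ≅ c → a ≅ c
  ≅-trans {a} {b} {c} (mod d) (mod e) = mod (∣-resp (eq a b c) (ℤᵈ.∣m∣n⇒∣m+n d e))
    where
    eq : ∀ a b c → (a - b) + (b - c) ≡ a - c
    eq = solve-∀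

  *-≅ : ∀ {a b c d} → a ≅ b → c ≅ d → a * c ≅ b * d
  *-≅ {a} {b} {c} {d} (mod x) (mod y) = mod (∣-resp (eq a b c d) (ℤᵈ.∣m∣n⇒∣m+n (ℤᵈ.∣m⇒∣m*n c x) (ℤᵈ.∣n⇒∣m*n b y)))
    where
    eq : ∀ a b c d → (a - b) * c + b * (c - d) ≡ a * c - b * d
    eq = solve-∀

  ^-≅ : ∀ {a b} n → a ≅ b → a ^ n ≅ b ^ n
  ^-≅ zero    x = ≅-reflexive refl
  ^-≅ (suc n) x = *-≅ x (^-≅ n x)

  ∏-≅ : ∀ n {f g} → (∀ i → i ℕ.< n → f i ≅ g i) → ∏ n f ≅ ∏ n g
  ∏-≅ zero    h = ≅-reflexive refl
  ∏-≅ (suc n) h = *-≅ (∏-≅ n λ i i<n → h i (ℕₚ.m<n⇒m<1+n i<n)) (h n ℕₚ.≤-refl)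

  ≅-resp-∣ : ∀ {a b} → a ≅ b → m ∣ a → m ∣ b
  ≅-resp-∣ {a} {b} (mod x) m∣a = ∣-resp (eq a b) (ℤᵈ.∣m∣n⇒∣m-n m∣a x)
    where
    eq : ∀ a b → a - (a - b) ≡ b
    eq = solve-∀

  ∣⇒≅0 : ∀ {a} → m ∣ a → a ≅ 0ℤ
  ∣⇒≅0 {a} d = mod (∣-resp (sym (ℤₚ.+-identityʳ a)) d)

  ≅0⇒∣ : ∀ {a} → a ≅ 0ℤ → m ∣ a
  ≅0⇒∣ {a} (mod d) = ∣-resp (ℤₚ.+-identityʳ a) d

opaque
  inverse : ∀ {n : ℕ} (a : ℤ) → Coprime (abs a) n → ∃ λ b → + n ∣ a * b - 1ℤ
  inverse {n} a cop = signed a (natural (Coprimality.coprime-Bézout cop))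
    where
    natural : Bézout.Identity 1 (abs a) n → ∃ λ b → + n ∣ + (abs a) * b - 1ℤ
    natural (Bézout.Identity.+- x y eq) = + x , divides (+ y) (trans (cong (_- 1ℤ) (trans (ℤₚ.*-comm (+ (abs a)) (+ x)) e)) (lem (+ y * + n)))
      where
      e : + x * + (abs a) ≡ 1ℤ + + y * + n
      e = trans (sym (ℤₚ.pos-* x (abs a))) (trans (cong +_ (sym eq)) (cong (λ w → 1ℤ + w) (ℤₚ.pos-* y n)))
      lem : ∀ z → 1ℤ + z - 1ℤ ≡ z
      lem = solve-∀
    natural (Bézout.Identity.-+ x y eq) = - + x , divides (- + y) (trans (lem (+ (abs a)) (+ x)) (trans (cong -_ e) (ℤₚ.neg-distribˡ-* (+ y) (+ n))))
      where
      e : 1ℤ + + x * + (abs a) ≡ + y * + n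
      e = trans (cong (λ w → 1ℤ + w) (sym (ℤₚ.pos-* x (abs a)))) (trans (cong +_ eq) (ℤₚ.pos-* y n))
      lem : ∀ u x → u * - x - 1ℤ ≡ - (1ℤ + x * u)
      lem = solve-∀
    signed : ∀ a → (∃ λ b → + n ∣ + (abs a) * b - 1ℤ) → ∃ λ b → + n ∣ a * b - 1ℤ
    signed (+ k)    r       = r
    signed -[1+ k ] (b , d) = - b , ∣-resp (lem (+ suc k) b) d
      where
      lem : ∀ u b → u * b - 1ℤ ≡ - u * - b - 1ℤ
      lem = solve-∀

prime∣*⇒ : ∀ {p a b} → Prime p → + p ∣ a * b → + p ∣ a ⊎ + p ∣ b
prime∣*⇒ {p} {a} {b} pr d with ℙ.euclidsLemma (abs a) (abs b) pr (subst (p ℕᵈ.∣_) (ℤₚ.abs-* a b) (ℤᵈ.∣⇒∣ᵤ d))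
... | inj₁ x = inj₁ (ℤᵈ.∣ᵤ⇒∣ x)
... | inj₂ y = inj₂ (ℤᵈ.∣ᵤ⇒∣ y)

prime-coprime : ∀ {p n} → Prime p → ¬ p ℕᵈ.∣ n → Coprime n p
prime-coprime {p} {n} pr p∤n (d∣n , d∣p) with ℙ.prime⇒irreducible pr d∣p
... | inj₁ d≡1  = d≡1
... | inj₂ refl = ⊥-elim (p∤n d∣n)

-- Odd primes p are parametrised throughout by P = (p - 1)/2.
odd : ℕ → ℕ
odd P = suc (P ℕ.+ P)

data Sign3 : ℤ → Set where
  nil : Sign3 0ℤ
  pos : Sign3 1ℤ
  neg : Sign3 -1ℤ

Sign3-* : ∀ {a b} → Sign3 a → Sign3 b → Sign3 (a * b)
Sign3-* nil _   = nil
Sign3-* pos nil = nil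
Sign3-* pos pos = pos
Sign3-* pos neg = neg
Sign3-* neg nil = nil
Sign3-* neg pos = neg
Sign3-* neg neg = pos

data Unit : ℤ → Set where
  pos : Unit 1ℤ
  neg : Unit -1ℤ

Unit-* : ∀ {a b} → Unit a → Unit b → Unit (a * b)
Unit-* pos pos = pos
Unit-* pos neg = neg
Unit-* neg pos = neg
Unit-* neg neg = pos

Unit-∏ : ∀ n {f} → (∀ i → Unit (f i)) → Unit (∏ n f)
Unit-∏ zero    h = pos
Unit-∏ (suc n) h = Unit-* (Unit-∏ n h) (h n)

Unit-sq : ∀ {a} → Unit a → a * a ≡ 1ℤ
Unit-sq pos = refl
Unit-sq neg = refl

-1^ : ∀ n → Unit (-1ℤ ^ n)
-1^ zero    = pos
-1^ (suc n) = Unit-* neg (-1^ n)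

Unit⇒Sign3 : ∀ {a} → Unit a → Sign3 a
Unit⇒Sign3 pos = pos
Unit⇒Sign3 neg = neg

opaque
  leg : ℕ → ℤ → ℤ
  leg P a = choose (+ odd P ℤᵈ.∣? a) 0ℤ (choose (+ odd P ℤᵈ.∣? (a ^ P - 1ℤ)) 1ℤ -1ℤ)

  leg-Sign3 : ∀ P a → Sign3 (leg P a)
  leg-Sign3 P a with + odd P ℤᵈ.∣? a | + odd P ℤᵈ.∣? (a ^ P - 1ℤ)
  ... | yes _ | _     = nil
  ... | no  _ | yes _ = pos
  ... | no  _ | no  _ = neg

  leg-∣ : ∀ {P a} → + odd P ∣ a → leg P a ≡ 0ℤ
  leg-∣ {P} {a} d = choose-yes (+ odd P ℤᵈ.∣? a) d

  leg-∤ : ∀ {P a} → ¬ + odd P ∣ a → leg P a ≡ choose (+ odd P ℤᵈ.∣? (a ^ P - 1ℤ)) 1ℤ -1ℤ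
  leg-∤ {P} {a} nd = choose-no (+ odd P ℤᵈ.∣? a) nd

^-*-distrib : ∀ a b n → (a * b) ^ n ≡ a ^ n * b ^ n
^-*-distrib a b zero    = refl
^-*-distrib a b (suc n) = trans (cong (a * b *_) (^-*-distrib a b n)) (lem a b (a ^ n) (b ^ n))
  where
  lem : ∀ a b x y → a * b * (x * y) ≡ a * x * (b * y)
  lem = solve-∀

module Legendre (P : ℕ) (pr : Prime (odd P)) where
  p : ℕ
  p = odd P
  open Mod (+ p) public

  0<P : 0 ℕ.< P
  0<P = half P pr
    where
    half : ∀ P → Prime (odd P) → 0 ℕ.< P
    half zero    pr = ⊥-elim (ℙ.¬prime[1] pr)
    half (suc _) _  = z<s

  2<p : 2 ℕ.< p
  2<p = s<s (ℕₚ.+-mono-≤ 0<P 0<P)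

  P<p : P ℕ.< p
  P<p = s≤s (ℕₚ.m≤m+n P P)

  p∤1 : ¬ + p ∣ 1ℤ
  p∤1 d with () ← small-∣⇒≡0 d (ℕₚ.<-trans (s<s z<s) 2<p)

  Sign3-≅ : ∀ {a b} → Sign3 a → Sign3 b → a ≅ b → a ≡ b
  Sign3-≅ {a} {b} sa sb (mod d) = ℤₚ.i-j≡0⇒i≡j a b (small-∣⇒≡0 d (ℕₚ.≤-<-trans (bound sa sb) 2<p))
    where
    bound : ∀ {a b} → Sign3 a → Sign3 b → abs (a - b) ℕ.≤ 2
    bound nil nil = z≤n
    bound nil pos = s≤s z≤n
    bound nil neg = s≤s z≤n
    bound pos nil = s≤s z≤n
    bound pos pos = z≤n
    bound pos neg = ℕₚ.≤-refl
    bound neg nil = s≤s z≤n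
    bound neg pos = ℕₚ.≤-refl
    bound neg neg = z≤n

  residue : ∀ z → z ≅ + (z ℤᵐ.%ℕ p)
  residue z = mod (divides (z ℤᵐ./ℕ p) (trans (cong (_- + (z ℤᵐ.%ℕ p)) (ℤᵐ.a≡a%ℕn+[a/ℕn]*n z p)) (lem (+ (z ℤᵐ.%ℕ p)) _)))
    where
    lem : ∀ r q → r + q - r ≡ q
    lem = solve-∀

  residue-unique : ∀ {u v} → u ℕ.< p → v ℕ.< p → + u ≅ + v → u ≡ v
  residue-unique {u} {v} u<p v<p (mod d) = ℤₚ.+-injective (ℤₚ.i-j≡0⇒i≡j (+ u) (+ v) (small-∣⇒≡0 d bound))
    where
    bound : abs (+ u - + v) ℕ.< p
    bound = ℕₚ.≤-<-trans (subst (ℕ._≤ u ℕ.⊔ v) (cong abs (sym (ℤₚ.m-n≡m⊖n u v))) (ℤₚ.∣m⊝n∣≤m⊔n u v)) (ℕₚ.⊔-lub u<p v<p)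

  ∣-* : ∀ {a b} → + p ∣ a * b → + p ∣ a ⊎ + p ∣ b
  ∣-* = prime∣*⇒ pr

  cancelʳ : ∀ {a b c} → ¬ + p ∣ c → a * c ≅ b * c → a ≅ b
  cancelʳ {a} {b} {c} p∤c (mod d) = aux (∣-* {a - b} {c} (∣-resp (eq a b c) d))
    where
    eq : ∀ a b c → a * c - b * c ≡ (a - b) * c
    eq = solve-∀
    aux : + p ∣ a - b ⊎ + p ∣ c → a ≅ b
    aux (inj₁ x) = mod x
    aux (inj₂ y) = ⊥-elim (p∤c y)

  opaque
    sgn : ℤ → ℤ
    sgn z = choose (z ℤᵐ.%ℕ p ℕ.≤? P) 1ℤ -1ℤ

    hlf : ℤ → ℕ
    hlf z = choose (z ℤᵐ.%ℕ p ℕ.≤? P) (z ℤᵐ.%ℕ p) (p ℕ.∸ z ℤᵐ.%ℕ p)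

    sgn-Unit : ∀ z → Unit (sgn z)
    sgn-Unit z with z ℤᵐ.%ℕ p ℕ.≤? P
    ... | yes _ = pos
    ... | no  _ = neg

    sgn-hlf : ∀ z → z ≅ sgn z * + hlf z
    sgn-hlf z with z ℤᵐ.%ℕ p ℕ.≤? P
    ... | yes _ = ≅-trans (residue z) (≅-reflexive (sym (ℤₚ.*-identityˡ _)))
    ... | no  _ = ≅-trans (residue z) (mod (divides 1ℤ (trans (cong (λ w → + r - -1ℤ * w) (+∸ (ℕₚ.<⇒≤ (ℤᵐ.n%ℕd<d z p)))) (lem (+ r) (+ p)))))
      where
      r : ℕ
      r = z ℤᵐ.%ℕ p
      lem : ∀ r p → r - -1ℤ * (p - r) ≡ 1ℤ * p
      lem = solve-∀

    hlf≤P : ∀ z → hlf z ℕ.≤ P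
    hlf≤P z with z ℤᵐ.%ℕ p ℕ.≤? P
    ... | yes r≤P = r≤P
    ... | no  r≰P = ℕₚ.≤-trans (ℕₚ.∸-monoʳ-≤ p (ℕₚ.≰⇒> r≰P)) (ℕₚ.≤-reflexive (ℕₚ.m+n∸m≡n P P))

    sgn-≤ : ∀ {z} → z ℤᵐ.%ℕ p ℕ.≤ P → sgn z ≡ 1ℤ
    sgn-≤ {z} = choose-yes (z ℤᵐ.%ℕ p ℕ.≤? P)

    sgn-≰ : ∀ {z} → ¬ z ℤᵐ.%ℕ p ℕ.≤ P → sgn z ≡ -1ℤ
    sgn-≰ {z} = choose-no (z ℤᵐ.%ℕ p ℕ.≤? P)

  hlf-unit : ∀ z → ¬ + p ∣ z → 0 ℕ.< hlf z
  hlf-unit z p∤z = ℕₚ.n≢0⇒n>0 λ h≡0 →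
    p∤z (≅0⇒∣ (≅-trans (sgn-hlf z) (≅-reflexive (trans (cong (λ k → sgn z * + k) h≡0) (ℤₚ.*-zeroʳ (sgn z))))))

  suc-unit : ∀ i → suc i ℕ.< p → ¬ + p ∣ + suc i
  suc-unit i i<p d with () ← small-∣⇒≡0 d i<p

  half-unique : ∀ {u v s} → Unit s → u ℕ.≤ P → 0 ℕ.< u → v ℕ.≤ P → + u ≅ s * + v → u ≡ v
  half-unique {u} {v} pos u≤P _ v≤P d =
    residue-unique (ℕₚ.≤-<-trans u≤P P<p) (ℕₚ.≤-<-trans v≤P P<p) (≅-trans d (≅-reflexive (ℤₚ.*-identityˡ _)))
  half-unique {u} {v} neg u≤P 0<u v≤P (mod d) = ⊥-elim (ℕₚ.<⇒≢ 0<u (sym (ℕₚ.m+n≡0⇒m≡0 u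
    (ℤₚ.+-injective (small-∣⇒≡0 (∣-resp (eq (+ u) (+ v)) d) (s≤s (ℕₚ.+-mono-≤ u≤P v≤P)))))))
    where
    eq : ∀ u v → u - -1ℤ * v ≡ u + v
    eq = solve-∀

  invert : ∀ {a} → ¬ + p ∣ a → ∃ λ b → a * b ≅ 1ℤ
  invert {a} p∤a = let b , d = inverse a (prime-coprime pr λ d → p∤a (ℤᵈ.∣ᵤ⇒∣ d)) in b , mod d

  invert-unit : ∀ {a b} → a * b ≅ 1ℤ → ¬ + p ∣ b
  invert-unit {a} {b} ab≅1 d = p∤1 (≅-resp-∣ ab≅1 (ℤᵈ.∣n⇒∣m*n a d))

  unit-* : ∀ {a b} → ¬ + p ∣ a → ¬ + p ∣ b → ¬ + p ∣ a * b
  unit-* {a} {b} p∤a p∤b d with ∣-* {a} {b} d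
  ... | inj₁ x = p∤a x
  ... | inj₂ y = p∤b y

  gaussSign : ℤ → ℤ
  gaussSign a = ∏ P (λ i → sgn (a * + suc i))

  -- Multiplication by a permutes the half system 1, …, P up to signs.
  private
    σ : ℤ → ℕ → ℕ
    σ a i = ℕ.pred (hlf (a * + suc i))

    module _ {a} (p∤a : ¬ + p ∣ a) where
      ai-unit : ∀ i → i ℕ.< P → ¬ + p ∣ a * + suc i
      ai-unit i i<P = unit-* p∤a (suc-unit i (ℕₚ.≤-<-trans i<P P<p))

      suc-σ : ∀ i → i ℕ.< P → suc (σ a i) ≡ hlf (a * + suc i)
      suc-σ i i<P = ℕₚ.suc-pred (hlf (a * + suc i)) {{ℕ.>-nonZero (hlf-unit _ (ai-unit i i<P))}}

      σ< : ∀ i → i ℕ.< P → σ a i ℕ.< P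
      σ< i i<P = subst (ℕ._≤ P) (sym (suc-σ i i<P)) (hlf≤P _)

    σ-inverse : ∀ {a b} → a * b ≅ 1ℤ → ¬ + p ∣ a → ¬ + p ∣ b → ∀ i → i ℕ.< P → σ b (σ a i) ≡ i
    σ-inverse {a} {b} ab≅1 p∤a p∤b i i<P = ℕₚ.suc-injective (trans (suc-σ p∤b (σ a i) (σ< p∤a i i<P))
      (sym (half-unique (Unit-* (sgn-Unit (a * + suc i)) (sgn-Unit (b * + suc (σ a i)))) i<P z<s (hlf≤P _) chain)))
      where
      s = sgn (a * + suc i)
      t = sgn (b * + suc (σ a i))
      h = hlf (b * + suc (σ a i))
      e₁ : + suc (σ a i) ≅ s * (a * + suc i)
      e₁ = ≅-trans (≅-reflexive (trans (cong +_ (suc-σ p∤a i i<P))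
              (trans (sym (ℤₚ.*-identityˡ _)) (trans (cong (_* + hlf (a * + suc i)) (sym (Unit-sq (sgn-Unit (a * + suc i))))) (ℤₚ.*-assoc s s _)))))
           (*-≅ {s} (≅-reflexive refl) (≅-sym {a * + suc i} (sgn-hlf (a * + suc i))))
      e₂ : t * + h ≅ s * + suc i
      e₂ = ≅-trans (≅-sym (sgn-hlf (b * + suc (σ a i)))) (≅-trans (*-≅ {b} (≅-reflexive refl) e₁)
             (≅-trans (≅-reflexive (lem b s a (+ suc i))) (≅-trans (*-≅ ab≅1 (≅-reflexive {s * + suc i} refl)) (≅-reflexive (ℤₚ.*-identityˡ _)))))
        where
        lem : ∀ b s a x → b * (s * (a * x)) ≡ a * b * (s * x)
        lem = solve-∀
      chain : + suc i ≅ s * t * + h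
      chain = ≅-trans (≅-reflexive (trans (sym (ℤₚ.*-identityˡ _)) (trans (cong (_* + suc i) (sym (Unit-sq (sgn-Unit (a * + suc i))))) (ℤₚ.*-assoc s s _))))
                (≅-trans (*-≅ {s} (≅-reflexive refl) (≅-sym e₂)) (≅-reflexive (sym (ℤₚ.*-assoc s t (+ h)))))

  ∏-unit : ∀ n {f} → (∀ i → i ℕ.< n → ¬ + p ∣ f i) → ¬ + p ∣ ∏ n f
  ∏-unit zero    h = p∤1
  ∏-unit (suc n) h = unit-* (∏-unit n λ i i<n → h i (ℕₚ.m<n⇒m<1+n i<n)) (h n ℕₚ.≤-refl)

  gauss-lemma : ∀ {a} → ¬ + p ∣ a → a ^ P ≅ gaussSign a
  gauss-lemma {a} p∤a = cancelʳ (∏-unit P λ i i<P → suc-unit i (ℕₚ.≤-<-trans i<P P<p)) chain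
    where
    a⁻¹ = proj₁ (invert p∤a)
    aa⁻¹≅1 = proj₂ (invert p∤a)
    a⁻¹a≅1 = ≅-trans {a⁻¹ * a} (≅-reflexive (ℤₚ.*-comm a⁻¹ a)) aa⁻¹≅1
    p∤a⁻¹ = invert-unit {a} aa⁻¹≅1
    perm : ∏ P (λ i → + suc (σ a i)) ≡ ∏ P (λ i → + suc i)
    perm = ∏-reindex P (λ i → + suc i) (σ a) (σ a⁻¹) (σ< p∤a) (σ< p∤a⁻¹) (σ-inverse aa⁻¹≅1 p∤a p∤a⁻¹) (σ-inverse a⁻¹a≅1 p∤a⁻¹ p∤a)
    chain : a ^ P * ∏ P (λ i → + suc i) ≅ gaussSign a * ∏ P (λ i → + suc i)
    chain = ≅-trans (≅-reflexive (trans (cong (_* ∏ P (λ i → + suc i)) (sym (∏-const P a))) (sym (∏-* P (λ _ → a) (λ i → + suc i)))))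
           (≅-trans (∏-≅ P λ i i<P → ≅-trans (sgn-hlf (a * + suc i)) (≅-reflexive (cong (λ k → sgn (a * + suc i) * + k) (sym (suc-σ p∤a i i<P)))))
           (≅-reflexive (trans (∏-* P (λ i → sgn (a * + suc i)) (λ i → + suc (σ a i))) (cong (gaussSign a *_) perm))))

  gaussSign-Unit : ∀ a → Unit (gaussSign a)
  gaussSign-Unit a = Unit-∏ P λ i → sgn-Unit (a * + suc i)

  leg-zero : ∀ {a} → + p ∣ a → leg P a ≡ 0ℤ
  leg-zero = leg-∣

  leg-gauss : ∀ {a} → ¬ + p ∣ a → leg P a ≡ gaussSign a
  leg-gauss {a} p∤a = trans (leg-∤ p∤a) (aux (+ odd P ℤᵈ.∣? (a ^ P - 1ℤ)) (gaussSign-Unit a) (gauss-lemma p∤a))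
    where
    aux : (d : Dec (+ p ∣ a ^ P - 1ℤ)) → ∀ {s} → Unit s → a ^ P ≅ s → choose d 1ℤ -1ℤ ≡ s
    aux (yes e) u   d = Sign3-≅ pos (Unit⇒Sign3 u) (≅-trans (≅-sym (mod e)) d)
    aux (no ¬e) pos d = ⊥-elim (¬e (difference d))
    aux (no ¬e) neg _ = refl

  leg-Unit : ∀ {a} → ¬ + p ∣ a → Unit (leg P a)
  leg-Unit {a} p∤a = subst Unit (sym (leg-gauss p∤a)) (gaussSign-Unit a)

  euler : ∀ a → leg P a ≅ a ^ P
  euler a = aux (+ p ℤᵈ.∣? a)
    where
    0^ : ∀ n → 0 ℕ.< n → 0ℤ ^ n ≡ 0ℤ
    0^ (suc n) _ = ℤₚ.*-zeroˡ (0ℤ ^ n)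
    aux : Dec (+ p ∣ a) → leg P a ≅ a ^ P
    aux (yes d) = ≅-trans (≅-reflexive (trans (leg-zero d) (sym (0^ P 0<P)))) (≅-sym (^-≅ P (∣⇒≅0 d)))
    aux (no nd) = ≅-trans (≅-reflexive (leg-gauss nd)) (≅-sym (gauss-lemma nd))

  leg-* : ∀ a b → leg P (a * b) ≡ leg P a * leg P b
  leg-* a b = Sign3-≅ (leg-Sign3 P _) (Sign3-* (leg-Sign3 P a) (leg-Sign3 P b))
    (≅-trans (euler (a * b)) (≅-trans (≅-reflexive (^-*-distrib a b P)) (*-≅ (≅-sym (euler a)) (≅-sym (euler b)))))

  leg-≅ : ∀ {a b} → a ≅ b → leg P a ≡ leg P b
  leg-≅ {a} {b} d = Sign3-≅ (leg-Sign3 P a) (leg-Sign3 P b) (≅-trans (euler a) (≅-trans (^-≅ P d) (≅-sym (euler b))))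

  leg-1 : leg P 1ℤ ≡ 1ℤ
  leg-1 = Sign3-≅ (leg-Sign3 P 1ℤ) pos (≅-trans (euler 1ℤ) (≅-reflexive (ℤₚ.^-zeroˡ P)))

  leg--1 : leg P -1ℤ ≡ -1ℤ ^ P
  leg--1 = Sign3-≅ (leg-Sign3 P -1ℤ) (Unit⇒Sign3 (-1^ P)) (euler -1ℤ)

choose-cong : ∀ {P Q : Set} {A : Set} {a b : A} (d : Dec P) (e : Dec Q) → (P → Q) → (Q → P) → choose d a b ≡ choose e a b
choose-cong (yes p) e f g = sym (choose-yes e (f p))
choose-cong (no ¬p) e f g = sym (choose-no e λ q → ¬p (g q))

module Squares (P : ℕ) (pr : Prime (odd P)) where
  open Legendre P pr

  private
    nz : ℕ → ℤ
    nz x = choose (x ℕ.≟ 0) 1ℤ (+ x)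

    nz-suc : ∀ {x} → x ≢ 0 → nz x ≡ + x
    nz-suc {x} = choose-no (x ℕ.≟ 0)

    unit : ∀ {x} → x ≢ 0 → x ℕ.< p → ¬ + p ∣ + x
    unit {zero}  x≢0 = ⊥-elim (x≢0 refl)
    unit {suc x} _   = suc-unit x

    fermat : ∀ {x} → ¬ + p ∣ x → x ^ (P ℕ.+ P) ≅ 1ℤ
    fermat {x} p∤x = ≅-trans (≅-reflexive (ℤₚ.^-distribˡ-+-* x P P))
      (≅-trans (*-≅ (gauss-lemma p∤x) (gauss-lemma p∤x)) (≅-reflexive (Unit-sq (gaussSign-Unit x))))

    module Pairing (a : ℤ) (p∤a : ¬ + p ∣ a) where
      τ : ℕ → ℕ
      τ x = (a * (+ x) ^ ℕ.pred (P ℕ.+ P)) ℤᵐ.%ℕ p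

      τ< : ∀ x → x ℕ.< p → τ x ℕ.< p
      τ< x _ = ℤᵐ.n%ℕd<d (a * (+ x) ^ ℕ.pred (P ℕ.+ P)) p

      suc-pred-2P : suc (ℕ.pred (P ℕ.+ P)) ≡ P ℕ.+ P
      suc-pred-2P = ℕₚ.suc-pred (P ℕ.+ P) {{ℕ.>-nonZero (ℕₚ.+-mono-< 0<P 0<P)}}

      x*τx : ∀ {x} → x ≢ 0 → x ℕ.< p → + x * + τ x ≅ a
      x*τx {x} x≢0 x<p = ≅-trans (*-≅ {+ x} (≅-reflexive refl) (≅-sym (residue _)))
        (≅-trans (≅-reflexive (lem (+ x) a ((+ x) ^ ℕ.pred (P ℕ.+ P))))
        (≅-trans (*-≅ {a} (≅-reflexive refl) (≅-trans (≅-reflexive (cong ((+ x) ^_) suc-pred-2P)) (fermat (unit x≢0 x<p))))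
                 (≅-reflexive (ℤₚ.*-identityʳ a))))
        where
        lem : ∀ x a y → x * (a * y) ≡ a * (x * y)
        lem = solve-∀

      τ0 : τ 0 ≡ 0
      τ0 = residue-unique (τ< 0 z<s) z<s (≅-trans (≅-sym (residue _)) (≅-reflexive
             (trans (cong (a *_) (zero^ (ℕ.pred (P ℕ.+ P)) (ℕₚ.≤-pred (subst (1 ℕ.<_) (sym suc-pred-2P) (ℕₚ.+-mono-≤ 0<P 0<P))))) (ℤₚ.*-zeroʳ a))))
        where
        zero^ : ∀ n → 0 ℕ.< n → 0ℤ ^ n ≡ 0ℤ
        zero^ (suc n) _ = ℤₚ.*-zeroˡ (0ℤ ^ n)

      τ≢0 : ∀ {x} → x ≢ 0 → x ℕ.< p → τ x ≢ 0
      τ≢0 {x} x≢0 x<p τx≡0 = p∤a (≅-resp-∣ (x*τx x≢0 x<p) (∣-resp (sym (trans (cong (λ k → + x * + k) τx≡0) (ℤₚ.*-zeroʳ (+ x)))) (divides 0ℤ (sym (ℤₚ.*-zeroˡ (+ p))))))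

      ττ : ∀ x → x ℕ.< p → τ (τ x) ≡ x
      ττ x x<p with x ℕ.≟ 0
      ... | yes refl = trans (cong τ τ0) τ0
      ... | no  x≢0  = residue-unique (τ< (τ x) (τ< x x<p)) x<p (cancelʳ (unit (τ≢0 x≢0 x<p) (τ< x x<p))
            (≅-trans (≅-reflexive (ℤₚ.*-comm (+ τ (τ x)) (+ τ x))) (≅-trans (x*τx (τ≢0 x≢0 x<p) (τ< x x<p)) (≅-sym (x*τx x≢0 x<p)))))

      fixed : ℕ → ℤ
      fixed x = choose (x ℕ.≟ τ x) (nz x) 1ℤ

      below : ℕ → ℤ
      below x = choose (x ℕ.<? τ x) (nz x) 1ℤ

      above : ℕ → ℤ
      above x = choose (τ x ℕ.<? x) (nz x) 1ℤ

      split : ∀ x → nz x ≡ below x * above x * fixed x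
      split x with x ℕ.<? τ x | τ x ℕ.<? x | x ℕ.≟ τ x
      ... | yes a | yes b | _     = ⊥-elim (ℕₚ.<-asym a b)
      ... | yes a | no  _ | yes b = ⊥-elim (ℕₚ.<⇒≢ a b)
      ... | yes _ | no  _ | no  _ = lem (nz x)
        where
        lem : ∀ y → y ≡ y * 1ℤ * 1ℤ
        lem = solve-∀
      ... | no  _ | yes b | yes c = ⊥-elim (ℕₚ.<⇒≢ b (sym c))
      ... | no  _ | yes _ | no  _ = lem (nz x)
        where
        lem : ∀ y → y ≡ 1ℤ * y * 1ℤ
        lem = solve-∀
      ... | no  _ | no  _ | yes _ = lem (nz x)
        where
        lem : ∀ y → y ≡ 1ℤ * 1ℤ * y
        lem = solve-∀
      ... | no  a | no  b | no  c = ⊥-elim (c (ℕₚ.≤-antisym (ℕₚ.≮⇒≥ b) (ℕₚ.≮⇒≥ a)))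

      paired : ∀ x → x ℕ.< p → below x * above (τ x) ≅ choose (x ℕ.<? τ x) a 1ℤ
      paired x x<p = ≅-trans (≅-reflexive (cong (below x *_) (trans (cong (λ k → choose (k ℕ.<? τ x) (nz (τ x)) 1ℤ) (ττ x x<p)) refl))) (aux (x ℕ.<? τ x))
        where
        aux : (d : Dec (x ℕ.< τ x)) → choose d (nz x) 1ℤ * choose d (nz (τ x)) 1ℤ ≅ choose d a 1ℤ
        aux (yes x<τx) = ≅-trans (≅-reflexive (cong₂ _*_ (nz-suc x≢0) (nz-suc (τ≢0 x≢0 x<p)))) (x*τx x≢0 x<p)
          where
          x≢0 : x ≢ 0
          x≢0 refl with () ← subst (0 ℕ.<_) τ0 x<τx
        aux (no _) = ≅-reflexive refl

      ∏-paired : ∏ p nz ≅ ∏ p (λ x → choose (x ℕ.<? τ x) a 1ℤ) * ∏ p fixed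
      ∏-paired = ≅-trans (≅-reflexive (trans (∏-cong p λ x _ → split x) (trans (∏-* p _ fixed) (cong (_* ∏ p fixed)
          (trans (∏-* p below above) (trans (cong (∏ p below *_) (sym (∏-reindex p above τ τ τ< τ< ττ ττ))) (sym (∏-* p below (λ x → above (τ x)))))))))
        ) (*-≅ (∏-≅ p paired) (≅-reflexive refl))

    count : ∀ {X : ℕ → Set} → (∀ n → Dec (X n)) → ℕ → ℕ
    count X? zero    = 0
    count X? (suc n) = choose (X? n) 1 0 ℕ.+ count X? n

    count-∏ : ∀ {X : ℕ → Set} (X? : ∀ n → Dec (X n)) n a → ∏ n (λ x → choose (X? x) a 1ℤ) ≡ a ^ count X? n
    count-∏ X? zero    a = refl
    count-∏ X? (suc n) a with X? n
    ... | yes _ = trans (cong (_* a) (count-∏ X? n a)) (ℤₚ.*-comm _ a)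
    ... | no  _ = trans (ℤₚ.*-identityʳ _) (count-∏ X? n a)

    count-∑ : ∀ {X : ℕ → Set} (X? : ∀ n → Dec (X n)) n → ∑ n (λ x → choose (X? x) 1ℤ 0ℤ) ≡ + count X? n
    count-∑ X? zero    = refl
    count-∑ X? (suc n) with X? n
    ... | yes _ = trans (cong (_+ 1ℤ) (count-∑ X? n)) (ℤₚ.+-comm (+ count X? n) 1ℤ)
    ... | no  _ = trans (ℤₚ.+-identityʳ _) (count-∑ X? n)

    nonsquare-product : ∀ a → ¬ + p ∣ a → (∀ x → x ℕ.< p → ¬ + x * + x ≅ a) → ∏ p nz ≅ a ^ P
    nonsquare-product a p∤a nonsq = ≅-trans ∏-paired (≅-reflexive (trans (cong₂ _*_ (trans (count-∏ X? p a) (cong (a ^_) count≡P)) (∏-trivial p fixed≡1)) (ℤₚ.*-identityʳ (a ^ P))))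
      where
      open Pairing a p∤a
      X? : ∀ x → Dec (x ℕ.< τ x)
      X? x = x ℕ.<? τ x
      τx≢x : ∀ x → x ℕ.< p → x ≢ 0 → x ≢ τ x
      τx≢x x x<p x≢0 e = nonsq x x<p (≅-trans (≅-reflexive (cong (λ k → + x * + k) e)) (x*τx x≢0 x<p))
      fixed≡1 : ∀ x → x ℕ.< p → fixed x ≡ 1ℤ
      fixed≡1 x x<p with x ℕ.≟ τ x
      ... | no  _ = refl
      ... | yes e with x ℕ.≟ 0
      ...   | yes _   = refl
      ...   | no  x≢0 = ⊥-elim (τx≢x x x<p x≢0 e)
      lt gt : ℕ → ℤ
      lt x = choose (x ℕ.<? τ x) 1ℤ 0ℤ
      gt x = choose (τ x ℕ.<? x) 1ℤ 0ℤ
      one : ∀ x → x ℕ.< p → lt x + gt x + choose (x ℕ.≟ 0) 1ℤ 0ℤ ≡ 1ℤ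
      one x x<p with x ℕ.<? τ x | τ x ℕ.<? x | x ℕ.≟ 0
      ... | yes a | yes b | _        = ⊥-elim (ℕₚ.<-asym a b)
      ... | yes a | no  _ | yes refl with () ← subst (0 ℕ.<_) τ0 a
      one x x<p | yes _ | no  _ | no  _    = refl
      one x x<p | no  _ | yes _ | no  _    = refl
      one .0 _  | no  _ | yes () | yes refl
      one x x<p | no  _ | no  _ | yes _    = refl
      one x x<p | no  a | no  b | no  c    = ⊥-elim (τx≢x x x<p c (ℕₚ.≤-antisym (ℕₚ.≮⇒≥ b) (ℕₚ.≮⇒≥ a)))
      lt∘τ : ∑ p gt ≡ ∑ p lt
      lt∘τ = trans (sym (∑-reindex p gt τ τ τ< τ< ττ ττ)) (∑-cong p λ x x<p → cong (λ k → choose (k ℕ.<? τ x) 1ℤ 0ℤ) (ττ x x<p))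
      zeroes : ∑ p (λ x → choose (x ℕ.≟ 0) 1ℤ 0ℤ) ≡ 1ℤ
      zeroes = ∑-single p 0 z<s λ i _ i≢0 → choose-no (i ℕ.≟ 0) i≢0
      total : + count X? p + + count X? p + 1ℤ ≡ + p
      total = trans (cong (_+ 1ℤ) (cong₂ _+_ (sym (count-∑ X? p)) (trans (sym (count-∑ X? p)) (sym lt∘τ))))
             (trans (cong (_+_ (∑ p lt + ∑ p gt)) (sym zeroes))
             (trans (cong (_+ ∑ p (λ x → choose (x ℕ.≟ 0) 1ℤ 0ℤ)) (sym (∑-+ p lt gt)))
             (trans (sym (∑-+ p (λ x → lt x + gt x) _)) (trans (∑-cong p one) (trans (∑-const p 1ℤ) (ℤₚ.*-identityʳ (+ p)))))))
      double-injective : ∀ m n → m ℕ.+ m ≡ n ℕ.+ n → m ≡ n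
      double-injective m n e = ℕₚ.*-cancelˡ-≡ m n 2 (trans (cong (m ℕ.+_) (ℕₚ.+-identityʳ m)) (trans e (cong (n ℕ.+_) (sym (ℕₚ.+-identityʳ n)))))
      count≡P : count X? p ≡ P
      count≡P = double-injective _ P (ℕₚ.+-cancelʳ-≡ 1 _ _ (trans (ℤₚ.+-injective total) (sym (ℕₚ.+-comm (P ℕ.+ P) 1))))

    -1≅2P : + (P ℕ.+ P) ≅ -1ℤ
    -1≅2P = mod (divides 1ℤ (sym (trans (ℤₚ.*-identityˡ (+ p)) (cong +_ (ℕₚ.+-comm 1 (P ℕ.+ P))))))

    wilson : ∏ p nz ≅ -1ℤ
    wilson = ≅-trans ∏-paired (≅-trans (≅-reflexive (trans (cong₂ _*_ (∏-trivial p λ x _ → ones (x ℕ.<? τ x)) (∏-single p (P ℕ.+ P) ℕₚ.≤-refl fixed≡1)) (ℤₚ.*-identityˡ _)))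
               (≅-trans (≅-reflexive fixed-top) -1≅2P))
      where
      open Pairing 1ℤ p∤1
      ones : ∀ {X : Set} (d : Dec X) → choose d 1ℤ 1ℤ ≡ 1ℤ
      ones (yes _) = refl
      ones (no  _) = refl
      2P≢0 : P ℕ.+ P ≢ 0
      2P≢0 e = ℕₚ.<⇒≢ (ℕₚ.+-mono-< 0<P 0<P) (sym e)
      fixed-top : fixed (P ℕ.+ P) ≡ + (P ℕ.+ P)
      fixed-top = trans (choose-yes (P ℕ.+ P ℕ.≟ τ (P ℕ.+ P)) (residue-unique ℕₚ.≤-refl (τ< _ ℕₚ.≤-refl)
        (cancelʳ {c = + (P ℕ.+ P)} (unit 2P≢0 ℕₚ.≤-refl) (≅-trans (*-≅ -1≅2P -1≅2P) (≅-trans (≅-sym (x*τx 2P≢0 ℕₚ.≤-refl)) (≅-reflexive (ℤₚ.*-comm (+ (P ℕ.+ P)) _)))))))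
        (nz-suc 2P≢0)
      fixed≡1 : ∀ x → x ℕ.< p → x ≢ P ℕ.+ P → fixed x ≡ 1ℤ
      fixed≡1 x x<p x≢2P with x ℕ.≟ τ x
      ... | no  _ = refl
      ... | yes e with x ℕ.≟ 0
      ...   | yes _   = refl
      ...   | no  x≢0 = aux (∣-* {+ x - 1ℤ} {+ x + 1ℤ} (∣-resp (lem (+ x)) (difference (≅-trans (≅-reflexive (cong (λ k → + x * + k) e)) (x*τx x≢0 x<p)))))
        where
        lem : ∀ x → x * x - 1ℤ ≡ (x - 1ℤ) * (x + 1ℤ)
        lem = solve-∀
        lem′ : ∀ x → x + 1ℤ ≡ x - -1ℤ
        lem′ = solve-∀
        aux : + p ∣ + x - 1ℤ ⊎ + p ∣ + x + 1ℤ → + x ≡ 1ℤ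
        aux (inj₁ d) = cong +_ (residue-unique x<p (ℕₚ.<-trans ℕₚ.≤-refl 2<p) (mod d))
        aux (inj₂ d) = ⊥-elim (x≢2P (residue-unique x<p ℕₚ.≤-refl (≅-trans (mod (∣-resp (lem′ (+ x)) d)) (≅-sym -1≅2P))))

  opaque
    square-root : ∀ {a} → leg P a ≡ 1ℤ → ∃ λ x → x * x ≅ a
    square-root {a} leg≡1 with Finₚ.any? (λ (i : Fin p) → + p ℤᵈ.∣? + Fin.toℕ i * + Fin.toℕ i - a)
    ... | yes (i , d) = + Fin.toℕ i , mod d
    ... | no  none    = ⊥-elim (contra (Sign3-≅ pos neg (≅-trans (≅-reflexive (sym leg≡1)) (≅-trans (euler a)
                         (≅-trans (≅-sym (nonsquare-product a p∤a nonsq)) wilson)))))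
      where
      contra : 1ℤ ≢ -1ℤ
      contra ()
      p∤a : ¬ + p ∣ a
      p∤a d with () ← trans (sym leg≡1) (leg-zero d)
      nonsq : ∀ x → x ℕ.< p → ¬ + x * + x ≅ a
      nonsq x x<p (mod d) = none (Fin.fromℕ< x<p , subst (λ k → + p ∣ + k * + k - a) (sym (Finₚ.toℕ-fromℕ< x<p)) d)

    nonresidue : ∃ λ t → leg P (+ t) ≡ -1ℤ
    nonresidue with Finₚ.any? (λ (i : Fin p) → leg P (+ Fin.toℕ i) ℤ.≟ -1ℤ)
    ... | yes (i , e) = Fin.toℕ i , e
    ... | no  none    = ⊥-elim (ℕₚ.<⇒≱ (ℕₚ.m<m+n P 0<P) (Finₚ.injective⇒≤ f-injective))
      where
      lemma : (i : Fin (P ℕ.+ P)) → leg P (+ suc (Fin.toℕ i)) ≡ 1ℤ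
      lemma i = aux refl (leg-Unit (suc-unit (Fin.toℕ i) i<p))
        where
        i<p : suc (Fin.toℕ i) ℕ.< p
        i<p = s≤s (Finₚ.toℕ<n i)
        aux : ∀ {s} → leg P (+ suc (Fin.toℕ i)) ≡ s → Unit s → leg P (+ suc (Fin.toℕ i)) ≡ 1ℤ
        aux e pos = e
        aux e neg = ⊥-elim (none (Fin.fromℕ< i<p , trans (cong (λ k → leg P (+ k)) (Finₚ.toℕ-fromℕ< i<p)) e))
      root : Fin (P ℕ.+ P) → ℤ
      root i = proj₁ (square-root (lemma i))
      h : Fin (P ℕ.+ P) → ℕ
      h i = hlf (root i)
      h² : ∀ i → + h i * + h i ≅ + suc (Fin.toℕ i)
      h² i = ≅-trans (≅-reflexive (trans (sym (ℤₚ.*-identityˡ _)) (trans (cong (_* (+ h i * + h i)) (sym (Unit-sq (sgn-Unit (root i))))) (lem (sgn (root i)) (+ h i)))))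
        (≅-trans (*-≅ (≅-sym (sgn-hlf (root i))) (≅-sym (sgn-hlf (root i)))) (proj₂ (square-root (lemma i))))
        where
        lem : ∀ s h → s * s * (h * h) ≡ (s * h) * (s * h)
        lem = solve-∀
      0<h : ∀ i → 0 ℕ.< h i
      0<h i = ℕₚ.n≢0⇒n>0 λ e → suc-unit (Fin.toℕ i) (s≤s (Finₚ.toℕ<n i)) (≅-resp-∣ (≅-trans (≅-reflexive (cong (λ k → + k * + k) (sym e))) (h² i)) (divides 0ℤ (sym (ℤₚ.*-zeroˡ (+ p)))))
      suc-pred-h : ∀ i → suc (ℕ.pred (h i)) ≡ h i
      suc-pred-h i = ℕₚ.suc-pred (h i) {{ℕ.>-nonZero (0<h i)}}
      f<P : ∀ i → ℕ.pred (h i) ℕ.< P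
      f<P i = subst (ℕ._≤ P) (sym (suc-pred-h i)) (hlf≤P (root i))
      f : Fin (P ℕ.+ P) → Fin P
      f i = Fin.fromℕ< (f<P i)
      f-injective : ∀ {i j} → f i ≡ f j → i ≡ j
      f-injective {i} {j} e = Finₚ.toℕ-injective (ℕₚ.suc-injective (residue-unique (s≤s (Finₚ.toℕ<n i)) (s≤s (Finₚ.toℕ<n j))
        (≅-trans (≅-sym (h² i)) (≅-trans (≅-reflexive (cong (λ k → + k * + k) hi≡hj)) (h² j)))))
        where
        hi≡hj : h i ≡ h j
        hi≡hj = trans (sym (suc-pred-h i)) (trans (cong suc (trans (sym (Finₚ.toℕ-fromℕ< (f<P i))) (trans (cong Fin.toℕ e) (Finₚ.toℕ-fromℕ< (f<P j))))) (suc-pred-h j))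

-- Quadratic reciprocity

private
  -- With u = q x and v = p y the sign  near u v p  is -1 exactly when  0 < p y - q x < p/2,
  -- that is when y = ⌈q x / p⌉ and q x has residue above p/2.
  Near : ℕ → ℕ → ℕ → Set
  Near u v p = u ℕ.< v × v ℕ.+ v ℕ.< u ℕ.+ u ℕ.+ p

  near? : ∀ u v p → Dec (Near u v p)
  near? u v p = (u ℕ.<? v) ×-dec (v ℕ.+ v ℕ.<? u ℕ.+ u ℕ.+ p)

  opaque
    near far : ℕ → ℕ → ℕ → ℤ
    near u v p = choose (near? u v p) -1ℤ 1ℤ
    far  u v p = choose (u ℕ.+ u ℕ.+ p ℕ.≤? v ℕ.+ v) -1ℤ 1ℤ

    less : ℕ → ℕ → ℤ
    less u v = choose (u ℕ.<? v) -1ℤ 1ℤ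

    near-yes : ∀ {u v p} → Near u v p → near u v p ≡ -1ℤ
    near-yes {u} {v} {p} = choose-yes (near? u v p)

    near-no : ∀ {u v p} → ¬ Near u v p → near u v p ≡ 1ℤ
    near-no {u} {v} {p} = choose-no (near? u v p)

    far-cong : ∀ u v p u′ v′ p′ → (u ℕ.+ u ℕ.+ p ℕ.≤ v ℕ.+ v → u′ ℕ.+ u′ ℕ.+ p′ ℕ.≤ v′ ℕ.+ v′) →
               (u′ ℕ.+ u′ ℕ.+ p′ ℕ.≤ v′ ℕ.+ v′ → u ℕ.+ u ℕ.+ p ℕ.≤ v ℕ.+ v) → far u v p ≡ far u′ v′ p′
    far-cong u v p u′ v′ p′ = choose-cong (u ℕ.+ u ℕ.+ p ℕ.≤? v ℕ.+ v) (u′ ℕ.+ u′ ℕ.+ p′ ℕ.≤? v′ ℕ.+ v′)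

    far-Unit : ∀ u v p → Unit (far u v p)
    far-Unit u v p with u ℕ.+ u ℕ.+ p ℕ.≤? v ℕ.+ v
    ... | yes _ = neg
    ... | no  _ = pos

    near*far : ∀ u v k → near u v (suc k) * far u v (suc k) ≡ less u v
    near*far u v k = aux (u ℕ.<? v) (v ℕ.+ v ℕ.<? u ℕ.+ u ℕ.+ suc k) (u ℕ.+ u ℕ.+ suc k ℕ.≤? v ℕ.+ v)
      where
      aux : (a : Dec (u ℕ.< v)) (b : Dec (v ℕ.+ v ℕ.< u ℕ.+ u ℕ.+ suc k)) (c : Dec (u ℕ.+ u ℕ.+ suc k ℕ.≤ v ℕ.+ v)) →
            choose (a ×-dec b) -1ℤ 1ℤ * choose c -1ℤ 1ℤ ≡ choose a -1ℤ 1ℤ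
      aux _       (yes b) (yes c) = ⊥-elim (ℕₚ.<⇒≱ b c)
      aux (yes a) (yes b) (no ¬c) = refl
      aux (yes a) (no ¬b) (yes c) = refl
      aux _       (no ¬b) (no ¬c) = ⊥-elim (¬c (ℕₚ.≮⇒≥ ¬b))
      aux (no ¬a) (no ¬b) (yes c) = ⊥-elim (ℕₚ.m+1+n≰m (u ℕ.+ u) (ℕₚ.≤-trans c (ℕₚ.+-mono-≤ (ℕₚ.≮⇒≥ ¬a) (ℕₚ.≮⇒≥ ¬a))))
      aux (no ¬a) (yes b) (no ¬c) = refl

    less*less : ∀ u v → u ≢ v → less u v * less v u ≡ -1ℤ
    less*less u v u≢v with u ℕ.<? v | v ℕ.<? u
    ... | yes a | yes b = ⊥-elim (ℕₚ.<-asym a b)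
    ... | yes _ | no  _ = refl
    ... | no  _ | yes _ = refl
    ... | no  a | no  b = ⊥-elim (u≢v (ℕₚ.≤-antisym (ℕₚ.≮⇒≥ b) (ℕₚ.≮⇒≥ a)))

  module Column (P Q : ℕ) (pr : Prime (odd P)) (x : ℕ) (x≤P : x ℕ.≤ P) where
    open Legendre P pr using (p; P<p; sgn; sgn-≤; sgn-≰)
    u r y₀ w : ℕ
    u  = odd Q ℕ.* x
    r  = u ℕ.% p
    y₀ = u ℕ./ p
    w  = y₀ ℕ.* p

    u≡r+w : u ≡ r ℕ.+ w
    u≡r+w = ℕᵐ.m≡m%n+[m/n]*n u p

    r<p : r ℕ.< p
    r<p = ℕᵐ.m%n<n u p

    2u+p : u ℕ.+ u ℕ.+ p ≡ r ℕ.+ r ℕ.+ p ℕ.+ (w ℕ.+ w)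
    2u+p = trans (cong (λ k → k ℕ.+ k ℕ.+ p) u≡r+w) (lem r w p)
      where
      lem : ∀ r w p → r ℕ.+ w ℕ.+ (r ℕ.+ w) ℕ.+ p ≡ r ℕ.+ r ℕ.+ p ℕ.+ (w ℕ.+ w)
      lem = ℕSolver.solve-∀

    double : ∀ p w → p ℕ.+ p ℕ.+ (w ℕ.+ w) ≡ (w ℕ.+ p) ℕ.+ (w ℕ.+ p)
    double = ℕSolver.solve-∀

    multiple≤ : ∀ j k → k ℕ.+ y₀ ℕ.≤ j → k ℕ.* p ℕ.+ w ℕ.≤ p ℕ.* j
    multiple≤ j k k+y₀≤j = subst₂ ℕ._≤_ (ℕₚ.*-distribʳ-+ p k y₀) (ℕₚ.*-comm j p) (ℕₚ.*-monoˡ-≤ p k+y₀≤j)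

    below : ∀ j → j ℕ.< y₀ → ¬ Near u (p ℕ.* suc j) p
    below j j<y₀ (u<v , _) = ℕₚ.<⇒≱ u<v (ℕₚ.≤-trans (ℕₚ.≤-trans (ℕₚ.≤-reflexive (ℕₚ.*-comm p (suc j))) (ℕₚ.*-monoˡ-≤ p j<y₀))
                       (subst (w ℕ.≤_) (sym u≡r+w) (ℕₚ.m≤n+m w r)))

    above : ∀ j → y₀ ℕ.< j → ¬ Near u (p ℕ.* suc j) p
    above j y₀<j (_ , b) = ℕₚ.<⇒≱ b (subst (ℕ._≤ p ℕ.* suc j ℕ.+ p ℕ.* suc j) (sym 2u+p)
      (ℕₚ.≤-trans (ℕₚ.+-monoˡ-≤ (w ℕ.+ w) (ℕₚ.+-mono-≤ (ℕₚ.+-mono-≤ (ℕₚ.<⇒≤ r<p) (ℕₚ.<⇒≤ r<p)) (ℕₚ.m≤m+n p p)))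
      (ℕₚ.≤-trans (ℕₚ.≤-reflexive (lem p w)) (ℕₚ.+-mono-≤ (multiple≤ (suc j) 2 (s≤s y₀<j)) (multiple≤ (suc j) 2 (s≤s y₀<j))))))
      where
      lem : ∀ p w → p ℕ.+ p ℕ.+ (p ℕ.+ p) ℕ.+ (w ℕ.+ w) ≡ 2 ℕ.* p ℕ.+ w ℕ.+ (2 ℕ.* p ℕ.+ w)
      lem = ℕSolver.solve-∀

    low : r ℕ.≤ P → ∀ j → y₀ ℕ.≤ j → ¬ Near u (p ℕ.* suc j) p
    low r≤P j y₀≤j (_ , b) = ℕₚ.<⇒≱ b (subst (ℕ._≤ p ℕ.* suc j ℕ.+ p ℕ.* suc j) (sym 2u+p)
      (ℕₚ.≤-trans (ℕₚ.+-monoˡ-≤ (w ℕ.+ w) (ℕₚ.+-monoˡ-≤ p (ℕₚ.≤-trans (ℕₚ.+-mono-≤ r≤P r≤P) (ℕₚ.n≤1+n (P ℕ.+ P)))))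
      (ℕₚ.≤-trans (ℕₚ.≤-reflexive (lem p w)) (ℕₚ.+-mono-≤ (multiple≤ (suc j) 1 (s≤s y₀≤j)) (multiple≤ (suc j) 1 (s≤s y₀≤j))))))
      where
      lem : ∀ p w → p ℕ.+ p ℕ.+ (w ℕ.+ w) ≡ 1 ℕ.* p ℕ.+ w ℕ.+ (1 ℕ.* p ℕ.+ w)
      lem = ℕSolver.solve-∀

    module _ (P<r : P ℕ.< r) where
      p<2r : p ℕ.< r ℕ.+ r
      p<2r = ℕₚ.≤-trans (ℕₚ.≤-reflexive (cong suc (sym (ℕₚ.+-suc P P)))) (ℕₚ.+-mono-≤ P<r P<r)

      hit : Near u (p ℕ.* suc y₀) p
      hit = subst₂ ℕ._<_ (sym u≡r+w) (sym v≡) (ℕₚ.+-monoˡ-< w r<p)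
          , subst₂ ℕ._<_ (trans (double p w) (cong₂ ℕ._+_ (trans (ℕₚ.+-comm w p) (sym v≡)) (trans (ℕₚ.+-comm w p) (sym v≡)))) (sym 2u+p)
              (ℕₚ.+-monoˡ-< (w ℕ.+ w) (ℕₚ.+-monoˡ-< p p<2r))
        where
        v≡ : p ℕ.* suc y₀ ≡ p ℕ.+ w
        v≡ = ℕₚ.*-comm p (suc y₀)

      y₀<Q : y₀ ℕ.< Q
      y₀<Q = ℕₚ.≰⇒> λ Q≤y₀ → ℕₚ.<⇒≱ (ℕₚ.≤-<-trans (ℕₚ.*-monoʳ-≤ (odd Q) x≤P) (ℕₚ.≤-<-trans (ℕₚ.m≤m+n _ Q)
          (ℕₚ.<-≤-trans (ℕₚ.≤-reflexive (cong suc (lem P Q))) (ℕₚ.+-mono-≤ P<r (ℕₚ.*-monoˡ-≤ p Q≤y₀))))) (ℕₚ.≤-reflexive (sym u≡r+w))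
        where
        lem : ∀ P Q → suc (Q ℕ.+ Q) ℕ.* P ℕ.+ Q ≡ P ℕ.+ Q ℕ.* suc (P ℕ.+ P)
        lem = ℕSolver.solve-∀

    column : sgn (+ odd Q * + x) ≡ ∏ Q (λ j → near u (p ℕ.* suc j) p)
    column = trans (cong sgn (sym (ℤₚ.pos-* (odd Q) x))) (aux (r ℕ.≤? P))
      where
      aux : Dec (r ℕ.≤ P) → sgn (+ u) ≡ ∏ Q (λ j → near u (p ℕ.* suc j) p)
      aux (yes r≤P) = trans (sgn-≤ r≤P) (sym (∏-trivial Q λ j _ → near-no (no-near j)))
        where
        no-near : ∀ j → ¬ Near u (p ℕ.* suc j) p
        no-near j with j ℕ.<? y₀
        ... | yes j<y₀ = below j j<y₀
        ... | no  j≮y₀ = low r≤P j (ℕₚ.≮⇒≥ j≮y₀)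
      aux (no r≰P) = trans (sgn-≰ r≰P) (sym (trans (∏-single Q y₀ (y₀<Q (ℕₚ.≰⇒> r≰P)) λ j _ j≢y₀ → near-no (no-near j j≢y₀)) (near-yes (hit (ℕₚ.≰⇒> r≰P)))))
        where
        no-near : ∀ j → j ≢ y₀ → ¬ Near u (p ℕ.* suc j) p
        no-near j j≢y₀ with j ℕ.<? y₀
        ... | yes j<y₀ = below j j<y₀
        ... | no  j≮y₀ = above j (ℕₚ.≤∧≢⇒< (ℕₚ.≮⇒≥ j≮y₀) (≢-sym j≢y₀))

distinct-primes : ∀ {p q} → Prime p → Prime q → p ≢ q → ¬ + p ∣ + q
distinct-primes {p} pr qr p≢q d with ℙ.prime⇒irreducible qr (ℤᵈ.∣⇒∣ᵤ d)
... | inj₁ refl = ℙ.¬prime[1] pr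
... | inj₂ e    = p≢q e

module _ (P Q : ℕ) (pr : Prime (odd P)) (qr : Prime (odd Q)) (p≢q : odd P ≢ odd Q) where
  private
    p q : ℕ
    p = odd P
    q = odd Q

    u v : ℕ → ℕ
    u i = q ℕ.* suc i
    v j = p ℕ.* suc j

    leg-near : ∀ P Q (pr : Prime (odd P)) → ¬ + odd P ∣ + odd Q →
               leg P (+ odd Q) ≡ ∏ P (λ i → ∏ Q (λ j → near (odd Q ℕ.* suc i) (odd P ℕ.* suc j) (odd P)))
    leg-near P Q pr p∤q = trans (Legendre.leg-gauss P pr p∤q) (∏-cong P λ i i<P → Column.column P Q pr (suc i) i<P)

    ∏∏-* : ∀ (f g : ℕ → ℕ → ℤ) → ∏ P (λ i → ∏ Q (f i)) * ∏ P (λ i → ∏ Q (g i)) ≡ ∏ P (λ i → ∏ Q (λ j → f i j * g i j))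
    ∏∏-* f g = trans (sym (∏-* P _ _)) (∏-cong P λ i _ → sym (∏-* Q (f i) (g i)))

    u≢v : ∀ i → i ℕ.< P → ∀ j → u i ≢ v j
    u≢v i i<P j e = aux (ℙ.euclidsLemma q (suc i) pr (ℕᵈ.divides (suc j) (trans e (ℕₚ.*-comm p (suc j)))))
      where
      aux : ¬ (p ℕᵈ.∣ q ⊎ p ℕᵈ.∣ suc i)
      aux (inj₁ d) = distinct-primes pr qr p≢q (ℤᵈ.∣ᵤ⇒∣ d)
      aux (inj₂ d) = ℕₚ.<⇒≱ (ℕₚ.≤-<-trans i<P (Legendre.P<p P pr)) (ℕᵈ.∣⇒≤ d)

    -- The central symmetry of the rectangle exchanges the two far regions.
    far-reverse : ∏ P (λ i → ∏ Q (λ j → far (u i) (v j) p)) ≡ ∏ P (λ i → ∏ Q (λ j → far (v j) (u i) q))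
    far-reverse = trans (sym (∏-reverse P _)) (∏-cong P λ i i<P → trans (sym (∏-reverse Q _)) (∏-cong Q λ j j<Q →
        far-cong (u (P ℕ.∸ suc i)) (v (Q ℕ.∸ suc j)) p (v j) (u i) q (Shift.forth (u i) (u (P ℕ.∸ suc i)) (v j) (v (Q ℕ.∸ suc j)) (reflect q i<P) (reflect p j<Q)) (Shift.back (u i) (u (P ℕ.∸ suc i)) (v j) (v (Q ℕ.∸ suc j)) (reflect q i<P) (reflect p j<Q))))
      where
      reflect : ∀ q {i P} → i ℕ.< P → q ℕ.* suc (P ℕ.∸ suc i) ℕ.+ q ℕ.* suc i ≡ q ℕ.* suc P
      reflect q {i} {P} i<P = trans (sym (ℕₚ.*-distribˡ-+ q (suc (P ℕ.∸ suc i)) (suc i))) (cong (λ k → q ℕ.* suc k) (ℕₚ.m∸n+n≡m i<P))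
      total : q ℕ.* suc P ℕ.+ q ℕ.* suc P ℕ.+ p ≡ p ℕ.* suc Q ℕ.+ p ℕ.* suc Q ℕ.+ q
      total = lem P Q
        where
        lem : ∀ P Q → suc (Q ℕ.+ Q) ℕ.* suc P ℕ.+ suc (Q ℕ.+ Q) ℕ.* suc P ℕ.+ suc (P ℕ.+ P)
                    ≡ suc (P ℕ.+ P) ℕ.* suc Q ℕ.+ suc (P ℕ.+ P) ℕ.* suc Q ℕ.+ suc (Q ℕ.+ Q)
        lem = ℕSolver.solve-∀
      module Shift (a a′ b b′ : ℕ) (ea : a′ ℕ.+ a ≡ q ℕ.* suc P) (eb : b′ ℕ.+ b ≡ p ℕ.* suc Q) where
        shift : a′ ℕ.+ a′ ℕ.+ p ℕ.+ (a ℕ.+ a ℕ.+ (b ℕ.+ b)) ≡ (b ℕ.+ b ℕ.+ q) ℕ.+ (p ℕ.* suc Q ℕ.+ p ℕ.* suc Q)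
        shift = trans (lem a a′ b p) (trans (cong (λ k → k ℕ.+ k ℕ.+ p ℕ.+ (b ℕ.+ b)) ea) (trans (cong (ℕ._+ (b ℕ.+ b)) total) (lem′ b q (p ℕ.* suc Q))))
          where
          lem : ∀ a a′ b p → a′ ℕ.+ a′ ℕ.+ p ℕ.+ (a ℕ.+ a ℕ.+ (b ℕ.+ b)) ≡ (a′ ℕ.+ a) ℕ.+ (a′ ℕ.+ a) ℕ.+ p ℕ.+ (b ℕ.+ b)
          lem = ℕSolver.solve-∀
          lem′ : ∀ b q t → t ℕ.+ t ℕ.+ q ℕ.+ (b ℕ.+ b) ≡ (b ℕ.+ b ℕ.+ q) ℕ.+ (t ℕ.+ t)
          lem′ = ℕSolver.solve-∀
        shift′ : b′ ℕ.+ b′ ℕ.+ (a ℕ.+ a ℕ.+ (b ℕ.+ b)) ≡ (a ℕ.+ a) ℕ.+ (p ℕ.* suc Q ℕ.+ p ℕ.* suc Q)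
        shift′ = trans (lem a b b′) (cong (λ k → a ℕ.+ a ℕ.+ (k ℕ.+ k)) eb)
          where
          lem : ∀ a b b′ → b′ ℕ.+ b′ ℕ.+ (a ℕ.+ a ℕ.+ (b ℕ.+ b)) ≡ (a ℕ.+ a) ℕ.+ ((b′ ℕ.+ b) ℕ.+ (b′ ℕ.+ b))
          lem = ℕSolver.solve-∀
        forth : a′ ℕ.+ a′ ℕ.+ p ℕ.≤ b′ ℕ.+ b′ → b ℕ.+ b ℕ.+ q ℕ.≤ a ℕ.+ a
        forth h = ℕₚ.+-cancelʳ-≤ _ _ _ (subst₂ ℕ._≤_ shift shift′ (ℕₚ.+-monoˡ-≤ _ h))
        back : b ℕ.+ b ℕ.+ q ℕ.≤ a ℕ.+ a → a′ ℕ.+ a′ ℕ.+ p ℕ.≤ b′ ℕ.+ b′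
        back h = ℕₚ.+-cancelʳ-≤ _ _ _ (subst₂ ℕ._≤_ (sym shift) (sym shift′) (ℕₚ.+-monoˡ-≤ _ h))

  quadratic-reciprocity : leg P (+ q) * leg Q (+ p) ≡ -1ℤ ^ (P ℕ.* Q)
  quadratic-reciprocity = begin
    leg P (+ q) * leg Q (+ p)
      ≡⟨ cong₂ _*_ (leg-near P Q pr (distinct-primes pr qr p≢q)) (trans (leg-near Q P qr (distinct-primes qr pr (≢-sym p≢q))) (sym (∏-swap P Q _))) ⟩
    N₁ * N₂
      ≡⟨ sym (trans (cong (N₁ * N₂ *_) (Unit-sq F-Unit)) (ℤₚ.*-identityʳ _)) ⟩
    N₁ * N₂ * (F * F)
      ≡⟨ lem N₁ N₂ F F ⟩
    (N₁ * F) * (N₂ * F)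
      ≡⟨ cong (λ k → N₁ * F * (N₂ * k)) far-reverse ⟩
    (N₁ * F) * (N₂ * ∏ P (λ i → ∏ Q (λ j → far (v j) (u i) q)))
      ≡⟨ cong₂ _*_ (∏∏-* _ _) (∏∏-* _ _) ⟩
    ∏ P (λ i → ∏ Q (λ j → near (u i) (v j) p * far (u i) (v j) p)) * ∏ P (λ i → ∏ Q (λ j → near (v j) (u i) q * far (v j) (u i) q))
      ≡⟨ ∏∏-* _ _ ⟩
    ∏ P (λ i → ∏ Q (λ j → near (u i) (v j) p * far (u i) (v j) p * (near (v j) (u i) q * far (v j) (u i) q)))
      ≡⟨ ∏-cong P (λ i i<P → ∏-cong Q λ j _ → trans (cong₂ _*_ (near*far (u i) (v j) _) (near*far (v j) (u i) _)) (less*less (u i) (v j) (u≢v i i<P j))) ⟩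
    ∏ P (λ i → ∏ Q (λ j → -1ℤ))
      ≡⟨ trans (∏-cong P λ _ _ → ∏-const Q -1ℤ) (∏-const P (-1ℤ ^ Q)) ⟩
    (-1ℤ ^ Q) ^ P
      ≡⟨ trans (ℤₚ.^-*-assoc -1ℤ Q P) (cong (-1ℤ ^_) (ℕₚ.*-comm Q P)) ⟩
    -1ℤ ^ (P ℕ.* Q) ∎
    where
    open ≡-Reasoning
    N₁ N₂ F : ℤ
    N₁ = ∏ P (λ i → ∏ Q (λ j → near (u i) (v j) p))
    N₂ = ∏ P (λ i → ∏ Q (λ j → near (v j) (u i) q))
    F  = ∏ P (λ i → ∏ Q (λ j → far (u i) (v j) p))
    F-Unit : Unit F
    F-Unit = Unit-∏ P λ i → Unit-∏ Q λ j → far-Unit (u i) (v j) p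
    lem : ∀ a b c d → a * b * (c * d) ≡ (a * c) * (b * d)
    lem = solve-∀

two : ℕ → ℤ
two zero          = 1ℤ
two (suc zero)    = -1ℤ
two (suc (suc P)) = - two P

private
  ∏-two : ∀ P → ∏ P (λ i → choose (suc i ℕ.+ suc i ℕ.≤? P) 1ℤ -1ℤ) ≡ two P
  ∏-two zero          = refl
  ∏-two (suc zero)    = refl
  ∏-two (suc (suc P)) = trans (∏-head (suc P) (λ i → choose (suc i ℕ.+ suc i ℕ.≤? suc (suc P)) 1ℤ -1ℤ))
    (negate (choose-yes {a = 1ℤ} {b = -1ℤ} (2 ℕ.≤? suc (suc P)) (s≤s (s≤s z≤n)))
      (trans (∏-cong P λ i _ → choose-cong (suc (suc i) ℕ.+ suc (suc i) ℕ.≤? suc (suc P)) (suc i ℕ.+ suc i ℕ.≤? P)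
            (λ h → ℕₚ.≤-pred (ℕₚ.≤-pred (subst (ℕ._≤ suc (suc P)) (cong suc (ℕₚ.+-suc (suc i) (suc i))) h)))
            (λ h → subst (ℕ._≤ suc (suc P)) (sym (cong suc (ℕₚ.+-suc (suc i) (suc i)))) (s≤s (s≤s h)))) (∏-two P))
      (choose-no (suc (suc P) ℕ.+ suc (suc P) ℕ.≤? suc (suc P)) (ℕₚ.m+1+n≰m (suc (suc P)))))
    where
    lem : ∀ t → 1ℤ * (t * -1ℤ) ≡ - t
    lem = solve-∀
    negate : ∀ {a b c t} → a ≡ 1ℤ → b ≡ t → c ≡ -1ℤ → a * (b * c) ≡ - t
    negate {t = t} refl refl refl = lem t

module _ (P : ℕ) (pr : Prime (odd P)) where
  open Legendre P pr

  leg-2 : leg P (+ 2) ≡ two P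
  leg-2 = trans (leg-gauss λ d → ℕₚ.<⇒≱ 2<p (ℕᵈ.∣⇒≤ (ℤᵈ.∣⇒∣ᵤ d))) (trans (∏-cong P λ i i<P → trans (cong sgn (double i)) (eval i i<P)) (∏-two P))
    where
    double : ∀ i → + 2 * + suc i ≡ + (suc i ℕ.+ suc i)
    double i = trans (sym (ℤₚ.pos-* 2 (suc i))) (cong (λ k → + (suc i ℕ.+ k)) (ℕₚ.+-identityʳ (suc i)))
    eval : ∀ i → i ℕ.< P → sgn (+ (suc i ℕ.+ suc i)) ≡ choose (suc i ℕ.+ suc i ℕ.≤? P) 1ℤ -1ℤ
    eval i i<P = aux (suc i ℕ.+ suc i ℕ.≤? P)
      where
      res : (suc i ℕ.+ suc i) ℕ.% p ≡ suc i ℕ.+ suc i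
      res = ℕᵐ.m<n⇒m%n≡m (s≤s (ℕₚ.+-mono-≤ i<P i<P))
      aux : (d : Dec (suc i ℕ.+ suc i ℕ.≤ P)) → sgn (+ (suc i ℕ.+ suc i)) ≡ choose d 1ℤ -1ℤ
      aux (yes h) = sgn-≤ (subst (ℕ._≤ P) (sym res) h)
      aux (no ¬h) = sgn-≰ λ h → ¬h (subst (ℕ._≤ P) res h)

-- Real characters

triangle : ∀ a b {m n} → abs a ℕ.≤ m → abs b ℕ.≤ n → abs (a + b) ℕ.≤ m ℕ.+ n
triangle a b h k = ℕₚ.≤-trans (ℤₚ.∣i+j∣≤∣i∣+∣j∣ a b) (ℕₚ.+-mono-≤ h k)

triangle⁻ : ∀ a b {m n} → abs a ℕ.≤ m → abs b ℕ.≤ n → abs (a - b) ℕ.≤ m ℕ.+ n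
triangle⁻ a b h k = ℕₚ.≤-trans (ℤₚ.∣i-j∣≤∣i∣+∣j∣ a b) (ℕₚ.+-mono-≤ h k)

abs-*-≤ : ∀ a b {m n} → abs a ℕ.≤ m → abs b ℕ.≤ n → abs (a * b) ℕ.≤ m ℕ.* n
abs-*-≤ a b h k = ℕₚ.≤-trans (ℕₚ.≤-reflexive (ℤₚ.abs-* a b)) (ℕₚ.*-mono-≤ h k)

Sign3-abs : ∀ {a} → Sign3 a → abs a ℕ.≤ 1
Sign3-abs nil = z≤n
Sign3-abs pos = s≤s z≤n
Sign3-abs neg = s≤s z≤n

record Character (M : ℕ) : Set where
  field
    fn     : ℕ → ℤ
    one    : fn 1 ≡ 1ℤ
    mult   : ∀ a b → fn (a ℕ.* b) ≡ fn a * fn b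
    sign3  : ∀ a → Sign3 (fn a)
    period : ∀ a → fn (M ℕ.+ a) ≡ fn a
open Character public

infixl 7 _⊗_
_⊗_ : ∀ {M} → Character M → Character M → Character M
fn     (ψ ⊗ φ) a   = fn ψ a * fn φ a
one    (ψ ⊗ φ)     = cong₂ _*_ (one ψ) (one φ)
mult   (ψ ⊗ φ) a b = trans (cong₂ _*_ (mult ψ a b) (mult φ a b)) (lem (fn ψ a) (fn ψ b) (fn φ a) (fn φ b))
  where
  lem : ∀ a b c d → a * b * (c * d) ≡ a * c * (b * d)
  lem = solve-∀
sign3  (ψ ⊗ φ) a   = Sign3-* (sign3 ψ a) (sign3 φ a)
period (ψ ⊗ φ) a   = cong₂ _*_ (period ψ a) (period φ a)

module _ {M : ℕ} where
  periods : ∀ (ψ : Character M) k a → fn ψ (k ℕ.* M ℕ.+ a) ≡ fn ψ a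
  periods ψ zero    a = refl
  periods ψ (suc k) a = trans (cong (fn ψ) (ℕₚ.+-assoc M (k ℕ.* M) a)) (trans (period ψ _) (periods ψ k a))

  residue-class : .{{_ : NonZero M}} → ∀ (ψ : Character M) a → fn ψ (a ℕ.% M) ≡ fn ψ a
  residue-class ψ a = sym (trans (cong (fn ψ) (trans (ℕᵐ.m≡m%n+[m/n]*n a M) (ℕₚ.+-comm (a ℕ.% M) _))) (periods ψ (a ℕ./ M) (a ℕ.% M)))

record UnitMod (M : ℕ) : Set where
  field
    elt inv : ℕ
    law     : .{{_ : NonZero M}} → (elt ℕ.* inv) ℕ.% M ≡ 1 ℕ.% M
open UnitMod public

module Sums (M : ℕ) {{M≢0 : NonZero M}} where
  opaque
    G : Character M → ℕ → ℕ → ℕ → ℤ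
    G ψ U t X = ∑ U (λ i → fn ψ (suc i) * + (X ℕ.∸ t ℕ.* suc i))

    G-def : ∀ ψ U t X → G ψ U t X ≡ ∑ U (λ i → fn ψ (suc i) * + (X ℕ.∸ t ℕ.* suc i))
    G-def ψ U t X = refl

  module Nonprincipal (ψ : Character M) (w : UnitMod M) (ψw≡-1 : fn ψ (elt w) ≡ -1ℤ) where
    private
      f : ℕ → ℤ
      f i = fn ψ (suc i)

      mul : ℕ → ℕ → ℕ
      mul t i = (t ℕ.* i) ℕ.% M

      mul-inverse : ∀ s t → (s ℕ.* t) ℕ.% M ≡ 1 ℕ.% M → ∀ i → i ℕ.< M → mul s (mul t i) ≡ i
      mul-inverse s t e i i<M = begin
        (s ℕ.* ((t ℕ.* i) ℕ.% M)) ℕ.% M           ≡⟨ ℕᵐ.%-distribˡ-* s _ M ⟩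
        ((s ℕ.% M) ℕ.* ((t ℕ.* i) ℕ.% M ℕ.% M)) ℕ.% M ≡⟨ cong (λ k → ((s ℕ.% M) ℕ.* k) ℕ.% M) (ℕᵐ.m%n%n≡m%n (t ℕ.* i) M) ⟩
        ((s ℕ.% M) ℕ.* ((t ℕ.* i) ℕ.% M)) ℕ.% M   ≡⟨ sym (ℕᵐ.%-distribˡ-* s (t ℕ.* i) M) ⟩
        (s ℕ.* (t ℕ.* i)) ℕ.% M                   ≡⟨ cong (ℕ._% M) (sym (ℕₚ.*-assoc s t i)) ⟩
        (s ℕ.* t ℕ.* i) ℕ.% M                     ≡⟨ ℕᵐ.%-distribˡ-* (s ℕ.* t) i M ⟩
        (((s ℕ.* t) ℕ.% M) ℕ.* (i ℕ.% M)) ℕ.% M   ≡⟨ cong (λ k → (k ℕ.* (i ℕ.% M)) ℕ.% M) e ⟩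
        ((1 ℕ.% M) ℕ.* (i ℕ.% M)) ℕ.% M           ≡⟨ sym (ℕᵐ.%-distribˡ-* 1 i M) ⟩
        (1 ℕ.* i) ℕ.% M                           ≡⟨ cong (ℕ._% M) (ℕₚ.*-identityˡ i) ⟩
        i ℕ.% M                                   ≡⟨ ℕᵐ.m<n⇒m%n≡m i<M ⟩
        i ∎
        where open ≡-Reasoning

      self-neg : ∀ s → s ≡ - s → s ≡ 0ℤ
      self-neg (+ zero)  e = refl
      self-neg (+ suc n) ()
      self-neg -[1+ n ]  ()

    sum-zero : ∑ M f ≡ 0ℤ
    sum-zero = trans shift (self-neg _ (trans (sym (∑-reindex M (fn ψ) (mul (elt w)) (mul (inv w)) (λ i _ → ℕᵐ.m%n<n _ M) (λ i _ → ℕᵐ.m%n<n _ M)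
                   (mul-inverse (inv w) (elt w) (trans (cong (ℕ._% M) (ℕₚ.*-comm (inv w) (elt w))) (law w)))
                   (mul-inverse (elt w) (inv w) (law w))))
                (trans (∑-cong M λ i _ → trans (residue-class ψ (elt w ℕ.* i)) (trans (mult ψ (elt w) i) (cong (_* fn ψ i) ψw≡-1)))
                (trans (∑-*ˡ M -1ℤ (fn ψ)) (ℤₚ.-1*i≡-i _)))))
      where
      shift : ∑ M f ≡ ∑ M (fn ψ)
      shift = ∑-shift
        where
        cancel : ∀ {a b c} → a + b ≡ c + a → b ≡ c
        cancel {a} {b} {c} e = trans (lem a b) (trans (cong (_- a) e) (lem′ a c))
          where
          lem : ∀ a b → b ≡ a + b - a
          lem = solve-∀
          lem′ : ∀ a c → c + a - a ≡ c
          lem′ = solve-∀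
        ∑-shift : ∑ M f ≡ ∑ M (fn ψ)
        ∑-shift = cancel {fn ψ 0} (trans (sym (∑-head M (fn ψ))) (cong (λ z → ∑ M (fn ψ) + z) (trans (cong (fn ψ) (sym (ℕₚ.+-identityʳ M))) (period ψ 0))))

    f-period : ∀ i → f (M ℕ.+ i) ≡ f i
    f-period i = trans (cong (fn ψ) (sym (ℕₚ.+-suc M i))) (period ψ (suc i))

    private
      partial-reduce : ∀ k r → ∑ (k ℕ.* M ℕ.+ r) f ≡ ∑ r f
      partial-reduce zero    r = refl
      partial-reduce (suc k) r = trans (cong (λ n → ∑ n f) (ℕₚ.+-assoc M (k ℕ.* M) r)) (trans (∑-++ M (k ℕ.* M ℕ.+ r) f)
        (trans (cong₂ _+_ sum-zero (∑-cong (k ℕ.* M ℕ.+ r) λ i _ → f-period i)) (trans (ℤₚ.+-identityˡ _) (partial-reduce k r))))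

    partial-bound : ∀ n → abs (∑ n f) ℕ.≤ M
    partial-bound n = subst (λ s → abs s ℕ.≤ M) (sym (trans (cong (λ k → ∑ k f) (trans (ℕᵐ.m≡m%n+[m/n]*n n M) (ℕₚ.+-comm (n ℕ.% M) _))) (partial-reduce (n ℕ./ M) (n ℕ.% M))))
      (ℕₚ.≤-trans (∑-bound (n ℕ.% M) 1 λ i _ → Sign3-abs (sign3 ψ (suc i)))
      (ℕₚ.≤-trans (ℕₚ.≤-reflexive (ℕₚ.*-identityʳ _)) (ℕₚ.<⇒≤ (ℕᵐ.m%n<n n M))))

    β : ℤ
    β = ∑ M (λ i → f i * - + suc i)

    β-bound : abs β ℕ.≤ M ℕ.* M
    β-bound = ∑-bound M M λ i i<M → subst (abs (f i * - + suc i) ℕ.≤_) (ℕₚ.*-identityˡ M) (abs-*-≤ (f i) (- + suc i) (Sign3-abs (sign3 ψ (suc i))) i<M)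

    private opaque
      unfolding G
      G-extend : ∀ U k t X → X ℕ.≤ t ℕ.* U → G ψ (U ℕ.+ k) t X ≡ G ψ U t X
      G-extend U k t X X≤tU = trans (∑-++ U k _) (trans (cong (λ z → ∑ U (λ i → f i * + (X ℕ.∸ t ℕ.* suc i)) + z) (∑-trivial k λ i _ →
        trans (cong (λ z → f (U ℕ.+ i) * + z) (ℕₚ.m≤n⇒m∸n≡0 (ℕₚ.≤-trans X≤tU (ℕₚ.*-monoʳ-≤ t (ℕₚ.m≤n⇒m≤1+n (ℕₚ.m≤m+n U i)))))) (ℤₚ.*-zeroʳ (f (U ℕ.+ i))))) (ℤₚ.+-identityʳ _))

      G-step : ∀ U t X → G ψ (M ℕ.+ U) t (X ℕ.+ t ℕ.* M) ≡ + t * β + G ψ U t X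
      G-step U t X = trans (∑-++ M U _) (cong₂ _+_ first (∑-cong U λ i _ → cong₂ (λ a b → a * + b) (f-period i) (second i)))
        where
        first : ∑ M (λ i → f i * + (X ℕ.+ t ℕ.* M ℕ.∸ t ℕ.* suc i)) ≡ + t * β
        first = begin
          ∑ M (λ i → f i * + (X ℕ.+ t ℕ.* M ℕ.∸ t ℕ.* suc i))
            ≡⟨ ∑-cong M (λ i i<M → trans (cong (f i *_) (trans (+∸ (ℕₚ.m≤n⇒m≤o+n X (ℕₚ.*-monoʳ-≤ t i<M))) (cong (λ z → + (X ℕ.+ t ℕ.* M) - z) (ℤₚ.pos-* t (suc i))))) (lem (f i) (+ (X ℕ.+ t ℕ.* M)) (+ t) (+ suc i))) ⟩
          ∑ M (λ i → + (X ℕ.+ t ℕ.* M) * f i + + t * (f i * - + suc i))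
            ≡⟨ ∑-+ M _ _ ⟩
          ∑ M (λ i → + (X ℕ.+ t ℕ.* M) * f i) + ∑ M (λ i → + t * (f i * - + suc i))
            ≡⟨ cong₂ _+_ (trans (∑-*ˡ M (+ (X ℕ.+ t ℕ.* M)) f) (trans (cong (+ (X ℕ.+ t ℕ.* M) *_) sum-zero) (ℤₚ.*-zeroʳ (+ (X ℕ.+ t ℕ.* M))))) (∑-*ˡ M (+ t) _) ⟩
          0ℤ + + t * β
            ≡⟨ ℤₚ.+-identityˡ _ ⟩
          + t * β ∎
          where
          open ≡-Reasoning
          lem : ∀ f x t i → f * (x - t * i) ≡ x * f + t * (f * - i)
          lem = solve-∀
        second : ∀ i → X ℕ.+ t ℕ.* M ℕ.∸ t ℕ.* suc (M ℕ.+ i) ≡ X ℕ.∸ t ℕ.* suc i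
        second i = trans (cong (X ℕ.+ t ℕ.* M ℕ.∸_) (trans (cong (t ℕ.*_) (sym (ℕₚ.+-suc M i))) (ℕₚ.*-distribˡ-+ t M (suc i))))
          (trans (sym (ℕₚ.∸-+-assoc (X ℕ.+ t ℕ.* M) (t ℕ.* M) (t ℕ.* suc i))) (cong (ℕ._∸ t ℕ.* suc i) (ℕₚ.m+n∸n≡m X (t ℕ.* M))))

      G-small : ∀ t r → r ℕ.≤ t ℕ.* M → abs (G ψ M t r) ℕ.≤ M ℕ.* (t ℕ.* M)
      G-small t r r≤tM = ∑-bound M (t ℕ.* M) λ i _ → subst (abs (f i * + (r ℕ.∸ t ℕ.* suc i)) ℕ.≤_) (ℕₚ.*-identityˡ (t ℕ.* M))
        (abs-*-≤ (f i) (+ (r ℕ.∸ t ℕ.* suc i)) (Sign3-abs (sign3 ψ (suc i))) (ℕₚ.≤-trans (ℕₚ.m∸n≤m r (t ℕ.* suc i)) r≤tM))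

    module _ (t : ℕ) {{t≢0 : NonZero t}} where
      private
        n≤t*n : ∀ n → n ℕ.≤ t ℕ.* n
        n≤t*n n = ℕₚ.m≤n*m n t

        resize : ∀ U V X → U ℕ.≤ V → X ℕ.≤ t ℕ.* U → G ψ V t X ≡ G ψ U t X
        resize U V X U≤V h = trans (cong (λ k → G ψ k t X) (sym (ℕₚ.m+[n∸m]≡n U≤V))) (G-extend U (V ℕ.∸ U) t X h)

        expand : ∀ q r → G ψ (r ℕ.+ q ℕ.* (t ℕ.* M)) t (r ℕ.+ q ℕ.* (t ℕ.* M)) ≡ + q * (+ t * β) + G ψ r t r
        expand zero    r = trans (cong (λ k → G ψ k t k) (ℕₚ.+-identityʳ r)) (sym (trans (cong (_+ G ψ r t r) (ℤₚ.*-zeroˡ (+ t * β))) (ℤₚ.+-identityˡ _)))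
        expand (suc q) r = begin
          G ψ (r ℕ.+ (t ℕ.* M ℕ.+ q ℕ.* (t ℕ.* M))) t (r ℕ.+ (t ℕ.* M ℕ.+ q ℕ.* (t ℕ.* M)))
            ≡⟨ cong (λ k → G ψ k t k) (trans (cong (r ℕ.+_) (ℕₚ.+-comm (t ℕ.* M) _)) (sym (ℕₚ.+-assoc r _ _))) ⟩
          G ψ (X ℕ.+ t ℕ.* M) t (X ℕ.+ t ℕ.* M)
            ≡⟨ resize (M ℕ.+ X) (X ℕ.+ t ℕ.* M) _ (ℕₚ.≤-trans (ℕₚ.≤-reflexive (ℕₚ.+-comm M X)) (ℕₚ.+-monoʳ-≤ X (n≤t*n M)))
                 (ℕₚ.≤-trans (ℕₚ.+-monoˡ-≤ (t ℕ.* M) (n≤t*n X)) (ℕₚ.≤-reflexive (trans (ℕₚ.+-comm (t ℕ.* X) _) (sym (ℕₚ.*-distribˡ-+ t M X))))) ⟩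
          G ψ (M ℕ.+ X) t (X ℕ.+ t ℕ.* M)
            ≡⟨ G-step X t X ⟩
          + t * β + G ψ X t X
            ≡⟨ cong (λ z → + t * β + z) (expand q r) ⟩
          + t * β + (+ q * (+ t * β) + G ψ r t r)
            ≡⟨ lem (+ t * β) (+ q) (G ψ r t r) ⟩
          + suc q * (+ t * β) + G ψ r t r ∎
          where
          open ≡-Reasoning
          X : ℕ
          X = r ℕ.+ q ℕ.* (t ℕ.* M)
          lem : ∀ x q g → x + (q * x + g) ≡ (1ℤ + q) * x + g
          lem = solve-∀

      G-error : ∀ X → abs (+ M * G ψ X t X - β * + X) ℕ.≤ t ℕ.* (M ℕ.* (M ℕ.* M) ℕ.+ M ℕ.* (M ℕ.* M))
      G-error X = subst (λ z → abs z ℕ.≤ t ℕ.* (M ℕ.* (M ℕ.* M) ℕ.+ M ℕ.* (M ℕ.* M))) (sym identity)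
        (ℕₚ.≤-trans (triangle⁻ (+ M * G ψ r t r) (β * + r)
            (abs-*-≤ (+ M) (G ψ r t r) ℕₚ.≤-refl (subst (λ z → abs z ℕ.≤ M ℕ.* (t ℕ.* M)) Gr (G-small t r r≤tM)))
            (abs-*-≤ β (+ r) β-bound r≤tM))
          (ℕₚ.≤-reflexive (lem t M)))
        where
        instance
          tM≢0 : NonZero (t ℕ.* M)
          tM≢0 = ℕₚ.m*n≢0 t M
        q r : ℕ
        q = X ℕ./ (t ℕ.* M)
        r = X ℕ.% (t ℕ.* M)
        X≡ : X ≡ r ℕ.+ q ℕ.* (t ℕ.* M)
        X≡ = ℕᵐ.m≡m%n+[m/n]*n X (t ℕ.* M)
        r≤tM : r ℕ.≤ t ℕ.* M
        r≤tM = ℕₚ.<⇒≤ (ℕᵐ.m%n<n X (t ℕ.* M))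
        Gr : G ψ M t r ≡ G ψ r t r
        Gr with ℕₚ.≤-total M r
        ... | inj₁ M≤r = sym (resize M r r M≤r r≤tM)
        ... | inj₂ r≤M = resize r M r r≤M (n≤t*n r)
        lem : ∀ t M → M ℕ.* (M ℕ.* (t ℕ.* M)) ℕ.+ (M ℕ.* M) ℕ.* (t ℕ.* M) ≡ t ℕ.* (M ℕ.* (M ℕ.* M) ℕ.+ M ℕ.* (M ℕ.* M))
        lem = ℕSolver.solve-∀
        cast : + X ≡ + r + + q * (+ t * + M)
        cast = trans (cong +_ X≡) (cong (λ z → + r + z) (trans (ℤₚ.pos-* q (t ℕ.* M)) (cong (+ q *_) (ℤₚ.pos-* t M))))
        identity : + M * G ψ X t X - β * + X ≡ + M * G ψ r t r - β * + r
        identity = trans (cong₂ (λ g x → + M * g - β * x) (trans (cong (λ k → G ψ k t k) X≡) (expand q r)) cast) (alg (+ M) (+ q) (+ t) β (G ψ r t r) (+ r))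
          where
          alg : ∀ M q t β g r → M * (q * (t * β) + g) - β * (r + q * (t * M)) ≡ M * g - β * r
          alg = solve-∀

module Hyperbola (M : ℕ) {{M≢0 : NonZero M}} where
  open Sums M

  private
    c₀ c₁ c₂ : ℕ
    c₀ = M ℕ.* (M ℕ.* M) ℕ.+ M ℕ.* (M ℕ.* M)
    c₁ = M ℕ.* (M ℕ.* M) ℕ.+ c₀
    c₂ = M ℕ.* M ℕ.+ c₀ ℕ.+ M ℕ.* M

    ×1 : ∀ a b {n} → abs a ℕ.≤ 1 → abs b ℕ.≤ n → abs (a * b) ℕ.≤ n
    ×1 a b h k = subst (abs (a * b) ℕ.≤_) (ℕₚ.*-identityˡ _) (abs-*-≤ a b h k)

  T : Character M → Character M → ℕ → ℤ
  T a b X = ∑ X (λ i → ∑ X (λ j → fn a (suc i) * fn b (suc j) * + (X ℕ.∸ suc i ℕ.* suc j)))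

  module _ (a b : Character M) (u v : UnitMod M) (au≡-1 : fn a (elt u) ≡ -1ℤ) (bv≡-1 : fn b (elt v) ≡ -1ℤ) where
    private
      module α-sums = Nonprincipal a u au≡-1
      module β-sums = Nonprincipal b v bv≡-1

      half : ∀ (a : Character M) (a-bound : ∀ n → abs (∑ n (λ i → fn a (suc i))) ℕ.≤ M)
             (b : Character M) (β : ℤ) → abs β ℕ.≤ M ℕ.* M →
             (∀ t {{_ : NonZero t}} X → abs (+ M * G b X t X - β * + X) ℕ.≤ t ℕ.* c₀) →
             ∀ Y → abs (+ M * ∑ Y (λ i → fn a (suc i) * G b (Y ℕ.* Y) (suc i) (Y ℕ.* Y))) ℕ.≤ c₁ ℕ.* (Y ℕ.* Y)
      half a a-bound b β β-bound error Y = subst (λ z → abs z ℕ.≤ c₁ ℕ.* X) (sym identity)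
        (ℕₚ.≤-trans (triangle (∑ Y α * (β * + X)) (∑ Y (λ i → α i * err i)) (abs-*-≤ (∑ Y α) (β * + X) (a-bound Y) (abs-*-≤ β (+ X) β-bound ℕₚ.≤-refl))
                                  (∑-bound Y {λ i → α i * err i} (Y ℕ.* c₀) λ i i<Y → ×1 (α i) (err i) (Sign3-abs (sign3 a (suc i))) (ℕₚ.≤-trans (error (suc i) X) (ℕₚ.*-monoˡ-≤ c₀ i<Y))))
                    (ℕₚ.≤-reflexive (lem M Y c₀)))
        where
        X : ℕ
        X = Y ℕ.* Y
        α err g : ℕ → ℤ
        α i = fn a (suc i)
        g i = G b X (suc i) X
        err i = + M * g i - β * + X
        lem : ∀ M Y c → M ℕ.* (M ℕ.* M ℕ.* (Y ℕ.* Y)) ℕ.+ Y ℕ.* (Y ℕ.* c) ≡ (M ℕ.* (M ℕ.* M) ℕ.+ c) ℕ.* (Y ℕ.* Y)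
        lem = ℕSolver.solve-∀
        alg : ∀ M a g x → M * (a * g) ≡ a * x + a * (M * g - x)
        alg = solve-∀
        identity : + M * ∑ Y (λ i → α i * g i) ≡ ∑ Y α * (β * + X) + ∑ Y (λ i → α i * err i)
        identity = trans (sym (∑-*ˡ Y (+ M) _)) (trans (∑-cong Y λ i _ → alg (+ M) (α i) (g i) (β * + X)) (trans (∑-+ Y _ _) (cong (_+ ∑ Y (λ i → α i * err i)) (∑-*ʳ Y (β * + X) α))))

      moment : ∀ (a : Character M) (a-bound : ∀ n → abs (∑ n (λ i → fn a (suc i))) ℕ.≤ M) (β : ℤ) → abs β ℕ.≤ M ℕ.* M →
               (∀ t {{_ : NonZero t}} X → abs (+ M * G a X t X - β * + X) ℕ.≤ t ℕ.* c₀) →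
               ∀ Y → 0 ℕ.< Y → abs (+ M * ∑ Y (λ i → fn a (suc i) * + suc i)) ℕ.≤ c₂ ℕ.* Y
      moment a a-bound β β-bound error Y 0<Y = subst (λ z → abs z ℕ.≤ c₂ ℕ.* Y) (sym identity)
        (ℕₚ.≤-trans (triangle⁻ (+ M * (+ Y * ∑ Y α) - err) (β * + Y)
           (triangle⁻ (+ M * (+ Y * ∑ Y α)) err (abs-*-≤ (+ M) (+ Y * ∑ Y α) (ℕₚ.≤-refl {M}) (abs-*-≤ (+ Y) (∑ Y α) (ℕₚ.≤-refl {Y}) (a-bound Y)))
              (ℕₚ.≤-trans (error 1 Y) (ℕₚ.≤-trans (ℕₚ.≤-reflexive (ℕₚ.*-comm 1 c₀)) (ℕₚ.*-monoʳ-≤ c₀ 0<Y))))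
           (abs-*-≤ β (+ Y) β-bound ℕₚ.≤-refl))
          (ℕₚ.≤-reflexive (lem M Y c₀)))
        where
        α : ℕ → ℤ
        α i = fn a (suc i)
        err : ℤ
        err = + M * G a Y 1 Y - β * + Y
        lem : ∀ M Y c → M ℕ.* (Y ℕ.* M) ℕ.+ c ℕ.* Y ℕ.+ M ℕ.* M ℕ.* Y ≡ (M ℕ.* M ℕ.+ c ℕ.+ M ℕ.* M) ℕ.* Y
        lem = ℕSolver.solve-∀
        G≡ : G a Y 1 Y ≡ + Y * ∑ Y α - ∑ Y (λ i → α i * + suc i)
        G≡ = trans (G-def a Y 1 Y) (trans (∑-cong Y λ i i<Y → trans (cong (λ k → α i * + (Y ℕ.∸ k)) (ℕₚ.*-identityˡ (suc i))) (trans (cong (α i *_) (+∸ i<Y)) (alg (α i) (+ Y) (+ suc i))))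
               (trans (∑-+ Y _ _) (cong₂ _+_ (∑-*ˡ Y (+ Y) α) (trans (∑-*ˡ Y -1ℤ (λ i → α i * + suc i)) (ℤₚ.-1*i≡-i _)))))
          where
          alg : ∀ a y i → a * (y - i) ≡ y * a + -1ℤ * (a * i)
          alg = solve-∀
        identity : + M * ∑ Y (λ i → α i * + suc i) ≡ + M * (+ Y * ∑ Y α) - err - β * + Y
        identity = trans (alg (+ M) (+ Y * ∑ Y α) _ (β * + Y)) (cong (λ z → + M * (+ Y * ∑ Y α) - (+ M * z - β * + Y) - β * + Y) (sym G≡))
          where
          alg : ∀ m s x b → m * x ≡ m * s - (m * (s - x) - b) - b
          alg = solve-∀

      module _ (Y : ℕ) (0<Y : 0 ℕ.< Y) where
        X k : ℕ
        X = Y ℕ.* Y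
        k = X ℕ.∸ Y

        α γ : ℕ → ℤ
        α i = fn a (suc i)
        γ j = fn b (suc j)

        g : ℕ → ℕ → ℤ
        g i j = α i * γ j * + (X ℕ.∸ suc i ℕ.* suc j)

        Y+k≡X : Y ℕ.+ k ≡ X
        Y+k≡X = ℕₚ.m+[n∸m]≡n (ℕₚ.m≤n*m Y Y {{ℕ.>-nonZero 0<Y}})

        SA SB SD ΣA ΣB μA μB : ℤ
        SA = ∑ Y (λ i → α i * G b X (suc i) X)
        SB = ∑ Y (λ j → γ j * G a X (suc j) X)
        SD = ∑ Y (λ i → ∑ Y (g i))
        ΣA = ∑ Y α
        ΣB = ∑ Y γ
        μA = ∑ Y (λ i → α i * + suc i)
        μB = ∑ Y (λ j → γ j * + suc j)

        row : ∀ i → ∑ X (g i) ≡ α i * G b X (suc i) X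
        row i = trans (trans (∑-cong X λ j _ → ℤₚ.*-assoc (α i) (γ j) _) (∑-*ˡ X (α i) _)) (cong (α i *_) (sym (G-def b X (suc i) X)))

        col : ∀ j → ∑ X (λ i → g i j) ≡ γ j * G a X (suc j) X
        col j = trans (trans (∑-cong X λ i _ → trans (lem (α i) (γ j) _) (cong (λ n → γ j * (α i * + (X ℕ.∸ n))) (ℕₚ.*-comm (suc i) (suc j)))) (∑-*ˡ X (γ j) _)) (cong (γ j *_) (sym (G-def a X (suc j) X)))
          where
          lem : ∀ a b c → a * b * c ≡ b * (a * c)
          lem = solve-∀

        beyond : ∀ i → ∑ X (g (Y ℕ.+ i)) ≡ ∑ Y (g (Y ℕ.+ i))
        beyond i = trans (cong (λ n → ∑ n (g (Y ℕ.+ i))) (sym Y+k≡X)) (trans (∑-++ Y k (g (Y ℕ.+ i))) (trans (cong (λ z → ∑ Y (g (Y ℕ.+ i)) + z) (∑-trivial k λ j _ →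
          trans (cong (λ n → α (Y ℕ.+ i) * γ (Y ℕ.+ j) * + n) (ℕₚ.m≤n⇒m∸n≡0 (ℕₚ.*-mono-≤ (ℕₚ.m≤n⇒m≤1+n (ℕₚ.m≤m+n Y i)) (ℕₚ.m≤n⇒m≤1+n (ℕₚ.m≤m+n Y j))))) (ℤₚ.*-zeroʳ (α (Y ℕ.+ i) * γ (Y ℕ.+ j))))) (ℤₚ.+-identityʳ _)))

        decompose : T a b X ≡ SA + (SB - SD)
        decompose = begin
          ∑ X (λ i → ∑ X (g i))
            ≡⟨ cong (λ n → ∑ n (λ i → ∑ X (g i))) (sym Y+k≡X) ⟩
          ∑ (Y ℕ.+ k) (λ i → ∑ X (g i))
            ≡⟨ ∑-++ Y k _ ⟩
          ∑ Y (λ i → ∑ X (g i)) + ∑ k (λ i → ∑ X (g (Y ℕ.+ i)))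
            ≡⟨ cong₂ _+_ (∑-cong Y λ i _ → row i) (trans (∑-cong k λ i _ → beyond i) rest) ⟩
          SA + (SB - SD) ∎
          where
          open ≡-Reasoning
          cancel : ∀ {s d r} → s ≡ d + r → r ≡ s - d
          cancel {s} {d} {r} refl = lem d r
            where
            lem : ∀ d r → r ≡ d + r - d
            lem = solve-∀
          rest : ∑ k (λ i → ∑ Y (g (Y ℕ.+ i))) ≡ SB - SD
          rest = cancel {SB} {SD} (trans (∑-cong Y λ j _ → sym (col j)) (trans (sym (∑-swap X Y g))
            (trans (cong (λ n → ∑ n (λ i → ∑ Y (g i))) (sym Y+k≡X)) (∑-++ Y k _))))

        square : SD ≡ + X * (ΣA * ΣB) - μA * μB
        square = trans (∑-cong Y λ i i<Y → inner i i<Y) (trans (∑-+ Y _ _) (cong₂ _+_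
            (trans (∑-*ʳ Y (+ X * ΣB) α) (alg₁ ΣA (+ X) ΣB)) (trans (∑-*ʳ Y (- μB) (λ i → α i * + suc i)) (alg₂ μA μB))))
          where
          alg₁ : ∀ a x b → a * (x * b) ≡ x * (a * b)
          alg₁ = solve-∀
          alg₂ : ∀ a b → a * - b ≡ - (a * b)
          alg₂ = solve-∀
          alg₃ : ∀ a b x i j → a * b * (x - i * j) ≡ a * x * b + - (a * i) * (b * j)
          alg₃ = solve-∀
          alg₄ : ∀ a x b i m → a * x * b + - (a * i) * m ≡ a * (x * b) + a * i * - m
          alg₄ = solve-∀
          inner : ∀ i → i ℕ.< Y → ∑ Y (g i) ≡ α i * (+ X * ΣB) + α i * + suc i * - μB
          inner i i<Y = trans (∑-cong Y λ j j<Y → trans (cong (α i * γ j *_) (trans (+∸ (ℕₚ.*-mono-≤ i<Y j<Y)) (cong (λ z → + X - z) (ℤₚ.pos-* (suc i) (suc j))))) (alg₃ (α i) (γ j) (+ X) (+ suc i) (+ suc j)))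
            (trans (∑-+ Y _ _) (trans (cong₂ _+_ (∑-*ˡ Y (α i * + X) γ) (∑-*ˡ Y (- (α i * + suc i)) (λ j → γ j * + suc j))) (alg₄ (α i) (+ X) ΣB (+ suc i) μB)))

        c₃ : ℕ
        c₃ = M ℕ.* c₁ ℕ.+ (M ℕ.* c₁ ℕ.+ (M ℕ.* M ℕ.* (M ℕ.* M) ℕ.+ c₂ ℕ.* c₂))

        scaled : abs (+ M * + M * T a b X) ℕ.≤ c₃ ℕ.* X
        scaled = subst (λ z → abs z ℕ.≤ c₃ ℕ.* X) (sym identity) (ℕₚ.≤-trans
          (triangle (+ M * (+ M * SA)) (+ M * (+ M * SB) - (+ M * + M * (+ X * (ΣA * ΣB)) - + M * μA * (+ M * μB))) (abs-*-≤ (+ M) (+ M * SA) (ℕₚ.≤-refl {M}) (half a α-sums.partial-bound b β-sums.β β-sums.β-bound (λ t → β-sums.G-error t) Y))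
            (triangle⁻ (+ M * (+ M * SB)) (+ M * + M * (+ X * (ΣA * ΣB)) - + M * μA * (+ M * μB)) (abs-*-≤ (+ M) (+ M * SB) (ℕₚ.≤-refl {M}) (half b β-sums.partial-bound a α-sums.β α-sums.β-bound (λ t → α-sums.G-error t) Y))
              (triangle⁻ (+ M * + M * (+ X * (ΣA * ΣB))) (+ M * μA * (+ M * μB))
                (abs-*-≤ (+ M * + M) (+ X * (ΣA * ΣB)) (ℕₚ.≤-reflexive (ℤₚ.abs-* (+ M) (+ M))) (abs-*-≤ (+ X) (ΣA * ΣB) (ℕₚ.≤-refl {X}) (abs-*-≤ ΣA ΣB (α-sums.partial-bound Y) (β-sums.partial-bound Y))))
                (abs-*-≤ (+ M * μA) (+ M * μB) (moment a α-sums.partial-bound α-sums.β α-sums.β-bound (λ t → α-sums.G-error t) Y 0<Y) (moment b β-sums.partial-bound β-sums.β β-sums.β-bound (λ t → β-sums.G-error t) Y 0<Y)))))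
          (ℕₚ.≤-reflexive (lem M Y c₁ c₂)))
          where
          lem : ∀ M Y c d → M ℕ.* (c ℕ.* (Y ℕ.* Y)) ℕ.+ (M ℕ.* (c ℕ.* (Y ℕ.* Y)) ℕ.+ (M ℕ.* M ℕ.* (Y ℕ.* Y ℕ.* (M ℕ.* M)) ℕ.+ d ℕ.* Y ℕ.* (d ℕ.* Y)))
                        ≡ (M ℕ.* c ℕ.+ (M ℕ.* c ℕ.+ (M ℕ.* M ℕ.* (M ℕ.* M) ℕ.+ d ℕ.* d))) ℕ.* (Y ℕ.* Y)
          lem = ℕSolver.solve-∀
          alg : ∀ M A B x s m n → M * M * (A + (B - (x * s - m * n))) ≡ M * (M * A) + (M * (M * B) - (M * M * (x * s) - M * m * (M * n)))
          alg = solve-∀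
          identity : + M * + M * T a b X ≡ + M * (+ M * SA) + (+ M * (+ M * SB) - (+ M * + M * (+ X * (ΣA * ΣB)) - + M * μA * (+ M * μB)))
          identity = trans (cong (+ M * + M *_) (trans decompose (cong (λ d → SA + (SB - d)) square))) (alg (+ M) SA SB (+ X) (ΣA * ΣB) μA μB)

    opaque
      T-bound : ∃ λ C → ∀ Y → abs (T a b (Y ℕ.* Y)) ℕ.≤ C ℕ.* (Y ℕ.* Y)
      T-bound = c , bound
        where
        c : ℕ
        c = M ℕ.* c₁ ℕ.+ (M ℕ.* c₁ ℕ.+ (M ℕ.* M ℕ.* (M ℕ.* M) ℕ.+ c₂ ℕ.* c₂))
        bound : ∀ Y → abs (T a b (Y ℕ.* Y)) ℕ.≤ c ℕ.* (Y ℕ.* Y)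
        bound zero      = z≤n
        bound Y@(suc _) = ℕₚ.≤-trans (ℕₚ.m≤n*m (abs t) (M ℕ.* M) {{ℕₚ.m*n≢0 M M}})
          (ℕₚ.≤-trans (ℕₚ.≤-reflexive (sym (trans (ℤₚ.abs-* (+ M * + M) t) (cong (ℕ._* abs t) (ℤₚ.abs-* (+ M) (+ M)))))) (scaled Y z<s))
          where
          t : ℤ
          t = T a b (Y ℕ.* Y)

-- Divisor sums of characters

∑-extend : ∀ {n X} f → n ℕ.≤ X → (∀ i → n ℕ.≤ i → f i ≡ 0ℤ) → ∑ X f ≡ ∑ n f
∑-extend {n} {X} f n≤X h = trans (cong (λ k → ∑ k f) (sym (ℕₚ.m+[n∸m]≡n n≤X))) (trans (∑-++ n (X ℕ.∸ n) f)
  (trans (cong (λ z → ∑ n f + z) (∑-trivial (X ℕ.∸ n) λ i _ → h (n ℕ.+ i) (ℕₚ.m≤m+n n i))) (ℤₚ.+-identityʳ _)))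

∑-multiples : ∀ d .{{_ : NonZero d}} X (h : ℕ → ℤ) → (∀ n → X ℕ.< n → h n ≡ 0ℤ) →
              ∑ X (λ j → h (d ℕ.* suc j)) ≡ ∑ X (λ a → choose (d ℕᵈ.∣? suc a) (h (suc a)) 0ℤ)
∑-multiples d X h h≡0 = trans (∑-cong X λ j _ → sym (column j)) (trans (sym (∑-swap X X δ)) (∑-cong X row))
  where
  δ : ℕ → ℕ → ℤ
  δ a j = choose (d ℕ.* suc j ℕ.≟ suc a) (h (suc a)) 0ℤ
  row : ∀ a → a ℕ.< X → ∑ X (δ a) ≡ choose (d ℕᵈ.∣? suc a) (h (suc a)) 0ℤ
  row a a<X with d ℕᵈ.∣? suc a
  ... | yes (ℕᵈ.divides zero ())
  ... | yes (ℕᵈ.divides (suc q) e) = trans (∑-single X q (ℕₚ.<-≤-trans (ℕₚ.≤-trans (ℕₚ.m≤m*n (suc q) d) (ℕₚ.≤-reflexive (sym e))) a<X)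
          (λ j _ j≢q → choose-no (d ℕ.* suc j ℕ.≟ suc a) λ e′ → j≢q (ℕₚ.suc-injective (ℕₚ.*-cancelˡ-≡ (suc j) (suc q) d (trans e′ (trans e (ℕₚ.*-comm (suc q) d)))))))
        (choose-yes (d ℕ.* suc q ℕ.≟ suc a) (trans (ℕₚ.*-comm d (suc q)) (sym e)))
  ... | no ∤a = ∑-trivial X λ j _ → choose-no (d ℕ.* suc j ℕ.≟ suc a) λ e → ∤a (ℕᵈ.divides (suc j) (trans (sym e) (ℕₚ.*-comm d (suc j))))
  column : ∀ j → ∑ X (λ a → δ a j) ≡ h (d ℕ.* suc j)
  column j with d ℕ.* suc j ℕ.≤? X
  ... | yes h≤ = trans (∑-single X (ℕ.pred (d ℕ.* suc j)) (subst (ℕ._≤ X) (sym suc-pred) h≤)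
          (λ a _ a≢ → choose-no (d ℕ.* suc j ℕ.≟ suc a) λ e → a≢ (cong ℕ.pred (sym e))))
        (trans (choose-yes (d ℕ.* suc j ℕ.≟ suc (ℕ.pred (d ℕ.* suc j))) (sym suc-pred)) (cong h suc-pred))
    where
    suc-pred : suc (ℕ.pred (d ℕ.* suc j)) ≡ d ℕ.* suc j
    suc-pred = ℕₚ.suc-pred (d ℕ.* suc j) {{ℕₚ.m*n≢0 d (suc j)}}
  ... | no h≰ = trans (∑-trivial X λ a a<X → choose-no (d ℕ.* suc j ℕ.≟ suc a) λ e → h≰ (subst (ℕ._≤ X) (sym e) a<X)) (sym (h≡0 _ (ℕₚ.≰⇒> h≰)))

prime-divisor : ∀ n → 1 ℕ.< n → ∃ λ q → Prime q × q ℕᵈ.∣ n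
prime-divisor n 1<n = aux (factorise n {{ℕ.>-nonZero (ℕₚ.<-trans z<s 1<n)}})
  where
  aux : PrimeFactorisation n → ∃ λ q → Prime q × q ℕᵈ.∣ n
  aux record { factors = []     ; isFactorisation = e } = ⊥-elim (ℕₚ.<⇒≢ 1<n (sym e))
  aux record { factors = q ∷ qs ; isFactorisation = e ; factorsPrime = pr ∷ _ } =
    q , pr , ℕᵈ.divides (product qs) (trans e (ℕₚ.*-comm q (product qs)))

prime-valuation : ∀ {q} → Prime q → ∀ n → 0 ℕ.< n → ∃ λ v → ∃ λ b → n ≡ q ℕ.^ v ℕ.* b × ¬ q ℕᵈ.∣ b
prime-valuation {q} pr n = go n (<-wellFounded n)
  where
  1<q : 1 ℕ.< q
  1<q = ℕ.nonTrivial⇒n>1 q {{ℙ.prime⇒nonTrivial pr}}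
  go : ∀ n → Acc ℕ._<_ n → 0 ℕ.< n → ∃ λ v → ∃ λ b → n ≡ q ℕ.^ v ℕ.* b × ¬ q ℕᵈ.∣ b
  go n (acc rs) 0<n with q ℕᵈ.∣? n
  ... | no  q∤n = 0 , n , sym (ℕₚ.*-identityˡ n) , q∤n
  ... | yes (ℕᵈ.divides m n≡mq) =
    let v , b , m≡ , q∤b = go m (rs m<n) 0<m
    in suc v , b , trans n≡mq (trans (ℕₚ.*-comm m q) (trans (cong (q ℕ.*_) m≡) (sym (ℕₚ.*-assoc q _ b)))) , q∤b
    where
    0<m : 0 ℕ.< m
    0<m = ℕₚ.n≢0⇒n>0 λ m≡0 → ℕₚ.<⇒≢ 0<n (sym (trans n≡mq (cong (ℕ._* q) m≡0)))
    m<n : m ℕ.< n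
    m<n = subst (m ℕ.<_) (sym n≡mq) (ℕₚ.m<m*n m q {{ℕ.>-nonZero 0<m}} 1<q)

prime-power-induction : (C : ℕ → Set) → C 1 →
  (∀ q v b → Prime q → 0 ℕ.< b → ¬ q ℕᵈ.∣ b → C b → C (q ℕ.^ suc v ℕ.* b)) → ∀ n → 0 ℕ.< n → C n
prime-power-induction C base step n = go n (<-wellFounded n)
  where
  go : ∀ n → Acc ℕ._<_ n → 0 ℕ.< n → C n
  go (suc zero)       _        _ = base
  go n@(suc (suc _)) (acc rs) _ with prime-divisor n (s≤s (s≤s z≤n))
  ... | q , pr , q∣n with prime-valuation pr n z<s
  ...   | zero  , b , n≡ , q∤b = ⊥-elim (q∤b (subst (q ℕᵈ.∣_) (trans n≡ (ℕₚ.*-identityˡ b)) q∣n))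
  ...   | suc v , b , n≡ , q∤b = subst C (sym n≡) (step q v b pr 0<b q∤b (go b (rs b<n) 0<b))
    where
    0<b : 0 ℕ.< b
    0<b = ℕₚ.n≢0⇒n>0 λ b≡0 → q∤b (subst (q ℕᵈ.∣_) (sym b≡0) (q ℕᵈ.∣0))
    b<n : b ℕ.< n
    b<n = subst (b ℕ.<_) (sym (trans n≡ (ℕₚ.*-comm (q ℕ.^ suc v) b))) (ℕₚ.m<m*n b (q ℕ.^ suc v) {{ℕ.>-nonZero 0<b}}
            (ℕₚ.<-≤-trans (ℕ.nonTrivial⇒n>1 q {{ℙ.prime⇒nonTrivial pr}}) (ℕₚ.m≤m*n q (q ℕ.^ v) {{ℕₚ.m^n≢0 q v {{ℙ.prime⇒nonZero pr}}}})))

data Parity : ℕ → Set where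
  even : ∀ k → Parity (k ℕ.+ k)
  odd′ : ∀ k → Parity (suc (k ℕ.+ k))

parity : ∀ n → Parity n
parity zero    = even 0
parity (suc n) with parity n
... | even k = odd′ k
... | odd′ k = subst Parity (cong suc (ℕₚ.+-suc k k)) (even (suc k))

module DivisorSum {M : ℕ} (χ : Character M) where
  private
    term : ℕ → ℕ → ℤ
    term n d = choose (d ℕᵈ.∣? n) (fn χ d) 0ℤ

    term-large : ∀ {n d} → 0 ℕ.< n → n ℕ.< d → term n d ≡ 0ℤ
    term-large {n} {d} 0<n n<d = choose-no (d ℕᵈ.∣? n) (ℕᵈ.>⇒∤ {{ℕ.>-nonZero 0<n}} n<d)

  R : ℕ → ℤ
  R n = ∑ n (λ i → choose (suc i ℕᵈ.∣? n) (fn χ (suc i)) 0ℤ)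

  R-extend : ∀ {n X} → 0 ℕ.< n → n ℕ.≤ X → ∑ X (λ i → choose (suc i ℕᵈ.∣? n) (fn χ (suc i)) 0ℤ) ≡ R n
  R-extend 0<n n≤X = ∑-extend _ n≤X λ i n≤i → term-large 0<n (s≤s n≤i)

  R-1 : R 1 ≡ 1ℤ
  R-1 = trans (ℤₚ.+-identityˡ _) (one χ)

  private
    prime-factor-out : ∀ {q d} → Prime q → ¬ q ℕᵈ.∣ d → ∀ v b → d ℕᵈ.∣ q ℕ.^ v ℕ.* b → d ℕᵈ.∣ b
    prime-factor-out {q} {d} pr q∤d zero    b h = subst (d ℕᵈ.∣_) (ℕₚ.*-identityˡ b) h
    prime-factor-out {q} {d} pr q∤d (suc v) b h = prime-factor-out pr q∤d v b
      (Coprimality.coprime-divisor (prime-coprime pr q∤d) (subst (d ℕᵈ.∣_) (ℕₚ.*-assoc q (q ℕ.^ v) b) h))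

  -- A divisor of q n either is q times a divisor of n, or is prime to q and then divides b.
  R-step : ∀ q v b → Prime q → 0 ℕ.< b → ¬ q ℕᵈ.∣ b → R (q ℕ.^ suc v ℕ.* b) ≡ fn χ q * R (q ℕ.^ v ℕ.* b) + R b
  R-step q v b pr 0<b q∤b = begin
    R N
      ≡⟨ ∑-cong N (λ i _ → split (suc i)) ⟩
    ∑ N (λ i → choose (q ℕᵈ.∣? suc i) (term N (suc i)) 0ℤ + term b (suc i))
      ≡⟨ ∑-+ N _ _ ⟩
    ∑ N (λ i → choose (q ℕᵈ.∣? suc i) (term N (suc i)) 0ℤ) + ∑ N (λ i → term b (suc i))
      ≡⟨ cong₂ _+_ (sym (∑-multiples q N (term N) λ m → term-large 0<N)) (R-extend 0<b b≤N) ⟩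
    ∑ N (λ j → term N (q ℕ.* suc j)) + R b
      ≡⟨ cong (_+ R b) (trans (∑-cong N λ j _ → multiple (suc j)) (trans (∑-*ˡ N (fn χ q) _) (cong (fn χ q *_) (R-extend 0<n n≤N)))) ⟩
    fn χ q * R n + R b ∎
    where
    open ≡-Reasoning
    instance
      q≢0 : NonZero q
      q≢0 = ℙ.prime⇒nonZero pr
      b≢0 : NonZero b
      b≢0 = ℕ.>-nonZero 0<b
      q^v≢0 : NonZero (q ℕ.^ v)
      q^v≢0 = ℕₚ.m^n≢0 q v
      n≢0 : NonZero (q ℕ.^ v ℕ.* b)
      n≢0 = ℕₚ.m*n≢0 (q ℕ.^ v) b
    n N : ℕ
    n = q ℕ.^ v ℕ.* b
    N = q ℕ.^ suc v ℕ.* b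
    N≡ : N ≡ q ℕ.* n
    N≡ = ℕₚ.*-assoc q (q ℕ.^ v) b
    0<n : 0 ℕ.< n
    0<n = ℕ.>-nonZero⁻¹ n
    n≤N : n ℕ.≤ N
    n≤N = subst (n ℕ.≤_) (sym N≡) (ℕₚ.m≤n*m n q)
    b≤N : b ℕ.≤ N
    b≤N = ℕₚ.≤-trans (ℕₚ.m≤n*m b (q ℕ.^ v)) n≤N
    0<N : 0 ℕ.< N
    0<N = ℕₚ.<-≤-trans 0<n n≤N
    multiple : ∀ d → term N (q ℕ.* d) ≡ fn χ q * term n d
    multiple d with q ℕ.* d ℕᵈ.∣? N | d ℕᵈ.∣? n
    ... | yes _ | yes _ = mult χ q d
    ... | yes h | no ¬k = ⊥-elim (¬k (ℕᵈ.*-cancelˡ-∣ q (subst (q ℕ.* d ℕᵈ.∣_) N≡ h)))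
    ... | no ¬h | yes k = ⊥-elim (¬h (subst (q ℕ.* d ℕᵈ.∣_) (sym N≡) (ℕᵈ.*-monoʳ-∣ q k)))
    ... | no  _ | no  _ = sym (ℤₚ.*-zeroʳ (fn χ q))
    split : ∀ d → term N d ≡ choose (q ℕᵈ.∣? d) (term N d) 0ℤ + term b d
    split d with q ℕᵈ.∣? d | d ℕᵈ.∣? N | d ℕᵈ.∣? b
    ... | yes q∣d | _     | yes k = ⊥-elim (q∤b (ℕᵈ.∣-trans q∣d k))
    ... | yes _   | _     | no  _ = sym (ℤₚ.+-identityʳ _)
    ... | no  _   | yes _ | yes _ = sym (ℤₚ.+-identityˡ _)
    ... | no  q∤d | yes h | no ¬k = ⊥-elim (¬k (prime-factor-out pr q∤d (suc v) b h))
    ... | no  _   | no ¬h | yes k = ⊥-elim (¬h (ℕᵈ.∣-trans k (ℕᵈ.divides (q ℕ.^ suc v) refl)))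
    ... | no  _   | no  _ | no  _ = refl

  geometric : ℤ → ℕ → ℤ
  geometric x zero    = 1ℤ
  geometric x (suc v) = x * geometric x v + 1ℤ

  R-prime-power : ∀ q v b → Prime q → 0 ℕ.< b → ¬ q ℕᵈ.∣ b → R (q ℕ.^ v ℕ.* b) ≡ geometric (fn χ q) v * R b
  R-prime-power q zero    b pr 0<b q∤b = trans (cong R (ℕₚ.*-identityˡ b)) (sym (ℤₚ.*-identityˡ (R b)))
  R-prime-power q (suc v) b pr 0<b q∤b = trans (R-step q v b pr 0<b q∤b)
    (trans (cong (λ z → fn χ q * z + R b) (R-prime-power q v b pr 0<b q∤b)) (lem (fn χ q) (geometric (fn χ q) v) (R b)))
    where
    lem : ∀ x g r → x * (g * r) + r ≡ (x * g + 1ℤ) * r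
    lem = solve-∀

  geometric-even : ∀ {x} → Sign3 x → ∀ k → 1ℤ ≤ geometric x (k ℕ.+ k)
  geometric-even {x} s zero    = ℤₚ.≤-refl
  geometric-even {x} s (suc k) = subst (λ n → 1ℤ ≤ geometric x (suc n)) (sym (ℕₚ.+-suc k k)) (aux s (geometric-even s k))
    where
    aux : ∀ {x} → Sign3 x → ∀ {g} → 1ℤ ≤ g → 1ℤ ≤ x * (x * g + 1ℤ) + 1ℤ
    aux nil {g} h = ℤₚ.≤-reflexive (sym (lem g))
      where
      lem : ∀ g → 0ℤ * (0ℤ * g + 1ℤ) + 1ℤ ≡ 1ℤ
      lem = solve-∀
    aux pos {g} h = ℤₚ.≤-trans h (subst (g ≤_) (lem g) (ℤₚ.i≤i+j g (+ 2)))
      where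
      lem : ∀ g → g + + 2 ≡ 1ℤ * (1ℤ * g + 1ℤ) + 1ℤ
      lem = solve-∀
    aux neg {g} h = subst (1ℤ ≤_) (lem g) h
      where
      lem : ∀ g → g ≡ -1ℤ * (-1ℤ * g + 1ℤ) + 1ℤ
      lem = solve-∀

  geometric-odd : ∀ k → geometric -1ℤ (suc (k ℕ.+ k)) ≡ 0ℤ
  geometric-odd zero    = refl
  geometric-odd (suc k) = trans (cong (λ n → geometric -1ℤ (suc (suc n))) (ℕₚ.+-suc k k)) (trans (lem (geometric -1ℤ (suc (k ℕ.+ k)))) (geometric-odd k))
    where
    lem : ∀ g → -1ℤ * (-1ℤ * g + 1ℤ) + 1ℤ ≡ g
    lem = solve-∀

  geometric-nonneg : ∀ {x} → Sign3 x → ∀ v → 0ℤ ≤ geometric x v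
  geometric-nonneg s v with parity v
  ... | even k = ℤₚ.≤-trans (+≤+ z≤n) (geometric-even s k)
  ... | odd′ k = aux s (geometric-even s k)
    where
    aux : ∀ {x} → Sign3 x → 1ℤ ≤ geometric x (k ℕ.+ k) → 0ℤ ≤ geometric x (suc (k ℕ.+ k))
    aux nil _ = subst (0ℤ ≤_) (sym (cong (_+ 1ℤ) (ℤₚ.*-zeroˡ (geometric 0ℤ (k ℕ.+ k))))) (+≤+ z≤n)
    aux pos h = ℤₚ.≤-trans (ℤₚ.≤-trans (+≤+ z≤n) h) (subst (λ z → z ≤ geometric 1ℤ (suc (k ℕ.+ k))) (ℤₚ.*-identityˡ (geometric 1ℤ (k ℕ.+ k))) (ℤₚ.i≤i+j _ 1ℤ))
    aux neg _ = ℤₚ.≤-reflexive (sym (geometric-odd k))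

  *-nonneg : ∀ {a b} → 0ℤ ≤ a → 0ℤ ≤ b → 0ℤ ≤ a * b
  *-nonneg {+ a} {+ b} _ _ = subst (0ℤ ≤_) (ℤₚ.pos-* a b) (+≤+ z≤n)

  *-≥1 : ∀ {a b} → 1ℤ ≤ a → 1ℤ ≤ b → 1ℤ ≤ a * b
  *-≥1 {+ a} {+ b} (+≤+ h) (+≤+ k) = subst (1ℤ ≤_) (ℤₚ.pos-* a b) (+≤+ (ℕₚ.*-mono-≤ h k))

  R-nonneg : ∀ n → 0 ℕ.< n → 0ℤ ≤ R n
  R-nonneg = prime-power-induction (λ n → 0ℤ ≤ R n) (subst (0ℤ ≤_) (sym R-1) (+≤+ z≤n)) λ q v b pr 0<b q∤b h →
    subst (0ℤ ≤_) (sym (R-prime-power q (suc v) b pr 0<b q∤b)) (*-nonneg (geometric-nonneg (sign3 χ q) (suc v)) h)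

  R-square : ∀ n → 0 ℕ.< n → 1ℤ ≤ R (n ℕ.* n)
  R-square = prime-power-induction (λ n → 1ℤ ≤ R (n ℕ.* n)) (subst (1ℤ ≤_) (sym R-1) ℤₚ.≤-refl) λ q v b pr 0<b q∤b h →
    subst (1ℤ ≤_) (sym (trans (cong R (power q (suc v) b)) (R-prime-power q (suc v ℕ.+ suc v) (b ℕ.* b) pr (ℕₚ.*-mono-≤ 0<b 0<b) (q∤b² pr q∤b))))
      (*-≥1 (geometric-even (sign3 χ q) (suc v)) h)
    where
    power : ∀ q v b → (q ℕ.^ v ℕ.* b) ℕ.* (q ℕ.^ v ℕ.* b) ≡ q ℕ.^ (v ℕ.+ v) ℕ.* (b ℕ.* b)
    power q v b = trans (lem (q ℕ.^ v) b) (cong (ℕ._* (b ℕ.* b)) (sym (ℕₚ.^-distribˡ-+-* q v v)))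
      where
      lem : ∀ x b → (x ℕ.* b) ℕ.* (x ℕ.* b) ≡ x ℕ.* x ℕ.* (b ℕ.* b)
      lem = ℕSolver.solve-∀
    q∤b² : ∀ {q b} → Prime q → ¬ q ℕᵈ.∣ b → ¬ q ℕᵈ.∣ b ℕ.* b
    q∤b² {q} {b} pr q∤b d with ℙ.euclidsLemma b b pr d
    ... | inj₁ x = q∤b x
    ... | inj₂ x = q∤b x

coprime-∣* : ∀ {m n z} → Coprime m n → + m ∣ z → + n ∣ z → + (m ℕ.* n) ∣ z
coprime-∣* {m} {n} {z} cop m∣z (divides w z≡wn) = aux (ℤᵈ.∣ᵤ⇒∣ (Coprimality.coprime-divisor cop
    (subst (m ℕᵈ.∣_) (trans (cong abs z≡wn) (trans (ℤₚ.abs-* w (+ n)) (ℕₚ.*-comm (abs w) n))) (ℤᵈ.∣⇒∣ᵤ m∣z))))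
  where
  aux : + m ∣ w → + (m ℕ.* n) ∣ z
  aux (divides t w≡tm) = divides t (trans z≡wn (trans (cong (_* + n) w≡tm) (trans (ℤₚ.*-assoc t (+ m) (+ n)) (cong (t *_) (sym (ℤₚ.pos-* m n))))))

record Root (κ D : ℤ) (m : ℕ) : Set where
  constructor root
  field
    value : ℤ
    holds : + m ∣ κ * (value * value) + D

root-* : ∀ {κ D m n} → Coprime m n → Root κ D m → Root κ D n → Root κ D (m ℕ.* n)
root-* {κ} {D} {m} {n} cop (root h m∣) (root k n∣) = root (h + + m * t) (coprime-∣* cop
    (transfer (h + + m * t) h (divides t (lem₁ h (+ m) t)) m∣)
    (transfer (h + + m * t) k (∣-resp (lem₂ h (+ m) (proj₁ m⁻¹) k) (ℤᵈ.∣m⇒∣m*n (k - h) (proj₂ m⁻¹))) n∣))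
  where
  m⁻¹ : ∃ λ b → + n ∣ + m * b - 1ℤ
  m⁻¹ = inverse (+ m) cop
  t : ℤ
  t = proj₁ m⁻¹ * (k - h)
  lem₁ : ∀ h m t → h + m * t - h ≡ t * m
  lem₁ = solve-∀
  lem₂ : ∀ h m b k → (m * b - 1ℤ) * (k - h) ≡ h + m * (b * (k - h)) - k
  lem₂ = solve-∀
  transfer : ∀ {d} x y → d ∣ x - y → d ∣ κ * (y * y) + D → d ∣ κ * (x * x) + D
  transfer x y e f = ∣-resp (lem κ D x y) (ℤᵈ.∣m∣n⇒∣m+n (ℤᵈ.∣n⇒∣m*n (κ * (x + y)) e) f)
    where
    lem : ∀ κ D x y → κ * (x + y) * (x - y) + (κ * (y * y) + D) ≡ κ * (x * x) + D
    lem = solve-∀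

root-1 : ∀ {κ D} → Root κ D 1
root-1 {κ} {D} = root 0ℤ (divides (κ * (0ℤ * 0ℤ) + D) (sym (ℤₚ.*-identityʳ _)))

module _ {M : ℕ} (χ : Character M) where
  open DivisorSum χ

  record Core (D : ℤ) (n : ℕ) : Set where
    field
      s core : ℕ
      factor : n ≡ s ℕ.* s ℕ.* core
      value  : fn χ core ≡ 1ℤ
      sqrt   : Root 1ℤ D core
      primes : ∀ {r} → Prime r → r ℕᵈ.∣ core → fn χ r ≡ 1ℤ

  opaque
    R≢0⇒core : ∀ D → (∀ q → Prime q → fn χ q ≡ 1ℤ → Root 1ℤ D q) →
               ∀ n → 0 ℕ.< n → R n ≢ 0ℤ → fn χ n ≢ 0ℤ → Core D n
    R≢0⇒core D roots = prime-power-induction (λ n → R n ≢ 0ℤ → fn χ n ≢ 0ℤ → Core D n)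
      (λ _ _ → record { s = 1 ; core = 1 ; factor = refl ; value = one χ ; sqrt = root-1
                      ; primes = λ pr d → ⊥-elim (ℙ.¬prime[1] (subst Prime (ℕᵈ.∣1⇒≡1 d) pr)) })
      step
      where
      step : ∀ q v b → Prime q → 0 ℕ.< b → ¬ q ℕᵈ.∣ b → (R b ≢ 0ℤ → fn χ b ≢ 0ℤ → Core D b) →
             R (q ℕ.^ suc v ℕ.* b) ≢ 0ℤ → fn χ (q ℕ.^ suc v ℕ.* b) ≢ 0ℤ → Core D (q ℕ.^ suc v ℕ.* b)
      step q v b pr 0<b q∤b ih R≢0 χ≢0 = build (parity (suc v)) refl
        where
        R≡ : R (q ℕ.^ suc v ℕ.* b) ≡ geometric (fn χ q) (suc v) * R b
        R≡ = R-prime-power q (suc v) b pr 0<b q∤b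
        open Core (ih (λ e → R≢0 (trans R≡ (trans (cong (geometric (fn χ q) (suc v) *_) e) (ℤₚ.*-zeroʳ (geometric (fn χ q) (suc v))))))
                      (λ e → χ≢0 (trans (mult χ _ b) (trans (cong (fn χ (q ℕ.^ suc v) *_) e) (ℤₚ.*-zeroʳ (fn χ (q ℕ.^ suc v)))))))
        build : ∀ {w} → Parity w → w ≡ suc v → Core D (q ℕ.^ suc v ℕ.* b)
        build (even k) e = record
          { s = q ℕ.^ k ℕ.* s ; core = core ; value = value ; sqrt = sqrt ; primes = primes
          ; factor = trans (cong₂ (λ w b → q ℕ.^ w ℕ.* b) (sym e) factor)
              (trans (cong (ℕ._* (s ℕ.* s ℕ.* core)) (ℕₚ.^-distribˡ-+-* q k k)) (lem (q ℕ.^ k) s core)) }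
          where
          lem : ∀ x s c → x ℕ.* x ℕ.* (s ℕ.* s ℕ.* c) ≡ x ℕ.* s ℕ.* (x ℕ.* s) ℕ.* c
          lem = ℕSolver.solve-∀
        build (odd′ k) e = record
          { s = q ℕ.^ k ℕ.* s ; core = q ℕ.* core
          ; value = trans (mult χ q core) (cong₂ _*_ χq≡1 value)
          ; sqrt = root-* (Coprimality.sym (prime-coprime pr λ d → q∤b (subst (q ℕᵈ.∣_) (sym factor) (ℕᵈ.∣n⇒∣m*n (s ℕ.* s) d)))) (roots q pr χq≡1) sqrt
          ; primes = λ pr′ d → new-prime pr′ (ℙ.euclidsLemma q core pr′ d)
          ; factor = trans (cong₂ (λ w b → q ℕ.^ w ℕ.* b) (sym e) factor)
              (trans (cong (λ x → q ℕ.* x ℕ.* (s ℕ.* s ℕ.* core)) (ℕₚ.^-distribˡ-+-* q k k)) (lem q (q ℕ.^ k) s core)) }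
          where
          lem : ∀ q x s c → q ℕ.* (x ℕ.* x) ℕ.* (s ℕ.* s ℕ.* c) ≡ x ℕ.* s ℕ.* (x ℕ.* s) ℕ.* (q ℕ.* c)
          lem = ℕSolver.solve-∀
          χq≡1 : fn χ q ≡ 1ℤ
          χq≡1 = cases refl (sign3 χ q)
            where
            cases : ∀ {x} → fn χ q ≡ x → Sign3 x → fn χ q ≡ 1ℤ
            cases e′ nil = ⊥-elim (χ≢0 (trans (mult χ _ b) (trans (cong (_* fn χ b) (trans (mult χ q (q ℕ.^ v)) (trans (cong (_* fn χ (q ℕ.^ v)) e′) (ℤₚ.*-zeroˡ (fn χ (q ℕ.^ v)))))) (ℤₚ.*-zeroˡ (fn χ b)))))
            cases e′ pos = e′
            cases e′ neg = ⊥-elim (R≢0 (trans R≡ (trans (cong (_* R b) (trans (cong₂ geometric e′ (sym e)) (geometric-odd k))) (ℤₚ.*-zeroˡ (R b)))))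
          new-prime : ∀ {r} → Prime r → r ℕᵈ.∣ q ⊎ r ℕᵈ.∣ core → fn χ r ≡ 1ℤ
          new-prime {r} pr′ (inj₁ d) with ℙ.prime⇒irreducible pr d
          ... | inj₁ refl = ⊥-elim (ℙ.¬prime[1] pr′)
          ... | inj₂ refl = χq≡1
          new-prime pr′ (inj₂ d) = primes pr′ d

-- Integers with prescribed characters

∑-zero-or-term : ∀ n f → ∑ n f ≢ 0ℤ → ∃ λ i → i ℕ.< n × f i ≢ 0ℤ
∑-zero-or-term zero    f h = ⊥-elim (h refl)
∑-zero-or-term (suc n) f h with f n ℤ.≟ 0ℤ
... | no  fn≢0 = n , ℕₚ.≤-refl , fn≢0
... | yes fn≡0 = let i , i<n , fi≢0 = ∑-zero-or-term n f λ e → h (trans (cong₂ _+_ e fn≡0) refl) in i , ℕₚ.m<n⇒m<1+n i<n , fi≢0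

∑-nonneg : ∀ n {f} → (∀ i → i ℕ.< n → 0ℤ ≤ f i) → 0ℤ ≤ ∑ n f
∑-nonneg n h = ℤₚ.≤-trans (ℤₚ.≤-reflexive (sym (∑-0 n))) (∑-mono n h)

∑-grow : ∀ {m n} f → m ℕ.≤ n → (∀ i → i ℕ.< n → 0ℤ ≤ f i) → ∑ m f ≤ ∑ n f
∑-grow {m} {n} f m≤n h = subst (λ k → ∑ m f ≤ ∑ k f) (ℕₚ.m+[n∸m]≡n m≤n) (subst (∑ m f ≤_) (sym (∑-++ m (n ℕ.∸ m) f))
  (subst (_≤ ∑ m f + ∑ (n ℕ.∸ m) (λ i → f (m ℕ.+ i))) (ℤₚ.+-identityʳ _)
    (ℤₚ.+-monoʳ-≤ (∑ m f) (∑-nonneg (n ℕ.∸ m) λ i i< → h (m ℕ.+ i) (subst (m ℕ.+ i ℕ.<_) (ℕₚ.m+[n∸m]≡n m≤n) (ℕₚ.+-monoʳ-< m i<))))))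

∑-subsequence : ∀ (e : ℕ → ℕ) → (∀ k → e k ℕ.< e (suc k)) → ∀ K X f → e K ℕ.≤ X → (∀ i → i ℕ.< X → 0ℤ ≤ f i) →
                ∑ K (λ k → f (e k)) ≤ ∑ X f
∑-subsequence e e< K X f eK≤X h = ℤₚ.≤-trans (go K eK≤X) (∑-grow f eK≤X h)
  where
  go : ∀ K → e K ℕ.≤ X → ∑ K (λ k → f (e k)) ≤ ∑ (e K) f
  go zero    e0≤X = ∑-nonneg (e 0) λ i i< → h i (ℕₚ.<-≤-trans i< e0≤X)
  go (suc K) eK≤X = ℤₚ.≤-trans (ℤₚ.+-monoˡ-≤ (f (e K)) (go K (ℕₚ.≤-trans (ℕₚ.<⇒≤ (e< K)) eK≤X)))
                               (∑-grow {suc (e K)} f (e< K) λ i i< → h i (ℕₚ.<-≤-trans i< eK≤X))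

module Existence (M : ℕ) {{M≢0 : NonZero M}} (χ : Character M) where
  open Sums M
  open Hyperbola M
  open DivisorSum χ

  opaque
    S : (ℕ → ℤ) → ℕ → ℤ
    S F X = ∑ X (λ i → ∑ X (λ j → fn χ (suc i) * F (suc i ℕ.* suc j) * + (X ℕ.∸ suc i ℕ.* suc j)))

    S-cong : ∀ {F G} X → (∀ n → F n ≡ G n) → S F X ≡ S G X
    S-cong X h = ∑-cong X λ i _ → ∑-cong X λ j _ → cong (λ z → fn χ (suc i) * z * + (X ℕ.∸ suc i ℕ.* suc j)) (h (suc i ℕ.* suc j))

    S-+ : ∀ F G X → S (λ n → F n + G n) X ≡ S F X + S G X
    S-+ F G X = trans (∑-cong X λ i _ → trans (∑-cong X λ j _ → lem (fn χ (suc i)) (F (suc i ℕ.* suc j)) (G (suc i ℕ.* suc j)) (+ (X ℕ.∸ suc i ℕ.* suc j))) (∑-+ X _ _)) (∑-+ X _ _)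
      where
      lem : ∀ c f g w → c * (f + g) * w ≡ c * f * w + c * g * w
      lem = solve-∀

    S-scale : ∀ c F X → S (λ n → c * F n) X ≡ c * S F X
    S-scale c F X = trans (∑-cong X λ i _ → trans (∑-cong X λ j _ → lem (fn χ (suc i)) c (F (suc i ℕ.* suc j)) (+ (X ℕ.∸ suc i ℕ.* suc j))) (∑-*ˡ X c _)) (∑-*ˡ X c _)
      where
      lem : ∀ x c f w → x * (c * f) * w ≡ c * (x * f * w)
      lem = solve-∀

    S-character : ∀ ψ X → S (fn ψ) X ≡ T (χ ⊗ ψ) ψ X
    S-character ψ X = ∑-cong X λ i _ → ∑-cong X λ j _ →
      cong (_* + (X ℕ.∸ suc i ℕ.* suc j)) (trans (cong (fn χ (suc i) *_) (mult ψ (suc i) (suc j))) (sym (ℤₚ.*-assoc (fn χ (suc i)) (fn ψ (suc i)) (fn ψ (suc j)))))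

    S-group : ∀ F X → S F X ≡ ∑ X (λ a → F (suc a) * R (suc a) * + (X ℕ.∸ suc a))
    S-group F X = trans (∑-cong X λ i _ → row i) (trans (∑-swap X X _) (∑-cong X column))
      where
      h : ℕ → ℤ
      h n = F n * + (X ℕ.∸ n)
      row : ∀ i → ∑ X (λ j → fn χ (suc i) * F (suc i ℕ.* suc j) * + (X ℕ.∸ suc i ℕ.* suc j)) ≡ ∑ X (λ a → choose (suc i ℕᵈ.∣? suc a) (fn χ (suc i)) 0ℤ * h (suc a))
      row i = trans (trans (∑-cong X λ j _ → ℤₚ.*-assoc (fn χ (suc i)) (F (suc i ℕ.* suc j)) _) (∑-*ˡ X (fn χ (suc i)) (λ j → h (suc i ℕ.* suc j))))
        (trans (cong (fn χ (suc i) *_) (∑-multiples (suc i) X h λ n X<n → trans (cong (λ k → F n * + k) (ℕₚ.m≤n⇒m∸n≡0 (ℕₚ.<⇒≤ X<n))) (ℤₚ.*-zeroʳ (F n))))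
        (trans (sym (∑-*ˡ X (fn χ (suc i)) _)) (∑-cong X λ a _ → move (suc i ℕᵈ.∣? suc a) (fn χ (suc i)) (h (suc a)))))
        where
        move : ∀ {P : Set} (d : Dec P) x y → x * choose d y 0ℤ ≡ choose d x 0ℤ * y
        move (yes _) x y = refl
        move (no  _) x y = trans (ℤₚ.*-zeroʳ x) (sym (ℤₚ.*-zeroˡ y))
      column : ∀ a → a ℕ.< X → ∑ X (λ i → choose (suc i ℕᵈ.∣? suc a) (fn χ (suc i)) 0ℤ * h (suc a)) ≡ F (suc a) * R (suc a) * + (X ℕ.∸ suc a)
      column a a<X = trans (∑-*ʳ X (h (suc a)) _) (trans (cong (_* h (suc a)) (R-extend z<s a<X)) (lem (R (suc a)) (F (suc a)) (+ (X ℕ.∸ suc a))))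
        where
        lem : ∀ r f w → r * (f * w) ≡ f * r * w
        lem = solve-∀

  Small : (ℕ → ℤ) → Set
  Small F = ∃ λ C → ∀ Y → abs (S F (Y ℕ.* Y)) ℕ.≤ C ℕ.* (Y ℕ.* Y)

  Small-cong : ∀ {F G} → (∀ n → F n ≡ G n) → Small F → Small G
  Small-cong h (C , b) = C , λ Y → subst (λ z → abs z ℕ.≤ C ℕ.* (Y ℕ.* Y)) (S-cong (Y ℕ.* Y) h) (b Y)

  Small-+ : ∀ F G → Small F → Small G → Small (λ n → F n + G n)
  Small-+ F G (C , b) (D , c) = C ℕ.+ D , λ Y → subst₂ (λ z k → abs z ℕ.≤ k) (sym (S-+ F G (Y ℕ.* Y))) (sym (ℕₚ.*-distribʳ-+ (Y ℕ.* Y) C D))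
    (triangle (S F (Y ℕ.* Y)) (S G (Y ℕ.* Y)) (b Y) (c Y))

  Small-scale : ∀ k F → Small F → Small (λ n → k * F n)
  Small-scale k F (C , b) = abs k ℕ.* C , λ Y → subst₂ (λ z c → abs z ℕ.≤ c) (sym (S-scale k F (Y ℕ.* Y))) (sym (ℕₚ.*-assoc (abs k) C (Y ℕ.* Y)))
    (abs-*-≤ k (S F (Y ℕ.* Y)) ℕₚ.≤-refl (b Y))

  record Constraint : Set where
    constructor _∶=_
    field
      char : Character M
      {sign} : ℤ
      unit : Unit sign
  open Constraint public

  indicator : List Constraint → ℕ → ℤ
  indicator []      n = 1ℤ
  indicator (c ∷ L) n = (fn (char c) n * fn (char c) n + sign c * fn (char c) n) * indicator L n

  At1 : UnitMod M → Constraint → Set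
  At1 u c = fn (char c) (elt u) ≡ 1ℤ

  small-nonprincipal : ∀ L ψ (u v : UnitMod M) → fn ψ (elt u) ≡ -1ℤ → fn (χ ⊗ ψ) (elt v) ≡ -1ℤ → All (At1 u) L → All (At1 v) L →
                       Small (λ n → fn ψ n * indicator L n)
  small-nonprincipal [] ψ u v ψu χψv _ _ = Small-cong (λ n → sym (ℤₚ.*-identityʳ (fn ψ n)))
    (let C , b = T-bound (χ ⊗ ψ) ψ v u χψv ψu in C , λ Y → subst (λ z → abs z ℕ.≤ C ℕ.* (Y ℕ.* Y)) (sym (S-character ψ (Y ℕ.* Y))) (b Y))
  small-nonprincipal (c ∷ L) ψ u v ψu χψv (cu ∷ us) (cv ∷ vs) = Small-cong (λ n → lem (fn ψ n) (fn (char c) n) (sign c) (indicator L n))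
    (Small-+ _ _ (small-nonprincipal L (ψ ⊗ (char c ⊗ char c)) u v (times² ψu cu) (times₂² (fn χ (elt v)) (fn ψ (elt v)) χψv cv) us vs)
                 (Small-scale (sign c) _ (small-nonprincipal L (ψ ⊗ char c) u v (times ψu cu) (times₂ (fn χ (elt v)) (fn ψ (elt v)) χψv cv) us vs)))
    where
    lem : ∀ p c e i → p * (c * c) * i + e * (p * c * i) ≡ p * ((c * c + e * c) * i)
    lem = solve-∀
    times : ∀ {a b} → a ≡ -1ℤ → b ≡ 1ℤ → a * b ≡ -1ℤ
    times refl refl = refl
    times² : ∀ {a b} → a ≡ -1ℤ → b ≡ 1ℤ → a * (b * b) ≡ -1ℤ
    times² refl refl = refl
    times₂ : ∀ x a {b} → x * a ≡ -1ℤ → b ≡ 1ℤ → x * (a * b) ≡ -1ℤ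
    times₂ x a e refl = trans (cong (x *_) (ℤₚ.*-identityʳ a)) e
    times₂² : ∀ x a {b} → x * a ≡ -1ℤ → b ≡ 1ℤ → x * (a * (b * b)) ≡ -1ℤ
    times₂² x a e refl = trans (cong (x *_) (ℤₚ.*-identityʳ a)) e

  Principal : Character M → Set
  Principal ψ = ∀ (u : UnitMod M) → fn ψ (elt u) ≡ 1ℤ

  unit-value : ∀ (ψ : Character M) (u : UnitMod M) → Unit (fn ψ (elt u))
  unit-value ψ u = aux (sign3 ψ (elt u)) (trans (sym (mult ψ (elt u) (inv u))) (trans (sym (residue-class ψ (elt u ℕ.* inv u)))
                     (trans (cong (fn ψ) (law u)) (trans (residue-class ψ 1) (one ψ)))))
    where
    aux : ∀ {a b} → Sign3 a → a * b ≡ 1ℤ → Unit a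
    aux {b = b} nil e with () ← trans (sym (ℤₚ.*-zeroˡ b)) e
    aux pos _ = pos
    aux neg _ = neg

  Principal-⊗² : ∀ {ψ} c → Principal ψ → Principal (ψ ⊗ (c ⊗ c))
  Principal-⊗² c p u = cong₂ _*_ (p u) (Unit-sq (unit-value c u))

  squares : List Constraint → Character M → Character M
  squares []      ψ = ψ
  squares (c ∷ L) ψ = squares L (ψ ⊗ (char c ⊗ char c))

  Separated : List Constraint → Set
  Separated []      = ⊤
  Separated (c ∷ L) = (Σ (UnitMod M) λ u → fn (char c) (elt u) ≡ -1ℤ × All (At1 u) L) × Separated L

  small-difference : ∀ L ψ (v : UnitMod M) → Principal ψ → fn χ (elt v) ≡ -1ℤ → All (At1 v) L → Separated L →
                     Small (λ n → fn ψ n * indicator L n - fn (squares L ψ) n)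
  small-difference [] ψ v _ _ _ _ = 0 , λ Y → ℕₚ.≤-reflexive (cong abs
      (trans (S-cong (Y ℕ.* Y) (λ n → lem (fn ψ n))) (trans (S-scale 0ℤ (fn ψ) (Y ℕ.* Y)) (ℤₚ.*-zeroˡ (S (fn ψ) (Y ℕ.* Y))))))
    where
    lem : ∀ p → p * 1ℤ - p ≡ 0ℤ * p
    lem = solve-∀
  small-difference (c ∷ L) ψ v pr χv (cv ∷ vs) ((u , cu , us) , sep) =
    Small-cong (λ n → lem (fn ψ n) (fn (char c) n) (sign c) (indicator L n) (fn (squares L (ψ ⊗ (char c ⊗ char c))) n))
      (Small-+ _ _ (small-difference L (ψ ⊗ (char c ⊗ char c)) v (Principal-⊗² {ψ} (char c) pr) χv vs sep)
        (Small-scale (sign c) _ (small-nonprincipal L (ψ ⊗ char c) u v (cong₂ _*_ (pr u) cu) (cong₂ _*_ χv (cong₂ _*_ (pr v) cv)) us vs)))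
    where
    lem : ∀ p c e i q → (p * (c * c) * i - q) + e * (p * c * i) ≡ p * ((c * c + e * c) * i) - q
    lem = solve-∀

  Nonneg : Character M → Set
  Nonneg ψ = ∀ n → 0ℤ ≤ fn ψ n

  sq-nonneg : ∀ {a} → Sign3 a → 0ℤ ≤ a * a
  sq-nonneg nil = +≤+ z≤n
  sq-nonneg pos = +≤+ z≤n
  sq-nonneg neg = +≤+ z≤n

  squares-nonneg : ∀ L ψ → Nonneg ψ → Nonneg (squares L ψ)
  squares-nonneg []      ψ h = h
  squares-nonneg (c ∷ L) ψ h = squares-nonneg L (ψ ⊗ (char c ⊗ char c)) λ n → *-nonneg (h n) (sq-nonneg (sign3 (char c) n))

  -- Squares of integers ≡ 1 (mod M) alone contribute at least (2C+1) · 3Z² > C · 4Z² = C X, where X = (2Z)².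
  opaque
    main-term : ∀ ψ → Nonneg ψ → ∀ C → ∃ λ Y → + (C ℕ.* (Y ℕ.* Y)) < S (fn ψ) (Y ℕ.* Y)
    main-term ψ ψ≥0 C = Y , ℤₚ.<-≤-trans (ℤ.+<+ count) (subst (+ (K ℕ.* (3 ℕ.* (Z ℕ.* Z))) ≤_) (sym (S-group (fn ψ) X))
        (ℤₚ.≤-trans (subst (_≤ ∑ K (λ k → f (e k))) (trans (∑-const K (+ (3 ℕ.* (Z ℕ.* Z)))) (sym (ℤₚ.pos-* K _))) (∑-mono K term))
          (∑-subsequence e e< K X f eK≤X f≥0)))
      where
      K Z Y X : ℕ
      K = suc (C ℕ.+ C)
      Z = suc (K ℕ.* M)
      Y = Z ℕ.+ Z
      X = Y ℕ.* Y
      f : ℕ → ℤ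
      f a = fn ψ (suc a) * R (suc a) * + (X ℕ.∸ suc a)
      f≥0 : ∀ a → a ℕ.< X → 0ℤ ≤ f a
      f≥0 a _ = *-nonneg (*-nonneg (ψ≥0 (suc a)) (R-nonneg (suc a) z<s)) (+≤+ z≤n)
      s e : ℕ → ℕ
      s k = suc (k ℕ.* M)
      e k = k ℕ.* M ℕ.+ k ℕ.* M ℕ.* s k
      kM< : ∀ k → k ℕ.* M ℕ.< suc k ℕ.* M
      kM< k = ℕₚ.m<n+m (k ℕ.* M) (ℕ.>-nonZero⁻¹ M)
      e< : ∀ k → e k ℕ.< e (suc k)
      e< k = ℕₚ.+-mono-<-≤ (kM< k) (ℕₚ.*-mono-≤ (ℕₚ.<⇒≤ (kM< k)) (s≤s (ℕₚ.<⇒≤ (kM< k))))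
      4Z² : ∀ Z → (Z ℕ.+ Z) ℕ.* (Z ℕ.+ Z) ≡ 3 ℕ.* (Z ℕ.* Z) ℕ.+ Z ℕ.* Z
      4Z² = ℕSolver.solve-∀
      eK≤X : e K ℕ.≤ X
      eK≤X = ℕₚ.≤-trans (ℕₚ.n≤1+n (e K)) (ℕₚ.≤-trans (ℕₚ.m≤n+m (Z ℕ.* Z) (3 ℕ.* (Z ℕ.* Z))) (ℕₚ.≤-reflexive (sym (4Z² Z))))
      count : C ℕ.* X ℕ.< K ℕ.* (3 ℕ.* (Z ℕ.* Z))
      count = subst₂ ℕ._<_ (sym (lem C Z)) (sym (lem′ C Z)) (ℕₚ.m<m+n _ {3 ℕ.* (Z ℕ.* Z) ℕ.+ C ℕ.* (Z ℕ.* Z) ℕ.+ C ℕ.* (Z ℕ.* Z)} z<s)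
        where
        lem : ∀ C Z → C ℕ.* ((Z ℕ.+ Z) ℕ.* (Z ℕ.+ Z)) ≡ 4 ℕ.* (C ℕ.* (Z ℕ.* Z))
        lem = ℕSolver.solve-∀
        lem′ : ∀ C Z → suc (C ℕ.+ C) ℕ.* (3 ℕ.* (Z ℕ.* Z)) ≡ 4 ℕ.* (C ℕ.* (Z ℕ.* Z)) ℕ.+ (3 ℕ.* (Z ℕ.* Z) ℕ.+ C ℕ.* (Z ℕ.* Z) ℕ.+ C ℕ.* (Z ℕ.* Z))
        lem′ = ℕSolver.solve-∀
      ψ-s : ∀ k → fn ψ (s k) ≡ 1ℤ
      ψ-s k = trans (cong (fn ψ) (ℕₚ.+-comm 1 (k ℕ.* M))) (trans (periods ψ k 1) (one ψ))
      term : ∀ k → k ℕ.< K → + (3 ℕ.* (Z ℕ.* Z)) ≤ f (e k)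
      term k k<K = bound (trans (mult ψ (s k) (s k)) (cong₂ _*_ (ψ-s k) (ψ-s k))) (R-square (s k) z<s)
          (subst (ℕ._≤ X ℕ.∸ s k ℕ.* s k) (trans (cong (ℕ._∸ Z ℕ.* Z) (4Z² Z)) (ℕₚ.m+n∸n≡m (3 ℕ.* (Z ℕ.* Z)) (Z ℕ.* Z)))
            (ℕₚ.∸-monoʳ-≤ X (ℕₚ.*-mono-≤ s≤Z s≤Z)))
        where
        s≤Z : s k ℕ.≤ Z
        s≤Z = s≤s (ℕₚ.*-monoˡ-≤ M (ℕₚ.<⇒≤ k<K))
        bound : ∀ {p r w c} → p ≡ 1ℤ → 1ℤ ≤ r → c ℕ.≤ w → + c ≤ p * r * + w
        bound {r = + suc r} {w} {c} refl (+≤+ _) c≤w = subst (+ c ≤_) (trans (ℤₚ.pos-* (suc r) w) (cong (_* + w) (sym (ℤₚ.*-identityˡ (+ suc r))))) (+≤+ (ℕₚ.≤-trans c≤w (ℕₚ.m≤n*m w (suc r))))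

  Satisfies : ℕ → Constraint → Set
  Satisfies n c = fn (char c) n ≡ sign c

  indicator≢0 : ∀ L n → indicator L n ≢ 0ℤ → All (Satisfies n) L
  indicator≢0 []      n h = []
  indicator≢0 (c ∷ L) n h = aux (sign3 (char c) n) (unit c) (λ e → h (trans (cong (_* indicator L n) e) (ℤₚ.*-zeroˡ (indicator L n)))) ∷
      indicator≢0 L n λ e → h (trans (cong ((fn (char c) n * fn (char c) n + sign c * fn (char c) n) *_) e) (ℤₚ.*-zeroʳ (fn (char c) n * fn (char c) n + sign c * fn (char c) n)))
    where
    aux : ∀ {x s} → Sign3 x → Unit s → x * x + s * x ≢ 0ℤ → x ≡ s
    aux nil pos h = ⊥-elim (h refl)
    aux nil neg h = ⊥-elim (h refl)
    aux pos pos h = refl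
    aux pos neg h = ⊥-elim (h refl)
    aux neg pos h = ⊥-elim (h refl)
    aux neg neg h = refl

  opaque
    exists : ∀ L (v : UnitMod M) → fn χ (elt v) ≡ -1ℤ → All (At1 v) L → Separated L →
             ∃ λ n → 0 ℕ.< n × R n ≢ 0ℤ × fn χ n ≢ 0ℤ × All (Satisfies n) L
    exists L v χv vs sep =
      conclude (∑-zero-or-term X f λ e → S≢0 (trans (S-group (λ n → fn ψ n * indicator L n) X) e))
      where
      ψ : Character M
      ψ = χ ⊗ χ
      ψ≥0 : Nonneg ψ
      ψ≥0 n = sq-nonneg (sign3 χ n)
      small : Small (λ n → fn ψ n * indicator L n - fn (squares L ψ) n)
      small = small-difference L ψ v (λ u → Unit-sq (unit-value χ u)) χv vs sep
      main : ∃ λ Y → + (proj₁ small ℕ.* (Y ℕ.* Y)) < S (fn (squares L ψ)) (Y ℕ.* Y)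
      main = main-term (squares L ψ) (squares-nonneg L ψ ψ≥0) (proj₁ small)
      Y X : ℕ
      Y = proj₁ main
      X = Y ℕ.* Y
      f : ℕ → ℤ
      f a = fn ψ (suc a) * indicator L (suc a) * R (suc a) * + (X ℕ.∸ suc a)
      diff : S (λ n → fn ψ n * indicator L n - fn (squares L ψ) n) X ≡ S (λ n → fn ψ n * indicator L n) X + -1ℤ * S (fn (squares L ψ)) X
      diff = trans (S-cong X (λ n → cong (λ z → fn ψ n * indicator L n + z) (sym (ℤₚ.-1*i≡-i (fn (squares L ψ) n)))))
               (trans (S-+ (λ n → fn ψ n * indicator L n) _ X) (cong (λ z → S (λ n → fn ψ n * indicator L n) X + z) (S-scale -1ℤ (fn (squares L ψ)) X)))
      S≢0 : S (λ n → fn ψ n * indicator L n) X ≢ 0ℤ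
      S≢0 e = contra (proj₂ main) (subst (ℕ._≤ proj₁ small ℕ.* X) (trans (cong abs (trans diff (trans (cong (_+ -1ℤ * S (fn (squares L ψ)) X) e) (trans (ℤₚ.+-identityˡ _) (ℤₚ.-1*i≡-i (S (fn (squares L ψ)) X)))))) (ℤₚ.∣-i∣≡∣i∣ (S (fn (squares L ψ)) X))) (proj₂ small Y))
        where
        contra : ∀ {c s} → + c < s → ¬ abs s ℕ.≤ c
        contra (ℤ.+<+ c<s) s≤c = ℕₚ.<⇒≱ c<s s≤c
      zero₁ : ∀ {x} i r w → x ≡ 0ℤ → x * x * i * r * w ≡ 0ℤ
      zero₁ i r w refl = trans (cong (_* w) (trans (cong (_* r) (ℤₚ.*-zeroˡ i)) (ℤₚ.*-zeroˡ r))) (ℤₚ.*-zeroˡ w)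
      zero₂ : ∀ {r} x i w → r ≡ 0ℤ → x * i * r * w ≡ 0ℤ
      zero₂ x i w refl = trans (cong (_* w) (ℤₚ.*-zeroʳ (x * i))) (ℤₚ.*-zeroˡ w)
      zero₃ : ∀ {i} x r w → i ≡ 0ℤ → x * i * r * w ≡ 0ℤ
      zero₃ x r w refl = trans (cong (λ z → z * r * w) (ℤₚ.*-zeroʳ x)) (trans (cong (_* w) (ℤₚ.*-zeroˡ r)) (ℤₚ.*-zeroˡ w))
      conclude : (∃ λ a → a ℕ.< X × f a ≢ 0ℤ) → ∃ λ n → 0 ℕ.< n × R n ≢ 0ℤ × fn χ n ≢ 0ℤ × All (Satisfies n) L
      conclude (a , _ , fa≢0) = suc a , z<s , (λ e → fa≢0 (zero₂ (fn ψ (suc a)) (indicator L (suc a)) (+ (X ℕ.∸ suc a)) e))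
        , (λ e → fa≢0 (zero₁ (indicator L (suc a)) (R (suc a)) (+ (X ℕ.∸ suc a)) e))
        , indicator≢0 L (suc a) (λ e → fa≢0 (zero₃ (fn ψ (suc a)) (R (suc a)) (+ (X ℕ.∸ suc a)) e))

-- Binary forms in a given genus

coprime-* : ∀ {u m n} → Coprime u m → Coprime u n → Coprime u (m ℕ.* n)
coprime-* um un (d∣u , d∣mn) = un (d∣u , Coprimality.coprime-divisor (λ { (e∣d , e∣m) → um (ℕᵈ.∣-trans e∣d d∣u , e∣m) }) d∣mn)

residue-1 : ∀ x m → + suc m ∣ + x - 1ℤ → x ℕ.% suc m ≡ 1 ℕ.% suc m
residue-1 zero    m d rewrite ℕₚ.suc-injective (ℕᵈ.∣1⇒≡1 (ℤᵈ.∣⇒∣ᵤ d)) = refl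
residue-1 (suc x) m d with ℤᵈ.∣⇒∣ᵤ d
... | ℕᵈ.divides k refl = ℕᵐ.[m+kn]%n≡m%n 1 k (suc m)

unit-inverse : ∀ u M → Coprime u M → ∃ λ i → .{{_ : NonZero M}} → (u ℕ.* i) ℕ.% M ≡ 1 ℕ.% M
unit-inverse u zero      cop = 0 , λ {{}}
unit-inverse u M@(suc _) cop = b ℤᵐ.%ℕ M , residue-1 (u ℕ.* (b ℤᵐ.%ℕ M)) _ (difference ub≅1)
  where
  b : ℤ
  b = proj₁ (inverse (+ u) cop)
  open Mod (+ M)
  ub≅1 : + (u ℕ.* (b ℤᵐ.%ℕ M)) ≅ 1ℤ
  ub≅1 = ≅-trans (≅-reflexive (ℤₚ.pos-* u _)) (≅-trans (*-≅ {+ u} (≅-reflexive refl) (≅-sym b≅)) (mod (proj₂ (inverse (+ u) cop))))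
    where
    b≅ : b ≅ + (b ℤᵐ.%ℕ M)
    b≅ = mod (divides (b ℤᵐ./ℕ M) (trans (cong (_- + (b ℤᵐ.%ℕ M)) (ℤᵐ.a≡a%ℕn+[a/ℕn]*n b M)) (lem (+ (b ℤᵐ.%ℕ M)) (b ℤᵐ./ℕ M * + M))))
      where
      lem : ∀ r q → r + q - r ≡ q
      lem = solve-∀

unit-mod : ∀ {u M} → Coprime u M → UnitMod M
unit-mod {u} {M} cop = record { elt = u ; inv = proj₁ (unit-inverse u M cop) ; law = proj₂ (unit-inverse u M cop) }

record Local (M P : ℕ) : Set where
  field
    isPrime  : Prime (odd P)
    cofactor : ℕ
    factor   : M ≡ odd P ℕ.* cofactor
    exact    : ¬ odd P ℕᵈ.∣ cofactor

  divides-M : odd P ℕᵈ.∣ M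
  divides-M = ℕᵈ.divides cofactor (trans factor (ℕₚ.*-comm (odd P) cofactor))

leg-char : ∀ {M P} → Prime (odd P) → odd P ℕᵈ.∣ M → Character M
leg-char {M} {P} pr p∣M = record
  { fn = λ n → leg P (+ n)
  ; one = leg-1
  ; mult = λ a b → trans (cong (leg P) (ℤₚ.pos-* a b)) (leg-* (+ a) (+ b))
  ; sign3 = λ n → leg-Sign3 P (+ n)
  ; period = λ a → leg-≅ (mod (∣-resp (lem (+ M) (+ a)) (ℤᵈ.∣ᵤ⇒∣ {+ odd P} {+ M} p∣M)))
  }
  where
  open Legendre P pr
  lem : ∀ M a → M ≡ M + a - a
  lem = solve-∀

odd-distinct : ∀ {P Q} → P ≢ Q → odd P ≢ odd Q
odd-distinct {P} {Q} P≢Q e = P≢Q (aux P Q (ℕₚ.suc-injective e))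
  where
  aux : ∀ P Q → P ℕ.+ P ≡ Q ℕ.+ Q → P ≡ Q
  aux P Q e = ℕₚ.*-cancelˡ-≡ P Q 2 (trans (cong (P ℕ.+_) (ℕₚ.+-identityʳ P)) (trans e (cong (Q ℕ.+_) (sym (ℕₚ.+-identityʳ Q)))))

opaque
  crt-unit : ∀ {p m} → Prime p → ¬ p ℕᵈ.∣ m → ∀ r → ¬ p ℕᵈ.∣ r →
             Σ (UnitMod (p ℕ.* m)) λ u → + p ∣ + elt u - + r × + m ∣ + elt u - 1ℤ
  crt-unit {p} {m} pr p∤m r p∤r = unit-mod cop , p∣u-r , m∣u-1
    where
    instance
      p≢0 : NonZero p
      p≢0 = ℙ.prime⇒nonZero pr
    inv-m : ∃ λ b → + p ∣ + m * b - 1ℤ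
    inv-m = inverse (+ m) (prime-coprime pr p∤m)
    z : ℤ
    z = proj₁ inv-m * (+ r - 1ℤ)
    k u : ℕ
    k = z ℤᵐ.%ℕ p
    u = 1 ℕ.+ m ℕ.* k
    k≡ : + k ≡ z - z ℤᵐ./ℕ p * + p
    k≡ = sym (trans (cong (_- z ℤᵐ./ℕ p * + p) (ℤᵐ.a≡a%ℕn+[a/ℕn]*n z p)) (lem (+ k) (z ℤᵐ./ℕ p * + p)))
      where
      lem : ∀ k q → k + q - q ≡ k
      lem = solve-∀
    u≡ : + u ≡ 1ℤ + + m * + k
    u≡ = cong (λ w → 1ℤ + w) (ℤₚ.pos-* m k)
    m∣u-1 : + m ∣ + u - 1ℤ
    m∣u-1 = divides (+ k) (trans (cong (_- 1ℤ) u≡) (lem (+ m) (+ k)))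
      where
      lem : ∀ m k → 1ℤ + m * k - 1ℤ ≡ k * m
      lem = solve-∀
    p∣u-r : + p ∣ + u - + r
    p∣u-r = ∣-resp (sym (trans (cong (_- + r) (trans u≡ (cong (λ w → 1ℤ + + m * w) k≡))) (lem (+ m) (proj₁ inv-m) (+ r) (z ℤᵐ./ℕ p) (+ p))))
      (ℤᵈ.∣m∣n⇒∣m-n (ℤᵈ.∣m⇒∣m*n (+ r - 1ℤ) (proj₂ inv-m)) (divides (+ m * (z ℤᵐ./ℕ p)) refl))
      where
      lem : ∀ m b r q p → 1ℤ + m * (b * (r - 1ℤ) - q * p) - r ≡ (m * b - 1ℤ) * (r - 1ℤ) - m * q * p
      lem = solve-∀
    cop : Coprime u (p ℕ.* m)
    cop = coprime-* (prime-coprime pr λ p∣u → p∤r (ℤᵈ.∣⇒∣ᵤ (∣-resp (lem (+ u) (+ r)) (ℤᵈ.∣m∣n⇒∣m-n {+ p} {+ u} {+ u - + r} (ℤᵈ.∣ᵤ⇒∣ p∣u) p∣u-r))))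
      λ { {d} (d∣u , d∣m) → ℕᵈ.∣1⇒≡1 (ℕᵈ.∣m+n∣m⇒∣n (subst (d ℕᵈ.∣_) (ℕₚ.+-comm 1 (m ℕ.* k)) d∣u) (ℕᵈ.∣m⇒∣m*n k d∣m)) }
      where
      lem : ∀ u r → u - (u - r) ≡ r
      lem = solve-∀

leg-unit : ∀ {M P} → Prime (odd P) → odd P ℕᵈ.∣ M → ∀ {x y} → + M ∣ x - y → leg P x ≡ leg P y
leg-unit {P = P} pr p∣M d = Legendre.leg-≅ P pr (Mod.mod (ℤᵈ.∣-trans (ℤᵈ.∣ᵤ⇒∣ p∣M) d))

module Genus (M : ℕ) {{M≢0 : NonZero M}} (ε : ℕ → ℤ) where

  nonresidue-unit : ∀ {P} → Local M P → Σ (UnitMod M) λ u → leg P (+ elt u) ≡ -1ℤ × (∀ {Q} → Local M Q → P ≢ Q → leg Q (+ elt u) ≡ 1ℤ)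
  nonresidue-unit {P} loc = aux (sym factor) (crt-unit isPrime exact t p∤t)
    where
    open Local loc
    t : ℕ
    t = proj₁ (Squares.nonresidue P isPrime)
    leg-t : leg P (+ t) ≡ -1ℤ
    leg-t = proj₂ (Squares.nonresidue P isPrime)
    p∤t : ¬ odd P ℕᵈ.∣ t
    p∤t d with () ← trans (sym leg-t) (leg-∣ (ℤᵈ.∣ᵤ⇒∣ {+ odd P} {+ t} d))
    aux : ∀ {M′} → M′ ≡ M → (Σ (UnitMod M′) λ u → + odd P ∣ + elt u - + t × + cofactor ∣ + elt u - 1ℤ) →
          Σ (UnitMod M) λ u → leg P (+ elt u) ≡ -1ℤ × (∀ {Q} → Local M Q → P ≢ Q → leg Q (+ elt u) ≡ 1ℤ)
    aux refl (u , d , e) = u , trans (leg-unit isPrime ℕᵈ.∣-refl d) leg-t , other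
      where
      other : ∀ {Q} → Local M Q → P ≢ Q → leg Q (+ elt u) ≡ 1ℤ
      other {Q} loc′ P≢Q = trans (leg-unit (Local.isPrime loc′) (q∣cofactor (ℙ.euclidsLemma (odd P) cofactor (Local.isPrime loc′) (subst (odd Q ℕᵈ.∣_) factor (Local.divides-M loc′)))) e) (Legendre.leg-1 Q (Local.isPrime loc′))
        where
        q∣cofactor : odd Q ℕᵈ.∣ odd P ⊎ odd Q ℕᵈ.∣ cofactor → odd Q ℕᵈ.∣ cofactor
        q∣cofactor (inj₁ x) = ⊥-elim (distinct-primes (Local.isPrime loc′) isPrime (≢-sym (odd-distinct {P} {Q} P≢Q)) (ℤᵈ.∣ᵤ⇒∣ x))
        q∣cofactor (inj₂ y) = y

  legendre : ∀ {P} → Local M P → Character M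
  legendre {P} loc = leg-char {P = P} (Local.isPrime loc) (Local.divides-M loc)

  character : Character M → ∀ {Ps} → All (Local M) Ps → Character M
  character φ []           = φ
  character φ (loc ∷ locs) = legendre loc ⊗ character φ locs

  module _ (φ : Character M) {Ps} (locs : All (Local M) Ps) where
    open Existence M (character φ locs)

    constraints : ∀ {Qs} → All (Local M) Qs → All (λ P → Unit (ε P)) Qs → List Constraint
    constraints []           []           = []
    constraints (loc ∷ locs) (unit ∷ units) = (legendre loc ∶= unit) ∷ constraints locs units

    at1 : ∀ {Qs} (u : UnitMod M) (locs′ : All (Local M) Qs) (units : All (λ P → Unit (ε P)) Qs) →
          All (λ P → leg P (+ elt u) ≡ 1ℤ) Qs → All (At1 u) (constraints locs′ units)
    at1 u []            []             []       = []
    at1 u (loc ∷ locs′) (unit ∷ units) (x ∷ xs) = x ∷ at1 u locs′ units xs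

    separated : ∀ {Qs} (locs′ : All (Local M) Qs) (units : All (λ P → Unit (ε P)) Qs) → AllPairs _≢_ Qs → Separated (constraints locs′ units)
    separated []            []             []       = tt
    separated (loc ∷ locs′) (unit ∷ units) (d ∷ ds) =
      let u , leg-u , others = nonresidue-unit loc
      in (u , leg-u , at1 u locs′ units (All.zipWith (λ { (loc′ , P≢Q) → others loc′ P≢Q }) (locs′ , d))) , separated locs′ units ds

    satisfied : ∀ {Qs n} (locs′ : All (Local M) Qs) (units : All (λ P → Unit (ε P)) Qs) → All (Satisfies n) (constraints locs′ units) → All (λ P → leg P (+ n) ≡ ε P) Qs
    satisfied []            []             []       = []
    satisfied (loc ∷ locs′) (unit ∷ units) (x ∷ xs) = x ∷ satisfied locs′ units xs

  character-at : ∀ φ u {Ps} (locs : All (Local M) Ps) → All (λ P → leg P (+ u) ≡ 1ℤ) Ps → fn (character φ locs) u ≡ fn φ u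
  character-at φ u []           []       = refl
  character-at φ u (loc ∷ locs) (x ∷ xs) = trans (cong₂ _*_ x (character-at φ u locs xs)) (ℤₚ.*-identityˡ (fn φ u))

  record Form (χ : Character M) (D : ℤ) (Ps : List ℕ) : Set where
    field
      a      : ℕ
      sqrt   : Root 1ℤ D a
      value  : fn χ a ≡ 1ℤ
      primes : ∀ {r} → Prime r → r ℕᵈ.∣ a → fn χ r ≡ 1ℤ
      legs   : All (λ P → leg P (+ a) ≡ ε P) Ps

  opaque
    genus-exists : ∀ D φ {Ps} (locs : All (Local M) Ps) → All (λ P → Unit (ε P)) Ps → AllPairs _≢_ Ps →
                   (v : UnitMod M) → fn φ (elt v) ≡ -1ℤ → All (λ P → leg P (+ elt v) ≡ 1ℤ) Ps →
                   (∀ q → Prime q → fn (character φ locs) q ≡ 1ℤ → Root 1ℤ D q) → Form (character φ locs) D Ps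
    genus-exists D φ {Ps} locs units distinct v φv vs roots = record
      { a = core ; sqrt = sqrt ; value = value ; primes = primes
      ; legs = All.zipWith legs (All.zip (locs , units) , satisfied φ locs locs units (proj₂ (proj₂ (proj₂ (proj₂ found))))) }
      where
      χ : Character M
      χ = character φ locs
      open Existence M χ
      found : ∃ λ n → 0 ℕ.< n × DivisorSum.R χ n ≢ 0ℤ × fn χ n ≢ 0ℤ × All (Satisfies n) (constraints φ locs locs units)
      found = exists (constraints φ locs locs units) v (trans (character-at φ (elt v) locs vs) φv) (at1 φ locs v locs units vs) (separated φ locs locs units distinct)
      n : ℕ
      n = proj₁ found
      χn≢0 : fn χ n ≢ 0ℤ
      χn≢0 = proj₁ (proj₂ (proj₂ (proj₂ found)))
      open Core (R≢0⇒core χ D roots n (proj₁ (proj₂ found)) (proj₁ (proj₂ (proj₂ found))) χn≢0)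
      legs : ∀ {P} → (Local M P × Unit (ε P)) × leg P (+ n) ≡ ε P → leg P (+ core) ≡ ε P
      legs {P} ((loc , unit) , e) = trans (sym (drop (leg-Sign3 P (+ s)) nz)) (trans (sym split) e)
        where
        c : Character M
        c = legendre loc
        split : leg P (+ n) ≡ leg P (+ s) * leg P (+ s) * leg P (+ core)
        split = trans (cong (λ k → leg P (+ k)) factor) (trans (mult c (s ℕ.* s) core) (cong (_* leg P (+ core)) (mult c s s)))
        Unit≢0 : ∀ {x} → Unit x → x ≢ 0ℤ
        Unit≢0 pos ()
        Unit≢0 neg ()
        nz : leg P (+ s) * leg P (+ s) * leg P (+ core) ≢ 0ℤ
        nz z = Unit≢0 unit (trans (sym e) (trans split z))
        drop : ∀ {x y} → Sign3 x → x * x * y ≢ 0ℤ → x * x * y ≡ y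
        drop {y = y} nil h = ⊥-elim (h (ℤₚ.*-zeroˡ y))
        drop {y = y} pos _ = ℤₚ.*-identityˡ y
        drop {y = y} neg _ = ℤₚ.*-identityˡ y

prod : List ℕ → ℕ
prod []       = 1
prod (P ∷ Ps) = odd P ℕ.* prod Ps

sum : List ℕ → ℕ
sum []       = 0
sum (P ∷ Ps) = P ℕ.+ sum Ps

legs : List ℕ → ℤ → ℤ
legs []       a = 1ℤ
legs (P ∷ Ps) a = leg P a * legs Ps a

AllPrime : List ℕ → Set
AllPrime = All (λ P → Prime (odd P))

prod-mod-4 : ∀ Ps → ∃ λ j → prod Ps ≡ 1 ℕ.+ 2 ℕ.* sum Ps ℕ.+ 4 ℕ.* j
prod-mod-4 []       = 0 , refl
prod-mod-4 (P ∷ Ps) = let j , e = prod-mod-4 Ps in P ℕ.* sum Ps ℕ.+ j ℕ.* suc (P ℕ.+ P) , trans (cong (odd P ℕ.*_) e) (lem P (sum Ps) j)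
  where
  lem : ∀ P S j → suc (P ℕ.+ P) ℕ.* (1 ℕ.+ 2 ℕ.* S ℕ.+ 4 ℕ.* j) ≡ 1 ℕ.+ 2 ℕ.* (P ℕ.+ S) ℕ.+ 4 ℕ.* (P ℕ.* S ℕ.+ j ℕ.* suc (P ℕ.+ P))
  lem = ℕSolver.solve-∀

-1^-even : ∀ k → -1ℤ ^ (k ℕ.+ k) ≡ 1ℤ
-1^-even k = trans (ℤₚ.^-distribˡ-+-* -1ℤ k k) (Unit-sq (-1^ k))

leg-reciprocal : ∀ P Q → Prime (odd P) → Prime (odd Q) → odd P ≢ odd Q → leg Q (+ odd P) ≡ -1ℤ ^ (P ℕ.* Q) * leg P (+ odd Q)
leg-reciprocal P Q pr qr p≢q = cancel (Legendre.leg-Unit P pr (distinct-primes pr qr p≢q)) (quadratic-reciprocity P Q pr qr p≢q)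
  where
  cancel : ∀ {x y z} → Unit x → x * y ≡ z → y ≡ z * x
  cancel {x} {y} u refl = trans (sym (ℤₚ.*-identityˡ y)) (trans (cong (_* y) (sym (Unit-sq u))) (lem x y))
    where
    lem : ∀ x y → x * x * y ≡ x * y * x
    lem = solve-∀

legs-reciprocal : ∀ Ps Q → AllPrime Ps → Prime (odd Q) → All (λ P → odd P ≢ odd Q) Ps →
                  leg Q (+ prod Ps) ≡ -1ℤ ^ (sum Ps ℕ.* Q) * legs Ps (+ odd Q)
legs-reciprocal []       Q _          qr _        = Legendre.leg-1 Q qr
legs-reciprocal (P ∷ Ps) Q (pr ∷ prs) qr (d ∷ ds) = begin
  leg Q (+ (odd P ℕ.* prod Ps))
    ≡⟨ trans (cong (leg Q) (ℤₚ.pos-* (odd P) (prod Ps))) (Legendre.leg-* Q qr (+ odd P) (+ prod Ps)) ⟩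
  leg Q (+ odd P) * leg Q (+ prod Ps)
    ≡⟨ cong₂ _*_ (leg-reciprocal P Q pr qr d) (legs-reciprocal Ps Q prs qr ds) ⟩
  (-1ℤ ^ (P ℕ.* Q) * leg P (+ odd Q)) * (-1ℤ ^ (sum Ps ℕ.* Q) * legs Ps (+ odd Q))
    ≡⟨ lem (-1ℤ ^ (P ℕ.* Q)) _ (-1ℤ ^ (sum Ps ℕ.* Q)) _ ⟩
  (-1ℤ ^ (P ℕ.* Q) * -1ℤ ^ (sum Ps ℕ.* Q)) * (leg P (+ odd Q) * legs Ps (+ odd Q))
    ≡⟨ cong (_* (leg P (+ odd Q) * legs Ps (+ odd Q))) (trans (sym (ℤₚ.^-distribˡ-+-* -1ℤ (P ℕ.* Q) (sum Ps ℕ.* Q))) (cong (-1ℤ ^_) (sym (ℕₚ.*-distribʳ-+ Q P (sum Ps))))) ⟩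
  -1ℤ ^ ((P ℕ.+ sum Ps) ℕ.* Q) * (leg P (+ odd Q) * legs Ps (+ odd Q)) ∎
  where
  open ≡-Reasoning
  lem : ∀ a b c d → (a * b) * (c * d) ≡ (a * c) * (b * d)
  lem = solve-∀

legs≢0⇒distinct : ∀ Ps Q → legs Ps (+ odd Q) ≢ 0ℤ → All (λ P → odd P ≢ odd Q) Ps
legs≢0⇒distinct []       Q h = []
legs≢0⇒distinct (P ∷ Ps) Q h =
  (λ e → h (trans (cong (_* legs Ps (+ odd Q)) (leg-∣ {P} {+ odd Q} (subst (λ q → + odd P ∣ + q) e ℤᵈ.∣-refl))) (ℤₚ.*-zeroˡ (legs Ps (+ odd Q)))))
  ∷ legs≢0⇒distinct Ps Q λ e → h (trans (cong (leg P (+ odd Q) *_) e) (ℤₚ.*-zeroʳ (leg P (+ odd Q))))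

data OddOr2 : ℕ → Set where
  is-2 : OddOr2 2
  is-odd : ∀ Q → OddOr2 (odd Q)

odd-or-2 : ∀ {q} → Prime q → OddOr2 q
odd-or-2 {q} pr with parity q
... | odd′ k = is-odd k
... | even k with ℙ.prime⇒irreducible pr {2} (ℕᵈ.divides k (trans (cong (k ℕ.+_) (sym (ℕₚ.+-identityʳ k))) (ℕₚ.*-comm 2 k)))
...   | inj₂ e = subst OddOr2 e is-2

square-root⇒root : ∀ {D} Q → Prime (odd Q) → leg Q (- D) ≡ 1ℤ → Root 1ℤ D (odd Q)
square-root⇒root {D} Q qr e = root (proj₁ r) (∣-resp (lem (proj₁ r) D) (Mod.difference (proj₂ r)))
  where
  r = Squares.square-root Q qr e
  lem : ∀ x D → x * x - - D ≡ 1ℤ * (x * x) + D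
  lem = solve-∀

root-2 : ∀ D → + 2 ∣ 1ℤ + D → Root 1ℤ D 2
root-2 D h = root 1ℤ h

private
  unit-cases : ∀ {x y z} → x * y ≡ 1ℤ → Unit y → z * y ≡ 1ℤ → x ≡ z
  unit-cases {x} {z = z} e pos f = trans (sym (ℤₚ.*-identityʳ x)) (trans e (trans (sym f) (ℤₚ.*-identityʳ z)))
  unit-cases {x} {z = z} e neg f = trans (lem x) (trans (cong (_* -1ℤ) (trans e (sym f))) (sym (lem z)))
    where
    lem : ∀ x → x ≡ x * -1ℤ * -1ℤ
    lem = solve-∀

signs : (ℕ → ℤ) → List ℕ → ℤ
signs ε []       = 1ℤ
signs ε (P ∷ Ps) = ε P * signs ε Ps

legs-signs : ∀ ε Ps a → All (λ P → leg P a ≡ ε P) Ps → legs Ps a ≡ signs ε Ps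
legs-signs ε []       a []       = refl
legs-signs ε (P ∷ Ps) a (e ∷ es) = cong₂ _*_ e (legs-signs ε Ps a es)

signs-Unit : ∀ {ε Ps} → All (λ P → Unit (ε P)) Ps → Unit (signs ε Ps)
signs-Unit []       = pos
signs-Unit (u ∷ us) = Unit-* u (signs-Unit us)

character-legs : ∀ M {{_ : NonZero M}} ε φ {Ps} (locs : All (Local M) Ps) n → fn (Genus.character M ε φ locs) n ≡ legs Ps (+ n) * fn φ n
character-legs M ε φ []                   n = sym (ℤₚ.*-identityˡ (fn φ n))
character-legs M ε φ (_∷_ {x = P} loc locs) n = trans (cong (leg P (+ n) *_) (character-legs M ε φ locs n)) (sym (ℤₚ.*-assoc (leg P (+ n)) _ (fn φ n)))

prime-∣-prod : ∀ Ps → AllPrime Ps → ∀ {q} → Prime q → q ℕᵈ.∣ prod Ps → ¬ All (λ P → odd P ≢ q) Ps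
prime-∣-prod []       _          pr d _        = ℙ.¬prime[1] (subst Prime (ℕᵈ.∣1⇒≡1 d) pr)
prime-∣-prod (P ∷ Ps) (p ∷ prs) pr d (ne ∷ nes) with ℙ.euclidsLemma (odd P) (prod Ps) pr d
... | inj₁ x = distinct-primes pr p (≢-sym ne) (ℤᵈ.∣ᵤ⇒∣ x)
... | inj₂ y = prime-∣-prod Ps prs pr y nes

locals : ∀ m {Ps} → AllPrime Ps → AllPairs _≢_ Ps → All (λ P → ¬ odd P ℕᵈ.∣ m) Ps → All (Local (prod Ps ℕ.* m)) Ps
locals m []         []       []       = []
locals m {P ∷ Ps} (pr ∷ prs) (d ∷ ds) (∤m ∷ ∤ms) =
  record { isPrime = pr ; cofactor = prod Ps ℕ.* m ; factor = ℕₚ.*-assoc (odd P) (prod Ps) m ; exact = coprime }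
  ∷ All.zipWith weaken (locals m prs ds ∤ms , All.zip (prs , d))
  where
  coprime : ¬ odd P ℕᵈ.∣ prod Ps ℕ.* m
  coprime h with ℙ.euclidsLemma (prod Ps) m pr h
  ... | inj₁ x = prime-∣-prod Ps prs pr x (All.map (λ {Q} P≢Q → ≢-sym (odd-distinct {P} {Q} P≢Q)) d)
  ... | inj₂ y = ∤m y
  weaken : ∀ {Q} → Local (prod Ps ℕ.* m) Q × (Prime (odd Q) × P ≢ Q) → Local (odd P ℕ.* prod Ps ℕ.* m) Q
  weaken {Q} (loc , qr , P≢Q) = record
    { isPrime = qr ; cofactor = odd P ℕ.* cofactor
    ; factor = trans (ℕₚ.*-assoc (odd P) (prod Ps) m) (trans (cong (odd P ℕ.*_) factor) (lem (odd P) (odd Q) cofactor))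
    ; exact = λ h → aux (ℙ.euclidsLemma (odd P) cofactor qr h) }
    where
    open Local loc using (cofactor; factor; exact)
    lem : ∀ p q c → p ℕ.* (q ℕ.* c) ≡ q ℕ.* (p ℕ.* c)
    lem = ℕSolver.solve-∀
    aux : ¬ (odd Q ℕᵈ.∣ odd P ⊎ odd Q ℕᵈ.∣ cofactor)
    aux (inj₁ x) = distinct-primes qr pr (≢-sym (odd-distinct {P} {Q} P≢Q)) (ℤᵈ.∣ᵤ⇒∣ x)
    aux (inj₂ y) = exact y

prod≢0 : ∀ Ps → NonZero (prod Ps)
prod≢0 []       = _
prod≢0 (P ∷ Ps) = ℕₚ.m*n≢0 (odd P) (prod Ps) {{_}} {{prod≢0 Ps}}

record BinaryForm (D : ℤ) (ε : ℕ → ℤ) (Ps : List ℕ) : Set where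
  field
    a     : ℕ
    sqrt  : Root 1ℤ D a
    chars : All (λ P → leg P (+ a) ≡ ε P) Ps

opaque
  odd-genus : ∀ P₀ Ps ε t → AllPrime (P₀ ∷ Ps) → AllPairs _≢_ (P₀ ∷ Ps) → All (λ P → Unit (ε P)) Ps → prod (P₀ ∷ Ps) ≡ 3 ℕ.+ 4 ℕ.* t →
              signs ε (P₀ ∷ Ps) ≡ 1ℤ →
              Σ (BinaryForm (+ prod (P₀ ∷ Ps)) ε (P₀ ∷ Ps)) λ f → ∀ {r} → Prime r → r ℕᵈ.∣ BinaryForm.a f → legs (P₀ ∷ Ps) (+ r) ≡ 1ℤ
  odd-genus P₀ Ps ε t prs dist units D≡3 signs≡1 = build (locals 1 prs dist (All.map (λ pr d → ℙ.¬prime[1] (subst Prime (ℕᵈ.∣1⇒≡1 d) pr)) prs))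
    where
    D M : ℕ
    D = prod (P₀ ∷ Ps)
    M = D ℕ.* 1
    instance
      M≢0 : NonZero M
      M≢0 = ℕₚ.m*n≢0 D 1 {{prod≢0 (P₀ ∷ Ps)}}
    S : ℕ
    S = sum (P₀ ∷ Ps)
    -1^S : -1ℤ ^ S ≡ -1ℤ
    -1^S = aux {j = proj₁ (prod-mod-4 (P₀ ∷ Ps))} (parity S) (proj₂ (prod-mod-4 (P₀ ∷ Ps)))
      where
      aux : ∀ {S j} → Parity S → D ≡ 1 ℕ.+ 2 ℕ.* S ℕ.+ 4 ℕ.* j → -1ℤ ^ S ≡ -1ℤ
      aux (odd′ k) _ = cong (-1ℤ *_) (-1^-even k)
      aux {j = j} (even k) e = ⊥-elim (1≢3 (trans (sym (ℕᵐ.[m+kn]%n≡m%n 1 (k ℕ.+ j) 4)) (trans (cong (ℕ._% 4) (trans (lem k j) (trans (sym e) (trans D≡3 (cong (3 ℕ.+_) (ℕₚ.*-comm 4 t)))))) (ℕᵐ.[m+kn]%n≡m%n 3 t 4))))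
        where
        1≢3 : 1 ≢ 3
        1≢3 ()
        lem : ∀ k j → 1 ℕ.+ (k ℕ.+ j) ℕ.* 4 ≡ 1 ℕ.+ 2 ℕ.* (k ℕ.+ k) ℕ.+ 4 ℕ.* j
        lem = ℕSolver.solve-∀
    build : All (Local M) (P₀ ∷ Ps) → Σ (BinaryForm (+ D) ε (P₀ ∷ Ps)) λ f → ∀ {r} → Prime r → r ℕᵈ.∣ BinaryForm.a f → legs (P₀ ∷ Ps) (+ r) ≡ 1ℤ
    build (loc₀ ∷ locs) = record { a = a ; sqrt = sqrt ; chars = first ∷ legs′ } , λ pr d → trans (sym (χ-legs _)) (primes pr d)
      where
      open Genus M ε
      φ : Character M
      φ = legendre loc₀
      χ : Character M
      χ = character φ locs
      χ-legs : ∀ n → fn χ n ≡ legs (P₀ ∷ Ps) (+ n)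
      χ-legs n = trans (character-legs M ε φ locs n) (ℤₚ.*-comm (legs Ps (+ n)) (leg P₀ (+ n)))
      roots : ∀ q → Prime q → fn χ q ≡ 1ℤ → Root 1ℤ (+ D) q
      roots q pr χq≡1 with odd-or-2 pr
      ... | is-2     = root-2 (+ D) (divides (+ (2 ℕ.+ 2 ℕ.* t)) (trans (cong (λ k → + suc k) D≡3) (trans (cong +_ (lem t)) (ℤₚ.pos-* (2 ℕ.+ 2 ℕ.* t) 2))))
        where
        lem : ∀ t → suc (3 ℕ.+ 4 ℕ.* t) ≡ (2 ℕ.+ 2 ℕ.* t) ℕ.* 2
        lem = ℕSolver.solve-∀
      ... | is-odd Q = square-root⇒root Q pr (begin
        leg Q (- + D)
          ≡⟨ trans (cong (leg Q) (sym (ℤₚ.-1*i≡-i (+ D)))) (Legendre.leg-* Q pr -1ℤ (+ D)) ⟩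
        leg Q -1ℤ * leg Q (+ D)
          ≡⟨ cong₂ _*_ (Legendre.leg--1 Q pr) (legs-reciprocal (P₀ ∷ Ps) Q prs pr (legs≢0⇒distinct (P₀ ∷ Ps) Q (λ e → 1≢0 (trans (sym legs≡1) e)))) ⟩
        -1ℤ ^ Q * (-1ℤ ^ (S ℕ.* Q) * legs (P₀ ∷ Ps) (+ odd Q))
          ≡⟨ cong₂ (λ x y → -1ℤ ^ Q * (x * y)) (trans (sym (ℤₚ.^-*-assoc -1ℤ S Q)) (cong (_^ Q) -1^S)) legs≡1 ⟩
        -1ℤ ^ Q * (-1ℤ ^ Q * 1ℤ)
          ≡⟨ trans (cong (-1ℤ ^ Q *_) (ℤₚ.*-identityʳ (-1ℤ ^ Q))) (Unit-sq (-1^ Q)) ⟩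
        1ℤ ∎)
        where
        open ≡-Reasoning
        1≢0 : 1ℤ ≢ 0ℤ
        1≢0 ()
        legs≡1 : legs (P₀ ∷ Ps) (+ odd Q) ≡ 1ℤ
        legs≡1 = trans (sym (χ-legs (odd Q))) χq≡1
      v : Σ (UnitMod M) λ u → leg P₀ (+ elt u) ≡ -1ℤ × (∀ {Q} → Local M Q → P₀ ≢ Q → leg Q (+ elt u) ≡ 1ℤ)
      v = nonresidue-unit loc₀
      heads : ∀ {Ps} → AllPairs _≢_ (P₀ ∷ Ps) → All (λ Q → P₀ ≢ Q) Ps × AllPairs _≢_ Ps
      heads (d ∷ ds) = d , ds
      separate : ∀ {Q} → Local M Q × P₀ ≢ Q → leg Q (+ elt (proj₁ v)) ≡ 1ℤ
      separate (loc , P₀≢Q) = proj₂ (proj₂ v) loc P₀≢Q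
      open Form (genus-exists (+ D) φ locs units (proj₂ (heads dist)) (proj₁ v) (proj₁ (proj₂ v)) (All.zipWith separate (locs , proj₁ (heads dist))) roots) renaming (legs to legs′)
      first : leg P₀ (+ a) ≡ ε P₀
      first = unit-cases (trans (cong (leg P₀ (+ a) *_) (sym (legs-signs ε Ps (+ a) legs′))) (trans (sym (χ-legs a)) value)) (signs-Unit units) signs≡1

-- The characters of conductor 8 with value -1 at 5: the one with value s = 1 at 3 belongs to ℚ(√-2), the one with s = -1 to ℚ(√2).
eight : ℤ → ℕ → ℤ
eight s 1 = 1ℤ
eight s 3 = s
eight s 5 = -1ℤ
eight s 7 = - s
eight s (suc (suc (suc (suc (suc (suc (suc (suc n)))))))) = eight s n
eight s _ = 0ℤ

eight-period : ∀ s k r → eight s (k ℕ.* 8 ℕ.+ r) ≡ eight s r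
eight-period s zero    r = refl
eight-period s (suc k) r = eight-period s k r

eight-% : ∀ s a → eight s a ≡ eight s (a ℕ.% 8)
eight-% s a = trans (cong (eight s) (trans (ℕᵐ.m≡m%n+[m/n]*n a 8) (ℕₚ.+-comm (a ℕ.% 8) _))) (eight-period s (a ℕ./ 8) (a ℕ.% 8))

Table : ℤ → Set
Table s = ∀ (i j : Fin 8) → eight s (Fin.toℕ i ℕ.* Fin.toℕ j) ≡ eight s (Fin.toℕ i) * eight s (Fin.toℕ j)

table? : ∀ s → Dec (Table s)
table? s = Finₚ.all? λ i → Finₚ.all? λ j → eight s (Fin.toℕ i ℕ.* Fin.toℕ j) ℤ.≟ eight s (Fin.toℕ i) * eight s (Fin.toℕ j)

table : ∀ {s} → Unit s → Table s
table pos = from-yes (table? 1ℤ)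
table neg = from-yes (table? -1ℤ)

eight-Sign3 : ∀ {s} → Unit s → (i : Fin 8) → Sign3 (eight s (Fin.toℕ i))
eight-Sign3 u Fin.zero = nil
eight-Sign3 u (Fin.suc Fin.zero) = pos
eight-Sign3 u (Fin.suc (Fin.suc Fin.zero)) = nil
eight-Sign3 u (Fin.suc (Fin.suc (Fin.suc Fin.zero))) = Unit⇒Sign3 u
eight-Sign3 u (Fin.suc (Fin.suc (Fin.suc (Fin.suc Fin.zero)))) = nil
eight-Sign3 u (Fin.suc (Fin.suc (Fin.suc (Fin.suc (Fin.suc Fin.zero))))) = neg
eight-Sign3 u (Fin.suc (Fin.suc (Fin.suc (Fin.suc (Fin.suc (Fin.suc Fin.zero)))))) = nil
eight-Sign3 pos (Fin.suc (Fin.suc (Fin.suc (Fin.suc (Fin.suc (Fin.suc (Fin.suc Fin.zero))))))) = neg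
eight-Sign3 neg (Fin.suc (Fin.suc (Fin.suc (Fin.suc (Fin.suc (Fin.suc (Fin.suc Fin.zero))))))) = pos

residue-8 : ∀ a → ∃ λ (i : Fin 8) → Fin.toℕ i ≡ a ℕ.% 8
residue-8 a = Fin.fromℕ< (ℕᵐ.m%n<n a 8) , Finₚ.toℕ-fromℕ< (ℕᵐ.m%n<n a 8)

eight-* : ∀ {s} → Unit s → ∀ a b → eight s (a ℕ.* b) ≡ eight s a * eight s b
eight-* {s} u a b = begin
  eight s (a ℕ.* b)                       ≡⟨ eight-% s (a ℕ.* b) ⟩
  eight s ((a ℕ.* b) ℕ.% 8)               ≡⟨ cong (eight s) (ℕᵐ.%-distribˡ-* a b 8) ⟩
  eight s (((a ℕ.% 8) ℕ.* (b ℕ.% 8)) ℕ.% 8) ≡⟨ sym (eight-% s ((a ℕ.% 8) ℕ.* (b ℕ.% 8))) ⟩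
  eight s ((a ℕ.% 8) ℕ.* (b ℕ.% 8))       ≡⟨ cong₂ (λ x y → eight s (x ℕ.* y)) (sym (proj₂ (residue-8 a))) (sym (proj₂ (residue-8 b))) ⟩
  eight s (Fin.toℕ (proj₁ (residue-8 a)) ℕ.* Fin.toℕ (proj₁ (residue-8 b))) ≡⟨ table u (proj₁ (residue-8 a)) (proj₁ (residue-8 b)) ⟩
  eight s (Fin.toℕ (proj₁ (residue-8 a))) * eight s (Fin.toℕ (proj₁ (residue-8 b))) ≡⟨ cong₂ (λ x y → eight s x * eight s y) (proj₂ (residue-8 a)) (proj₂ (residue-8 b)) ⟩
  eight s (a ℕ.% 8) * eight s (b ℕ.% 8)   ≡⟨ sym (cong₂ _*_ (eight-% s a) (eight-% s b)) ⟩
  eight s a * eight s b                   ∎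
  where open ≡-Reasoning

eight-char : ∀ {s} → Unit s → ∀ N → Character (N ℕ.* 8)
eight-char {s} u N = record
  { fn = eight s ; one = refl ; mult = eight-* u
  ; sign3 = λ a → subst Sign3 (trans (cong (eight s) (proj₂ (residue-8 a))) (sym (eight-% s a))) (eight-Sign3 u (proj₁ (residue-8 a)))
  ; period = eight-period s N }

odd-4+ : ∀ Q → odd (suc (suc (suc (suc Q)))) ≡ 8 ℕ.+ odd Q
odd-4+ = lem
  where
  lem : ∀ Q → suc (suc (suc (suc (suc Q))) ℕ.+ suc (suc (suc (suc Q)))) ≡ 8 ℕ.+ suc (Q ℕ.+ Q)
  lem = ℕSolver.solve-∀

eight-plus : ∀ Q → eight 1ℤ (odd Q) ≡ -1ℤ ^ Q * two Q
eight-plus 0 = refl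
eight-plus 1 = refl
eight-plus 2 = refl
eight-plus 3 = refl
eight-plus (suc (suc (suc (suc Q)))) = trans (cong (eight 1ℤ) (odd-4+ Q)) (trans (eight-plus Q) (lem (-1ℤ ^ Q) (two Q)))
  where
  lem : ∀ x t → x * t ≡ -1ℤ * (-1ℤ * (-1ℤ * (-1ℤ * x))) * - - t
  lem = solve-∀

eight-minus : ∀ Q → eight -1ℤ (odd Q) ≡ two Q
eight-minus 0 = refl
eight-minus 1 = refl
eight-minus 2 = refl
eight-minus 3 = refl
eight-minus (suc (suc (suc (suc Q)))) = trans (cong (eight -1ℤ) (odd-4+ Q)) (trans (eight-minus Q) (sym (ℤₚ.neg-involutive (two Q))))

eight-sum : ∀ S → ∃ λ s → Unit s × ∀ Q → eight s (odd Q) ≡ -1ℤ ^ Q * two Q * -1ℤ ^ (S ℕ.* Q)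
eight-sum S with parity S
... | even k = 1ℤ , pos , λ Q → trans (eight-plus Q) (sym (trans (cong (-1ℤ ^ Q * two Q *_) (trans (sym (ℤₚ.^-*-assoc -1ℤ (k ℕ.+ k) Q)) (trans (cong (_^ Q) (-1^-even k)) (ℤₚ.^-zeroˡ Q)))) (ℤₚ.*-identityʳ _)))
... | odd′ k = -1ℤ , neg , λ Q → trans (eight-minus Q) (sym (trans (cong (-1ℤ ^ Q * two Q *_) (trans (sym (ℤₚ.^-*-assoc -1ℤ (suc (k ℕ.+ k)) Q)) (cong (λ z → (-1ℤ * z) ^ Q) (-1^-even k))))
      (trans (lem (-1ℤ ^ Q) (two Q)) (trans (cong (_* two Q) (Unit-sq (-1^ Q))) (ℤₚ.*-identityˡ (two Q))))))
  where
  lem : ∀ x t → x * t * x ≡ x * x * t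
  lem = solve-∀

prod-odd : ∀ Ps → ∃ λ k → prod Ps ≡ odd k
prod-odd Ps = let j , e = prod-mod-4 Ps in sum Ps ℕ.+ 2 ℕ.* j , trans e (lem (sum Ps) j)
  where
  lem : ∀ S j → 1 ℕ.+ 2 ℕ.* S ℕ.+ 4 ℕ.* j ≡ suc ((S ℕ.+ 2 ℕ.* j) ℕ.+ (S ℕ.+ 2 ℕ.* j))
  lem = ℕSolver.solve-∀

odd∤8 : ∀ {P} → Prime (odd P) → ¬ odd P ℕᵈ.∣ 8
odd∤8 {P} pr d = aux (ℙ.euclidsLemma 2 4 pr d)
  where
  p∤2 : ¬ odd P ℕᵈ.∣ 2
  p∤2 h = ℕₚ.<⇒≱ (Legendre.2<p P pr) (ℕᵈ.∣⇒≤ h)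
  aux : ¬ (odd P ℕᵈ.∣ 2 ⊎ odd P ℕᵈ.∣ 4)
  aux (inj₁ h) = p∤2 h
  aux (inj₂ h) with ℙ.euclidsLemma 2 2 pr h
  ... | inj₁ x = p∤2 x
  ... | inj₂ x = p∤2 x

opaque
  even-genus : ∀ Ps ε → AllPrime Ps → AllPairs _≢_ Ps → All (λ P → Unit (ε P)) Ps →
               Σ (BinaryForm (+ (2 ℕ.* prod Ps)) ε Ps) λ f → ¬ 2 ℕᵈ.∣ BinaryForm.a f
  even-genus Ps ε prs dist units = record { a = a ; sqrt = sqrt ; chars = legs′ } , not-even
    where
    N M S : ℕ
    N = prod Ps
    M = N ℕ.* 8
    S = sum Ps
    instance
      M≢0 : NonZero M
      M≢0 = ℕₚ.m*n≢0 N 8 {{prod≢0 Ps}}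
    s : ℤ
    s = proj₁ (eight-sum S)
    φ : Character M
    φ = eight-char (proj₁ (proj₂ (eight-sum S))) N
    locs : All (Local M) Ps
    locs = locals 8 prs dist (All.map (λ {P} → odd∤8 {P}) prs)
    open Genus M ε
    χ : Character M
    χ = character φ locs
    χ-legs : ∀ n → fn χ n ≡ legs Ps (+ n) * eight s n
    χ-legs n = character-legs M ε φ locs n
    χ2≡0 : fn χ 2 ≡ 0ℤ
    χ2≡0 = trans (χ-legs 2) (ℤₚ.*-zeroʳ (legs Ps (+ 2)))
    0≢1 : 0ℤ ≢ 1ℤ
    0≢1 ()
    -- 1 + 4N is ≡ 1 modulo N and ≡ 5 modulo 8.
    w : ℕ
    w = suc (4 ℕ.* N)
    w-N : Coprime w N
    w-N {d} (d∣w , d∣N) = ℕᵈ.∣1⇒≡1 (ℕᵈ.∣m+n∣m⇒∣n (subst (d ℕᵈ.∣_) (ℕₚ.+-comm 1 (4 ℕ.* N)) d∣w) (ℕᵈ.∣n⇒∣m*n 4 d∣N))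
    w-2 : Coprime w 2
    w-2 {d} (d∣w , d∣2) = ℕᵈ.∣1⇒≡1 (ℕᵈ.∣m+n∣m⇒∣n (subst (d ℕᵈ.∣_) (trans (ℕₚ.+-comm 1 (4 ℕ.* N)) (cong (ℕ._+ 1) (ℕₚ.*-assoc 2 2 N))) d∣w) (ℕᵈ.∣m⇒∣m*n (2 ℕ.* N) d∣2))
    v : UnitMod M
    v = unit-mod (coprime-* w-N (coprime-* w-2 (coprime-* w-2 w-2)))
    φv : eight s w ≡ -1ℤ
    φv = trans (cong (λ n → eight s (suc (4 ℕ.* n))) (proj₂ (prod-odd Ps))) (trans (cong (eight s) (lem (proj₁ (prod-odd Ps)))) (eight-period s (proj₁ (prod-odd Ps)) 5))
      where
      lem : ∀ k → suc (4 ℕ.* suc (k ℕ.+ k)) ≡ k ℕ.* 8 ℕ.+ 5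
      lem = ℕSolver.solve-∀
    legs-v : ∀ {P} → Local M P × Prime (odd P) → leg P (+ w) ≡ 1ℤ
    legs-v {P} (loc , pr) = trans (leg-unit pr p∣N (divides (+ 4) (ℤₚ.pos-* 4 N))) (Legendre.leg-1 P pr)
      where
      p∣N : odd P ℕᵈ.∣ N
      p∣N with ℙ.euclidsLemma N 8 pr (Local.divides-M loc)
      ... | inj₁ x = x
      ... | inj₂ y = ⊥-elim (odd∤8 {P} pr y)
    roots : ∀ q → Prime q → fn χ q ≡ 1ℤ → Root 1ℤ (+ (2 ℕ.* N)) q
    roots q pr χq≡1 with odd-or-2 pr
    ... | is-2     = ⊥-elim (0≢1 (trans (sym χ2≡0) χq≡1))
    ... | is-odd Q = square-root⇒root Q pr (begin
      leg Q (- + (2 ℕ.* N))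
        ≡⟨ trans (cong (leg Q) (trans (cong -_ (ℤₚ.pos-* 2 N)) (sym (ℤₚ.-1*i≡-i (+ 2 * + N))))) (trans (leg-* -1ℤ (+ 2 * + N)) (cong (leg Q -1ℤ *_) (leg-* (+ 2) (+ N)))) ⟩
      leg Q -1ℤ * (leg Q (+ 2) * leg Q (+ N))
        ≡⟨ cong₂ _*_ leg--1 (cong₂ _*_ (leg-2 Q pr) (legs-reciprocal Ps Q prs pr (legs≢0⇒distinct Ps Q legs≢0))) ⟩
      -1ℤ ^ Q * (two Q * (-1ℤ ^ (S ℕ.* Q) * legs Ps (+ odd Q)))
        ≡⟨ lem (-1ℤ ^ Q) (two Q) (-1ℤ ^ (S ℕ.* Q)) (legs Ps (+ odd Q)) ⟩
      legs Ps (+ odd Q) * (-1ℤ ^ Q * two Q * -1ℤ ^ (S ℕ.* Q))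
        ≡⟨ trans (cong (legs Ps (+ odd Q) *_) (sym (proj₂ (proj₂ (eight-sum S)) Q))) (trans (sym (χ-legs (odd Q))) χq≡1) ⟩
      1ℤ ∎)
      where
      open ≡-Reasoning
      open Legendre Q pr using (leg-*; leg--1)
      legs≢0 : legs Ps (+ odd Q) ≢ 0ℤ
      legs≢0 e = 0≢1 (trans (sym (trans (χ-legs (odd Q)) (trans (cong (_* eight s (odd Q)) e) (ℤₚ.*-zeroˡ (eight s (odd Q)))))) χq≡1)
      lem : ∀ a b c d → a * (b * (c * d)) ≡ d * (a * b * c)
      lem = solve-∀
    open Form (genus-exists (+ (2 ℕ.* N)) φ locs units dist v (φv) (All.map legs-v (All.zip (locs , prs))) roots) renaming (legs to legs′)
    not-even : ¬ 2 ℕᵈ.∣ a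
    not-even d = 0≢1 (trans (sym χ2≡0) (primes ℙ.prime[2] d))

-- Ternary forms of determinant 1 and 3

-- a x² + b y² + c z² + 2 (d y z + e x z + f x y)
record Ternary : Set where
  constructor ternary
  field
    a b c d e f : ℤ

  value : ℤ → ℤ → ℤ → ℤ
  value x y z = a * (x * x) + b * (y * y) + c * (z * z) + + 2 * (d * (y * z) + e * (x * z) + f * (x * y))

  -- a · value = (a x + f y + e z)² + p y² + 2 q y z + r z²
  p q r det : ℤ
  p   = a * b - f * f
  q   = a * d - e * f
  r   = a * c - e * e
  det = a * b * c + + 2 * (d * e * f) - a * (d * d) - b * (e * e) - c * (f * f)

open Ternary public using (value; det)

record _⇄_ (g g′ : Ternary) : Set where
  field
    to   : ∀ x y z → ∃ λ x′ → ∃ λ y′ → ∃ λ z′ → value g′ x′ y′ z′ ≡ value g x y z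
    from : ∀ x y z → ∃ λ x′ → ∃ λ y′ → ∃ λ z′ → value g x′ y′ z′ ≡ value g′ x y z
open _⇄_ public

⇄-refl : ∀ {g} → g ⇄ g
⇄-refl = record { to = λ x y z → x , y , z , refl ; from = λ x y z → x , y , z , refl }

⇄-trans : ∀ {g h k} → g ⇄ h → h ⇄ k → g ⇄ k
⇄-trans A B = record
  { to   = λ x y z → let x′ , y′ , z′ , e = to A x y z ; x″ , y″ , z″ , e′ = to B x′ y′ z′ in x″ , y″ , z″ , trans e′ e
  ; from = λ x y z → let x′ , y′ , z′ , e = from B x y z ; x″ , y″ , z″ , e′ = from A x′ y′ z′ in x″ , y″ , z″ , trans e′ e }

shear₁₂ shear₂₃ : ℤ → Ternary → Ternary
shear₁₂ k (ternary a b c d e f) = ternary a (b + + 2 * (k * f) + k * k * a) c (d + k * e) e (f + k * a)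
shear₂₃ k (ternary a b c d e f) = ternary a b (c + + 2 * (k * d) + k * k * b) (d + k * b) (e + k * f) f

swap₁₂ swap₂₃ : Ternary → Ternary
swap₁₂ (ternary a b c d e f) = ternary b a c e d f
swap₂₃ (ternary a b c d e f) = ternary a c b d f e

shear₁₂-⇄ : ∀ k g → g ⇄ shear₁₂ k g
shear₁₂-⇄ k (ternary a b c d e f) = record
  { to   = λ x y z → x - k * y , y , z , lem₁ a b c d e f k x y z
  ; from = λ x y z → x + k * y , y , z , lem₂ a b c d e f k x y z }
  where
  lem₁ : ∀ a b c d e f k x y z →
    a * ((x - k * y) * (x - k * y)) + (b + + 2 * (k * f) + k * k * a) * (y * y) + c * (z * z) + + 2 * ((d + k * e) * (y * z) + e * ((x - k * y) * z) + (f + k * a) * ((x - k * y) * y))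
    ≡ a * (x * x) + b * (y * y) + c * (z * z) + + 2 * (d * (y * z) + e * (x * z) + f * (x * y))
  lem₁ = solve-∀
  lem₂ : ∀ a b c d e f k x y z →
    a * ((x + k * y) * (x + k * y)) + b * (y * y) + c * (z * z) + + 2 * (d * (y * z) + e * ((x + k * y) * z) + f * ((x + k * y) * y))
    ≡ a * (x * x) + (b + + 2 * (k * f) + k * k * a) * (y * y) + c * (z * z) + + 2 * ((d + k * e) * (y * z) + e * (x * z) + (f + k * a) * (x * y))
  lem₂ = solve-∀

shear₂₃-⇄ : ∀ k g → g ⇄ shear₂₃ k g
shear₂₃-⇄ k (ternary a b c d e f) = record
  { to   = λ x y z → x , y - k * z , z , lem₁ a b c d e f k x y z
  ; from = λ x y z → x , y + k * z , z , lem₂ a b c d e f k x y z }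
  where
  lem₁ : ∀ a b c d e f k x y z →
    a * (x * x) + b * ((y - k * z) * (y - k * z)) + (c + + 2 * (k * d) + k * k * b) * (z * z) + + 2 * ((d + k * b) * ((y - k * z) * z) + (e + k * f) * (x * z) + f * (x * (y - k * z)))
    ≡ a * (x * x) + b * (y * y) + c * (z * z) + + 2 * (d * (y * z) + e * (x * z) + f * (x * y))
  lem₁ = solve-∀
  lem₂ : ∀ a b c d e f k x y z →
    a * (x * x) + b * ((y + k * z) * (y + k * z)) + c * (z * z) + + 2 * (d * ((y + k * z) * z) + e * (x * z) + f * (x * (y + k * z)))
    ≡ a * (x * x) + b * (y * y) + (c + + 2 * (k * d) + k * k * b) * (z * z) + + 2 * ((d + k * b) * (y * z) + (e + k * f) * (x * z) + f * (x * y))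
  lem₂ = solve-∀

swap₁₂-⇄ : ∀ g → g ⇄ swap₁₂ g
swap₁₂-⇄ (ternary a b c d e f) = record
  { to = λ x y z → y , x , z , lem a b c d e f x y z ; from = λ x y z → y , x , z , lem b a c e d f x y z }
  where
  lem : ∀ a b c d e f x y z → b * (y * y) + a * (x * x) + c * (z * z) + + 2 * (e * (x * z) + d * (y * z) + f * (y * x))
      ≡ a * (x * x) + b * (y * y) + c * (z * z) + + 2 * (d * (y * z) + e * (x * z) + f * (x * y))
  lem = solve-∀

swap₂₃-⇄ : ∀ g → g ⇄ swap₂₃ g
swap₂₃-⇄ (ternary a b c d e f) = record
  { to = λ x y z → x , z , y , lem a b c d e f x y z ; from = λ x y z → x , z , y , lem a c b d f e x y z }
  where
  lem : ∀ a b c d e f x y z → a * (x * x) + c * (z * z) + b * (y * y) + + 2 * (d * (z * y) + f * (x * y) + e * (x * z))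
      ≡ a * (x * x) + b * (y * y) + c * (z * z) + + 2 * (d * (y * z) + e * (x * z) + f * (x * y))
  lem = solve-∀

record Definite (δ : ℤ) (g : Ternary) : Set where
  constructor definite
  open Ternary g using (a; p)
  field
    0<a : 0ℤ < a
    0<p : 0ℤ < p
    det≡ : det g ≡ δ

shear₁₂-definite : ∀ {δ} k g → Definite δ g → Definite δ (shear₁₂ k g)
shear₁₂-definite k (ternary a b c d e f) (definite 0<a 0<p e′) = definite 0<a (subst (0ℤ <_) (lem-p a b f k) 0<p) (trans (lem-det a b c d e f k) e′)
  where
  lem-p : ∀ a b f k → a * b - f * f ≡ a * (b + + 2 * (k * f) + k * k * a) - (f + k * a) * (f + k * a)
  lem-p = solve-∀
  lem-det : ∀ a b c d e f k → a * (b + + 2 * (k * f) + k * k * a) * c + + 2 * ((d + k * e) * e * (f + k * a)) - a * ((d + k * e) * (d + k * e)) - (b + + 2 * (k * f) + k * k * a) * (e * e) - c * ((f + k * a) * (f + k * a))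
          ≡ a * b * c + + 2 * (d * e * f) - a * (d * d) - b * (e * e) - c * (f * f)
  lem-det = solve-∀

shear₂₃-definite : ∀ {δ} k g → Definite δ g → Definite δ (shear₂₃ k g)
shear₂₃-definite k (ternary a b c d e f) (definite 0<a 0<p e′) = definite 0<a 0<p (trans (lem-det a b c d e f k) e′)
  where
  lem-det : ∀ a b c d e f k → a * b * (c + + 2 * (k * d) + k * k * b) + + 2 * ((d + k * b) * (e + k * f) * f) - a * ((d + k * b) * (d + k * b)) - b * ((e + k * f) * (e + k * f)) - (c + + 2 * (k * d) + k * k * b) * (f * f)
          ≡ a * b * c + + 2 * (d * e * f) - a * (d * d) - b * (e * e) - c * (f * f)
  lem-det = solve-∀

square-abs : ∀ z → z * z ≡ + (abs z ℕ.* abs z)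
square-abs (+ n)    = sym (ℤₚ.pos-* n n)
square-abs -[1+ n ] = refl

positive-factor : ∀ {x y} z → 0ℤ < x → 0ℤ < x * y - z * z → 0ℤ < y
positive-factor {y = + suc n} z _ _ = ℤ.+<+ z<s
positive-factor {x} {+ zero} z _ h = ⊥-elim (ℤₚ.<⇒≱ h (subst (_≤ 0ℤ) (sym (trans (cong₂ _-_ (ℤₚ.*-zeroʳ x) (square-abs z)) (ℤₚ.+-identityˡ (- + (abs z ℕ.* abs z))))) (ℤₚ.neg-mono-≤ (+≤+ z≤n))))
positive-factor {+ suc m} { -[1+ n ]} z _ h = ⊥-elim (ℤₚ.<⇒≱ h (subst (λ w → -[1+ n ℕ.+ m ℕ.* suc n ] - w ≤ 0ℤ) (sym (square-abs z)) (ℤₚ.+-mono-≤ (ℤ.-≤+ {m = n ℕ.+ m ℕ.* suc n} {0}) (ℤₚ.neg-mono-≤ (+≤+ (z≤n {abs z ℕ.* abs z}))))))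
positive-factor {+ zero} { -[1+ n ]} z (ℤ.+<+ ()) h

p*r-q² : ∀ a b c d e f → (a * b - f * f) * (a * c - e * e) - (a * d - e * f) * (a * d - e * f) ≡ a * (a * b * c + + 2 * (d * e * f) - a * (d * d) - b * (e * e) - c * (f * f))
p*r-q² = solve-∀

0<* : ∀ {x y} → 0ℤ < x → 0ℤ < y → 0ℤ < x * y
0<* {+ suc m} {+ suc n} _ _ = ℤ.+<+ z<s
0<* {+ zero} (ℤ.+<+ ()) _
0<* {+ suc m} {+ zero} _ (ℤ.+<+ ())

module _ {δ} (0<δ : 0ℤ < δ) where
  0<b : ∀ g → Definite δ g → 0ℤ < Ternary.b g
  0<b (ternary a b c d e f) (definite 0<a 0<p _) = positive-factor f 0<a 0<p

  0<r : ∀ g → Definite δ g → 0ℤ < Ternary.r g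
  0<r (ternary a b c d e f) (definite 0<a 0<p e′) = positive-factor (a * d - e * f) 0<p
    (subst (0ℤ <_) (sym (trans (p*r-q² a b c d e f) (cong (a *_) e′))) (0<* 0<a 0<δ))

  swap₁₂-definite : ∀ g → Definite δ g → Definite δ (swap₁₂ g)
  swap₁₂-definite g@(ternary a b c d e f) D@(definite 0<a 0<p e′) = definite (0<b g D) (subst (λ z → 0ℤ < z - f * f) (ℤₚ.*-comm a b) 0<p) (trans (lem a b c d e f) e′)
    where
    lem : ∀ a b c d e f → b * a * c + + 2 * (e * d * f) - b * (e * e) - a * (d * d) - c * (f * f) ≡ a * b * c + + 2 * (d * e * f) - a * (d * d) - b * (e * e) - c * (f * f)
    lem = solve-∀

  swap₂₃-definite : ∀ g → Definite δ g → Definite δ (swap₂₃ g)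
  swap₂₃-definite g@(ternary a b c d e f) D@(definite 0<a 0<p e′) = definite 0<a (0<r g D) (trans (lem a b c d e f) e′)
    where
    lem : ∀ a b c d e f → a * c * b + + 2 * (d * f * e) - a * (d * d) - c * (f * f) - b * (e * e) ≡ a * b * c + + 2 * (d * e * f) - a * (d * d) - b * (e * e) - c * (f * f)
    lem = solve-∀

round : ∀ f a → 0ℤ < a → ∃ λ k → 2 ℕ.* abs (f + k * a) ℕ.≤ abs a
round f (+ zero)  (ℤ.+<+ ())
round f a@(+ n@(suc _)) _ = aux (2 ℕ.* r ℕ.≤? n)
  where
  r : ℕ
  r = f ℤᵐ.%ℕ n
  t : ℤ
  t = f ℤᵐ./ℕ n
  f≡ : f ≡ + r + t * + n
  f≡ = ℤᵐ.a≡a%ℕn+[a/ℕn]*n f n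
  aux : Dec (2 ℕ.* r ℕ.≤ n) → ∃ λ k → 2 ℕ.* abs (f + k * a) ℕ.≤ n
  aux (yes h) = - t , subst (λ z → 2 ℕ.* abs z ℕ.≤ n) (sym (trans (cong (_+ - t * a) f≡) (lem (+ r) t a))) h
    where
    lem : ∀ r t a → r + t * a + - t * a ≡ r
    lem = solve-∀
  aux (no ¬h) = - t - 1ℤ , subst (λ z → 2 ℕ.* z ℕ.≤ n) (sym (trans (cong abs (trans (cong (_+ (- t - 1ℤ) * a) f≡) (trans (lem (+ r) t a) (cong -_ (sym (+∸ (ℕₚ.<⇒≤ (ℤᵐ.n%ℕd<d f n)))))))) (ℤₚ.∣-i∣≡∣i∣ (+ (n ℕ.∸ r)))))
      (ℕₚ.+-cancelʳ-≤ (2 ℕ.* r) _ _ (ℕₚ.≤-trans (ℕₚ.≤-reflexive (trans (sym (ℕₚ.*-distribˡ-+ 2 (n ℕ.∸ r) r)) (trans (cong (2 ℕ.*_) (ℕₚ.m∸n+n≡m (ℕₚ.<⇒≤ (ℤᵐ.n%ℕd<d f n)))) (cong (n ℕ.+_) (ℕₚ.+-identityʳ n))))) (ℕₚ.+-monoʳ-≤ n (ℕₚ.<⇒≤ (ℕₚ.≰⇒> ¬h)))))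
    where
    lem : ∀ r t a → r + t * a + (- t - 1ℤ) * a ≡ - (a - r)
    lem = solve-∀

record Reduced (g : Ternary) : Set where
  open Ternary g
  field
    2f≤a : 2 ℕ.* abs f ℕ.≤ abs a
    a≤b  : a ≤ b
    2q≤p : 2 ℕ.* abs q ℕ.≤ abs p
    p≤r  : p ≤ r

abs-mono-< : ∀ {x y} → 0ℤ < x → x < y → abs x ℕ.< abs y
abs-mono-< {+ _} {+ _} _ (ℤ.+<+ h) = h

opaque
  reduction : ∀ {δ} → 0ℤ < δ → ∀ g → Definite δ g → ∃ λ g′ → g ⇄ g′ × Definite δ g′ × Reduced g′
  reduction {δ} 0<δ g D = outer (<-wellFounded _) g D refl
    where
    Result : Ternary → Set
    Result g = ∃ λ g′ → g ⇄ g′ × Definite δ g′ × Reduced g′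
    via : ∀ {g h} → g ⇄ h → Result h → Result g
    via A (g′ , B , D , R) = g′ , ⇄-trans A B , D , R
    outer : ∀ {m} → Acc ℕ._<_ m → ∀ g → Definite δ g → abs (Ternary.a g) ≡ m → Result g
    outer {m} (acc rec-a) g D a≡m = inner (<-wellFounded _) g D a≡m refl
      where
      inner : ∀ {n} → Acc ℕ._<_ n → ∀ g → Definite δ g → abs (Ternary.a g) ≡ m → abs (Ternary.p g) ≡ n → Result g
      inner (acc rec-p) g@(ternary a _ _ _ _ f) D a≡m p≡n =
        via (shear₁₂-⇄ k g) (step₁ (shear₁₂ k g) (shear₁₂-definite k g D) refl (p-same g) (proj₂ (round f a (Definite.0<a D))))
        where
        k : ℤ
        k = proj₁ (round f a (Definite.0<a D))
        p-same : ∀ g → Ternary.p (shear₁₂ k g) ≡ Ternary.p g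
        p-same (ternary a b c d e f) = lem a b f k
          where
          lem : ∀ a b f k → a * (b + + 2 * (k * f) + k * k * a) - (f + k * a) * (f + k * a) ≡ a * b - f * f
          lem = solve-∀
        step₁ : ∀ h → Definite δ h → Ternary.a h ≡ a → Ternary.p h ≡ Ternary.p g → 2 ℕ.* abs (Ternary.f h) ℕ.≤ abs (Ternary.a h) → Result h
        step₁ h D refl p≡ 2f≤a with Ternary.b h ℤ.<? Ternary.a h
        ... | yes b<a = via (swap₁₂-⇄ h) (outer (rec-a (subst (abs (Ternary.b h) ℕ.<_) a≡m (abs-mono-< (0<b 0<δ h D) b<a))) (swap₁₂ h) (swap₁₂-definite 0<δ h D) refl)
        ... | no  b≮a = via (shear₂₃-⇄ l h) (step₂ (shear₂₃ l h) (shear₂₃-definite l h D) refl p≡ 2f≤a (ℤₚ.≮⇒≥ b≮a) (subst (λ z → 2 ℕ.* abs z ℕ.≤ abs (Ternary.p h)) (q≡ h) (proj₂ (round (Ternary.q h) (Ternary.p h) (Definite.0<p D)))))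
          where
          l : ℤ
          l = proj₁ (round (Ternary.q h) (Ternary.p h) (Definite.0<p D))
          q≡ : ∀ h → Ternary.q h + l * Ternary.p h ≡ Ternary.q (shear₂₃ l h)
          q≡ (ternary a b c d e f) = lem a b d e f l
            where
            lem : ∀ a b d e f l → a * d - e * f + l * (a * b - f * f) ≡ a * (d + l * b) - (e + l * f) * f
            lem = solve-∀
          step₂ : ∀ h′ → Definite δ h′ → Ternary.a h′ ≡ Ternary.a h → Ternary.p h′ ≡ Ternary.p g → 2 ℕ.* abs (Ternary.f h′) ℕ.≤ abs (Ternary.a h′) → Ternary.a h′ ≤ Ternary.b h′ →
                  2 ℕ.* abs (Ternary.q h′) ℕ.≤ abs (Ternary.p h′) → Result h′
          step₂ h′ D a≡ p≡ 2f≤a a≤b 2q≤p with Ternary.r h′ ℤ.<? Ternary.p h′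
          ... | yes r<p = via (swap₂₃-⇄ h′) (inner (rec-p (subst (abs (Ternary.r h′) ℕ.<_) (trans (cong abs p≡) p≡n) (abs-mono-< (0<r 0<δ h′ D) r<p))) (swap₂₃ h′) (swap₂₃-definite 0<δ h′ D) (trans (cong abs a≡) a≡m) refl)
          ... | no  r≮p = h′ , ⇄-refl , D , record { 2f≤a = 2f≤a ; a≤b = a≤b ; 2q≤p = 2q≤p ; p≤r = ℤₚ.≮⇒≥ r≮p }

private
  reduced-bound : ∀ A B F P → 2 ℕ.* F ℕ.≤ A → A ℕ.≤ B → A ℕ.* B ≡ P ℕ.+ F ℕ.* F → 3 ℕ.* (A ℕ.* A) ℕ.≤ 4 ℕ.* P
  reduced-bound A B F P 2F≤A A≤B e = ℕₚ.+-cancelʳ-≤ (A ℕ.* A) _ _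
    (ℕₚ.≤-trans (ℕₚ.≤-reflexive (lem₁ (A ℕ.* A))) (ℕₚ.≤-trans (ℕₚ.*-monoʳ-≤ 4 (ℕₚ.*-monoʳ-≤ A A≤B)) (ℕₚ.≤-trans (ℕₚ.≤-reflexive (trans (cong (4 ℕ.*_) e) (lem₂ P F)))
      (ℕₚ.+-monoʳ-≤ (4 ℕ.* P) (ℕₚ.*-mono-≤ 2F≤A 2F≤A)))))
    where
    lem₁ : ∀ x → 3 ℕ.* x ℕ.+ x ≡ 4 ℕ.* x
    lem₁ = ℕSolver.solve-∀
    lem₂ : ∀ P F → 4 ℕ.* (P ℕ.+ F ℕ.* F) ≡ 4 ℕ.* P ℕ.+ 2 ℕ.* F ℕ.* (2 ℕ.* F)
    lem₂ = ℕSolver.solve-∀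

  leading≤1 : ∀ A P δ → 0 ℕ.< P → δ ℕ.≤ 3 → 3 ℕ.* (A ℕ.* A) ℕ.≤ 4 ℕ.* P → 3 ℕ.* (P ℕ.* P) ℕ.≤ 4 ℕ.* (A ℕ.* δ) → A ℕ.≤ 1
  leading≤1 A P δ 0<P δ≤3 h k = ℕₚ.≮⇒≥ λ 2≤A → ℕₚ.<⇒≱ (ℕₚ.≤-trans (3≤P 2≤A) ℕₚ.≤-refl) (ℕₚ.≤-pred (ℕₚ.*-cancelˡ-< 9 P 3 (ℕₚ.≤-<-trans (9P≤24 2≤A) (ℕₚ.m≤m+n 25 2))))
    where
    3≤P : 2 ℕ.≤ A → 3 ℕ.≤ P
    3≤P 2≤A = ℕₚ.*-cancelˡ-≤ {3} {P} 4 (ℕₚ.≤-trans (ℕₚ.*-monoʳ-≤ 3 (ℕₚ.*-mono-≤ 2≤A 2≤A)) h)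
    3A≤2P : 2 ℕ.≤ A → 3 ℕ.* A ℕ.≤ 2 ℕ.* P
    3A≤2P 2≤A = ℕₚ.*-cancelˡ-≤ 2 (ℕₚ.≤-trans (ℕₚ.≤-trans (ℕₚ.≤-reflexive (lem A)) (ℕₚ.*-monoʳ-≤ 3 (ℕₚ.*-monoˡ-≤ A 2≤A))) (ℕₚ.≤-trans h (ℕₚ.≤-reflexive (lem′ P))))
      where
      lem : ∀ A → 2 ℕ.* (3 ℕ.* A) ≡ 3 ℕ.* (2 ℕ.* A)
      lem = ℕSolver.solve-∀
      lem′ : ∀ P → 4 ℕ.* P ≡ 2 ℕ.* (2 ℕ.* P)
      lem′ = ℕSolver.solve-∀
    9P≤24 : 2 ℕ.≤ A → 9 ℕ.* P ℕ.≤ 24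
    9P≤24 2≤A = ℕₚ.*-cancelˡ-≤ P {{ℕ.>-nonZero 0<P}} (begin
      P ℕ.* (9 ℕ.* P)           ≡⟨ lem P ⟩
      3 ℕ.* (3 ℕ.* (P ℕ.* P))   ≤⟨ ℕₚ.*-monoʳ-≤ 3 k ⟩
      3 ℕ.* (4 ℕ.* (A ℕ.* δ))   ≡⟨ lem′ A δ ⟩
      4 ℕ.* δ ℕ.* (3 ℕ.* A)     ≤⟨ ℕₚ.*-mono-≤ (ℕₚ.*-monoʳ-≤ 4 δ≤3) (3A≤2P 2≤A) ⟩
      12 ℕ.* (2 ℕ.* P)          ≡⟨ lem″ P ⟩
      P ℕ.* 24                  ∎)
      where
      open ℕₚ.≤-Reasoning
      lem : ∀ P → P ℕ.* (9 ℕ.* P) ≡ 3 ℕ.* (3 ℕ.* (P ℕ.* P))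
      lem = ℕSolver.solve-∀
      lem′ : ∀ A δ → 3 ℕ.* (4 ℕ.* (A ℕ.* δ)) ≡ 4 ℕ.* δ ℕ.* (3 ℕ.* A)
      lem′ = ℕSolver.solve-∀
      lem″ : ∀ P → 12 ℕ.* (2 ℕ.* P) ≡ P ℕ.* 24
      lem″ = ℕSolver.solve-∀

  2F≤1⇒F≡0 : ∀ F → 2 ℕ.* F ℕ.≤ 1 → F ≡ 0
  2F≤1⇒F≡0 zero    _ = refl
  2F≤1⇒F≡0 (suc F) h = ⊥-elim (ℕₚ.<⇒≱ (ℕₚ.*-monoʳ-≤ 2 {1} {suc F} (s≤s z≤n)) h)

  to-ℕ : ∀ {x y p z} → 0ℤ < x → 0ℤ < y → 0ℤ < p → x * y ≡ p + z * z → abs x ℕ.* abs y ≡ abs p ℕ.+ abs z ℕ.* abs z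
  to-ℕ {x} {y} {p} {z} 0<x 0<y 0<p e = ℤₚ.+-injective (trans (ℤₚ.pos-* (abs x) (abs y)) (trans (cong₂ _*_ (+abs 0<x) (+abs 0<y)) (trans e (cong₂ _+_ (sym (+abs 0<p)) (square-abs z)))))
    where
    +abs : ∀ {x} → 0ℤ < x → + abs x ≡ x
    +abs (ℤ.+<+ _) = refl

  abs≡⇒ : ∀ {x n} → 0ℤ < x → abs x ≡ n → x ≡ + n
  abs≡⇒ (ℤ.+<+ _) refl = refl

  ≤⇒abs≤ : ∀ {x y} → 0ℤ < x → x ≤ y → abs x ℕ.≤ abs y
  ≤⇒abs≤ (ℤ.+<+ _) (+≤+ h) = h

record Diagonal (g : Ternary) (δ : ℕ) : Set where
  open Ternary g
  field
    a≡1 : a ≡ 1ℤ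
    f≡0 : f ≡ 0ℤ
    0<p : 0 ℕ.< abs p
    p≡  : p ≡ + abs p
    r≡  : r ≡ + abs r
    3p² : 3 ℕ.* (abs p ℕ.* abs p) ℕ.≤ 4 ℕ.* δ
    2q≤p : 2 ℕ.* abs q ℕ.≤ abs p
    p*r : abs p ℕ.* abs r ≡ δ ℕ.+ abs q ℕ.* abs q

diagonal : ∀ δ → 0 ℕ.< δ → δ ℕ.≤ 3 → ∀ g → Definite (+ δ) g → Reduced g → Diagonal g δ
diagonal δ 0<δ δ≤3 g@(ternary a b c d e f) D@(definite 0<a 0<p det≡) R = record
  { a≡1 = abs≡⇒ 0<a A≡1 ; f≡0 = ℤₚ.∣i∣≡0⇒i≡0 (2F≤1⇒F≡0 (abs f) (subst (2 ℕ.* abs f ℕ.≤_) A≡1 2f≤a))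
  ; 0<p = 0<abs 0<p ; p≡ = abs≡⇒ 0<p refl ; r≡ = abs≡⇒ 0<r′ refl
  ; 3p² = subst (λ A → 3 ℕ.* (abs p ℕ.* abs p) ℕ.≤ 4 ℕ.* A) (trans (cong (ℕ._* δ) A≡1) (ℕₚ.*-identityˡ δ)) 3P²≤
  ; 2q≤p = 2q≤p
  ; p*r = trans PR≡ (cong (ℕ._+ abs q ℕ.* abs q) (trans (cong (ℕ._* δ) A≡1) (ℕₚ.*-identityˡ δ))) }
  where
  open Ternary g using (p; q; r)
  open Reduced R
  0<abs : ∀ {x} → 0ℤ < x → 0 ℕ.< abs x
  0<abs (ℤ.+<+ h) = h
  0<r′ : 0ℤ < r
  0<r′ = 0<r (ℤ.+<+ 0<δ) g D
  3A²≤ : 3 ℕ.* (abs a ℕ.* abs a) ℕ.≤ 4 ℕ.* abs p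
  3A²≤ = reduced-bound (abs a) (abs b) (abs f) (abs p) 2f≤a (≤⇒abs≤ 0<a a≤b) (to-ℕ {a} {b} {p} {f} 0<a (0<b (ℤ.+<+ 0<δ) g D) 0<p (lem (a * b) (f * f)))
    where
    lem : ∀ x y → x ≡ x - y + y
    lem = solve-∀
  PR≡ : abs p ℕ.* abs r ≡ abs a ℕ.* δ ℕ.+ abs q ℕ.* abs q
  PR≡ = trans (to-ℕ {p} {r} {a * + δ} {q} 0<p 0<r′ (0<* 0<a (ℤ.+<+ 0<δ)) (trans (lem (p * r) (q * q)) (cong (_+ q * q) (trans (p*r-q² a b c d e f) (cong (a *_) det≡)))))
              (cong (ℕ._+ abs q ℕ.* abs q) (ℤₚ.abs-* a (+ δ)))
    where
    lem : ∀ x y → x ≡ x - y + y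
    lem = solve-∀
  3P²≤ : 3 ℕ.* (abs p ℕ.* abs p) ℕ.≤ 4 ℕ.* (abs a ℕ.* δ)
  3P²≤ = reduced-bound (abs p) (abs r) (abs q) (abs a ℕ.* δ) 2q≤p (≤⇒abs≤ 0<p p≤r) PR≡
  A≡1 : abs a ≡ 1
  A≡1 = ℕₚ.≤-antisym (leading≤1 (abs a) (abs p) δ (0<abs 0<p) δ≤3 3A²≤ 3P²≤) (0<abs 0<a)

complete-square : ∀ {g δ} → Diagonal g δ → ∀ x y z → value g x y z ≡ (x + Ternary.e g * z) * (x + Ternary.e g * z) + + abs (Ternary.p g) * (y * y) + + 2 * (Ternary.q g * (y * z)) + + abs (Ternary.r g) * (z * z)
complete-square {ternary a b c d e f} G x y z = trans (aux (Diagonal.a≡1 G) (Diagonal.f≡0 G))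
    (cong₂ (λ p r → (x + e * z) * (x + e * z) + p * (y * y) + + 2 * ((a * d - e * f) * (y * z)) + r * (z * z)) (Diagonal.p≡ G) (Diagonal.r≡ G))
  where
  aux : ∀ {a f} → a ≡ 1ℤ → f ≡ 0ℤ → a * (x * x) + b * (y * y) + c * (z * z) + + 2 * (d * (y * z) + e * (x * z) + f * (x * y))
      ≡ (x + e * z) * (x + e * z) + (a * b - f * f) * (y * y) + + 2 * ((a * d - e * f) * (y * z)) + (a * c - e * e) * (z * z)
  aux refl refl = lem b c d e x y z
    where
    lem : ∀ b c d e x y z → 1ℤ * (x * x) + b * (y * y) + c * (z * z) + + 2 * (d * (y * z) + e * (x * z) + 0ℤ * (x * y))
        ≡ (x + e * z) * (x + e * z) + (1ℤ * b - 0ℤ * 0ℤ) * (y * y) + + 2 * ((1ℤ * d - e * 0ℤ) * (y * z)) + (1ℤ * c - e * e) * (z * z)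
    lem = solve-∀

private
  small-p : ∀ P δ → 0 ℕ.< P → 3 ℕ.* (P ℕ.* P) ℕ.≤ 4 ℕ.* δ → δ ℕ.≤ 3 → P ≡ 1 ⊎ (P ≡ 2 × ¬ δ ℕ.≤ 1)
  small-p 1 δ _ _ _ = inj₁ refl
  small-p 2 δ _ h _ = inj₂ (refl , λ δ≤1 → ℕₚ.<⇒≱ (ℕₚ.≤-trans (ℕₚ.m≤m+n 5 7) h) (ℕₚ.*-monoʳ-≤ 4 δ≤1))
  small-p (suc (suc (suc P))) δ _ h δ≤3 = ⊥-elim (ℕₚ.<⇒≱ (ℕₚ.≤-trans (ℕₚ.m≤m+n 13 14) (ℕₚ.*-monoʳ-≤ 3 (ℕₚ.*-mono-≤ {3} {suc (suc (suc P))} (s≤s (s≤s (s≤s z≤n))) (s≤s (s≤s (s≤s z≤n)))))) (ℕₚ.≤-trans h (ℕₚ.*-monoʳ-≤ 4 δ≤3)))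

  p≡1⇒ : ∀ {g δ} (G : Diagonal g δ) → abs (Ternary.p g) ≡ 1 → ∀ x y z → ∃ λ u → value g x y z ≡ u * u + y * y + + δ * (z * z)
  p≡1⇒ {g} {δ} G P≡1 x y z = x + Ternary.e g * z , trans (complete-square G x y z) (aux (+ P) Q (+ Rr) (cong +_ P≡1) Q≡0 (cong +_ R≡δ))
    where
    P Rr : ℕ
    P = abs (Ternary.p g)
    Rr = abs (Ternary.r g)
    Q : ℤ
    Q = Ternary.q g
    Q≡0 : Q ≡ 0ℤ
    Q≡0 = ℤₚ.∣i∣≡0⇒i≡0 (2F≤1⇒F≡0 (abs Q) (subst (2 ℕ.* abs Q ℕ.≤_) P≡1 (Diagonal.2q≤p G)))
    R≡δ : Rr ≡ δ
    R≡δ = trans (sym (ℕₚ.*-identityˡ Rr)) (trans (cong (ℕ._* Rr) (sym P≡1)) (trans (Diagonal.p*r G) (trans (cong (λ q → δ ℕ.+ abs q ℕ.* abs q) Q≡0) (ℕₚ.+-identityʳ δ))))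
    aux : ∀ p q r → p ≡ 1ℤ → q ≡ 0ℤ → r ≡ + δ → (x + Ternary.e g * z) * (x + Ternary.e g * z) + p * (y * y) + + 2 * (q * (y * z)) + r * (z * z)
        ≡ (x + Ternary.e g * z) * (x + Ternary.e g * z) + y * y + + δ * (z * z)
    aux _ _ _ refl refl refl = lem ((x + Ternary.e g * z) * (x + Ternary.e g * z)) y z (+ δ * (z * z))
      where
      lem : ∀ s y z t → s + 1ℤ * (y * y) + + 2 * (0ℤ * (y * z)) + t ≡ s + y * y + t
      lem = solve-∀

opaque
  det-1⇒three-squares : ∀ g → Definite 1ℤ g → ∀ x y z → ∃ λ u → ∃ λ v → ∃ λ w → value g x y z ≡ u * u + v * v + w * w
  det-1⇒three-squares g D x y z = finish (reduction (ℤ.+<+ z<s) g D)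
    where
    finish : (∃ λ g′ → g ⇄ g′ × Definite 1ℤ g′ × Reduced g′) → ∃ λ u → ∃ λ v → ∃ λ w → value g x y z ≡ u * u + v * v + w * w
    finish (g′ , A , D′ , R) = aux (small-p _ 1 (Diagonal.0<p G) (Diagonal.3p² G) (s≤s z≤n)) (to A x y z)
      where
      G : Diagonal g′ 1
      G = diagonal 1 z<s (s≤s z≤n) g′ D′ R
      aux : abs (Ternary.p g′) ≡ 1 ⊎ (abs (Ternary.p g′) ≡ 2 × ¬ 1 ℕ.≤ 1) → (∃ λ x′ → ∃ λ y′ → ∃ λ z′ → value g′ x′ y′ z′ ≡ value g x y z) →
            ∃ λ u → ∃ λ v → ∃ λ w → value g x y z ≡ u * u + v * v + w * w
      aux (inj₁ P≡1) (x′ , y′ , z′ , e) = let u , e′ = p≡1⇒ G P≡1 x′ y′ z′ in u , y′ , z′ , trans (sym e) (trans e′ (cong (λ t → u * u + y′ * y′ + t) (ℤₚ.*-identityˡ (z′ * z′))))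
      aux (inj₂ (_ , h)) _ = ⊥-elim (h ℕₚ.≤-refl)

-- The other class of determinant 3, x² + 2 (y² + y z + z²), represents 6.
opaque
  det-3⇒ : ∀ g → Definite (+ 3) g → (∀ x y z → value g x y z ≢ + 6) → ∀ x y z → ∃ λ u → ∃ λ v → ∃ λ w → value g x y z ≡ u * u + v * v + + 3 * (w * w)
  det-3⇒ g D ≢6 x y z = finish (reduction (ℤ.+<+ z<s) g D)
    where
    finish : (∃ λ g′ → g ⇄ g′ × Definite (+ 3) g′ × Reduced g′) → ∃ λ u → ∃ λ v → ∃ λ w → value g x y z ≡ u * u + v * v + + 3 * (w * w)
    finish (g′ , A , D′ , R) = aux (small-p _ 3 (Diagonal.0<p G) (Diagonal.3p² G) ℕₚ.≤-refl) (to A x y z)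
      where
      G : Diagonal g′ 3
      G = diagonal 3 z<s ℕₚ.≤-refl g′ D′ R
      aux : abs (Ternary.p g′) ≡ 1 ⊎ (abs (Ternary.p g′) ≡ 2 × ¬ 3 ℕ.≤ 1) → (∃ λ x′ → ∃ λ y′ → ∃ λ z′ → value g′ x′ y′ z′ ≡ value g x y z) →
            ∃ λ u → ∃ λ v → ∃ λ w → value g x y z ≡ u * u + v * v + + 3 * (w * w)
      aux (inj₁ P≡1) (x′ , y′ , z′ , e) = let u , e′ = p≡1⇒ G P≡1 x′ y′ z′ in u , y′ , z′ , trans (sym e) e′
      aux (inj₂ (P≡2 , _)) _ = let x₀ , y₀ , z₀ , e = from A (+ 2) 1ℤ 0ℤ in ⊥-elim (≢6 x₀ y₀ z₀ (trans e (trans (complete-square G (+ 2) 1ℤ 0ℤ)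
          (trans (cong (λ P → (+ 2 + Ternary.e g′ * 0ℤ) * (+ 2 + Ternary.e g′ * 0ℤ) + + P * (1ℤ * 1ℤ) + + 2 * (Ternary.q g′ * (1ℤ * 0ℤ)) + + abs (Ternary.r g′) * (0ℤ * 0ℤ)) P≡2) (lem (Ternary.e g′) (Ternary.q g′) (+ abs (Ternary.r g′)))))))
        where
        lem : ∀ e q r → (+ 2 + e * 0ℤ) * (+ 2 + e * 0ℤ) + + 2 * (1ℤ * 1ℤ) + + 2 * (q * (1ℤ * 0ℤ)) + r * (0ℤ * 0ℤ) ≡ + 6
        lem = solve-∀

-- The form (a y² + 2 h y z + c z² + κ w²) / N of determinant e κ on the lattice w ≡ l y + l′ z (mod N),
-- where a c - h² = e N, κ l² ≡ -a and l′ ≡ l h / a (mod N).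
module Lattice (κ e N a : ℕ) (0<κ : 0 ℕ.< κ) (0<N : 0 ℕ.< N) (0<a : 0 ℕ.< a)
               (sqrt-a : Root (+ κ) (+ a) N) (sqrt-D : Root 1ℤ (+ e * + N) a) (cop : Coprime a N) where
  private
    l h c A a⁻¹ w l′ F B : ℤ
    l   = Root.value sqrt-a
    h   = Root.value sqrt-D
    c   = quotient (Root.holds sqrt-D)
    A   = quotient (Root.holds sqrt-a)
    a⁻¹ = proj₁ (inverse (+ a) cop)
    w   = quotient (proj₂ (inverse (+ a) cop))
    l′  = l * h * a⁻¹
    F   = A * h * a⁻¹ - w * h
    B   = A * (h * h) * (a⁻¹ * a⁻¹) + + a * + e * (a⁻¹ * a⁻¹) - c * (+ 2 * w + w * w * + N)

    AN : + κ * (l * l) + + a ≡ A * + N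
    AN = _∣_.equality (Root.holds sqrt-a)

    disc : h * h ≡ c * + a - + e * + N
    disc = trans (lem (h * h) (+ e * + N)) (cong (_- + e * + N) (_∣_.equality (Root.holds sqrt-D)))
      where
      lem : ∀ x y → x ≡ 1ℤ * x + y - y
      lem = solve-∀

    inv-law : + a * a⁻¹ ≡ 1ℤ + w * + N
    inv-law = trans (lem (+ a * a⁻¹)) (cong (λ z → 1ℤ + z) (_∣_.equality (proj₂ (inverse (+ a) cop))))
      where
      lem : ∀ x → x ≡ 1ℤ + (x - 1ℤ)
      lem = solve-∀

    κl² : + κ * (l * l) ≡ A * + N - + a
    κl² = trans (lem (+ κ * (l * l)) (+ a)) (cong (_- + a) AN)
      where
      lem : ∀ x y → x ≡ x + y - y
      lem = solve-∀

    FN : h + + κ * (l * l′) ≡ F * + N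
    FN = trans (lem₁ h (+ κ) l a⁻¹) (trans (cong (λ z → h + z * (h * a⁻¹)) κl²) (trans (lem₂ h A (+ N) (+ a) a⁻¹) (trans (cong (λ z → h + A * + N * h * a⁻¹ - z * h) inv-law) (lem₃ h A (+ N) a⁻¹ w))))
      where
      lem₁ : ∀ h κ l b → h + κ * (l * (l * h * b)) ≡ h + κ * (l * l) * (h * b)
      lem₁ = solve-∀
      lem₂ : ∀ h A N a b → h + (A * N - a) * (h * b) ≡ h + A * N * h * b - a * b * h
      lem₂ = solve-∀
      lem₃ : ∀ h A N b w → h + A * N * h * b - (1ℤ + w * N) * h ≡ (A * h * b - w * h) * N
      lem₃ = solve-∀

    BN : c + + κ * (l′ * l′) ≡ B * + N
    BN = trans (lem₁ c (+ κ) l h a⁻¹) (trans (cong (λ z → c + z * (h * h) * (a⁻¹ * a⁻¹)) κl²)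
        (trans (lem₂ c A (+ N) (h * h) a⁻¹ (+ a)) (trans (cong (λ z → c + A * + N * (h * h) * (a⁻¹ * a⁻¹) - + a * z * (a⁻¹ * a⁻¹)) disc)
        (trans (lem₃ c A (+ N) (h * h) a⁻¹ (+ a) (+ e)) (trans (cong (λ z → c + A * + N * (h * h) * (a⁻¹ * a⁻¹) - z * z * c + + a * + e * + N * (a⁻¹ * a⁻¹)) inv-law) (lem₄ c A (+ N) (h * h) (a⁻¹ * a⁻¹) (+ a * + e) w))))))
      where
      lem₁ : ∀ c κ l h b → c + κ * (l * h * b * (l * h * b)) ≡ c + κ * (l * l) * (h * h) * (b * b)
      lem₁ = solve-∀
      lem₂ : ∀ c A N H b a → c + (A * N - a) * H * (b * b) ≡ c + A * N * H * (b * b) - a * H * (b * b)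
      lem₂ = solve-∀
      lem₃ : ∀ c A N H b a e → c + A * N * H * (b * b) - a * (c * a - e * N) * (b * b) ≡ c + A * N * H * (b * b) - a * b * (a * b) * c + a * e * N * (b * b)
      lem₃ = solve-∀
      lem₄ : ∀ c A N H b e w → c + A * N * H * b - (1ℤ + w * N) * (1ℤ + w * N) * c + e * N * b ≡ (A * H * b + e * b - c * (+ 2 * w + w * w * N)) * N
      lem₄ = solve-∀

  lattice : Ternary
  lattice = ternary (+ κ * + N) A B F (+ κ * l′) (+ κ * l)

  private
    instance
      N≢0 : ℤ.NonZero (+ N)
      N≢0 = ℕ.>-nonZero 0<N

    det-lattice : det lattice ≡ + e * + κ
    det-lattice = ℤₚ.*-cancelʳ-≡ _ _ (+ N) (trans (lem₁ (+ κ) A B F l l′ (+ N)) (trans (substitute (sym AN) (sym BN) (sym FN))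
        (trans (lem₂ (+ κ) l l′ (+ a) c h) (trans (cong (λ z → + κ * (+ a * c - z)) disc) (lem₃ (+ κ) (+ a) c (+ e) (+ N))))))
      where
      formula : ℤ → ℤ → ℤ → ℤ
      formula x y z = + κ * (x * y - z * z) + + 2 * (+ κ * + κ * (l * l′) * z) - + κ * + κ * (l′ * l′) * x - + κ * + κ * (l * l) * y
      lem₁ : ∀ κ A B F l l′ N → (κ * N * A * B + + 2 * (F * (κ * l′) * (κ * l)) - κ * N * (F * F) - A * (κ * l′ * (κ * l′)) - B * (κ * l * (κ * l))) * N
           ≡ κ * (A * N * (B * N) - F * N * (F * N)) + + 2 * (κ * κ * (l * l′) * (F * N)) - κ * κ * (l′ * l′) * (A * N) - κ * κ * (l * l) * (B * N)
      lem₁ = solve-∀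
      substitute : ∀ {x x′ y y′ z z′} → x ≡ x′ → y ≡ y′ → z ≡ z′ → formula x y z ≡ formula x′ y′ z′
      substitute refl refl refl = refl
      lem₂ : ∀ κ l l′ a c h → κ * ((κ * (l * l) + a) * (c + κ * (l′ * l′)) - (h + κ * (l * l′)) * (h + κ * (l * l′))) + + 2 * (κ * κ * (l * l′) * (h + κ * (l * l′)))
             - κ * κ * (l′ * l′) * (κ * (l * l) + a) - κ * κ * (l * l) * (c + κ * (l′ * l′)) ≡ κ * (a * c - h * h)
      lem₂ = solve-∀
      lem₃ : ∀ κ a c e N → κ * (a * c - (c * a - e * N)) ≡ e * κ * N
      lem₃ = solve-∀

  lattice-definite : Definite (+ e * + κ) lattice
  lattice-definite = definite (0<* (ℤ.+<+ 0<κ) (ℤ.+<+ 0<N)) (subst (0ℤ <_) (trans (cong (+ κ *_) (trans (lem (+ a) (+ κ * (l * l))) (cong (_- + κ * (l * l)) AN))) (lem′ (+ κ) A (+ N) l)) (0<* (ℤ.+<+ 0<κ) (ℤ.+<+ 0<a))) det-lattice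
    where
    lem : ∀ a x → a ≡ x + a - x
    lem = solve-∀
    lem′ : ∀ κ A N l → κ * (A * N - κ * (l * l)) ≡ κ * N * A - κ * l * (κ * l)
    lem′ = solve-∀

  value-100 : value lattice 1ℤ 0ℤ 0ℤ ≡ + κ * + N
  value-100 = lem (+ κ * + N) A B F (+ κ * l′) (+ κ * l)
    where
    lem : ∀ a b c d e f → a * (1ℤ * 1ℤ) + b * (0ℤ * 0ℤ) + c * (0ℤ * 0ℤ) + + 2 * (d * (0ℤ * 0ℤ) + e * (1ℤ * 0ℤ) + f * (1ℤ * 0ℤ)) ≡ a
    lem = solve-∀

  -- Up to the factor a N, the form is  κ a W² + S² + e N z².
  value-diagonal : ∀ x y z → ∃ λ W → ∃ λ S → + a * (value lattice x y z * + N) ≡ + κ * + a * (W * W) + S * S + + e * + N * (z * z)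
  value-diagonal x y z = + N * x + l * y + l′ * z , + a * y + h * z ,
    trans (cong (+ a *_) (trans (lem₁ (+ κ) A B F l l′ (+ N) x y z) (substitute (sym AN) (sym BN) (sym FN))))
      (trans (lem₂ (+ κ) (+ a) c h l l′ (+ N) x y z) (trans (cong (λ H → + κ * + a * ((+ N * x + l * y + l′ * z) * (+ N * x + l * y + l′ * z)) + (+ a * y + h * z) * (+ a * y + h * z) + (c * + a - H) * (z * z)) disc)
        (lem₃ (+ κ * + a * ((+ N * x + l * y + l′ * z) * (+ N * x + l * y + l′ * z)) + (+ a * y + h * z) * (+ a * y + h * z)) (c * + a) (+ e * + N) (z * z))))
    where
    formula : ℤ → ℤ → ℤ → ℤ
    formula u v t = + κ * (+ N * x * (+ N * x)) + u * (y * y) + v * (z * z) + + 2 * (t * (y * z)) + + 2 * (+ κ * l′ * + N * (x * z)) + + 2 * (+ κ * l * + N * (x * y))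
    lem₁ : ∀ κ A B F l l′ N x y z → (κ * N * (x * x) + A * (y * y) + B * (z * z) + + 2 * (F * (y * z) + κ * l′ * (x * z) + κ * l * (x * y))) * N
         ≡ κ * (N * x * (N * x)) + A * N * (y * y) + B * N * (z * z) + + 2 * (F * N * (y * z)) + + 2 * (κ * l′ * N * (x * z)) + + 2 * (κ * l * N * (x * y))
    lem₁ = solve-∀
    substitute : ∀ {u u′ v v′ t t′} → u ≡ u′ → v ≡ v′ → t ≡ t′ → formula u v t ≡ formula u′ v′ t′
    substitute refl refl refl = refl
    lem₂ : ∀ κ a c h l l′ N x y z →
      a * (κ * (N * x * (N * x)) + (κ * (l * l) + a) * (y * y) + (c + κ * (l′ * l′)) * (z * z) + + 2 * ((h + κ * (l * l′)) * (y * z)) + + 2 * (κ * l′ * N * (x * z)) + + 2 * (κ * l * N * (x * y)))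
      ≡ κ * a * ((N * x + l * y + l′ * z) * (N * x + l * y + l′ * z)) + (a * y + h * z) * (a * y + h * z) + (c * a - h * h) * (z * z)
    lem₂ = solve-∀
    lem₃ : ∀ s c e z → s + (c - (c - e)) * z ≡ s + e * z
    lem₃ = solve-∀

opaque
  lattice-form : ∀ κ e N a → 0 ℕ.< κ → 0 ℕ.< N → 0 ℕ.< a → Root (+ κ) (+ a) N → Root 1ℤ (+ e * + N) a → Coprime a N →
                 ∃ λ g → Definite (+ e * + κ) g × value g 1ℤ 0ℤ 0ℤ ≡ + κ * + N ×
                   (∀ x y z → ∃ λ W → ∃ λ S → + a * (value g x y z * + N) ≡ + κ * + a * (W * W) + S * S + + e * + N * (z * z))
  lattice-form κ e N a 0<κ 0<N 0<a sqrt-a sqrt-D cop = lattice , lattice-definite , value-100 , value-diagonal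
    where open Lattice κ e N a 0<κ 0<N 0<a sqrt-a sqrt-D cop

-- Three ternary quadratic forms

record OddSquarefree (n : ℕ) : Set where
  field
    s      : ℕ
    halves : List ℕ
    factor : n ≡ s ℕ.* s ℕ.* prod halves
    primes : AllPrime halves
    unique : AllPairs _≢_ halves

∣-prod : ∀ Ps → All (λ P → odd P ℕᵈ.∣ prod Ps) Ps
∣-prod []       = []
∣-prod (P ∷ Ps) = ℕᵈ.divides (prod Ps) (ℕₚ.*-comm (odd P) (prod Ps)) ∷ All.map (ℕᵈ.∣n⇒∣m*n (odd P)) (∣-prod Ps)

odd-squarefree : ∀ n → 0 ℕ.< n → ¬ 2 ℕᵈ.∣ n → OddSquarefree n
odd-squarefree = prime-power-induction (λ n → ¬ 2 ℕᵈ.∣ n → OddSquarefree n)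
  (λ _ → record { s = 1 ; halves = [] ; factor = refl ; primes = [] ; unique = [] }) step
  where
  step : ∀ q v b → Prime q → 0 ℕ.< b → ¬ q ℕᵈ.∣ b → (¬ 2 ℕᵈ.∣ b → OddSquarefree b) → ¬ 2 ℕᵈ.∣ q ℕ.^ suc v ℕ.* b → OddSquarefree (q ℕ.^ suc v ℕ.* b)
  step q v b pr 0<b q∤b ih 2∤n = build (odd-or-2 pr) (parity (suc v)) refl refl
    where
    open OddSquarefree (ih λ d → 2∤n (ℕᵈ.∣n⇒∣m*n (q ℕ.^ suc v) d))
    build : ∀ {p w} → OddOr2 p → Parity w → p ≡ q → w ≡ suc v → OddSquarefree (q ℕ.^ suc v ℕ.* b)
    build is-2 _ refl _ = ⊥-elim (2∤n (ℕᵈ.∣m⇒∣m*n b (ℕᵈ.m∣m*n (2 ℕ.^ v))))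
    build (is-odd P) (even k) _ e = record
      { s = q ℕ.^ k ℕ.* s ; halves = halves ; primes = primes ; unique = unique
      ; factor = trans (cong₂ (λ w b → q ℕ.^ w ℕ.* b) (sym e) factor) (trans (cong (ℕ._* (s ℕ.* s ℕ.* prod halves)) (ℕₚ.^-distribˡ-+-* q k k)) (lem (q ℕ.^ k) s (prod halves))) }
      where
      lem : ∀ x s c → x ℕ.* x ℕ.* (s ℕ.* s ℕ.* c) ≡ x ℕ.* s ℕ.* (x ℕ.* s) ℕ.* c
      lem = ℕSolver.solve-∀
    build (is-odd P) (odd′ k) refl e = record
      { s = q ℕ.^ k ℕ.* s ; halves = P ∷ halves ; primes = pr ∷ primes ; unique = All.map new (∣-prod halves) ∷ unique
      ; factor = trans (cong₂ (λ w b → q ℕ.^ w ℕ.* b) (sym e) factor) (trans (cong (λ x → q ℕ.* x ℕ.* (s ℕ.* s ℕ.* prod halves)) (ℕₚ.^-distribˡ-+-* q k k)) (lem q (q ℕ.^ k) s (prod halves))) }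
      where
      lem : ∀ q x s c → q ℕ.* (x ℕ.* x) ℕ.* (s ℕ.* s ℕ.* c) ≡ x ℕ.* s ℕ.* (x ℕ.* s) ℕ.* (q ℕ.* c)
      lem = ℕSolver.solve-∀
      new : ∀ {Q} → odd Q ℕᵈ.∣ prod halves → P ≢ Q
      new d refl = q∤b (subst (q ℕᵈ.∣_) (sym factor) (ℕᵈ.∣n⇒∣m*n (s ℕ.* s) d))

root-local : ∀ P → Prime (odd P) → ∀ {κ a} → ¬ + odd P ∣ + κ → leg P (+ a) ≡ leg P (- + κ) → Root (+ κ) (+ a) (odd P)
root-local P pr {κ} {a} p∤κ e = root (x * k) (∣-resp (lem (+ κ) k x (+ a)) (ℤᵈ.∣m∣n⇒∣m-n (ℤᵈ.∣n⇒∣m*n (+ κ * k * k) (difference (proj₂ sq))) (ℤᵈ.∣m⇒∣m*n (+ a * (+ κ * k + 1ℤ)) (difference (proj₂ inv-κ)))))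
  where
  open Legendre P pr
  p∤-κ : ¬ + odd P ∣ - + κ
  p∤-κ d = p∤κ (∣-resp (ℤₚ.neg-involutive (+ κ)) (ℤᵈ.∣m⇒∣-m d))
  sq : ∃ λ x → x * x ≅ - + κ * + a
  sq = Squares.square-root P pr (trans (leg-* (- + κ) (+ a)) (trans (cong (leg P (- + κ) *_) e) (Unit-sq (leg-Unit p∤-κ))))
  inv-κ : ∃ λ k → + κ * k ≅ 1ℤ
  inv-κ = invert p∤κ
  x k : ℤ
  x = proj₁ sq
  k = proj₁ inv-κ
  lem : ∀ κ k x a → κ * k * k * (x * x - - κ * a) - (κ * k - 1ℤ) * (a * (κ * k + 1ℤ)) ≡ κ * (x * k * (x * k)) + a
  lem = solve-∀

module _ {κ a : ℕ} where
  root-prod : ∀ Ps → AllPrime Ps → AllPairs _≢_ Ps → All (λ P → ¬ + odd P ∣ + κ) Ps → All (λ P → leg P (+ a) ≡ leg P (- + κ)) Ps → Root (+ κ) (+ a) (prod Ps)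
  root-prod []       []         []       []       []       = root-1
  root-prod (P ∷ Ps) (pr ∷ prs) (d ∷ ds) (n ∷ ns) (e ∷ es) =
    root-* (Coprimality.sym (prime-coprime pr λ h → prime-∣-prod Ps prs pr h (All.map (λ {Q} P≢Q → ≢-sym (odd-distinct {P} {Q} P≢Q)) d)))
           (root-local P pr n e) (root-prod Ps prs ds ns es)

coprime-prod : ∀ {a} Ps → AllPrime Ps → All (λ P → leg P (+ a) ≢ 0ℤ) Ps → Coprime a (prod Ps)
coprime-prod     []       _          _        = λ { (_ , d∣1) → ℕᵈ.∣1⇒≡1 d∣1 }
coprime-prod {a} (P ∷ Ps) (pr ∷ prs) (e ∷ es) = coprime-* (prime-coprime pr λ d → e (leg-∣ {P} (ℤᵈ.∣ᵤ⇒∣ {+ odd P} {+ a} d))) (coprime-prod Ps prs es)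

Unit≢0 : ∀ {x} → Unit x → x ≢ 0ℤ
Unit≢0 pos ()
Unit≢0 neg ()

signs-* : ∀ {ε} (f : ℕ → ℤ) → f 1 ≡ 1ℤ → (∀ m n → f (m ℕ.* n) ≡ f m * f n) → ∀ Ps → All (λ P → ε P ≡ f (odd P)) Ps → signs ε Ps ≡ f (prod Ps)
signs-* f f1 f* []       []       = sym f1
signs-* f f1 f* (P ∷ Ps) (e ∷ es) = trans (cong₂ _*_ e (signs-* f f1 f* Ps es)) (sym (f* (odd P) (prod Ps)))

legs-* : ∀ {a} (f : ℕ → ℤ) → f 1 ≡ 1ℤ → (∀ m n → f (m ℕ.* n) ≡ f m * f n) → ∀ Ps → All (λ P → leg P a ≡ f (odd P)) Ps → legs Ps a ≡ f (prod Ps)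
legs-* f f1 f* []       []       = sym f1
legs-* f f1 f* (P ∷ Ps) (e ∷ es) = trans (cong₂ _*_ e (legs-* f f1 f* Ps es)) (sym (f* (odd P) (prod Ps)))

leg--2 : ∀ {P} → Prime (odd P) → leg P (- + 2) ≡ eight 1ℤ (odd P)
leg--2 {P} pr = trans (leg-* -1ℤ (+ 2)) (trans (cong₂ _*_ leg--1 (leg-2 P pr)) (sym (eight-plus P)))
  where open Legendre P pr

prime[3] : Prime 3
prime[3] = from-yes (ℙ.prime? 3)

leg--3 : ∀ {P} → Prime (odd P) → odd P ≢ 3 → leg P (- + 3) ≡ leg 1 (+ odd P)
leg--3 {P} pr p≢3 = trans (leg-* -1ℤ (+ 3)) (trans (cong₂ _*_ leg--1 (trans (leg-reciprocal 1 P prime[3] pr (≢-sym p≢3)) (cong (λ k → -1ℤ ^ k * leg 1 (+ odd P)) (ℕₚ.*-identityˡ P))))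
    (trans (sym (ℤₚ.*-assoc (-1ℤ ^ P) (-1ℤ ^ P) (leg 1 (+ odd P)))) (trans (cong (_* leg 1 (+ odd P)) (Unit-sq (-1^ P))) (ℤₚ.*-identityˡ _))))
  where open Legendre P pr

leg-3 : ∀ n → leg 1 (+ (1 ℕ.+ n ℕ.* 3)) ≡ 1ℤ
leg-3 n = trans (leg-≅ (mod (divides (+ n) (trans (lem (+ (n ℕ.* 3))) (ℤₚ.pos-* n 3))))) leg-1
  where
  open Legendre 1 prime[3]
  lem : ∀ x → 1ℤ + x - 1ℤ ≡ x
  lem = solve-∀

neg-∤ : ∀ {d x} → ¬ d ∣ x → ¬ d ∣ - x
neg-∤ {d} {x} h e = h (∣-resp (ℤₚ.neg-involutive x) (ℤᵈ.∣m⇒∣-m e))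

ThreeSquares Form133 Form113 : ℕ → Set
ThreeSquares n = ∃ λ x → ∃ λ y → ∃ λ z → + n ≡ x * x + y * y + z * z
Form133 n = ∃ λ x → ∃ λ y → ∃ λ z → + n ≡ x * x + + 3 * (y * y) + + 3 * (z * z)
Form113 n = ∃ λ x → ∃ λ y → ∃ λ z → + n ≡ x * x + y * y + + 3 * (z * z)

odd≢2 : ∀ P → odd P ≢ 2
odd≢2 (suc P) e with () ← trans (sym (ℕₚ.+-suc P P)) (ℕₚ.suc-injective (ℕₚ.suc-injective e))

odd-prod : ∀ t P₀ Ps → prod (P₀ ∷ Ps) ≡ t ℕ.* 8 ℕ.+ 3 → AllPrime (P₀ ∷ Ps) → AllPairs _≢_ (P₀ ∷ Ps) → ThreeSquares (prod (P₀ ∷ Ps))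
odd-prod t P₀ Ps N≡ prs@(_ ∷ prs′) uniq = finish (odd-genus P₀ Ps ε (t ℕ.* 2) prs uniq (All.map ε-unit prs′) (trans N≡ (lem t)) signs≡1)
  where
  N : ℕ
  N = prod (P₀ ∷ Ps)
  ε : ℕ → ℤ
  ε P = leg P (- + 2)
  lem : ∀ t → t ℕ.* 8 ℕ.+ 3 ≡ 3 ℕ.+ 4 ℕ.* (t ℕ.* 2)
  lem = ℕSolver.solve-∀
  ∤2 : ∀ {P} → Prime (odd P) → ¬ + odd P ∣ + 2
  ∤2 {P} pr = distinct-primes pr ℙ.prime[2] (odd≢2 P)
  ε-unit : ∀ {P} → Prime (odd P) → Unit (ε P)
  ε-unit {P} pr = Legendre.leg-Unit P pr (neg-∤ (∤2 {P} pr))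
  signs≡1 : signs ε (P₀ ∷ Ps) ≡ 1ℤ
  signs≡1 = trans (signs-* {ε} (eight 1ℤ) refl (eight-* pos) (P₀ ∷ Ps) (All.map (λ {P} → leg--2 {P}) prs)) (trans (cong (eight 1ℤ) N≡) (eight-period 1ℤ t 3))
  legs2 : legs (P₀ ∷ Ps) (+ 2) ≡ -1ℤ
  legs2 = trans (legs-* (eight -1ℤ) refl (eight-* neg) (P₀ ∷ Ps) (All.map (λ {P} pr → trans (leg-2 P pr) (sym (eight-minus P))) prs)) (trans (cong (eight -1ℤ) N≡) (eight-period -1ℤ t 3))
  finish : (Σ (BinaryForm (+ N) ε (P₀ ∷ Ps)) λ f → ∀ {r} → Prime r → r ℕᵈ.∣ BinaryForm.a f → legs (P₀ ∷ Ps) (+ r) ≡ 1ℤ) → ThreeSquares N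
  finish (f , split) = conclude (lattice-form 1 1 N (2 ℕ.* a) z<s (ℕ.>-nonZero⁻¹ N {{prod≢0 (P₀ ∷ Ps)}}) (ℕₚ.*-mono-≤ {1} {2} (s≤s z≤n) 0<a)
      (root-prod (P₀ ∷ Ps) prs uniq (All.map (λ {P} → ∤1 {P}) prs) chars″)
      (subst (λ D → Root 1ℤ D (2 ℕ.* a)) (sym (ℤₚ.*-identityˡ (+ N))) (root-* (Coprimality.sym (prime-coprime ℙ.prime[2] 2∤a)) (root-2 (+ N) 2∣1+N) sqrt))
      (coprime-prod (P₀ ∷ Ps) prs (All.map (λ { {P} (pr , e) → λ z → Unit≢0 (Legendre.leg-Unit P pr (neg-∤ (∤1 {P} pr))) (trans (sym e) z) }) (All.zip (prs , chars″)))))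
    where
    open BinaryForm f
    2∤a : ¬ 2 ℕᵈ.∣ a
    2∤a d = -1≢1 (trans (sym legs2) (split ℙ.prime[2] d))
      where
      -1≢1 : -1ℤ ≢ 1ℤ
      -1≢1 ()
    0<a : 0 ℕ.< a
    0<a = ℕₚ.n≢0⇒n>0 λ e → 2∤a (subst (2 ℕᵈ.∣_) (sym e) (2 ℕᵈ.∣0))
    chars′ : ∀ {P} → Prime (odd P) × leg P (+ a) ≡ ε P → leg P (+ (2 ℕ.* a)) ≡ leg P (- + 1)
    chars′ {P} (pr , e) = trans (cong (leg P) (ℤₚ.pos-* 2 a)) (trans (leg-* (+ 2) (+ a)) (trans (cong (leg P (+ 2) *_) (trans e (leg-* -1ℤ (+ 2)))) (cancel (leg P -1ℤ) (leg-Unit (∤2 {P} pr)))))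
      where
      open Legendre P pr using (leg-*; leg-Unit)
      cancel : ∀ m {x} → Unit x → x * (m * x) ≡ m
      cancel m {x} u = trans (lem′ m x) (trans (cong (_* m) (Unit-sq u)) (ℤₚ.*-identityˡ m))
        where
        lem′ : ∀ m x → x * (m * x) ≡ x * x * m
        lem′ = solve-∀
    chars″ : All (λ P → leg P (+ (2 ℕ.* a)) ≡ leg P (- + 1)) (P₀ ∷ Ps)
    chars″ = All.map (λ {P} → chars′ {P}) (All.zip (prs , chars))
    ∤1 : ∀ {P} → Prime (odd P) → ¬ + odd P ∣ + 1
    ∤1 {P} pr = Legendre.p∤1 P pr
    2∣1+N : + 2 ∣ 1ℤ + + N
    2∣1+N = divides (+ (t ℕ.* 4 ℕ.+ 2)) (trans (cong (λ k → + suc k) N≡) (trans (cong +_ (lem′ t)) (ℤₚ.pos-* (t ℕ.* 4 ℕ.+ 2) 2)))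
      where
      lem′ : ∀ t → suc (t ℕ.* 8 ℕ.+ 3) ≡ (t ℕ.* 4 ℕ.+ 2) ℕ.* 2
      lem′ = ℕSolver.solve-∀
    conclude : (∃ λ g → Definite 1ℤ g × value g 1ℤ 0ℤ 0ℤ ≡ + 1 * + N × (∀ x y z → ∃ λ W → ∃ λ S → + (2 ℕ.* a) * (value g x y z * + N) ≡ + 1 * + (2 ℕ.* a) * (W * W) + S * S + + 1 * + N * (z * z))) → ThreeSquares N
    conclude (g , D , val , _) = convert (det-1⇒three-squares g D 1ℤ 0ℤ 0ℤ)
      where
      convert : (∃ λ u → ∃ λ v → ∃ λ w → value g 1ℤ 0ℤ 0ℤ ≡ u * u + v * v + w * w) → ThreeSquares N
      convert (u , v , w , e) = u , v , w , trans (sym (trans val (ℤₚ.*-identityˡ (+ N)))) e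

data Mod3 (z : ℤ) : Set where
  zero : + 3 ∣ z → Mod3 z
  unit : + 3 ∣ z * z - 1ℤ → Mod3 z

mod-3 : ∀ z → Mod3 z
mod-3 z = aux (z ℤᵐ.%ℕ 3) {z ℤᵐ./ℕ 3} (ℤᵐ.n%ℕd<d z 3) (ℤᵐ.a≡a%ℕn+[a/ℕn]*n z 3)
  where
  aux : ∀ r {t} → r ℕ.< 3 → z ≡ + r + t * + 3 → Mod3 z
  aux 0 {t} _ refl = zero (divides t (ℤₚ.+-identityˡ (t * + 3)))
  aux 1 {t} _ refl = unit (divides (t * (+ 2 + t * + 3)) (lem t))
    where
    lem : ∀ t → (1ℤ + t * + 3) * (1ℤ + t * + 3) - 1ℤ ≡ t * (+ 2 + t * + 3) * + 3
    lem = solve-∀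
  aux 2 {t} _ refl = unit (divides (1ℤ + + 4 * t + + 3 * (t * t)) (lem t))
    where
    lem : ∀ t → (+ 2 + t * + 3) * (+ 2 + t * + 3) - 1ℤ ≡ (1ℤ + + 4 * t + + 3 * (t * t)) * + 3
    lem = solve-∀
  aux (suc (suc (suc r))) (s≤s (s≤s (s≤s ())))

3∤ : ∀ {n} → 0 ℕ.< n → n ℕ.< 3 → ¬ + 3 ∣ + n
3∤ 0<n n<3 d with refl ← small-∣⇒≡0 d n<3 = ℕₚ.<⇒≱ 0<n z≤n

sum-of-squares-mod-3 : ∀ {x y} → + 3 ∣ x * x + y * y → + 3 ∣ x × + 3 ∣ y
sum-of-squares-mod-3 {x} {y} d with mod-3 x | mod-3 y
... | zero a | zero b = a , b
... | zero a | unit b = ⊥-elim (3∤ {1} z<s (s<s z<s) (∣-resp (lem x y) (ℤᵈ.∣m∣n⇒∣m-n (ℤᵈ.∣m∣n⇒∣m-n d (ℤᵈ.∣m⇒∣m*n x a)) b)))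
  where
  lem : ∀ x y → x * x + y * y - x * x - (y * y - 1ℤ) ≡ 1ℤ
  lem = solve-∀
... | unit a | zero b = ⊥-elim (3∤ {1} z<s (s<s z<s) (∣-resp (lem x y) (ℤᵈ.∣m∣n⇒∣m-n (ℤᵈ.∣m∣n⇒∣m-n d (ℤᵈ.∣m⇒∣m*n y b)) a)))
  where
  lem : ∀ x y → x * x + y * y - y * y - (x * x - 1ℤ) ≡ 1ℤ
  lem = solve-∀
... | unit a | unit b = ⊥-elim (3∤ {2} z<s (s<s (s<s z<s)) (∣-resp (lem x y) (ℤᵈ.∣m∣n⇒∣m-n (ℤᵈ.∣m∣n⇒∣m-n d a) b)))
  where
  lem : ∀ x y → x * x + y * y - (x * x - 1ℤ) - (y * y - 1ℤ) ≡ + 2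
  lem = solve-∀

1mod3 : ℤ → Set
1mod3 x = + 3 ∣ x - 1ℤ

1mod3⇒∤ : ∀ {x} → 1mod3 x → ¬ + 3 ∣ x
1mod3⇒∤ {x} d e = 3∤ {1} z<s (s<s z<s) (∣-resp (lem x) (ℤᵈ.∣m∣n⇒∣m-n e d))
  where
  lem : ∀ x → x - (x - 1ℤ) ≡ 1ℤ
  lem = solve-∀

twice-nonsquare : ∀ {x} z → 1mod3 x → ¬ + 3 ∣ + 2 * x - z * z
twice-nonsquare {x} z d e with mod-3 z
... | zero a = 3∤ {2} z<s (s<s (s<s z<s)) (∣-resp (lem x z) (ℤᵈ.∣m∣n⇒∣m-n (ℤᵈ.∣m∣n⇒∣m+n e (ℤᵈ.∣m⇒∣m*n z a)) (ℤᵈ.∣n⇒∣m*n (+ 2) d)))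
  where
  lem : ∀ x z → + 2 * x - z * z + z * z - + 2 * (x - 1ℤ) ≡ + 2
  lem = solve-∀
... | unit a = 3∤ {1} z<s (s<s z<s) (∣-resp (lem x z) (ℤᵈ.∣m∣n⇒∣m-n (ℤᵈ.∣m∣n⇒∣m+n e a) (ℤᵈ.∣n⇒∣m*n (+ 2) d)))
  where
  lem : ∀ x z → + 2 * x - z * z + (z * z - 1ℤ) - + 2 * (x - 1ℤ) ≡ 1ℤ
  lem = solve-∀

-1-nonsquare : ∀ {x} z → 1mod3 x → ¬ + 3 ∣ z * z + x
-1-nonsquare {x} z d e with mod-3 z
... | zero a = 3∤ {1} z<s (s<s z<s) (∣-resp (lem x z) (ℤᵈ.∣m∣n⇒∣m-n (ℤᵈ.∣m∣n⇒∣m-n e (ℤᵈ.∣m⇒∣m*n z a)) d))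
  where
  lem : ∀ x z → z * z + x - z * z - (x - 1ℤ) ≡ 1ℤ
  lem = solve-∀
... | unit a = 3∤ {2} z<s (s<s (s<s z<s)) (∣-resp (lem x z) (ℤᵈ.∣m∣n⇒∣m-n (ℤᵈ.∣m∣n⇒∣m-n e a) d))
  where
  lem : ∀ x z → z * z + x - (z * z - 1ℤ) - (x - 1ℤ) ≡ + 2
  lem = solve-∀

3∣* : ∀ {x y} → + 3 ∣ x * y → ¬ + 3 ∣ x → + 3 ∣ y
3∣* {x} {y} d n with prime∣*⇒ {3} {x} {y} prime[3] d
... | inj₁ e = ⊥-elim (n e)
... | inj₂ e = e

-- Neither lattice represents 6: the form is anisotropic modulo 3.
no-six₁₃ : ∀ {a N c} h S W z → 1mod3 N → h * h ≡ c * a - N → ¬ a * (+ 6 * N) ≡ + 3 * a * (W * W) + S * S + N * (z * z)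
no-six₁₃ {a} {N} {c} h S W z N≡1 disc e = twice-nonsquare {N} W N≡1 (3∣* {a} {+ 2 * N - W * W} (final (proj₁ both) (proj₂ both)) 3∤a)
  where
  3∤a : ¬ + 3 ∣ a
  3∤a d = -1-nonsquare {N} h N≡1 (∣-resp (trans (lem c a N) (cong (_+ N) (sym disc))) (ℤᵈ.∣n⇒∣m*n c d))
    where
    lem : ∀ c a N → c * a ≡ c * a - N + N
    lem = solve-∀
  both : + 3 ∣ S × + 3 ∣ z
  both = sum-of-squares-mod-3 {S} {z} (∣-resp (trans (cong (λ L → L - + 3 * a * (W * W) - (N - 1ℤ) * (z * z)) e) (lem a W S N z))
    (ℤᵈ.∣m∣n⇒∣m-n (ℤᵈ.∣m∣n⇒∣m-n {+ 3} {a * (+ 6 * N)} (divides (+ 2 * a * N) (lem₁ a N)) (divides (a * (W * W)) (lem₂ a (W * W)))) (ℤᵈ.∣m⇒∣m*n (z * z) N≡1)))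
    where
    lem : ∀ a W S N z → + 3 * a * (W * W) + S * S + N * (z * z) - + 3 * a * (W * W) - (N - 1ℤ) * (z * z) ≡ S * S + z * z
    lem = solve-∀
    lem₁ : ∀ a N → a * (+ 6 * N) ≡ + 2 * a * N * + 3
    lem₁ = solve-∀
    lem₂ : ∀ a w → + 3 * a * w ≡ a * w * + 3
    lem₂ = solve-∀
  final : + 3 ∣ S → + 3 ∣ z → + 3 ∣ a * (+ 2 * N - W * W)
  final (divides s refl) (divides y refl) = divides (s * s + N * (y * y)) (ℤₚ.*-cancelʳ-≡ _ _ (+ 3) (trans (lem a N (W * W)) (trans (cong (_- + 3 * a * (W * W)) e) (lem′ a (W * W) s N y))))
    where
    lem : ∀ a N w → a * (+ 2 * N - w) * + 3 ≡ a * (+ 6 * N) - + 3 * a * w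
    lem = solve-∀
    lem′ : ∀ a w s N y → + 3 * a * w + s * + 3 * (s * + 3) + N * (y * + 3 * (y * + 3)) - + 3 * a * w ≡ (s * s + N * (y * y)) * + 3 * + 3
    lem′ = solve-∀

no-six₃₁ : ∀ {a N} S W z → 1mod3 a → 1mod3 N → ¬ a * (+ 6 * N) ≡ a * (W * W) + S * S + + 3 * N * (z * z)
no-six₃₁ {a} {N} S W z a≡1 N≡1 e = twice-nonsquare {a} z a≡1 (3∣* {N} {+ 2 * a - z * z} (final (proj₁ both) (proj₂ both)) (1mod3⇒∤ {N} N≡1))
  where
  both : + 3 ∣ W × + 3 ∣ S
  both = sum-of-squares-mod-3 {W} {S} (∣-resp (trans (cong (λ L → L - + 3 * N * (z * z) - (a - 1ℤ) * (W * W)) e) (lem a W S N z))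
    (ℤᵈ.∣m∣n⇒∣m-n (ℤᵈ.∣m∣n⇒∣m-n {+ 3} {a * (+ 6 * N)} (divides (+ 2 * a * N) (lem₁ a N)) (divides (N * (z * z)) (lem₂ N (z * z)))) (ℤᵈ.∣m⇒∣m*n (W * W) a≡1)))
    where
    lem : ∀ a W S N z → a * (W * W) + S * S + + 3 * N * (z * z) - + 3 * N * (z * z) - (a - 1ℤ) * (W * W) ≡ W * W + S * S
    lem = solve-∀
    lem₁ : ∀ a N → a * (+ 6 * N) ≡ + 2 * a * N * + 3
    lem₁ = solve-∀
    lem₂ : ∀ a w → + 3 * a * w ≡ a * w * + 3
    lem₂ = solve-∀
  final : + 3 ∣ W → + 3 ∣ S → + 3 ∣ N * (+ 2 * a - z * z)
  final (divides w refl) (divides s refl) = divides (a * (w * w) + s * s) (ℤₚ.*-cancelʳ-≡ _ _ (+ 3) (trans (lem a N (z * z)) (trans (cong (_- + 3 * N * (z * z)) e) (lem′ a w s N (z * z)))))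
    where
    lem : ∀ a N w → N * (+ 2 * a - w) * + 3 ≡ a * (+ 6 * N) - + 3 * N * w
    lem = solve-∀
    lem′ : ∀ a w s N y → a * (w * + 3 * (w * + 3)) + s * + 3 * (s * + 3) + + 3 * N * y - + 3 * N * y ≡ (a * (w * w) + s * s) * + 3 * + 3
    lem′ = solve-∀

form-133 : ∀ {N u v w} → + 3 * + N ≡ u * u + v * v + + 3 * (w * w) → Form133 N
form-133 {N} {u} {v} {w} e = aux (proj₁ both) (proj₂ both)
  where
  both : + 3 ∣ u × + 3 ∣ v
  both = sum-of-squares-mod-3 {u} {v} (divides (+ N - w * w) (trans (lem (u * u + v * v) (w * w)) (trans (cong (_- + 3 * (w * w)) (sym e)) (lem′ (+ N) (w * w)))))
    where
    lem : ∀ s w → s ≡ s + + 3 * w - + 3 * w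
    lem = solve-∀
    lem′ : ∀ N w → + 3 * N - + 3 * w ≡ (N - w) * + 3
    lem′ = solve-∀
  aux : + 3 ∣ u → + 3 ∣ v → Form133 N
  aux (divides x refl) (divides y refl) = w , x , y , ℤₚ.*-cancelˡ-≡ (+ 3) _ _ (trans e (lem x y w))
    where
    lem : ∀ x y w → x * + 3 * (x * + 3) + y * + 3 * (y * + 3) + + 3 * (w * w) ≡ + 3 * (w * w + + 3 * (x * x) + + 3 * (y * y))
    lem = solve-∀

form-133-from : ∀ N a → 0 ℕ.< N → 0 ℕ.< a → 1mod3 (+ N) → Root (+ 3) (+ a) N → Root 1ℤ (+ N) a → Coprime a N → Form133 N
form-133-from N a 0<N 0<a N≡1 rt sqrt cop = conclude (lattice-form 3 1 N a z<s 0<N 0<a rt (subst (λ D → Root 1ℤ D a) (sym (ℤₚ.*-identityˡ (+ N))) sqrt) cop)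
  where
  disc : Root.value sqrt * Root.value sqrt ≡ quotient (Root.holds sqrt) * + a - + N
  disc = trans (lem (Root.value sqrt) (+ N)) (cong (_- + N) (_∣_.equality (Root.holds sqrt)))
    where
    lem : ∀ h N → h * h ≡ 1ℤ * (h * h) + N - N
    lem = solve-∀
  conclude : (∃ λ g → Definite (+ 3) g × value g 1ℤ 0ℤ 0ℤ ≡ + 3 * + N × (∀ x y z → ∃ λ W → ∃ λ S → + a * (value g x y z * + N) ≡ + 3 * + a * (W * W) + S * S + + 1 * + N * (z * z))) → Form133 N
  conclude (g , D , val , diag) = convert (det-3⇒ g D (λ x y z → ≢6 x y z (diag x y z)) 1ℤ 0ℤ 0ℤ)
    where
    ≢6 : ∀ x y z → (∃ λ W → ∃ λ S → + a * (value g x y z * + N) ≡ + 3 * + a * (W * W) + S * S + + 1 * + N * (z * z)) → value g x y z ≢ + 6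
    ≢6 x y z (W , S , d) e = no-six₁₃ {+ a} {+ N} {quotient (Root.holds sqrt)} (Root.value sqrt) S W z N≡1 disc
      (trans (cong (λ V → + a * (V * + N)) (sym e)) (trans d (cong (λ n → + 3 * + a * (W * W) + S * S + n * (z * z)) (ℤₚ.*-identityˡ (+ N)))))
    convert : (∃ λ u → ∃ λ v → ∃ λ w → value g 1ℤ 0ℤ 0ℤ ≡ u * u + v * v + + 3 * (w * w)) → Form133 N
    convert (u , v , w , e) = form-133 {N} {u} {v} {w} (trans (sym val) e)

form-113-from : ∀ N a → 0 ℕ.< N → 0 ℕ.< a → 1mod3 (+ N) → 1mod3 (+ a) → Root (+ 1) (+ a) N → Root 1ℤ (+ 3 * + N) a → Coprime a N → Form113 N
form-113-from N a 0<N 0<a N≡1 a≡1 rt sqrt cop = conclude (lattice-form 1 3 N a z<s 0<N 0<a rt sqrt cop)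
  where
  conclude : (∃ λ g → Definite (+ 3) g × value g 1ℤ 0ℤ 0ℤ ≡ + 1 * + N × (∀ x y z → ∃ λ W → ∃ λ S → + a * (value g x y z * + N) ≡ + 1 * + a * (W * W) + S * S + + 3 * + N * (z * z))) → Form113 N
  conclude (g , D , val , diag) = convert (det-3⇒ g D (λ x y z → ≢6 x y z (diag x y z)) 1ℤ 0ℤ 0ℤ)
    where
    ≢6 : ∀ x y z → (∃ λ W → ∃ λ S → + a * (value g x y z * + N) ≡ + 1 * + a * (W * W) + S * S + + 3 * + N * (z * z)) → value g x y z ≢ + 6
    ≢6 x y z (W , S , d) e = no-six₃₁ {+ a} {+ N} S W z a≡1 N≡1
      (trans (cong (λ V → + a * (V * + N)) (sym e)) (trans d (cong (λ n → n * (W * W) + S * S + + 3 * + N * (z * z)) (ℤₚ.*-identityˡ (+ a)))))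
    convert : (∃ λ u → ∃ λ v → ∃ λ w → value g 1ℤ 0ℤ 0ℤ ≡ u * u + v * v + + 3 * (w * w)) → Form113 N
    convert (u , v , w , e) = u , v , w , trans (sym (trans val (ℤₚ.*-identityˡ (+ N)))) e

scale : ∀ s {m n} (f : ℤ → ℤ → ℤ → ℤ) → (∀ t x y z → + t * + t * f x y z ≡ f (+ t * x) (+ t * y) (+ t * z)) → n ≡ s ℕ.* s ℕ.* m →
        (∃ λ x → ∃ λ y → ∃ λ z → + m ≡ f x y z) → ∃ λ x → ∃ λ y → ∃ λ z → + n ≡ f x y z
scale s {m} f homogeneous e (x , y , z , m≡) = + s * x , + s * y , + s * z ,
  trans (cong +_ e) (trans (ℤₚ.pos-* (s ℕ.* s) m) (trans (cong₂ _*_ (ℤₚ.pos-* s s) m≡) (homogeneous s x y z)))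

UnitSquares24 : Set
UnitSquares24 = ∀ (i j : Fin 24) → ¬ 2 ℕᵈ.∣ Fin.toℕ i → ¬ 3 ℕᵈ.∣ Fin.toℕ i → (Fin.toℕ i ℕ.* Fin.toℕ i ℕ.* Fin.toℕ j) ℕ.% 24 ≡ Fin.toℕ j

unit-squares-24? : Dec UnitSquares24
unit-squares-24? = Finₚ.all? λ i → Finₚ.all? λ j → ¬? (2 ℕᵈ.∣? Fin.toℕ i) →-dec (¬? (3 ℕᵈ.∣? Fin.toℕ i) →-dec ((Fin.toℕ i ℕ.* Fin.toℕ i ℕ.* Fin.toℕ j) ℕ.% 24 ℕ.≟ Fin.toℕ j))

unit-squares-24 : UnitSquares24
unit-squares-24 = from-yes unit-squares-24?

core-mod-24 : ∀ s m → ¬ 2 ℕᵈ.∣ s → ¬ 3 ℕᵈ.∣ s → (s ℕ.* s ℕ.* m) ℕ.% 24 ≡ m ℕ.% 24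
core-mod-24 s m 2∤s 3∤s = begin
  (s ℕ.* s ℕ.* m) ℕ.% 24 ≡⟨ ℕᵐ.%-distribˡ-* (s ℕ.* s) m 24 ⟩
  ((s ℕ.* s) ℕ.% 24 ℕ.* (m ℕ.% 24)) ℕ.% 24 ≡⟨ cong (λ k → (k ℕ.* (m ℕ.% 24)) ℕ.% 24) (ℕᵐ.%-distribˡ-* s s 24) ⟩
  ((r ℕ.* r) ℕ.% 24 ℕ.* (m ℕ.% 24)) ℕ.% 24 ≡⟨ cong (λ k → ((r ℕ.* r) ℕ.% 24 ℕ.* k) ℕ.% 24) (sym (ℕᵐ.m%n%n≡m%n m 24)) ⟩
  ((r ℕ.* r) ℕ.% 24 ℕ.* (m ℕ.% 24 ℕ.% 24)) ℕ.% 24 ≡⟨ sym (ℕᵐ.%-distribˡ-* (r ℕ.* r) (m ℕ.% 24) 24) ⟩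
  (r ℕ.* r ℕ.* (m ℕ.% 24)) ℕ.% 24 ≡⟨ cong₂ (λ x y → (x ℕ.* x ℕ.* y) ℕ.% 24) (sym i≡) (sym j≡) ⟩
  (Fin.toℕ i ℕ.* Fin.toℕ i ℕ.* Fin.toℕ j) ℕ.% 24 ≡⟨ unit-squares-24 i j (λ d → 2∤s (divides-s 12 2 (subst (2 ℕᵈ.∣_) i≡ d))) (λ d → 3∤s (divides-s 8 3 (subst (3 ℕᵈ.∣_) i≡ d))) ⟩
  Fin.toℕ j ≡⟨ j≡ ⟩
  m ℕ.% 24 ∎
  where
  open ≡-Reasoning
  r : ℕ
  r = s ℕ.% 24
  i j : Fin 24
  i = Fin.fromℕ< (ℕᵐ.m%n<n s 24)
  j = Fin.fromℕ< (ℕᵐ.m%n<n m 24)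
  i≡ : Fin.toℕ i ≡ r
  i≡ = Finₚ.toℕ-fromℕ< (ℕᵐ.m%n<n s 24)
  j≡ : Fin.toℕ j ≡ m ℕ.% 24
  j≡ = Finₚ.toℕ-fromℕ< (ℕᵐ.m%n<n m 24)
  divides-s : ∀ k d → .{{_ : NonZero (k ℕ.* d)}} → d ℕᵈ.∣ s ℕ.% (k ℕ.* d) → d ℕᵈ.∣ s
  divides-s k d h = subst (d ℕᵈ.∣_) (sym (ℕᵐ.m≡m%n+[m/n]*n s (k ℕ.* d))) (ℕᵈ.∣m∣n⇒∣m+n h (ℕᵈ.∣n⇒∣m*n (s ℕ./ (k ℕ.* d)) (ℕᵈ.divides k refl)))

from-residue : ∀ {n r} → n ℕ.% 24 ≡ r → ∃ λ t → n ≡ r ℕ.+ t ℕ.* 24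
from-residue {n} refl = n ℕ./ 24 , ℕᵐ.m≡m%n+[m/n]*n n 24

record Core24 (n r : ℕ) : Set where
  field
    s      : ℕ
    halves : List ℕ
    factor : n ≡ s ℕ.* s ℕ.* prod halves
    primes : AllPrime halves
    unique : AllPairs _≢_ halves
    class  : prod halves ℕ.% 24 ≡ r

core-24 : ∀ n r → n ℕ.% 24 ≡ r → ¬ 2 ℕᵈ.∣ r → ¬ 3 ℕᵈ.∣ r → Core24 n r
core-24 n r e 2∤r 3∤r = record { s = s ; halves = halves ; factor = factor ; primes = primes ; unique = unique
  ; class = trans (sym (core-mod-24 s (prod halves) (∤s 2∤n) (∤s 3∤n))) (trans (cong (ℕ._% 24) (sym factor)) e) }
  where
  2∤n : ¬ 2 ℕᵈ.∣ n
  2∤n d = 2∤r (subst (2 ℕᵈ.∣_) e (ℕᵈ.%-presˡ-∣ d (ℕᵈ.divides 12 refl)))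
  3∤n : ¬ 3 ℕᵈ.∣ n
  3∤n d = 3∤r (subst (3 ℕᵈ.∣_) e (ℕᵈ.%-presˡ-∣ d (ℕᵈ.divides 8 refl)))
  open OddSquarefree (odd-squarefree n (ℕₚ.n≢0⇒n>0 λ n≡0 → 2∤n (subst (2 ℕᵈ.∣_) (sym n≡0) (2 ℕᵈ.∣0))) 2∤n)
  ∤s : ∀ {d} → ¬ d ℕᵈ.∣ n → ¬ d ℕᵈ.∣ s
  ∤s {d} h k = h (subst (d ℕᵈ.∣_) (sym factor) (ℕᵈ.∣m⇒∣m*n (prod halves) (ℕᵈ.∣m⇒∣m*n s k)))

three-squares : ∀ n → n ℕ.% 24 ≡ 19 → ThreeSquares n
three-squares n e = scale s (λ x y z → x * x + y * y + z * z) homogeneous factor (core halves primes unique class)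
  where
  open Core24 (core-24 n 19 e (from-no (2 ℕᵈ.∣? 19)) (from-no (3 ℕᵈ.∣? 19)))
  homogeneous : ∀ t x y z → + t * + t * (x * x + y * y + z * z) ≡ + t * x * (+ t * x) + + t * y * (+ t * y) + + t * z * (+ t * z)
  homogeneous t = lem (+ t)
    where
    lem : ∀ t x y z → t * t * (x * x + y * y + z * z) ≡ t * x * (t * x) + t * y * (t * y) + t * z * (t * z)
    lem = solve-∀
  core : ∀ Ps → AllPrime Ps → AllPairs _≢_ Ps → prod Ps ℕ.% 24 ≡ 19 → ThreeSquares (prod Ps)
  core []        prs uniq ()
  core (P₀ ∷ Ps) prs uniq c = let t , N≡ = from-residue c in odd-prod (t ℕ.* 3 ℕ.+ 2) P₀ Ps (trans N≡ (lem t)) prs uniq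
    where
    lem : ∀ t → 19 ℕ.+ t ℕ.* 24 ≡ (t ℕ.* 3 ℕ.+ 2) ℕ.* 8 ℕ.+ 3
    lem = ℕSolver.solve-∀

homogeneous-133 : ∀ t x y z → + t * + t * (x * x + + 3 * (y * y) + + 3 * (z * z)) ≡ + t * x * (+ t * x) + + 3 * (+ t * y * (+ t * y)) + + 3 * (+ t * z * (+ t * z))
homogeneous-133 t = lem (+ t)
  where
  lem : ∀ t x y z → t * t * (x * x + + 3 * (y * y) + + 3 * (z * z)) ≡ t * x * (t * x) + + 3 * (t * y * (t * y)) + + 3 * (t * z * (t * z))
  lem = solve-∀

∤⇒odd≢3 : ∀ Ps → ¬ 3 ℕᵈ.∣ prod Ps → All (λ P → odd P ≢ 3) Ps
∤⇒odd≢3 Ps 3∤ = All.map (λ {P} d e → 3∤ (subst (ℕᵈ._∣ prod Ps) e d)) (∣-prod Ps)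

∤3 : ∀ {P} → Prime (odd P) × odd P ≢ 3 → ¬ + odd P ∣ + 3
∤3 (pr , ne) = distinct-primes pr prime[3] ne

chars-unit : ∀ {P e} → Prime (odd P) × odd P ≢ e → Prime e → Unit (leg P (- + e))
chars-unit {P} (pr , ne) er = Legendre.leg-Unit P pr (neg-∤ (distinct-primes pr er ne))

nonzero-leg : ∀ {P a} → leg P (+ a) ≢ 0ℤ → 0 ℕ.< a
nonzero-leg {P} {zero}  h = ⊥-elim (h (leg-∣ {P} (divides 0ℤ (sym (ℤₚ.*-zeroˡ (+ odd P))))))
nonzero-leg {P} {suc a} h = z<s

module _ (Ps : List ℕ) (prs : AllPrime Ps) (uniq : AllPairs _≢_ Ps) (3∤N : ¬ 3 ℕᵈ.∣ prod Ps) where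
  prs≢3 : All (λ P → Prime (odd P) × odd P ≢ 3) Ps
  prs≢3 = All.zip (prs , ∤⇒odd≢3 Ps 3∤N)

  units-3 : All (λ P → Unit (leg P (- + 3))) Ps
  units-3 = All.map (λ {P} h → chars-unit {P} h prime[3]) prs≢3

  root-3 : ∀ {a} → All (λ P → leg P (+ a) ≡ leg P (- + 3)) Ps → Root (+ 3) (+ a) (prod Ps)
  root-3 chars = root-prod Ps prs uniq (All.map (λ {P} → ∤3 {P}) prs≢3) chars

  coprime-3 : ∀ {a} → All (λ P → leg P (+ a) ≡ leg P (- + 3)) Ps → Coprime a (prod Ps)
  coprime-3 chars = coprime-prod Ps prs (All.map (λ { (u , e) z → Unit≢0 u (trans (sym e) z) }) (All.zip (units-3 , chars)))

odd-133 : ∀ Ps → AllPrime Ps → AllPairs _≢_ Ps → prod Ps ℕ.% 24 ≡ 7 → Form133 (prod Ps)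
odd-133 []        prs uniq ()
odd-133 (P₀ ∷ Ps) prs uniq c = finish (odd-genus P₀ Ps ε (t ℕ.* 6 ℕ.+ 1) prs uniq (All.tail (units-3 (P₀ ∷ Ps) prs uniq 3∤N)) (trans N≡ (lem t)) signs≡1)
  where
  N t : ℕ
  N = prod (P₀ ∷ Ps)
  t = proj₁ (from-residue {N} c)
  N≡ : N ≡ 7 ℕ.+ t ℕ.* 24
  N≡ = proj₂ (from-residue {N} c)
  ε : ℕ → ℤ
  ε P = leg P (- + 3)
  3∤N : ¬ 3 ℕᵈ.∣ N
  3∤N d = from-no (3 ℕᵈ.∣? 7) (subst (3 ℕᵈ.∣_) c (ℕᵈ.%-presˡ-∣ d (ℕᵈ.divides 8 refl)))
  lem : ∀ t → 7 ℕ.+ t ℕ.* 24 ≡ 3 ℕ.+ 4 ℕ.* (t ℕ.* 6 ℕ.+ 1)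
  lem = ℕSolver.solve-∀
  lem₃ : ∀ t → 7 ℕ.+ t ℕ.* 24 ≡ 1 ℕ.+ (t ℕ.* 8 ℕ.+ 2) ℕ.* 3
  lem₃ = ℕSolver.solve-∀
  signs≡1 : signs ε (P₀ ∷ Ps) ≡ 1ℤ
  signs≡1 = trans (signs-* {ε} (λ n → leg 1 (+ n)) leg-1 (λ m n → trans (cong (leg 1) (ℤₚ.pos-* m n)) (leg-* (+ m) (+ n))) (P₀ ∷ Ps) (All.map (λ { {P} (pr , ne) → leg--3 {P} pr ne }) (prs≢3 (P₀ ∷ Ps) prs uniq 3∤N)))
    (trans (cong (λ n → leg 1 (+ n)) (trans N≡ (lem₃ t))) (leg-3 (t ℕ.* 8 ℕ.+ 2)))
    where open Legendre 1 prime[3]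
  N≡1 : 1mod3 (+ N)
  N≡1 = divides (+ (t ℕ.* 8 ℕ.+ 2)) (trans (cong (λ n → + n - 1ℤ) (trans N≡ (lem₃ t))) (ℤₚ.pos-* (t ℕ.* 8 ℕ.+ 2) 3))
  finish : (Σ (BinaryForm (+ N) ε (P₀ ∷ Ps)) λ f → ∀ {r} → Prime r → r ℕᵈ.∣ BinaryForm.a f → legs (P₀ ∷ Ps) (+ r) ≡ 1ℤ) → Form133 N
  finish (f , _) = form-133-from N a (ℕ.>-nonZero⁻¹ N {{prod≢0 (P₀ ∷ Ps)}})
      (nonzero-leg {P₀} λ z → Unit≢0 (All.head (units-3 (P₀ ∷ Ps) prs uniq 3∤N)) (trans (sym (All.head chars)) z)) N≡1
      (root-3 (P₀ ∷ Ps) prs uniq 3∤N chars) sqrt (coprime-3 (P₀ ∷ Ps) prs uniq 3∤N chars)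
    where open BinaryForm f

form-133-odd : ∀ n → n ℕ.% 24 ≡ 7 → Form133 n
form-133-odd n e = scale s (λ x y z → x * x + + 3 * (y * y) + + 3 * (z * z)) homogeneous-133 factor (odd-133 halves primes unique class)
  where open Core24 (core-24 n 7 e (from-no (2 ℕᵈ.∣? 7)) (from-no (3 ℕᵈ.∣? 7)))

even-133 : ∀ Ps → AllPrime Ps → AllPairs _≢_ Ps → 1mod3 (+ (2 ℕ.* prod Ps)) → Form133 (2 ℕ.* prod Ps)
even-133 Ps prs uniq N≡1 = finish (even-genus Ps (λ P → leg P (- + 3)) prs uniq (units-3 Ps prs uniq 3∤m))
  where
  m : ℕ
  m = prod Ps
  3∤m : ¬ 3 ℕᵈ.∣ m
  3∤m d = 1mod3⇒∤ {+ (2 ℕ.* m)} N≡1 (ℤᵈ.∣ᵤ⇒∣ {+ 3} {+ (2 ℕ.* m)} (ℕᵈ.∣n⇒∣m*n 2 d))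
  2∤m : ¬ 2 ℕᵈ.∣ m
  2∤m d = prime-∣-prod Ps prs ℙ.prime[2] d (All.map (λ {P} _ → odd≢2 P) prs)
  finish : (Σ (BinaryForm (+ (2 ℕ.* m)) (λ P → leg P (- + 3)) Ps) λ f → ¬ 2 ℕᵈ.∣ BinaryForm.a f) → Form133 (2 ℕ.* m)
  finish (f , 2∤a) = form-133-from (2 ℕ.* m) a (ℕₚ.*-mono-≤ {1} {2} (s≤s z≤n) (ℕ.>-nonZero⁻¹ m {{prod≢0 Ps}})) (ℕₚ.n≢0⇒n>0 λ e → 2∤a (subst (2 ℕᵈ.∣_) (sym e) (2 ℕᵈ.∣0))) N≡1
      (root-* (Coprimality.sym (prime-coprime ℙ.prime[2] 2∤m)) (root 1ℤ (2∣3+a (parity a) refl)) (root-3 Ps prs uniq 3∤m chars)) sqrt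
      (coprime-* (prime-coprime ℙ.prime[2] 2∤a) (coprime-3 Ps prs uniq 3∤m chars))
    where
    open BinaryForm f
    2∣3+a : ∀ {b} → Parity b → b ≡ a → + 2 ∣ + 3 * (1ℤ * 1ℤ) + + a
    2∣3+a (even k) refl = ⊥-elim (2∤a (ℕᵈ.divides k (lem k)))
      where
      lem : ∀ k → k ℕ.+ k ≡ k ℕ.* 2
      lem = ℕSolver.solve-∀
    2∣3+a (odd′ k) refl = divides (+ (2 ℕ.+ k)) (trans (cong +_ (lem k)) (ℤₚ.pos-* (2 ℕ.+ k) 2))
      where
      lem : ∀ k → 3 ℕ.+ suc (k ℕ.+ k) ≡ (2 ℕ.+ k) ℕ.* 2
      lem = ℕSolver.solve-∀

form-133-even : ∀ k → Form133 (2 ℕ.* (5 ℕ.+ k ℕ.* 6))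
form-133-even k = scale s (λ x y z → x * x + + 3 * (y * y) + + 3 * (z * z)) homogeneous-133
    (trans (cong (2 ℕ.*_) factor) (lem s (prod halves))) (even-133 halves primes unique m≡)
  where
  n : ℕ
  n = 5 ℕ.+ k ℕ.* 6
  2∤n : ¬ 2 ℕᵈ.∣ n
  2∤n d = from-no (2 ℕᵈ.∣? 1) (ℕᵈ.∣m+n∣m⇒∣n (subst (2 ℕᵈ.∣_) (e k) d) (ℕᵈ.divides (2 ℕ.+ k ℕ.* 3) refl))
    where
    e : ∀ k → 5 ℕ.+ k ℕ.* 6 ≡ (2 ℕ.+ k ℕ.* 3) ℕ.* 2 ℕ.+ 1
    e = ℕSolver.solve-∀
  3∤n : ¬ 3 ℕᵈ.∣ n
  3∤n d = from-no (3 ℕᵈ.∣? 2) (ℕᵈ.∣m+n∣m⇒∣n (subst (3 ℕᵈ.∣_) (e k) d) (ℕᵈ.divides (1 ℕ.+ k ℕ.* 2) refl))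
    where
    e : ∀ k → 5 ℕ.+ k ℕ.* 6 ≡ (1 ℕ.+ k ℕ.* 2) ℕ.* 3 ℕ.+ 2
    e = ℕSolver.solve-∀
  open Core24 (core-24 n (n ℕ.% 24) refl (λ d → 2∤n (ℕᵈ.∣n∣m%n⇒∣m (ℕᵈ.divides 12 refl) d)) (λ d → 3∤n (ℕᵈ.∣n∣m%n⇒∣m (ℕᵈ.divides 8 refl) d)))
  lem : ∀ s m → 2 ℕ.* (s ℕ.* s ℕ.* m) ≡ s ℕ.* s ℕ.* (2 ℕ.* m)
  lem = ℕSolver.solve-∀
  m≡ : 1mod3 (+ (2 ℕ.* prod halves))
  m≡ = ∣-resp (alg (+ (2 ℕ.* n)) (+ (2 ℕ.* prod halves))) (ℤᵈ.∣m∣n⇒∣m-n {+ 3} {+ (2 ℕ.* n) - 1ℤ} {+ (2 ℕ.* n) - + (2 ℕ.* prod halves)} (divides (+ (3 ℕ.+ k ℕ.* 4)) (trans (cong (λ x → + x - 1ℤ) (e₁ k)) (ℤₚ.pos-* (3 ℕ.+ k ℕ.* 4) 3)))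
      (divides (+ (16 ℕ.* (n ℕ./ 24)) - + (16 ℕ.* (prod halves ℕ./ 24)))
        (trans (cong₂ (λ x y → + (2 ℕ.* x) - + (2 ℕ.* y)) (ℕᵐ.m≡m%n+[m/n]*n n 24) (trans (ℕᵐ.m≡m%n+[m/n]*n (prod halves) 24) (cong (ℕ._+ prod halves ℕ./ 24 ℕ.* 24) class)))
          (trans (cong₂ _-_ (cast (n ℕ.% 24) (n ℕ./ 24)) (cast (n ℕ.% 24) (prod halves ℕ./ 24))) (alg′ (+ (2 ℕ.* (n ℕ.% 24))) (+ (16 ℕ.* (n ℕ./ 24))) (+ (16 ℕ.* (prod halves ℕ./ 24))))))))
    where
    alg : ∀ n m → n - 1ℤ - (n - m) ≡ m - 1ℤ
    alg = solve-∀
    alg′ : ∀ r x y → r + x * + 3 - (r + y * + 3) ≡ (x - y) * + 3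
    alg′ = solve-∀
    e₁ : ∀ k → 2 ℕ.* (5 ℕ.+ k ℕ.* 6) ≡ 1 ℕ.+ (3 ℕ.+ k ℕ.* 4) ℕ.* 3
    e₁ = ℕSolver.solve-∀
    cast : ∀ r x → + (2 ℕ.* (r ℕ.+ x ℕ.* 24)) ≡ + (2 ℕ.* r) + + (16 ℕ.* x) * + 3
    cast r x = trans (cong +_ (e r x)) (cong (λ z → + (2 ℕ.* r) + z) (ℤₚ.pos-* (16 ℕ.* x) 3))
      where
      e : ∀ r x → 2 ℕ.* (r ℕ.+ x ℕ.* 24) ≡ 2 ℕ.* r ℕ.+ 16 ℕ.* x ℕ.* 3
      e = ℕSolver.solve-∀

odd-113 : ∀ Ps → AllPrime Ps → AllPairs _≢_ Ps → prod Ps ℕ.% 24 ≡ 13 → Form113 (prod Ps)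
odd-113 Ps prs uniq c = finish (odd-genus 1 Ps ε (t ℕ.* 18 ℕ.+ 9) (prime[3] ∷ prs) (≢1 ∷ uniq) (All.map (λ { {P} (pr , ne) → ε-unit {P} pr ne }) (All.zip (prs , ≢1)))
    (trans (cong (3 ℕ.*_) N≡) (lem t)) (cong₂ _*_ (ε-1) signs≡1))
  where
  N t : ℕ
  N = prod Ps
  t = proj₁ (from-residue {N} c)
  N≡ : N ≡ 13 ℕ.+ t ℕ.* 24
  N≡ = proj₂ (from-residue {N} c)
  ε : ℕ → ℤ
  ε P = choose (P ℕ.≟ 1) 1ℤ (leg P -1ℤ)
  ε-1 : ε 1 ≡ 1ℤ
  ε-1 = refl
  ε-≢1 : ∀ {P} → 1 ≢ P → ε P ≡ leg P -1ℤ
  ε-≢1 {P} ne = choose-no (P ℕ.≟ 1) (≢-sym ne)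
  3∤N : ¬ 3 ℕᵈ.∣ N
  3∤N d = from-no (3 ℕᵈ.∣? 13) (subst (3 ℕᵈ.∣_) c (ℕᵈ.%-presˡ-∣ d (ℕᵈ.divides 8 refl)))
  ≢1 : All (λ P → 1 ≢ P) Ps
  ≢1 = All.map (λ { ne refl → ne refl }) (∤⇒odd≢3 Ps 3∤N)
  lem : ∀ t → 3 ℕ.* (13 ℕ.+ t ℕ.* 24) ≡ 3 ℕ.+ 4 ℕ.* (t ℕ.* 18 ℕ.+ 9)
  lem = ℕSolver.solve-∀
  lem₃ : ∀ t → 13 ℕ.+ t ℕ.* 24 ≡ 1 ℕ.+ (t ℕ.* 8 ℕ.+ 4) ℕ.* 3
  lem₃ = ℕSolver.solve-∀
  lem₈ : ∀ t → 13 ℕ.+ t ℕ.* 24 ≡ (t ℕ.* 3 ℕ.+ 1) ℕ.* 8 ℕ.+ 5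
  lem₈ = ℕSolver.solve-∀
  ∤-1 : ∀ {P} → Prime (odd P) → ¬ + odd P ∣ -1ℤ
  ∤-1 {P} pr = neg-∤ (Legendre.p∤1 P pr)
  ε-unit : ∀ {P} → Prime (odd P) → 1 ≢ P → Unit (ε P)
  ε-unit {P} pr ne = subst Unit (sym (ε-≢1 {P} ne)) (Legendre.leg-Unit P pr (∤-1 {P} pr))
  f : ℕ → ℤ
  f n = eight 1ℤ n * eight -1ℤ n
  f-* : ∀ m n → f (m ℕ.* n) ≡ f m * f n
  f-* m n = trans (cong₂ _*_ (eight-* pos m n) (eight-* neg m n)) (alg (eight 1ℤ m) (eight 1ℤ n) (eight -1ℤ m) (eight -1ℤ n))
    where
    alg : ∀ a b c d → a * b * (c * d) ≡ a * c * (b * d)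
    alg = solve-∀
  two-Unit : ∀ P → Unit (two P)
  two-Unit zero          = pos
  two-Unit (suc zero)    = neg
  two-Unit (suc (suc P)) = negate (two-Unit P)
    where
    negate : ∀ {x} → Unit x → Unit (- x)
    negate pos = neg
    negate neg = pos
  ε≡f : ∀ {P} → Prime (odd P) × 1 ≢ P → ε P ≡ f (odd P)
  ε≡f {P} (pr , ne) = trans (ε-≢1 {P} ne) (trans (Legendre.leg--1 P pr) (sym (trans (cong₂ _*_ (eight-plus P) (eight-minus P)) (trans (ℤₚ.*-assoc (-1ℤ ^ P) (two P) (two P)) (trans (cong (-1ℤ ^ P *_) (Unit-sq (two-Unit P))) (ℤₚ.*-identityʳ (-1ℤ ^ P)))))))
  signs≡1 : signs ε Ps ≡ 1ℤ
  signs≡1 = trans (signs-* {ε} f refl f-* Ps (All.map (λ {P} → ε≡f {P}) (All.zip (prs , ≢1)))) (trans (cong f (trans N≡ (lem₈ t))) (cong₂ _*_ (eight-period 1ℤ (t ℕ.* 3 ℕ.+ 1) 5) (eight-period -1ℤ (t ℕ.* 3 ℕ.+ 1) 5)))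
  N≡1 : 1mod3 (+ N)
  N≡1 = divides (+ (t ℕ.* 8 ℕ.+ 4)) (trans (cong (λ n → + n - 1ℤ) (trans N≡ (lem₃ t))) (ℤₚ.pos-* (t ℕ.* 8 ℕ.+ 4) 3))
  finish : (Σ (BinaryForm (+ prod (1 ∷ Ps)) ε (1 ∷ Ps)) λ f → ∀ {r} → Prime r → r ℕᵈ.∣ BinaryForm.a f → legs (1 ∷ Ps) (+ r) ≡ 1ℤ) → Form113 N
  finish (form , _) = conclude chars
    where
    open BinaryForm form
    a≡1 : leg 1 (+ a) ≡ 1ℤ → Mod3 (+ a) → 1mod3 (+ a)
    a≡1 e (zero d) = ⊥-elim (Unit≢0 pos (trans (sym e) (leg-∣ {1} d)))
    a≡1 e (unit d) = cases (prime∣*⇒ {3} {+ a - 1ℤ} {+ a + 1ℤ} prime[3] (∣-resp (alg (+ a)) d))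
      where
      open Legendre 1 prime[3]
      alg : ∀ a → a * a - 1ℤ ≡ (a - 1ℤ) * (a + 1ℤ)
      alg = solve-∀
      alg′ : ∀ a → a + 1ℤ ≡ a - -1ℤ
      alg′ = solve-∀
      1≢-1 : 1ℤ ≢ -1ℤ
      1≢-1 ()
      cases : + 3 ∣ + a - 1ℤ ⊎ + 3 ∣ + a + 1ℤ → 1mod3 (+ a)
      cases (inj₁ h) = h
      cases (inj₂ h) = ⊥-elim (1≢-1 (trans (sym e) (trans (leg-≅ (mod (∣-resp (alg′ (+ a)) h))) leg--1)))
    conclude : All (λ P → leg P (+ a) ≡ ε P) (1 ∷ Ps) → Form113 N
    conclude (e ∷ es) = form-113-from N a (ℕ.>-nonZero⁻¹ N {{prod≢0 Ps}}) (nonzero-leg {1} λ z → Unit≢0 pos (trans (sym e) z)) N≡1 (a≡1 e (mod-3 (+ a)))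
        (root-prod Ps prs uniq (All.map (λ {P} pr → Legendre.p∤1 P pr) prs) es′)
        (subst (λ D → Root 1ℤ D a) (ℤₚ.pos-* 3 N) sqrt)
        (coprime-prod Ps prs (All.map (λ { {P} (pr , e′) z → Unit≢0 (Legendre.leg-Unit P pr (∤-1 {P} pr)) (trans (sym e′) z) }) (All.zip (prs , es′))))
      where
      es′ : All (λ P → leg P (+ a) ≡ leg P -1ℤ) Ps
      es′ = All.map (λ { {P} (e′ , ne) → trans e′ (ε-≢1 {P} ne) }) (All.zip (es , ≢1))

form-113 : ∀ n → n ℕ.% 24 ≡ 13 → Form113 n
form-113 n e = scale s (λ x y z → x * x + y * y + + 3 * (z * z)) homogeneous factor (odd-113 halves primes unique class)
  where
  open Core24 (core-24 n 13 e (from-no (2 ℕᵈ.∣? 13)) (from-no (3 ℕᵈ.∣? 13)))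
  homogeneous : ∀ t x y z → + t * + t * (x * x + y * y + + 3 * (z * z)) ≡ + t * x * (+ t * x) + + t * y * (+ t * y) + + 3 * (+ t * z * (+ t * z))
  homogeneous t = lem (+ t)
    where
    lem : ∀ t x y z → t * t * (x * x + y * y + + 3 * (z * z)) ≡ t * x * (t * x) + t * y * (t * y) + + 3 * (t * z * (t * z))
    lem = solve-∀

-- Congruence conditions on the variables

data Par (z : ℤ) : Set where
  evenℤ : ∀ k → z ≡ + 2 * k → Par z
  oddℤ  : ∀ k → z ≡ + 2 * k + 1ℤ → Par z

par : ∀ z → Par z
par z = aux (z ℤᵐ.%ℕ 2) {z ℤᵐ./ℕ 2} (ℤᵐ.n%ℕd<d z 2) (ℤᵐ.a≡a%ℕn+[a/ℕn]*n z 2)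
  where
  aux : ∀ r {t} → r ℕ.< 2 → z ≡ + r + t * + 2 → Par z
  aux 0 {t} _ e = evenℤ t (trans e (lem t))
    where
    lem : ∀ t → 0ℤ + t * + 2 ≡ + 2 * t
    lem = solve-∀
  aux 1 {t} _ e = oddℤ t (trans e (lem t))
    where
    lem : ∀ t → 1ℤ + t * + 2 ≡ + 2 * t + 1ℤ
    lem = solve-∀
  aux (suc (suc r)) (s≤s (s≤s ()))

Odd : ℤ → Set
Odd z = ∃ λ k → z ≡ + 2 * k + 1ℤ

bit₂ : ∀ {z} → Par z → ℤ
bit₂ (evenℤ _ _) = 0ℤ
bit₂ (oddℤ  _ _) = 1ℤ

square-mod-4 : ∀ {z} (p : Par z) → + 4 ∣ z * z - bit₂ p
square-mod-4 (evenℤ k refl) = divides (k * k) (lem k)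
  where
  lem : ∀ k → + 2 * k * (+ 2 * k) - 0ℤ ≡ k * k * + 4
  lem = solve-∀
square-mod-4 (oddℤ k refl) = divides (k * k + k) (lem k)
  where
  lem : ∀ k → (+ 2 * k + 1ℤ) * (+ 2 * k + 1ℤ) - 1ℤ ≡ (k * k + k) * + 4
  lem = solve-∀

bit₃ : ∀ {z} → Mod3 z → ℤ
bit₃ (zero _) = 0ℤ
bit₃ (unit _) = 1ℤ

square-mod-3 : ∀ {z} (p : Mod3 z) → + 3 ∣ z * z - bit₃ p
square-mod-3 {z} (zero d) = ∣-resp (sym (ℤₚ.+-identityʳ (z * z))) (ℤᵈ.∣m⇒∣m*n z d)
square-mod-3 (unit d) = d

∣-scale : ∀ {m} β y b → m ∣ y - b → m ∣ β * y - β * b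
∣-scale β y b d = ∣-resp (lem β y b) (ℤᵈ.∣n⇒∣m*n β d)
  where
  lem : ∀ a b c → a * (b - c) ≡ a * b - a * c
  lem = solve-∀

residues : ∀ {m} r {N t₁ t₂ t₃ b₁ b₂ b₃} → m ∣ N - r → N ≡ t₁ + t₂ + t₃ →
           m ∣ t₁ - b₁ → m ∣ t₂ - b₂ → m ∣ t₃ - b₃ → m ∣ r - (b₁ + b₂ + b₃)
residues {m} r {N} {t₁} {t₂} {t₃} {b₁} {b₂} {b₃} d e d₁ d₂ d₃ = ∣-resp (trans (cong (λ n → t₁ - b₁ + (t₂ - b₂) + (t₃ - b₃) - (n - r)) e) (lem t₁ t₂ t₃ b₁ b₂ b₃ r))
  (ℤᵈ.∣m∣n⇒∣m-n {m} {t₁ - b₁ + (t₂ - b₂) + (t₃ - b₃)} {N - r} (ℤᵈ.∣m∣n⇒∣m+n {m} {t₁ - b₁ + (t₂ - b₂)} (ℤᵈ.∣m∣n⇒∣m+n {m} {t₁ - b₁} d₁ d₂) d₃) d)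
  where
  lem : ∀ x y z a b c r → x - a + (y - b) + (z - c) - (x + y + z - r) ≡ r - (a + b + c)
  lem = solve-∀

signed-class : ∀ m c X → + m ∣ X - c ⊎ + m ∣ X + c → ∃ λ x → (+ m * x + c) * (+ m * x + c) ≡ X * X
signed-class m c X (inj₁ (divides q e)) = q , cong (λ z → z * z) (trans (cong (_+ c) (ℤₚ.*-comm (+ m) q)) (trans (cong (_+ c) (sym e)) (lem X c)))
  where
  lem : ∀ X c → X - c + c ≡ X
  lem = solve-∀
signed-class m c X (inj₂ (divides q e)) = - q , trans (cong (λ z → z * z) (trans (lem (+ m) q c) (cong (λ z → - z + c) (sym e)))) (lem′ X c)
  where
  lem : ∀ m q c → m * - q + c ≡ - (q * m) + c
  lem = solve-∀
  lem′ : ∀ X c → (- (X + c) + c) * (- (X + c) + c) ≡ X * X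
  lem′ = solve-∀

2∣odd±odd : ∀ {X c} → Odd X → Odd c → + 2 ∣ X - c × + 2 ∣ X + c
2∣odd±odd (a , refl) (b , refl) = divides (a - b) (lem a b) , divides (a + b + 1ℤ) (lem′ a b)
  where
  lem : ∀ a b → + 2 * a + 1ℤ - (+ 2 * b + 1ℤ) ≡ (a - b) * + 2
  lem = solve-∀
  lem′ : ∀ a b → + 2 * a + 1ℤ + (+ 2 * b + 1ℤ) ≡ (a + b + 1ℤ) * + 2
  lem′ = solve-∀

prime-square-roots : ∀ p → Prime p → ∀ {X c} → + p ∣ X * X - c * c → + p ∣ X - c ⊎ + p ∣ X + c
prime-square-roots p pr {X} {c} d = prime∣*⇒ {p} {X - c} {X + c} pr (∣-resp (lem X c) d)
  where
  lem : ∀ X c → X * X - c * c ≡ (X - c) * (X + c)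
  lem = solve-∀

class-2p : ∀ p → Prime p → Coprime p 2 → ∀ {X c} → Odd X → Odd c → + p ∣ X * X - c * c → + (p ℕ.* 2) ∣ X - c ⊎ + (p ℕ.* 2) ∣ X + c
class-2p p pr cop {X} {c} oX oc d = aux (prime-square-roots p pr {X} {c} d)
  where
  aux : + p ∣ X - c ⊎ + p ∣ X + c → + (p ℕ.* 2) ∣ X - c ⊎ + (p ℕ.* 2) ∣ X + c
  aux (inj₁ h) = inj₁ (coprime-∣* cop h (proj₁ (2∣odd±odd oX oc)))
  aux (inj₂ h) = inj₂ (coprime-∣* cop h (proj₂ (2∣odd±odd oX oc)))

coprime-3-2 : Coprime 3 2
coprime-3-2 = prime-coprime ℙ.prime[2] (from-no (2 ℕᵈ.∣? 3))

prime[5] : Prime 5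
prime[5] = from-yes (ℙ.prime? 5)

coprime-5-2 : Coprime 5 2
coprime-5-2 = prime-coprime ℙ.prime[2] (from-no (2 ℕᵈ.∣? 5))

coprime-9-2 : Coprime 9 2
coprime-9-2 = prime-coprime ℙ.prime[2] (from-no (2 ℕᵈ.∣? 9))

-- As 3 ∤ c, only one of X - c and X + c is divisible by 3.
class-18 : ∀ {X} c → Odd X → Odd c → ¬ + 3 ∣ c → + 9 ∣ X * X - c * c → ∃ λ x → (+ 18 * x + c) * (+ 18 * x + c) ≡ X * X
class-18 {X} c oX oc 3∤c d = signed-class 18 c X (aux (both (prime-square-roots 3 prime[3] {X} {c} (ℤᵈ.∣-trans (divides (+ 3) refl) d))))
  where
  3∤both : + 3 ∣ X - c → ¬ + 3 ∣ X + c
  3∤both h k = 3∤c (3∣* {+ 2} {c} (∣-resp (lem X c) (ℤᵈ.∣m∣n⇒∣m-n k h)) (3∤ {2} z<s (s<s (s<s z<s))))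
    where
    lem : ∀ X c → X + c - (X - c) ≡ + 2 * c
    lem = solve-∀
  nine : ∀ {u v} → + 9 ∣ u * v → + 3 ∣ u → ¬ + 3 ∣ v → + 9 ∣ u
  nine {v = v} (divides q e) (divides w refl) h = aux′ (3∣* {v} {w} (divides q (ℤₚ.*-cancelʳ-≡ _ _ (+ 3) (trans (lem v w) (trans e (lem′ q))))) h)
    where
    lem : ∀ v w → v * w * + 3 ≡ w * + 3 * v
    lem = solve-∀
    lem′ : ∀ q → q * + 9 ≡ q * + 3 * + 3
    lem′ = solve-∀
    aux′ : + 3 ∣ w → + 9 ∣ w * + 3
    aux′ (divides t refl) = divides t (ℤₚ.*-assoc t (+ 3) (+ 3))
  factor : X * X - c * c ≡ (X - c) * (X + c)
  factor = lem X c
    where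
    lem : ∀ X c → X * X - c * c ≡ (X - c) * (X + c)
    lem = solve-∀
  both : + 3 ∣ X - c ⊎ + 3 ∣ X + c → + 9 ∣ X - c ⊎ + 9 ∣ X + c
  both (inj₁ h) = inj₁ (nine {X - c} {X + c} (∣-resp factor d) h (3∤both h))
  both (inj₂ h) = inj₂ (nine {X + c} {X - c} (∣-resp (trans factor (ℤₚ.*-comm (X - c) (X + c))) d) h (λ k → 3∤both k h))
  aux : + 9 ∣ X - c ⊎ + 9 ∣ X + c → + 18 ∣ X - c ⊎ + 18 ∣ X + c
  aux (inj₁ h) = inj₁ (coprime-∣* coprime-9-2 h (proj₁ (2∣odd±odd oX oc)))
  aux (inj₂ h) = inj₂ (coprime-∣* coprime-9-2 h (proj₂ (2∣odd±odd oX oc)))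

Unit3 : ℤ → Set
Unit3 z = ¬ + 3 ∣ z

unit3-square : ∀ {z} → Unit3 z → + 3 ∣ z * z - 1ℤ
unit3-square {z} h with mod-3 z
... | zero d = ⊥-elim (h d)
... | unit d = d

odd-1 : Odd 1ℤ
odd-1 = 0ℤ , refl

class-6 : ∀ {Z} → Odd Z → Unit3 Z → ∃ λ z → (+ 6 * z + 1ℤ) * (+ 6 * z + 1ℤ) ≡ Z * Z
class-6 {Z} o u = signed-class 6 1ℤ Z (class-2p 3 prime[3] coprime-3-2 o odd-1 (unit3-square {Z} u))

class-4 : ∀ {Y} → Odd Y → ∃ λ y → (+ 4 * y + 1ℤ) * (+ 4 * y + 1ℤ) ≡ Y * Y
class-4 {Y} (k , e) = signed-class 4 1ℤ Y (aux (par k))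
  where
  aux : Par k → + 4 ∣ Y - 1ℤ ⊎ + 4 ∣ Y + 1ℤ
  aux (evenℤ j refl) = inj₁ (divides j (trans (cong (_- 1ℤ) e) (lem j)))
    where
    lem : ∀ j → + 2 * (+ 2 * j) + 1ℤ - 1ℤ ≡ j * + 4
    lem = solve-∀
  aux (oddℤ j refl) = inj₂ (divides (j + 1ℤ) (trans (cong (_+ 1ℤ) e) (lem j)))
    where
    lem : ∀ j → + 2 * (+ 2 * j + 1ℤ) + 1ℤ + 1ℤ ≡ (j + 1ℤ) * + 4
    lem = solve-∀

-- x² + 3y² is unchanged under (x, y) ↦ ((x + 3y)/2, (x - y)/2) and under the same map with -y for y.
both-odd : ∀ {X Y m} k j → X ≡ + 2 * k → Y ≡ + 2 * j → X * X + + 3 * (Y * Y) ≡ + 8 * m + + 4 → ∃ λ X′ → ∃ λ Y′ → Odd X′ × Odd Y′ × X′ * X′ + + 3 * (Y′ * Y′) ≡ X * X + + 3 * (Y * Y)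
both-odd {m = m} k j refl refl e = k + + 3 * j , k - j , o₁ (par (k - j)) , o₂ (par (k - j)) , lem k j
  where
  lem : ∀ k j → (k + + 3 * j) * (k + + 3 * j) + + 3 * ((k - j) * (k - j)) ≡ + 2 * k * (+ 2 * k) + + 3 * (+ 2 * j * (+ 2 * j))
  lem = solve-∀
  absurd : ∀ h → k - j ≡ + 2 * h → ⊥
  absurd h k-j = from-no (+ 4 ℤᵈ.∣? + 2) (∣-resp value≡2 (divides (+ 2 * h * h + + 2 * h * j + + 2 * (j * j) - m) (trans (cong (λ z → + 2 * (z * z + + 3 * (j * j)) - + 4 * m) k≡) (lem₂ h j m))))
    where
    k≡ : k ≡ + 2 * h + j
    k≡ = trans (lem₄ k j) (cong (_+ j) k-j)
      where
      lem₄ : ∀ k j → k ≡ k - j + j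
      lem₄ = solve-∀
    lem₁ : ∀ k j m → + 2 * (+ 2 * (k * k + + 3 * (j * j)) - + 4 * m) ≡ + 2 * k * (+ 2 * k) + + 3 * (+ 2 * j * (+ 2 * j)) - + 8 * m
    lem₁ = solve-∀
    lem₂ : ∀ h j m → + 2 * ((+ 2 * h + j) * (+ 2 * h + j) + + 3 * (j * j)) - + 4 * m ≡ (+ 2 * h * h + + 2 * h * j + + 2 * (j * j) - m) * + 4
    lem₂ = solve-∀
    lem₃ : ∀ m → + 8 * m + + 4 - + 8 * m ≡ + 2 * + 2
    lem₃ = solve-∀
    value≡2 : + 2 * (k * k + + 3 * (j * j)) - + 4 * m ≡ + 2
    value≡2 = ℤₚ.*-cancelˡ-≡ (+ 2) _ _ (trans (lem₁ k j m) (trans (cong (_- + 8 * m) e) (lem₃ m)))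
  o₁ : Par (k - j) → Odd (k + + 3 * j)
  o₁ (evenℤ h e′) = ⊥-elim (absurd h e′)
  o₁ (oddℤ h e′)  = h + + 2 * j , trans (lem₁ k j) (trans (cong (_+ + 4 * j) e′) (lem₂ h j))
    where
    lem₁ : ∀ k j → k + + 3 * j ≡ k - j + + 4 * j
    lem₁ = solve-∀
    lem₂ : ∀ h j → + 2 * h + 1ℤ + + 4 * j ≡ + 2 * (h + + 2 * j) + 1ℤ
    lem₂ = solve-∀
  o₂ : Par (k - j) → Odd (k - j)
  o₂ (evenℤ h e′) = ⊥-elim (absurd h e′)
  o₂ (oddℤ h e′)  = h , e′

Good : ℤ → Set
Good z = Odd z × Unit3 z

prime-to-3 : ∀ {X Y} → Good X → Odd Y → ∃ λ X′ → ∃ λ Y′ → Good X′ × Good Y′ × X′ * X′ + + 3 * (Y′ * Y′) ≡ X * X + + 3 * (Y * Y)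
prime-to-3 {X} {Y} ((a , refl) , uX) (b , refl) = aux (+ 3 ℤᵈ.∣? (+ 2 * b + 1ℤ)) (par (a - b))
  where
  unit₂ : ∀ {x y} → + 2 * x ≡ X - y → + 3 ∣ y → Unit3 x
  unit₂ {x} {y} e 3∣y 3∣x = uX (∣-resp (trans (cong (_+ y) e) (lem X y)) (ℤᵈ.∣m∣n⇒∣m+n {+ 3} {+ 2 * x} (ℤᵈ.∣n⇒∣m*n (+ 2) 3∣x) 3∣y))
    where
    lem : ∀ X y → X - y + y ≡ X
    lem = solve-∀
  aux : Dec (+ 3 ∣ Y) → Par (a - b) → ∃ λ X′ → ∃ λ Y′ → Good X′ × Good Y′ × X′ * X′ + + 3 * (Y′ * Y′) ≡ X * X + + 3 * (Y * Y)
  aux (no h)  _ = X , Y , ((a , refl) , uX) , ((b , refl) , h) , refl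
  aux (yes d) (oddℤ h e) = a + + 3 * b + + 2 , a - b
    , ((h + + 2 * b + 1ℤ , trans (lem₁ a b) (trans (cong (_+ (+ 4 * b + + 2)) e) (lem₂ h b))) , unit₂ {y = - (+ 3 * Y)} (lem₃ a b) (ℤᵈ.∣m⇒∣-m (divides Y (ℤₚ.*-comm (+ 3) Y))))
    , ((h , e) , unit₂ {y = Y} (lem₄ a b) d) , lem a b
    where
    lem : ∀ a b → (a + + 3 * b + + 2) * (a + + 3 * b + + 2) + + 3 * ((a - b) * (a - b)) ≡ (+ 2 * a + 1ℤ) * (+ 2 * a + 1ℤ) + + 3 * ((+ 2 * b + 1ℤ) * (+ 2 * b + 1ℤ))
    lem = solve-∀
    lem₁ : ∀ a b → a + + 3 * b + + 2 ≡ a - b + (+ 4 * b + + 2)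
    lem₁ = solve-∀
    lem₂ : ∀ h b → + 2 * h + 1ℤ + (+ 4 * b + + 2) ≡ + 2 * (h + + 2 * b + 1ℤ) + 1ℤ
    lem₂ = solve-∀
    lem₃ : ∀ a b → + 2 * (a + + 3 * b + + 2) ≡ + 2 * a + 1ℤ - - (+ 3 * (+ 2 * b + 1ℤ))
    lem₃ = solve-∀
    lem₄ : ∀ a b → + 2 * (a - b) ≡ + 2 * a + 1ℤ - (+ 2 * b + 1ℤ)
    lem₄ = solve-∀
  aux (yes d) (evenℤ h e) = a - + 3 * b - 1ℤ , a + b + 1ℤ
    , ((h - b - 1ℤ , trans (lem₁ a b) (trans (cong (λ z → z - + 2 * b - 1ℤ) e) (lem₂ h b))) , unit₂ {y = + 3 * Y} (lem₃ a b) (divides Y (ℤₚ.*-comm (+ 3) Y)))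
    , ((h + b , trans (lem₅ a b) (trans (cong (λ z → z + + 2 * b + 1ℤ) e) (lem₆ h b))) , unit₂ {y = - Y} (lem₄ a b) (ℤᵈ.∣m⇒∣-m d)) , lem a b
    where
    lem : ∀ a b → (a - + 3 * b - 1ℤ) * (a - + 3 * b - 1ℤ) + + 3 * ((a + b + 1ℤ) * (a + b + 1ℤ)) ≡ (+ 2 * a + 1ℤ) * (+ 2 * a + 1ℤ) + + 3 * ((+ 2 * b + 1ℤ) * (+ 2 * b + 1ℤ))
    lem = solve-∀
    lem₁ : ∀ a b → a - + 3 * b - 1ℤ ≡ a - b - + 2 * b - 1ℤ
    lem₁ = solve-∀
    lem₂ : ∀ h b → + 2 * h - + 2 * b - 1ℤ ≡ + 2 * (h - b - 1ℤ) + 1ℤ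
    lem₂ = solve-∀
    lem₃ : ∀ a b → + 2 * (a - + 3 * b - 1ℤ) ≡ + 2 * a + 1ℤ - + 3 * (+ 2 * b + 1ℤ)
    lem₃ = solve-∀
    lem₄ : ∀ a b → + 2 * (a + b + 1ℤ) ≡ + 2 * a + 1ℤ - - (+ 2 * b + 1ℤ)
    lem₄ = solve-∀
    lem₅ : ∀ a b → a + b + 1ℤ ≡ a - b + + 2 * b + 1ℤ
    lem₅ = solve-∀
    lem₆ : ∀ h b → + 2 * h + + 2 * b + 1ℤ ≡ + 2 * (h + b) + 1ℤ
    lem₆ = solve-∀

residue-∣ : ∀ {n} r t d → n ≡ r ℕ.+ t ℕ.* d → + d ∣ + n - + r
residue-∣ r t d refl = divides (+ t) (trans (lem (+ r) (+ (t ℕ.* d))) (ℤₚ.pos-* t d))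
  where
  lem : ∀ r x → r + x - r ≡ x
  lem = solve-∀

record OddSquares (n : ℕ) : Set where
  field
    X U V : ℤ
    good  : Good X
    oddU  : Odd U
    oddV  : Odd V
    sum≡  : + n ≡ X * X + + 9 * (U * U + V * V)

odd-triple : ∀ {n x y z} → + 4 ∣ n - + 3 → n ≡ x * x + y * y + z * z → Odd x × Odd y × Odd z
odd-triple {n} {x} {y} {z} d e = aux (par x) (par y) (par z)
  where
  res : (a : Par x) (b : Par y) (c : Par z) → + 4 ∣ + 3 - (bit₂ a + bit₂ b + bit₂ c)
  res a b c = residues (+ 3) {n} {x * x} {y * y} {z * z} d e (square-mod-4 a) (square-mod-4 b) (square-mod-4 c)
  aux : Par x → Par y → Par z → Odd x × Odd y × Odd z
  aux (oddℤ k e₁) (oddℤ l e₂) (oddℤ m e₃) = (k , e₁) , (l , e₂) , (m , e₃)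
  aux a@(evenℤ _ _) b@(evenℤ _ _) c@(evenℤ _ _) = ⊥-elim (from-no (+ 4 ℤᵈ.∣? + 3) (res a b c))
  aux a@(evenℤ _ _) b@(evenℤ _ _) c@(oddℤ _ _)  = ⊥-elim (from-no (+ 4 ℤᵈ.∣? + 2) (res a b c))
  aux a@(evenℤ _ _) b@(oddℤ _ _)  c@(evenℤ _ _) = ⊥-elim (from-no (+ 4 ℤᵈ.∣? + 2) (res a b c))
  aux a@(evenℤ _ _) b@(oddℤ _ _)  c@(oddℤ _ _)  = ⊥-elim (from-no (+ 4 ℤᵈ.∣? + 1) (res a b c))
  aux a@(oddℤ _ _)  b@(evenℤ _ _) c@(evenℤ _ _) = ⊥-elim (from-no (+ 4 ℤᵈ.∣? + 2) (res a b c))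
  aux a@(oddℤ _ _)  b@(evenℤ _ _) c@(oddℤ _ _)  = ⊥-elim (from-no (+ 4 ℤᵈ.∣? + 1) (res a b c))
  aux a@(oddℤ _ _)  b@(oddℤ _ _)  c@(evenℤ _ _) = ⊥-elim (from-no (+ 4 ℤᵈ.∣? + 1) (res a b c))

third : ∀ {z} → + 3 ∣ z → Odd z → ∃ λ w → Odd w × z * z ≡ + 9 * (w * w)
third {z} (divides w refl) (k , e) = w , (k - w , trans (lem w) (trans (cong (_- + 2 * w) e) (lem′ k w))) , lem″ w
  where
  lem : ∀ w → w ≡ w * + 3 - + 2 * w
  lem = solve-∀
  lem′ : ∀ k w → + 2 * k + 1ℤ - + 2 * w ≡ + 2 * (k - w) + 1ℤ
  lem′ = solve-∀
  lem″ : ∀ w → w * + 3 * (w * + 3) ≡ + 9 * (w * w)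
  lem″ = solve-∀

unit-3 : ∀ {z} → + 3 ∣ z * z - 1ℤ → Unit3 z
unit-3 {z} d h = 1mod3⇒∤ {z * z} d (ℤᵈ.∣m⇒∣m*n z h)

odd-squares : ∀ n → n ℕ.% 24 ≡ 19 → OddSquares n
odd-squares n c = build (three-squares n c)
  where
  t : ℕ
  t = proj₁ (from-residue {n} c)
  n≡ : n ≡ 19 ℕ.+ t ℕ.* 24
  n≡ = proj₂ (from-residue {n} c)
  build : ThreeSquares n → OddSquares n
  build (x , y , z , e) = aux (odd-triple {+ n} {x} {y} {z} (residue-∣ 3 (4 ℕ.+ t ℕ.* 6) 4 (trans n≡ (lem₄ t))) e) (mod-3 x) (mod-3 y) (mod-3 z)
    where
    lem₄ : ∀ n → 19 ℕ.+ n ℕ.* 24 ≡ 3 ℕ.+ (4 ℕ.+ n ℕ.* 6) ℕ.* 4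
    lem₄ = ℕSolver.solve-∀
    lem₃ : ∀ n → 19 ℕ.+ n ℕ.* 24 ≡ 1 ℕ.+ (6 ℕ.+ n ℕ.* 8) ℕ.* 3
    lem₃ = ℕSolver.solve-∀
    res : (a : Mod3 x) (b : Mod3 y) (c : Mod3 z) → + 3 ∣ + 1 - (bit₃ a + bit₃ b + bit₃ c)
    res a b c = residues (+ 1) {+ n} {x * x} {y * y} {z * z} (residue-∣ 1 (6 ℕ.+ t ℕ.* 8) 3 (trans n≡ (lem₃ t))) e (square-mod-3 a) (square-mod-3 b) (square-mod-3 c)
    choice : ∀ {x y z} → Odd x → + 3 ∣ x * x - 1ℤ → (∃ λ w → Odd w × y * y ≡ + 9 * (w * w)) → (∃ λ w → Odd w × z * z ≡ + 9 * (w * w)) → + n ≡ x * x + y * y + z * z → OddSquares n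
    choice {x} ox u (U , oU , eU) (V , oV , eV) e = record { X = x ; U = U ; V = V ; good = ox , unit-3 {x} u ; oddU = oU ; oddV = oV
      ; sum≡ = trans e (trans (cong₂ (λ a b → x * x + a + b) eU eV) (alg (x * x) (U * U) (V * V))) }
      where
      alg : ∀ x u v → x + + 9 * u + + 9 * v ≡ x + + 9 * (u + v)
      alg = solve-∀
    rot₁ : ∀ x y z → x + y + z ≡ y + x + z
    rot₁ = solve-∀
    rot₂ : ∀ x y z → x + y + z ≡ z + x + y
    rot₂ = solve-∀
    aux : Odd x × Odd y × Odd z → Mod3 x → Mod3 y → Mod3 z → OddSquares n
    aux (ox , oy , oz) (unit a) (zero b) (zero c) = choice {x} {y} {z} ox a (third b oy) (third c oz) e
    aux (ox , oy , oz) (zero a) (unit b) (zero c) = choice {y} {x} {z} oy b (third a ox) (third c oz) (trans e (rot₁ (x * x) (y * y) (z * z)))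
    aux (ox , oy , oz) (zero a) (zero b) (unit c) = choice {z} {x} {y} oz c (third a ox) (third b oy) (trans e (rot₂ (x * x) (y * y) (z * z)))
    aux _ a@(zero _) b@(zero _) c@(zero _) = ⊥-elim (from-no (+ 3 ℤᵈ.∣? + 1) (res a b c))
    aux _ a@(zero _) b@(unit _) c@(unit _) = ⊥-elim (from-no (+ 3 ℤᵈ.∣? -1ℤ) (res a b c))
    aux _ a@(unit _) b@(zero _) c@(unit _) = ⊥-elim (from-no (+ 3 ℤᵈ.∣? -1ℤ) (res a b c))
    aux _ a@(unit _) b@(unit _) c@(zero _) = ⊥-elim (from-no (+ 3 ℤᵈ.∣? -1ℤ) (res a b c))
    aux _ a@(unit _) b@(unit _) c@(unit _) = ⊥-elim (from-no (+ 3 ℤᵈ.∣? - + 2) (res a b c))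

record Good133 (n : ℕ) : Set where
  field
    X Y Z : ℤ
    goodX : Good X
    goodY : Good Y
    goodZ : Good Z
    sum≡  : + n ≡ X * X + + 3 * (Y * Y) + + 3 * (Z * Z)

odd-square-8 : ∀ {z} → Odd z → ∃ λ m → z * z ≡ + 8 * m + 1ℤ
odd-square-8 {z} (k , refl) = aux (par k)
  where
  aux : Par k → ∃ λ m → (+ 2 * k + 1ℤ) * (+ 2 * k + 1ℤ) ≡ + 8 * m + 1ℤ
  aux (evenℤ j refl) = + 2 * (j * j) + j , lem j
    where
    lem : ∀ j → (+ 2 * (+ 2 * j) + 1ℤ) * (+ 2 * (+ 2 * j) + 1ℤ) ≡ + 8 * (+ 2 * (j * j) + j) + 1ℤ
    lem = solve-∀
  aux (oddℤ j refl) = + 2 * (j * j) + + 3 * j + 1ℤ , lem j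
    where
    lem : ∀ j → (+ 2 * (+ 2 * j + 1ℤ) + 1ℤ) * (+ 2 * (+ 2 * j + 1ℤ) + 1ℤ) ≡ + 8 * (+ 2 * (j * j) + + 3 * j + 1ℤ) + 1ℤ
    lem = solve-∀

minus-odd : ∀ {n s z} β k → n ≡ + 8 * k + (+ 4 + β) → n ≡ s + β * (z * z) → Odd z → ∃ λ m → s ≡ + 8 * m + + 4
minus-odd {n} {s} {z} β k e f o = let m , z² = odd-square-8 {z} o in k - β * m ,
  trans (lem s (β * (z * z))) (trans (cong (_- β * (z * z)) (trans (sym f) e)) (trans (cong (λ w → + 8 * k + (+ 4 + β) - β * w) z²) (lem′ k β m)))
  where
  lem : ∀ s t → s ≡ s + t - t
  lem = solve-∀
  lem′ : ∀ k β m → + 8 * k + (+ 4 + β) - β * (+ 8 * m + 1ℤ) ≡ + 8 * (k - β * m) + + 4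
  lem′ = solve-∀

good-133 : ∀ n → n ℕ.% 24 ≡ 7 → Good133 n
good-133 n c = build (form-133-odd n c)
  where
  t : ℕ
  t = proj₁ (from-residue {n} c)
  n≡ : n ≡ 7 ℕ.+ t ℕ.* 24
  n≡ = proj₂ (from-residue {n} c)
  n≡8 : + n ≡ + 8 * + (t ℕ.* 3) + (+ 4 + + 3)
  n≡8 = trans (cong +_ (trans n≡ (lem t))) (cong (_+ + 7) (ℤₚ.pos-* 8 (t ℕ.* 3)))
    where
    lem : ∀ n → 7 ℕ.+ n ℕ.* 24 ≡ 8 ℕ.* (n ℕ.* 3) ℕ.+ 7
    lem = ℕSolver.solve-∀
  good : ∀ {X Y Z} → Odd X → Odd Y → Odd Z → + n ≡ X * X + + 3 * (Y * Y) + + 3 * (Z * Z) → Good133 n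
  good {X} {Y} {Z} oX oY oZ e = step (prime-to-3 {X} {Y} (oX , uX) oY)
    where
    uX : Unit3 X
    uX h = 1mod3⇒∤ {+ n} (residue-∣ 1 (2 ℕ.+ t ℕ.* 8) 3 (trans n≡ (lem t))) (∣-resp (trans (lem′ (X * X) (Y * Y) (Z * Z)) (sym e)) (ℤᵈ.∣m∣n⇒∣m+n {+ 3} {X * X} {(Y * Y + Z * Z) * + 3} (ℤᵈ.∣m⇒∣m*n X h) (divides (Y * Y + Z * Z) refl)))
      where
      lem : ∀ n → 7 ℕ.+ n ℕ.* 24 ≡ 1 ℕ.+ (2 ℕ.+ n ℕ.* 8) ℕ.* 3
      lem = ℕSolver.solve-∀
      lem′ : ∀ x y z → x + (y + z) * + 3 ≡ x + + 3 * y + + 3 * z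
      lem′ = solve-∀
    step : (∃ λ X′ → ∃ λ Y′ → Good X′ × Good Y′ × X′ * X′ + + 3 * (Y′ * Y′) ≡ X * X + + 3 * (Y * Y)) → Good133 n
    step (X′ , Y′ , gX , gY , e′) = step₂ (prime-to-3 {X′} {Z} gX oZ)
      where
      swap : ∀ x y z → x + y + z ≡ x + z + y
      swap = solve-∀
      step₂ : (∃ λ X″ → ∃ λ Z′ → Good X″ × Good Z′ × X″ * X″ + + 3 * (Z′ * Z′) ≡ X′ * X′ + + 3 * (Z * Z)) → Good133 n
      step₂ (X″ , Z′ , gX″ , gZ , e″) = record { X = X″ ; Y = Y′ ; Z = Z′ ; goodX = gX″ ; goodY = gY ; goodZ = gZ
        ; sum≡ = trans e (trans (cong (_+ + 3 * (Z * Z)) (sym e′)) (trans (swap (X′ * X′) (+ 3 * (Y′ * Y′)) (+ 3 * (Z * Z))) (trans (cong (_+ + 3 * (Y′ * Y′)) (sym e″)) (swap (X″ * X″) (+ 3 * (Z′ * Z′)) (+ 3 * (Y′ * Y′)))))) }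
  build : Form133 n → Good133 n
  build (x , y , z , e) = aux (par x) (par y) (par z)
    where
    swap : ∀ x y z → x + y + z ≡ x + z + y
    swap = solve-∀
    lem₄ : ∀ n → 7 ℕ.+ n ℕ.* 24 ≡ 3 ℕ.+ (1 ℕ.+ n ℕ.* 6) ℕ.* 4
    lem₄ = ℕSolver.solve-∀
    res : (a : Par x) (b : Par y) (c : Par z) → + 4 ∣ + 3 - (bit₂ a + + 3 * bit₂ b + + 3 * bit₂ c)
    res a b c = residues (+ 3) {+ n} {x * x} {+ 3 * (y * y)} {+ 3 * (z * z)} (residue-∣ 3 (1 ℕ.+ t ℕ.* 6) 4 (trans n≡ (lem₄ t))) e (square-mod-4 a) (∣-scale (+ 3) (y * y) (bit₂ b) (square-mod-4 b)) (∣-scale (+ 3) (z * z) (bit₂ c) (square-mod-4 c))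
    via : ∀ {x y z} → + n ≡ x * x + + 3 * (y * y) + + 3 * (z * z) → Odd z → (∃ λ x′ → ∃ λ y′ → Odd x′ × Odd y′ × x′ * x′ + + 3 * (y′ * y′) ≡ x * x + + 3 * (y * y)) → Good133 n
    via {z = z} e oz (x′ , y′ , ox , oy , e′) = good {x′} {y′} {z} ox oy oz (trans e (cong (_+ + 3 * (z * z)) (sym e′)))
    aux : Par x → Par y → Par z → Good133 n
    aux (oddℤ k e₁) (oddℤ l e₂) (oddℤ m e₃) = good {x} {y} {z} (k , e₁) (l , e₂) (m , e₃) e
    aux (evenℤ k e₁) (evenℤ l e₂) (oddℤ m e₃) = via {x} {y} {z} e (m , e₃) (let w , f = minus-odd {+ n} {x * x + + 3 * (y * y)} {z} (+ 3) (+ (t ℕ.* 3)) n≡8 e (m , e₃) in both-odd {m = w} k l e₁ e₂ f)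
    aux (evenℤ k e₁) (oddℤ l e₂) (evenℤ m e₃) = via {x} {z} {y} e′ (l , e₂) (let w , f = minus-odd {+ n} {x * x + + 3 * (z * z)} {y} (+ 3) (+ (t ℕ.* 3)) n≡8 e′ (l , e₂) in both-odd {m = w} k m e₁ e₃ f)
      where
      e′ : + n ≡ x * x + + 3 * (z * z) + + 3 * (y * y)
      e′ = trans e (swap (x * x) (+ 3 * (y * y)) (+ 3 * (z * z)))
    aux a@(evenℤ _ _) b@(evenℤ _ _) c@(evenℤ _ _) = ⊥-elim (from-no (+ 4 ℤᵈ.∣? + 3) (res a b c))
    aux a@(evenℤ _ _) b@(oddℤ _ _)  c@(oddℤ _ _)  = ⊥-elim (from-no (+ 4 ℤᵈ.∣? - + 3) (res a b c))
    aux a@(oddℤ _ _)  b@(evenℤ _ _) c@(evenℤ _ _) = ⊥-elim (from-no (+ 4 ℤᵈ.∣? + 2) (res a b c))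
    aux a@(oddℤ _ _)  b@(evenℤ _ _) c@(oddℤ _ _)  = ⊥-elim (from-no (+ 4 ℤᵈ.∣? - + 1) (res a b c))
    aux a@(oddℤ _ _)  b@(oddℤ _ _)  c@(evenℤ _ _) = ⊥-elim (from-no (+ 4 ℤᵈ.∣? - + 1) (res a b c))

record Good193 (n : ℕ) : Set where
  field
    X Y Z : ℤ
    goodX : Good X
    goodY : Good Y
    goodZ : Good Z
    sum≡  : + n ≡ X * X + + 9 * (Y * Y) + + 3 * (Z * Z)

good-193 : ∀ n → n ℕ.% 24 ≡ 13 → Good193 n
good-193 n c = build (form-113 n c)
  where
  t : ℕ
  t = proj₁ (from-residue {n} c)
  n≡ : n ≡ 13 ℕ.+ t ℕ.* 24
  n≡ = proj₂ (from-residue {n} c)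
  n≡8 : + n ≡ + 8 * + (1 ℕ.+ t ℕ.* 3) + (+ 4 + + 1)
  n≡8 = trans (cong +_ (trans n≡ (lem t))) (cong (_+ + 5) (ℤₚ.pos-* 8 (1 ℕ.+ t ℕ.* 3)))
    where
    lem : ∀ n → 13 ℕ.+ n ℕ.* 24 ≡ 8 ℕ.* (1 ℕ.+ n ℕ.* 3) ℕ.+ 5
    lem = ℕSolver.solve-∀
  ordered : ∀ {X Y Z} → Good X → Odd Y → + 3 ∣ Y → Odd Z → + n ≡ X * X + Y * Y + + 3 * (Z * Z) → Good193 n
  ordered {X} {Y} {Z} gX oY 3∣Y oZ e = step (third {Y} 3∣Y oY) (prime-to-3 {X} {Z} gX oZ)
    where
    step : (∃ λ w → Odd w × Y * Y ≡ + 9 * (w * w)) → (∃ λ X′ → ∃ λ Z′ → Good X′ × Good Z′ × X′ * X′ + + 3 * (Z′ * Z′) ≡ X * X + + 3 * (Z * Z)) → Good193 n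
    step (w , ow , ew) (X′ , Z′ , gX′ , gZ′ , e′) = step₂ (prime-to-3 {Z′} {w} gZ′ ow)
      where
      step₂ : (∃ λ Z″ → ∃ λ w′ → Good Z″ × Good w′ × Z″ * Z″ + + 3 * (w′ * w′) ≡ Z′ * Z′ + + 3 * (w * w)) → Good193 n
      step₂ (Z″ , w′ , gZ″ , gw , e″) = record { X = X′ ; Y = w′ ; Z = Z″ ; goodX = gX′ ; goodY = gw ; goodZ = gZ″
        ; sum≡ = trans e (trans (cong (λ y → X * X + y + + 3 * (Z * Z)) ew) (trans (lem₁ (X * X) (w * w) (Z * Z)) (trans (cong (_+ + 9 * (w * w)) (sym e′)) (trans (lem₂ (X′ * X′) (w * w) (Z′ * Z′)) (trans (cong (λ s → X′ * X′ + + 3 * s) (sym e″)) (lem₃ (X′ * X′) (w′ * w′) (Z″ * Z″))))))) }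
        where
        lem₁ : ∀ x w z → x + + 9 * w + + 3 * z ≡ x + + 3 * z + + 9 * w
        lem₁ = solve-∀
        lem₂ : ∀ x w z → x + + 3 * z + + 9 * w ≡ x + + 3 * (z + + 3 * w)
        lem₂ = solve-∀
        lem₃ : ∀ x w z → x + + 3 * (z + + 3 * w) ≡ x + + 9 * w + + 3 * z
        lem₃ = solve-∀
  swap : ∀ x y z → x + y + z ≡ y + x + z
  swap = solve-∀
  good : ∀ {X Y Z} → Odd X → Odd Y → Odd Z → + n ≡ X * X + Y * Y + + 3 * (Z * Z) → Good193 n
  good {X} {Y} {Z} oX oY oZ e = aux (mod-3 X) (mod-3 Y)
    where
    lem₃ : ∀ n → 13 ℕ.+ n ℕ.* 24 ≡ 1 ℕ.+ (4 ℕ.+ n ℕ.* 8) ℕ.* 3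
    lem₃ = ℕSolver.solve-∀
    res : (a : Mod3 X) (b : Mod3 Y) → + 3 ∣ + 1 - (bit₃ a + bit₃ b + 0ℤ)
    res a b = residues (+ 1) {+ n} {X * X} {Y * Y} {+ 3 * (Z * Z)} (residue-∣ 1 (4 ℕ.+ t ℕ.* 8) 3 (trans n≡ (lem₃ t))) e (square-mod-3 a) (square-mod-3 b) (divides (Z * Z) (trans (ℤₚ.+-identityʳ (+ 3 * (Z * Z))) (ℤₚ.*-comm (+ 3) (Z * Z))))
    aux : Mod3 X → Mod3 Y → Good193 n
    aux (unit a) (zero b) = ordered {X} {Y} {Z} (oX , unit-3 {X} a) oY b oZ e
    aux (zero a) (unit b) = ordered {Y} {X} {Z} (oY , unit-3 {Y} b) oX a oZ (trans e (swap (X * X) (Y * Y) (+ 3 * (Z * Z))))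
    aux a@(zero _) b@(zero _) = ⊥-elim (from-no (+ 3 ℤᵈ.∣? + 1) (res a b))
    aux a@(unit _) b@(unit _) = ⊥-elim (from-no (+ 3 ℤᵈ.∣? -1ℤ) (res a b))
  build : Form113 n → Good193 n
  build (x , y , z , e) = aux (par x) (par y) (par z)
    where
    lem₄ : ∀ n → 13 ℕ.+ n ℕ.* 24 ≡ 1 ℕ.+ (3 ℕ.+ n ℕ.* 6) ℕ.* 4
    lem₄ = ℕSolver.solve-∀
    res : (a : Par x) (b : Par y) (c : Par z) → + 4 ∣ + 1 - (bit₂ a + bit₂ b + + 3 * bit₂ c)
    res a b c = residues (+ 1) {+ n} {x * x} {y * y} {+ 3 * (z * z)} (residue-∣ 1 (3 ℕ.+ t ℕ.* 6) 4 (trans n≡ (lem₄ t))) e (square-mod-4 a) (square-mod-4 b) (∣-scale (+ 3) (z * z) (bit₂ c) (square-mod-4 c))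
    via : ∀ {x y z} → + n ≡ y * y + x * x + + 3 * (z * z) → ∀ k l m → x ≡ + 2 * k → z ≡ + 2 * l → y ≡ + 2 * m + 1ℤ → Good193 n
    via {x} {y} {z} e k l m ex ez ey = finish (let w , f = minus-odd {+ n} {x * x + + 3 * (z * z)} {y} 1ℤ (+ (1 ℕ.+ t ℕ.* 3)) n≡8 (trans e (lem (x * x) (y * y) (+ 3 * (z * z)))) (m , ey) in both-odd {m = w} k l ex ez f)
      where
      lem : ∀ x y z → y + x + z ≡ x + z + 1ℤ * y
      lem = solve-∀
      lem′ : ∀ x y z → y + x + z ≡ y + (x + z)
      lem′ = solve-∀
      finish : (∃ λ x′ → ∃ λ z′ → Odd x′ × Odd z′ × x′ * x′ + + 3 * (z′ * z′) ≡ x * x + + 3 * (z * z)) → Good193 n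
      finish (x′ , z′ , ox , oz , e′) = good {y} {x′} {z′} (m , ey) ox oz (trans e (trans (lem′ (x * x) (y * y) (+ 3 * (z * z))) (trans (cong (λ w → y * y + w) (sym e′)) (sym (lem′ (x′ * x′) (y * y) (+ 3 * (z′ * z′)))))))
    aux : Par x → Par y → Par z → Good193 n
    aux (oddℤ k e₁) (oddℤ l e₂) (oddℤ m e₃) = good {x} {y} {z} (k , e₁) (l , e₂) (m , e₃) e
    aux (evenℤ k e₁) (oddℤ l e₂) (evenℤ m e₃) = via {x} {y} {z} (trans e (swap (x * x) (y * y) (+ 3 * (z * z)))) k m l e₁ e₃ e₂
    aux (oddℤ k e₁) (evenℤ l e₂) (evenℤ m e₃) = via {y} {x} {z} e l m k e₂ e₃ e₁
    aux a@(evenℤ _ _) b@(evenℤ _ _) c@(evenℤ _ _) = ⊥-elim (from-no (+ 4 ℤᵈ.∣? + 1) (res a b c))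
    aux a@(evenℤ _ _) b@(evenℤ _ _) c@(oddℤ _ _)  = ⊥-elim (from-no (+ 4 ℤᵈ.∣? - + 2) (res a b c))
    aux a@(evenℤ _ _) b@(oddℤ _ _)  c@(oddℤ _ _)  = ⊥-elim (from-no (+ 4 ℤᵈ.∣? - + 3) (res a b c))
    aux a@(oddℤ _ _)  b@(evenℤ _ _) c@(oddℤ _ _)  = ⊥-elim (from-no (+ 4 ℤᵈ.∣? - + 3) (res a b c))
    aux a@(oddℤ _ _)  b@(oddℤ _ _)  c@(evenℤ _ _) = ⊥-elim (from-no (+ 4 ℤᵈ.∣? - + 1) (res a b c))

-- Universal tuples

cast-72 : ∀ n k → + (72 ℕ.* n ℕ.+ k) ≡ + 36 * (+ 2 * + n) + + k
cast-72 n k = cong (_+ + k) (trans (ℤₚ.pos-* 72 n) (lem (+ n)))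
  where
  lem : ∀ n → + 72 * n ≡ + 36 * (+ 2 * n)
  lem = solve-∀

residue-72 : ∀ n k → (72 ℕ.* n ℕ.+ k) ℕ.% 24 ≡ k ℕ.% 24
residue-72 n k = trans (cong (ℕ._% 24) (lem n k)) (ℕᵐ.[m+kn]%n≡m%n k (n ℕ.* 3) 24)
  where
  lem : ∀ n k → 72 ℕ.* n ℕ.+ k ≡ k ℕ.+ n ℕ.* 3 ℕ.* 24
  lem = ℕSolver.solve-∀

cancel-36 : ∀ {m t k} → + 36 * m + k ≡ + 36 * t + k → m ≡ t
cancel-36 {m} {t} {k} e = ℤₚ.*-cancelˡ-≡ (+ 36) m t (trans (sym (lem (+ 36 * m) k)) (trans (cong (_- k) e) (lem (+ 36 * t) k)))
  where
  lem : ∀ x k → x + k - k ≡ x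
  lem = solve-∀

-- 72 n + c² + 6 = (18 x + c)² + 3 (6 y + 1)² + 3 (6 z + 1)², and similarly below.
tuple-133 : ∀ c → Odd (+ c) → ¬ + 3 ∣ + c → ∀ n → Good133 (72 ℕ.* n ℕ.+ (c ℕ.* c ℕ.+ 6)) → Represents 9 (+ c) 3 (+ 1) 3 (+ 1) n
tuple-133 c oc 3∤c n form = solution (class-18 {X} (+ c) (proj₁ goodX) oc 3∤c nine) (class-6 {Y} (proj₁ goodY) (proj₂ goodY)) (class-6 {Z} (proj₁ goodZ) (proj₂ goodZ))
  where
  open Good133 form
  eq : + 36 * (+ 2 * + n) + (+ c * + c + + 6) ≡ X * X + + 3 * (Y * Y) + + 3 * (Z * Z)
  eq = trans (cong (λ k → + 36 * (+ 2 * + n) + (k + + 6)) (sym (ℤₚ.pos-* c c))) (trans (sym (cast-72 n (c ℕ.* c ℕ.+ 6))) sum≡)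
  nine : + 9 ∣ X * X - + c * + c
  nine = aux (unit3-square {Y} (proj₂ goodY)) (unit3-square {Z} (proj₂ goodZ))
    where
    aux : + 3 ∣ Y * Y - 1ℤ → + 3 ∣ Z * Z - 1ℤ → + 9 ∣ X * X - + c * + c
    aux (divides q e) (divides r f) = divides (+ 8 * + n - q - r) (trans (lem₁ (X * X) (Y * Y) (Z * Z) (+ c * + c)) (trans (cong (λ s → s - (+ c * + c + + 6) - + 3 * (Y * Y - 1ℤ) - + 3 * (Z * Z - 1ℤ)) (sym eq))
        (trans (cong₂ (λ a b → + 36 * (+ 2 * + n) + (+ c * + c + + 6) - (+ c * + c + + 6) - + 3 * a - + 3 * b) e f) (lem₂ (+ n) (+ c * + c + + 6) q r))))
      where
      lem₁ : ∀ x y z c → x - c ≡ x + + 3 * y + + 3 * z - (c + + 6) - + 3 * (y - 1ℤ) - + 3 * (z - 1ℤ)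
      lem₁ = solve-∀
      lem₂ : ∀ n c q r → + 36 * (+ 2 * n) + c - c - + 3 * (q * + 3) - + 3 * (r * + 3) ≡ (+ 8 * n - q - r) * + 9
      lem₂ = solve-∀
  solution : (∃ λ x → (+ 18 * x + + c) * (+ 18 * x + + c) ≡ X * X) → (∃ λ y → (+ 6 * y + 1ℤ) * (+ 6 * y + 1ℤ) ≡ Y * Y) → (∃ λ z → (+ 6 * z + 1ℤ) * (+ 6 * z + 1ℤ) ≡ Z * Z) → Represents 9 (+ c) 3 (+ 1) 3 (+ 1) n
  solution (x , ex) (y , ey) (z , ez) = x , y , z , cancel-36 (trans eq (trans (sym (cong₂ _+_ (cong₂ (λ a b → a + + 3 * b) ex ey) (cong (+ 3 *_) ez))) (lem (+ c) x y z)))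
    where
    lem : ∀ c x y z → (+ 18 * x + c) * (+ 18 * x + c) + + 3 * ((+ 6 * y + 1ℤ) * (+ 6 * y + 1ℤ)) + + 3 * ((+ 6 * z + 1ℤ) * (+ 6 * z + 1ℤ))
        ≡ + 36 * (x * (+ 9 * x + c) + y * (+ 3 * y + + 1) + z * (+ 3 * z + + 1)) + (c * c + + 6)
    lem = solve-∀

module Tuples193 (c : ℕ) (oc : Odd (+ c)) (3∤c : ¬ + 3 ∣ + c) (n : ℕ) (form : Good193 (72 ℕ.* n ℕ.+ (c ℕ.* c ℕ.+ 12))) where
  open Good193 form
  eq : + 36 * (+ 2 * + n) + (+ c * + c + + 12) ≡ X * X + + 9 * (Y * Y) + + 3 * (Z * Z)
  eq = trans (cong (λ k → + 36 * (+ 2 * + n) + (k + + 12)) (sym (ℤₚ.pos-* c c))) (trans (sym (cast-72 n (c ℕ.* c ℕ.+ 12))) sum≡)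
  nine : + 9 ∣ X * X - + c * + c
  nine = aux (unit3-square {Z} (proj₂ goodZ))
    where
    aux : + 3 ∣ Z * Z - 1ℤ → + 9 ∣ X * X - + c * + c
    aux (divides q e) = divides (+ 8 * + n + 1ℤ - Y * Y - q) (trans (lem₁ (X * X) (Y * Y) (Z * Z) (+ c * + c)) (trans (cong (λ s → s - (+ c * + c + + 12) + + 9 - + 9 * (Y * Y) - + 3 * (Z * Z - 1ℤ)) (sym eq))
        (trans (cong (λ a → + 36 * (+ 2 * + n) + (+ c * + c + + 12) - (+ c * + c + + 12) + + 9 - + 9 * (Y * Y) - + 3 * a) e) (lem₂ (+ n) (+ c * + c + + 12) q (Y * Y)))))
      where
      lem₁ : ∀ x y z c → x - c ≡ x + + 9 * y + + 3 * z - (c + + 12) + + 9 - + 9 * y - + 3 * (z - 1ℤ)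
      lem₁ = solve-∀
      lem₂ : ∀ n c q y → + 36 * (+ 2 * n) + c - c + + 9 - + 9 * y - + 3 * (q * + 3) ≡ (+ 8 * n + 1ℤ - y - q) * + 9
      lem₂ = solve-∀
  rootX : ∃ λ x → (+ 18 * x + + c) * (+ 18 * x + + c) ≡ X * X
  rootX = class-18 {X} (+ c) (proj₁ goodX) oc 3∤c nine
  rootY : ∃ λ y → (+ 6 * y + 1ℤ) * (+ 6 * y + 1ℤ) ≡ Y * Y
  rootY = class-6 {Y} (proj₁ goodY) (proj₂ goodY)
  rootZ : ∃ λ z → (+ 6 * z + 1ℤ) * (+ 6 * z + 1ℤ) ≡ Z * Z
  rootZ = class-6 {Z} (proj₁ goodZ) (proj₂ goodZ)

  triangular : Represents 9 (+ c) 4 (+ 2) 3 (+ 1) n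
  triangular = solution rootX (class-4 {Y} (proj₁ goodY)) rootZ
    where
    solution : (∃ λ x → (+ 18 * x + + c) * (+ 18 * x + + c) ≡ X * X) → (∃ λ y → (+ 4 * y + 1ℤ) * (+ 4 * y + 1ℤ) ≡ Y * Y) → (∃ λ z → (+ 6 * z + 1ℤ) * (+ 6 * z + 1ℤ) ≡ Z * Z) → Represents 9 (+ c) 4 (+ 2) 3 (+ 1) n
    solution (x , ex) (y , ey) (z , ez) = x , y , z , cancel-36 (trans eq (trans (sym (cong₂ _+_ (cong₂ (λ a b → a + + 9 * b) ex ey) (cong (+ 3 *_) ez))) (lem (+ c) x y z)))
      where
      lem : ∀ c x y z → (+ 18 * x + c) * (+ 18 * x + c) + + 9 * ((+ 4 * y + 1ℤ) * (+ 4 * y + 1ℤ)) + + 3 * ((+ 6 * z + 1ℤ) * (+ 6 * z + 1ℤ))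
          ≡ + 36 * (x * (+ 9 * x + c) + y * (+ 4 * y + + 2) + z * (+ 3 * z + + 1)) + (c * c + + 12)
      lem = solve-∀

  nonagonal : Represents 9 (+ c) 9 (+ 3) 3 (+ 1) n
  nonagonal = solution rootX rootY rootZ
    where
    solution : (∃ λ x → (+ 18 * x + + c) * (+ 18 * x + + c) ≡ X * X) → (∃ λ y → (+ 6 * y + 1ℤ) * (+ 6 * y + 1ℤ) ≡ Y * Y) → (∃ λ z → (+ 6 * z + 1ℤ) * (+ 6 * z + 1ℤ) ≡ Z * Z) → Represents 9 (+ c) 9 (+ 3) 3 (+ 1) n
    solution (x , ex) (y , ey) (z , ez) = x , y , z , cancel-36 (trans eq (trans (sym (cong₂ _+_ (cong₂ (λ a b → a + + 9 * b) ex ey) (cong (+ 3 *_) ez))) (lem (+ c) x y z)))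
      where
      lem : ∀ c x y z → (+ 18 * x + c) * (+ 18 * x + c) + + 9 * ((+ 6 * y + 1ℤ) * (+ 6 * y + 1ℤ)) + + 3 * ((+ 6 * z + 1ℤ) * (+ 6 * z + 1ℤ))
          ≡ + 36 * (x * (+ 9 * x + c) + y * (+ 9 * y + + 3) + z * (+ 3 * z + + 1)) + (c * c + + 12)
      lem = solve-∀

represents-swap : ∀ {a₁ a₂ b₁ b₂ c₁ c₂ n} → Represents a₁ a₂ b₁ b₂ c₁ c₂ n → Represents b₁ b₂ a₁ a₂ c₁ c₂ n
represents-swap {a₁} {a₂} {b₁} {b₂} {c₁} {c₂} (x , y , z , e) = y , x , z , trans e (cong (_+ twiceTerm (+ c₁) c₂ z) (ℤₚ.+-comm (twiceTerm (+ a₁) a₂ x) (twiceTerm (+ b₁) b₂ y)))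

data Mod5 (z : ℤ) : Set where
  zero : + 5 ∣ z → Mod5 z
  pos  : + 5 ∣ z * z - 1ℤ → Mod5 z
  neg  : + 5 ∣ z * z - -1ℤ → Mod5 z

mod-5 : ∀ z → Mod5 z
mod-5 z = aux (z ℤᵐ.%ℕ 5) {z ℤᵐ./ℕ 5} (ℤᵐ.n%ℕd<d z 5) (ℤᵐ.a≡a%ℕn+[a/ℕn]*n z 5)
  where
  lem : ∀ r k t → (r + t * + 5) * (r + t * + 5) - (r * r - k * + 5) ≡ (k + + 2 * r * t + + 5 * (t * t)) * + 5
  lem = solve-∀
  aux : ∀ r {t} → r ℕ.< 5 → z ≡ + r + t * + 5 → Mod5 z
  aux 0 {t} _ refl = zero (divides t (ℤₚ.+-identityˡ (t * + 5)))
  aux 1 {t} _ refl = pos (divides (0ℤ + + 2 * + 1 * t + + 5 * (t * t)) (lem (+ 1) 0ℤ t))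
  aux 2 {t} _ refl = neg (divides (+ 1 + + 2 * + 2 * t + + 5 * (t * t)) (lem (+ 2) (+ 1) t))
  aux 3 {t} _ refl = neg (divides (+ 2 + + 2 * + 3 * t + + 5 * (t * t)) (lem (+ 3) (+ 2) t))
  aux 4 {t} _ refl = pos (divides (+ 3 + + 2 * + 4 * t + + 5 * (t * t)) (lem (+ 4) (+ 3) t))
  aux (suc (suc (suc (suc (suc r))))) (s≤s (s≤s (s≤s (s≤s (s≤s ())))))

5∣* : ∀ {k x} → ¬ + 5 ∣ k → + 5 ∣ k * x → + 5 ∣ x
5∣* {k} {x} h d with prime∣*⇒ {5} {k} {x} prime[5] d
... | inj₁ e = ⊥-elim (h e)
... | inj₂ e = e

TimesFive : ℤ → ℤ → Set
TimesFive u v = ∃ λ y → ∃ λ z → y * y + z * z ≡ + 5 * (u * u + v * v) × ¬ + 5 ∣ y × ¬ + 5 ∣ z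

-- Multiply u + i v by 2 ± i; common factors 5 are traded for 3 ± 4 i.
times-five : ∀ u v → Odd u → TimesFive u v
times-five u v ou = go u v ou (<-wellFounded (abs u))
  where
  go : ∀ u v → Odd u → Acc ℕ._<_ (abs u) → TimesFive u v
  go u v (k , u≡) (acc rec) = aux (+ 5 ℤᵈ.∣? + 2 * u - v) (+ 5 ℤᵈ.∣? + 2 * u + v)
    where
    aux : Dec (+ 5 ∣ + 2 * u - v) → Dec (+ 5 ∣ + 2 * u + v) → TimesFive u v
    aux (no h) _ = + 2 * u - v , u + + 2 * v , lem u v , h , λ d → h (∣-resp (lem′ u v) (ℤᵈ.∣m∣n⇒∣m-n {+ 5} {+ 2 * (u + + 2 * v)} {v * + 5} (ℤᵈ.∣n⇒∣m*n (+ 2) d) (divides v refl)))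
      where
      lem : ∀ u v → (+ 2 * u - v) * (+ 2 * u - v) + (u + + 2 * v) * (u + + 2 * v) ≡ + 5 * (u * u + v * v)
      lem = solve-∀
      lem′ : ∀ u v → + 2 * (u + + 2 * v) - v * + 5 ≡ + 2 * u - v
      lem′ = solve-∀
    aux (yes _) (no h) = + 2 * u + v , u - + 2 * v , lem u v , h , λ d → h (∣-resp (lem′ u v) (ℤᵈ.∣m∣n⇒∣m+n {+ 5} {+ 2 * (u - + 2 * v)} {v * + 5} (ℤᵈ.∣n⇒∣m*n (+ 2) d) (divides v refl)))
      where
      lem : ∀ u v → (+ 2 * u + v) * (+ 2 * u + v) + (u - + 2 * v) * (u - + 2 * v) ≡ + 5 * (u * u + v * v)
      lem = solve-∀
      lem′ : ∀ u v → + 2 * (u - + 2 * v) + v * + 5 ≡ + 2 * u + v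
      lem′ = solve-∀
    aux (yes d₁) (yes d₂) = descend (5∣* {+ 4} {u} (from-no (+ 5 ℤᵈ.∣? + 4)) (∣-resp (lem u v) (ℤᵈ.∣m∣n⇒∣m+n d₁ d₂))) (5∣* {+ 2} {v} (from-no (+ 5 ℤᵈ.∣? + 2)) (∣-resp (lem′ u v) (ℤᵈ.∣m∣n⇒∣m-n d₂ d₁)))
      where
      lem : ∀ u v → + 2 * u - v + (+ 2 * u + v) ≡ + 4 * u
      lem = solve-∀
      lem′ : ∀ u v → + 2 * u + v - (+ 2 * u - v) ≡ + 2 * v
      lem′ = solve-∀
      descend : + 5 ∣ u → + 5 ∣ v → TimesFive u v
      descend (divides s us) (divides t vt) = lift (go s t (k - + 2 * s , trans (lem₁ s) (trans (cong (_- + 4 * s) (trans (sym us) u≡)) (lem₂ k s))) (rec s<u))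
        where
        lem₁ : ∀ s → s ≡ s * + 5 - + 4 * s
        lem₁ = solve-∀
        lem₂ : ∀ k s → + 2 * k + 1ℤ - + 4 * s ≡ + 2 * (k - + 2 * s) + 1ℤ
        lem₂ = solve-∀
        s≢0 : abs s ≢ 0
        s≢0 e = from-no (+ 2 ℤᵈ.∣? + 1) (divides (- k) (trans (lem₃ k) (trans (cong (_- k * + 2) (trans (sym u≡) (trans us (cong (_* + 5) (ℤₚ.∣i∣≡0⇒i≡0 {s} e))))) (lem₄ k))))
          where
          lem₃ : ∀ k → 1ℤ ≡ + 2 * k + 1ℤ - k * + 2
          lem₃ = solve-∀
          lem₄ : ∀ k → 0ℤ * + 5 - k * + 2 ≡ - k * + 2
          lem₄ = solve-∀
        s<u : abs s ℕ.< abs u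
        s<u = subst (abs s ℕ.<_) (sym (trans (cong abs us) (ℤₚ.abs-* s (+ 5)))) (ℕₚ.m<m*n (abs s) 5 {{ℕ.≢-nonZero s≢0}} (s<s z<s))
        lift : TimesFive s t → TimesFive u v
        lift (y , z , e , 5∤y , 5∤z) = choose-sign (+ 5 ℤᵈ.∣? + 3 * y + + 4 * z)
          where
          norm : + 25 * (y * y + z * z) ≡ + 5 * (u * u + v * v)
          norm = trans (cong (+ 25 *_) e) (trans (lem₅ s t) (sym (cong₂ (λ u v → + 5 * (u * u + v * v)) us vt)))
            where
            lem₅ : ∀ s t → + 25 * (+ 5 * (s * s + t * t)) ≡ + 5 * (s * + 5 * (s * + 5) + t * + 5 * (t * + 5))
            lem₅ = solve-∀
          choose-sign : Dec (+ 5 ∣ + 3 * y + + 4 * z) → TimesFive u v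
          choose-sign (no h) = + 3 * y + + 4 * z , + 4 * y - + 3 * z , trans (lem₆ y z) norm , h ,
            λ d → h (5∣* {+ 2} {+ 3 * y + + 4 * z} (from-no (+ 5 ℤᵈ.∣? + 2)) (∣-resp (lem₇ y z) (ℤᵈ.∣m∣n⇒∣m-n {+ 5} {(+ 2 * y + z) * + 5} (divides (+ 2 * y + z) refl) d)))
            where
            lem₆ : ∀ y z → (+ 3 * y + + 4 * z) * (+ 3 * y + + 4 * z) + (+ 4 * y - + 3 * z) * (+ 4 * y - + 3 * z) ≡ + 25 * (y * y + z * z)
            lem₆ = solve-∀
            lem₇ : ∀ y z → (+ 2 * y + z) * + 5 - (+ 4 * y - + 3 * z) ≡ + 2 * (+ 3 * y + + 4 * z)
            lem₇ = solve-∀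
          choose-sign (yes d₀) = + 3 * y - + 4 * z , + 4 * y + + 3 * z , trans (lem₆ y z) norm , h ,
            λ d → h (5∣* {+ 2} {+ 3 * y - + 4 * z} (from-no (+ 5 ℤᵈ.∣? + 2)) (∣-resp (lem₇ y z) (ℤᵈ.∣m∣n⇒∣m-n {+ 5} {(+ 2 * y - z) * + 5} (divides (+ 2 * y - z) refl) d)))
            where
            lem₆ : ∀ y z → (+ 3 * y - + 4 * z) * (+ 3 * y - + 4 * z) + (+ 4 * y + + 3 * z) * (+ 4 * y + + 3 * z) ≡ + 25 * (y * y + z * z)
            lem₆ = solve-∀
            lem₇ : ∀ y z → (+ 2 * y - z) * + 5 - (+ 4 * y + + 3 * z) ≡ + 2 * (+ 3 * y - + 4 * z)
            lem₇ = solve-∀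
            lem₈ : ∀ y z → + 3 * y + + 4 * z + (+ 3 * y - + 4 * z) ≡ + 6 * y
            lem₈ = solve-∀
            h : ¬ + 5 ∣ + 3 * y - + 4 * z
            h d = 5∤y (5∣* {+ 6} {y} (from-no (+ 5 ℤᵈ.∣? + 6)) (∣-resp (lem₈ y z) (ℤᵈ.∣m∣n⇒∣m+n d₀ d)))

Tenths : ℤ → ℤ → Set
Tenths u v = ∃ λ y → ∃ λ z → (+ 10 * y + + 3) * (+ 10 * y + + 3) + (+ 10 * z + + 1) * (+ 10 * z + + 1) ≡ + 5 * (u * u + v * v)

tenths : ∀ u v → Odd u → Odd v → Tenths u v
tenths u v ou ov = start (times-five u v ou)
  where
  start : TimesFive u v → Tenths u v
  start (y , z , e , 5∤y , 5∤z) = sort (par y) (par z) (mod-5 y) (mod-5 z)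
    where
    residue-sum : ∀ b c m → + m ∣ y * y - b → + m ∣ z * z - c → + m ∣ (y * y + z * z) - (b + c)
    residue-sum b c m d f = ∣-resp (lem (y * y) (z * z) b c) (ℤᵈ.∣m∣n⇒∣m+n d f)
      where
      lem : ∀ y z b c → y - b + (z - c) ≡ (y + z) - (b + c)
      lem = solve-∀
    sum-5 : ∀ b c → + 5 ∣ y * y - b → + 5 ∣ z * z - c → + 5 ∣ b + c
    sum-5 b c d f = ∣-resp (trans (cong (_- (y * y + z * z - (b + c))) (sym e)) (lem (y * y + z * z) (b + c))) (ℤᵈ.∣m∣n⇒∣m-n {+ 5} {+ 5 * (u * u + v * v)} (divides (u * u + v * v) (ℤₚ.*-comm (+ 5) (u * u + v * v))) (residue-sum b c 5 d f))
      where
      lem : ∀ s b → s - (s - b) ≡ b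
      lem = solve-∀
    sum-4 : (p : Par y) (q : Par z) → + 4 ∣ + 2 - (bit₂ p + bit₂ q)
    sum-4 p q = residue ou ov
      where
      residue : Odd u → Odd v → + 4 ∣ + 2 - (bit₂ p + bit₂ q)
      residue (a , refl) (b , refl) = ∣-resp (trans (cong (λ s → s - (bit₂ p + bit₂ q) - (s - + 2)) e) (lem (+ 5 * ((+ 2 * a + 1ℤ) * (+ 2 * a + 1ℤ) + (+ 2 * b + 1ℤ) * (+ 2 * b + 1ℤ))) (bit₂ p + bit₂ q)))
        (ℤᵈ.∣m∣n⇒∣m-n (residue-sum (bit₂ p) (bit₂ q) 4 (square-mod-4 p) (square-mod-4 q)) (∣-resp (cong (_- + 2) (sym e)) (divides (+ 5 * (a * a + a + b * b + b) + + 2) (lem′ a b))))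
        where
        lem : ∀ s b → s - b - (s - + 2) ≡ + 2 - b
        lem = solve-∀
        lem′ : ∀ a b → + 5 * ((+ 2 * a + 1ℤ) * (+ 2 * a + 1ℤ) + (+ 2 * b + 1ℤ) * (+ 2 * b + 1ℤ)) - + 2 ≡ (+ 5 * (a * a + a + b * b + b) + + 2) * + 4
        lem′ = solve-∀
    odd-3 : Odd (+ 3)
    odd-3 = 1ℤ , refl
    finish : ∀ {y z} → Odd y → Odd z → + 5 ∣ y * y - -1ℤ → + 5 ∣ z * z - 1ℤ → y * y + z * z ≡ + 5 * (u * u + v * v) → Tenths u v
    finish {y} {z} oy oz d f e = collect (signed-class 10 (+ 3) y (class-2p 5 prime[5] coprime-5-2 oy odd-3 (∣-resp (lem (y * y)) (ℤᵈ.∣m∣n⇒∣m-n d (divides (+ 2) refl)))))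
                                         (signed-class 10 1ℤ z (class-2p 5 prime[5] coprime-5-2 oz odd-1 f))
      where
      lem : ∀ y → y - -1ℤ - + 10 ≡ y - + 3 * + 3
      lem = solve-∀
      collect : (∃ λ x → (+ 10 * x + + 3) * (+ 10 * x + + 3) ≡ y * y) → (∃ λ x → (+ 10 * x + 1ℤ) * (+ 10 * x + 1ℤ) ≡ z * z) → Tenths u v
      collect (y′ , ey) (z′ , ez) = y′ , z′ , trans (cong₂ _+_ ey ez) e
    sort : Par y → Par z → Mod5 y → Mod5 z → Tenths u v
    sort (oddℤ k ek) (oddℤ l el) (neg d) (pos f) = finish {y} {z} (k , ek) (l , el) d f e
    sort (oddℤ k ek) (oddℤ l el) (pos d) (neg f) = finish {z} {y} (l , el) (k , ek) f d (trans (ℤₚ.+-comm (z * z) (y * y)) e)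
    sort _ _ (zero d) _ = ⊥-elim (5∤y d)
    sort _ _ _ (zero d) = ⊥-elim (5∤z d)
    sort _ _ (pos d) (pos f) = ⊥-elim (from-no (+ 5 ℤᵈ.∣? + 2) (sum-5 1ℤ 1ℤ d f))
    sort _ _ (neg d) (neg f) = ⊥-elim (from-no (+ 5 ℤᵈ.∣? - + 2) (sum-5 -1ℤ -1ℤ d f))
    sort p@(evenℤ _ _) q@(evenℤ _ _) _ _ = ⊥-elim (from-no (+ 4 ℤᵈ.∣? + 2) (sum-4 p q))
    sort p@(evenℤ _ _) q@(oddℤ _ _)  _ _ = ⊥-elim (from-no (+ 4 ℤᵈ.∣? + 1) (sum-4 p q))
    sort p@(oddℤ _ _)  q@(evenℤ _ _) _ _ = ⊥-elim (from-no (+ 4 ℤᵈ.∣? + 1) (sum-4 p q))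

-- Odd u, v can be written as y ± 2 z with y odd, after changing the sign of v if necessary.
half-sum : ∀ u v → Odd u → Odd v → ∃ λ y → ∃ λ z → Odd y × u * u + v * v ≡ + 2 * (y * y) + + 8 * (z * z)
half-sum u v (a , refl) (b , refl) = aux (par (a - b))
  where
  aux : Par (a - b) → ∃ λ y → ∃ λ z → Odd y × (+ 2 * a + 1ℤ) * (+ 2 * a + 1ℤ) + (+ 2 * b + 1ℤ) * (+ 2 * b + 1ℤ) ≡ + 2 * (y * y) + + 8 * (z * z)
  aux (evenℤ k e) = + 2 * (b + k) + 1ℤ , k , (b + k , refl) , trans (cong (λ a → (+ 2 * a + 1ℤ) * (+ 2 * a + 1ℤ) + (+ 2 * b + 1ℤ) * (+ 2 * b + 1ℤ)) (trans (lem a b) (cong (λ d → b + d) e))) (lem′ b k)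
    where
    lem : ∀ a b → a ≡ b + (a - b)
    lem = solve-∀
    lem′ : ∀ b k → (+ 2 * (b + + 2 * k) + 1ℤ) * (+ 2 * (b + + 2 * k) + 1ℤ) + (+ 2 * b + 1ℤ) * (+ 2 * b + 1ℤ) ≡ + 2 * ((+ 2 * (b + k) + 1ℤ) * (+ 2 * (b + k) + 1ℤ)) + + 8 * (k * k)
    lem′ = solve-∀
  aux (oddℤ k e) = + 2 * k + 1ℤ , b + k + 1ℤ , (k , refl) , trans (cong (λ a → (+ 2 * a + 1ℤ) * (+ 2 * a + 1ℤ) + (+ 2 * b + 1ℤ) * (+ 2 * b + 1ℤ)) (trans (lem a b) (cong (λ d → b + d) e))) (lem′ b k)
    where
    lem : ∀ a b → a ≡ b + (a - b)
    lem = solve-∀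
    lem′ : ∀ b k → (+ 2 * (b + (+ 2 * k + 1ℤ)) + 1ℤ) * (+ 2 * (b + (+ 2 * k + 1ℤ)) + 1ℤ) + (+ 2 * b + 1ℤ) * (+ 2 * b + 1ℤ) ≡ + 2 * ((+ 2 * k + 1ℤ) * (+ 2 * k + 1ℤ)) + + 8 * ((b + k + 1ℤ) * (b + k + 1ℤ))
    lem′ = solve-∀

module TuplesSquares (c : ℕ) (oc : Odd (+ c)) (3∤c : ¬ + 3 ∣ + c) (n : ℕ) (form : OddSquares (72 ℕ.* n ℕ.+ (c ℕ.* c ℕ.+ 18))) where
  open OddSquares form
  eq : + 36 * (+ 2 * + n) + (+ c * + c + + 18) ≡ X * X + + 9 * (U * U + V * V)
  eq = trans (cong (λ k → + 36 * (+ 2 * + n) + (k + + 18)) (sym (ℤₚ.pos-* c c))) (trans (sym (cast-72 n (c ℕ.* c ℕ.+ 18))) sum≡)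
  nine : + 9 ∣ X * X - + c * + c
  nine = divides (+ 8 * + n + + 2 - (U * U + V * V)) (trans (lem₁ (X * X) (U * U + V * V) (+ c * + c)) (trans (cong (λ s → s - (+ c * + c + + 18) + + 18 - + 9 * (U * U + V * V)) (sym eq)) (lem₂ (+ n) (+ c * + c + + 18) (U * U + V * V))))
    where
    lem₁ : ∀ x w c → x - c ≡ x + + 9 * w - (c + + 18) + + 18 - + 9 * w
    lem₁ = solve-∀
    lem₂ : ∀ n c w → + 36 * (+ 2 * n) + c - c + + 18 - + 9 * w ≡ (+ 8 * n + + 2 - w) * + 9
    lem₂ = solve-∀
  rootX : ∃ λ x → (+ 18 * x + + c) * (+ 18 * x + + c) ≡ X * X
  rootX = class-18 {X} (+ c) (proj₁ good) oc 3∤c nine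

  triangular : Represents 9 (+ c) 4 (+ 2) 4 (+ 2) n
  triangular = solution rootX (class-4 {U} oddU) (class-4 {V} oddV)
    where
    solution : (∃ λ x → (+ 18 * x + + c) * (+ 18 * x + + c) ≡ X * X) → (∃ λ y → (+ 4 * y + 1ℤ) * (+ 4 * y + 1ℤ) ≡ U * U) → (∃ λ z → (+ 4 * z + 1ℤ) * (+ 4 * z + 1ℤ) ≡ V * V) → Represents 9 (+ c) 4 (+ 2) 4 (+ 2) n
    solution (x , ex) (y , ey) (z , ez) = x , y , z , cancel-36 (trans eq (trans (sym (cong₂ (λ a b → a + + 9 * b) ex (cong₂ _+_ ey ez))) (lem (+ c) x y z)))
      where
      lem : ∀ c x y z → (+ 18 * x + c) * (+ 18 * x + c) + + 9 * ((+ 4 * y + 1ℤ) * (+ 4 * y + 1ℤ) + (+ 4 * z + 1ℤ) * (+ 4 * z + 1ℤ))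
          ≡ + 36 * (x * (+ 9 * x + c) + y * (+ 4 * y + + 2) + z * (+ 4 * z + + 2)) + (c * c + + 18)
      lem = solve-∀

  square : Represents 9 (+ c) 8 (+ 4) 2 (+ 0) n
  square = solution rootX (half-sum U V oddU oddV)
    where
    solution : (∃ λ x → (+ 18 * x + + c) * (+ 18 * x + + c) ≡ X * X) → (∃ λ y → ∃ λ z → Odd y × U * U + V * V ≡ + 2 * (y * y) + + 8 * (z * z)) → Represents 9 (+ c) 8 (+ 4) 2 (+ 0) n
    solution (x , ex) (Y , z , oY , e) = inner (class-4 {Y} oY)
      where
      inner : (∃ λ y → (+ 4 * y + 1ℤ) * (+ 4 * y + 1ℤ) ≡ Y * Y) → Represents 9 (+ c) 8 (+ 4) 2 (+ 0) n
      inner (y , ey) = x , y , z , cancel-36 (trans eq (trans (sym (cong₂ (λ a b → a + + 9 * b) ex (trans (cong (λ s → + 2 * s + + 8 * (z * z)) ey) (sym e)))) (lem (+ c) x y z)))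
        where
        lem : ∀ c x y z → (+ 18 * x + c) * (+ 18 * x + c) + + 9 * (+ 2 * ((+ 4 * y + 1ℤ) * (+ 4 * y + 1ℤ)) + + 8 * (z * z))
            ≡ + 36 * (x * (+ 9 * x + c) + y * (+ 8 * y + + 4) + z * (+ 2 * z + + 0)) + (c * c + + 18)
        lem = solve-∀

  pentagonal : Represents 9 (+ c) 5 (+ 3) 5 (+ 1) n
  pentagonal = solution rootX (tenths U V oddU oddV)
    where
    solution : (∃ λ x → (+ 18 * x + + c) * (+ 18 * x + + c) ≡ X * X) → Tenths U V → Represents 9 (+ c) 5 (+ 3) 5 (+ 1) n
    solution (x , ex) (y , z , e) = x , y , z , cancel-36 (ℤₚ.*-cancelˡ-≡ (+ 5) _ _ (trans (cong (+ 5 *_) eq) (trans (distrib (X * X) (U * U + V * V)) (trans (sym (cong₂ (λ a b → + 5 * a + + 9 * b) ex e)) (lem (+ c) x y z)))))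
      where
      distrib : ∀ x w → + 5 * (x + + 9 * w) ≡ + 5 * x + + 9 * (+ 5 * w)
      distrib = solve-∀
      lem : ∀ c x y z → + 5 * ((+ 18 * x + c) * (+ 18 * x + c)) + + 9 * ((+ 10 * y + + 3) * (+ 10 * y + + 3) + (+ 10 * z + + 1) * (+ 10 * z + + 1))
          ≡ + 5 * (+ 36 * (x * (+ 9 * x + c) + y * (+ 5 * y + + 3) + z * (+ 5 * z + + 1)) + (c * c + + 18))
      lem = solve-∀

tuples-193 : ∀ c → Odd (+ c) → ¬ + 3 ∣ + c → (c ℕ.* c ℕ.+ 12) ℕ.% 24 ≡ 13 →
  ∀ n → Represents 9 (+ c) 4 (+ 2) 3 (+ 1) n × Represents 9 (+ c) 9 (+ 3) 3 (+ 1) n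
tuples-193 c oc 3∤c h n = triangular , nonagonal
  where open Tuples193 c oc 3∤c n (good-193 (72 ℕ.* n ℕ.+ (c ℕ.* c ℕ.+ 12)) (trans (residue-72 n (c ℕ.* c ℕ.+ 12)) h))

tuples-squares : ∀ c → Odd (+ c) → ¬ + 3 ∣ + c → (c ℕ.* c ℕ.+ 18) ℕ.% 24 ≡ 19 →
  ∀ n → Represents 9 (+ c) 4 (+ 2) 4 (+ 2) n × Represents 9 (+ c) 8 (+ 4) 2 (+ 0) n × Represents 9 (+ c) 5 (+ 3) 5 (+ 1) n
tuples-squares c oc 3∤c h n = triangular , square , pentagonal
  where open TuplesSquares c oc 3∤c n (odd-squares (72 ℕ.* n ℕ.+ (c ℕ.* c ℕ.+ 18)) (trans (residue-72 n (c ℕ.* c ℕ.+ 18)) h))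

tuple-10 : ∀ n → Represents 10 (+ 6) 10 (+ 2) 6 (+ 4) n
tuple-10 n = start (form-133-even n)
  where
  eq₀ : + (2 ℕ.* (5 ℕ.+ n ℕ.* 6)) ≡ + 10 + + 12 * + n
  eq₀ = trans (cong +_ (lem n)) (cong (λ w → + 10 + w) (ℤₚ.pos-* 12 n))
    where
    lem : ∀ n → 2 ℕ.* (5 ℕ.+ n ℕ.* 6) ≡ 10 ℕ.+ 12 ℕ.* n
    lem = ℕSolver.solve-∀
  start : Form133 (2 ℕ.* (5 ℕ.+ n ℕ.* 6)) → Represents 10 (+ 6) 10 (+ 2) 6 (+ 4) n
  start (X , A , B , e) = aux (par X) (par A) (par B)
    where
    eq : + 10 + + 12 * + n ≡ X * X + + 3 * (A * A) + + 3 * (B * B)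
    eq = trans (sym eq₀) e
    res : (a : Par X) (b : Par A) (c : Par B) → + 4 ∣ + 2 - (bit₂ a + + 3 * bit₂ b + + 3 * bit₂ c)
    res a b c = residues (+ 2) {+ 10 + + 12 * + n} {X * X} {+ 3 * (A * A)} {+ 3 * (B * B)} (divides (+ 2 + + 3 * + n) (lem (+ n))) eq (square-mod-4 a) (∣-scale (+ 3) (A * A) (bit₂ b) (square-mod-4 b)) (∣-scale (+ 3) (B * B) (bit₂ c) (square-mod-4 c))
      where
      lem : ∀ n → + 10 + + 12 * n - + 2 ≡ (+ 2 + + 3 * n) * + 4
      lem = solve-∀
    main : ∀ W → X ≡ + 2 * W → Odd A → Odd B → Represents 10 (+ 6) 10 (+ 2) 6 (+ 4) n
    main W refl oA oB = solution (tenths A B oA oB) (signed-class 3 1ℤ W (prime-square-roots 3 prime[3] {W} {1ℤ} (unit3-square {W} uW)))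
      where
      uW : Unit3 W
      uW h = 1mod3⇒∤ {+ 10 + + 12 * + n} (divides (+ 3 + + 4 * + n) (lem₁ (+ n))) (∣-resp (trans (lem₂ W (A * A) (B * B)) (sym eq)) (ℤᵈ.∣m∣n⇒∣m+n {+ 3} {W * (+ 4 * W)} {(A * A + B * B) * + 3} (ℤᵈ.∣m⇒∣m*n (+ 4 * W) h) (divides (A * A + B * B) refl)))
        where
        lem₁ : ∀ n → + 10 + + 12 * n - 1ℤ ≡ (+ 3 + + 4 * n) * + 3
        lem₁ = solve-∀
        lem₂ : ∀ w a b → w * (+ 4 * w) + (a + b) * + 3 ≡ + 2 * w * (+ 2 * w) + + 3 * a + + 3 * b
        lem₂ = solve-∀
      solution : Tenths A B → (∃ λ z → (+ 3 * z + 1ℤ) * (+ 3 * z + 1ℤ) ≡ W * W) → Represents 10 (+ 6) 10 (+ 2) 6 (+ 4) n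
      solution (x , y , exy) (z , ez) = x , y , z , ℤₚ.*-cancelˡ-≡ (+ 30) _ _ (trans (lem₃ (+ n)) (trans (cong (λ s → + 5 * s - + 50) eq) (trans (lem₄ (W) (A * A) (B * B)) (trans (sym (cong₂ (λ s t → + 3 * s + + 20 * t - + 50) exy ez)) (lem₅ x y z)))))
        where
        lem₃ : ∀ n → + 30 * (+ 2 * n) ≡ + 5 * (+ 10 + + 12 * n) - + 50
        lem₃ = solve-∀
        lem₄ : ∀ w a b → + 5 * (+ 2 * w * (+ 2 * w) + + 3 * a + + 3 * b) - + 50 ≡ + 3 * (+ 5 * (a + b)) + + 20 * (w * w) - + 50
        lem₄ = solve-∀
        lem₅ : ∀ x y z → + 3 * ((+ 10 * x + + 3) * (+ 10 * x + + 3) + (+ 10 * y + + 1) * (+ 10 * y + + 1)) + + 20 * ((+ 3 * z + 1ℤ) * (+ 3 * z + 1ℤ)) - + 50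
             ≡ + 30 * (x * (+ 10 * x + + 6) + y * (+ 10 * y + + 2) + z * (+ 6 * z + + 4))
        lem₅ = solve-∀
    aux : Par X → Par A → Par B → Represents 10 (+ 6) 10 (+ 2) 6 (+ 4) n
    aux (evenℤ W eW) (oddℤ k ek) (oddℤ l el) = main W eW (k , ek) (l , el)
    aux a@(evenℤ _ _) b@(evenℤ _ _) c@(evenℤ _ _) = ⊥-elim (from-no (+ 4 ℤᵈ.∣? + 2) (res a b c))
    aux a@(evenℤ _ _) b@(evenℤ _ _) c@(oddℤ _ _)  = ⊥-elim (from-no (+ 4 ℤᵈ.∣? - + 1) (res a b c))
    aux a@(evenℤ _ _) b@(oddℤ _ _)  c@(evenℤ _ _) = ⊥-elim (from-no (+ 4 ℤᵈ.∣? - + 1) (res a b c))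
    aux a@(oddℤ _ _)  b@(evenℤ _ _) c@(evenℤ _ _) = ⊥-elim (from-no (+ 4 ℤᵈ.∣? + 1) (res a b c))
    aux a@(oddℤ _ _)  b@(evenℤ _ _) c@(oddℤ _ _)  = ⊥-elim (from-no (+ 4 ℤᵈ.∣? - + 2) (res a b c))
    aux a@(oddℤ _ _)  b@(oddℤ _ _)  c@(evenℤ _ _) = ⊥-elim (from-no (+ 4 ℤᵈ.∣? - + 2) (res a b c))
    aux a@(oddℤ _ _)  b@(oddℤ _ _)  c@(oddℤ _ _)  = ⊥-elim (from-no (+ 4 ℤᵈ.∣? - + 5) (res a b c))

universal : ∀ a b c (i j k : ℤ) → EvenDiff (+ suc a) i → EvenDiff (+ suc b) j → EvenDiff (+ suc c) k →
            (∀ n → Represents (suc a) i (suc b) j (suc c) k n) → Universal (suc a) i (suc b) j (suc c) k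
universal a b c i j k p q r rep = (a , refl) , (b , refl) , (c , refl) , p , q , r , rep

theorem2p2 : Universal 9 (+ 1) 4 (+ 2) 3 (+ 1) × Universal 9 (+ 3) 9 (+ 1) 3 (+ 1) ×
    Universal 9 (+ 5) 4 (+ 2) 4 (+ 2) × Universal 9 (+ 5) 5 (+ 3) 5 (+ 1) ×
    Universal 9 (+ 5) 8 (+ 4) 2 (+ 0) × Universal 9 (+ 5) 9 (+ 3) 3 (+ 1) ×
    Universal 9 (+ 7) 4 (+ 2) 4 (+ 2) × Universal 9 (+ 7) 5 (+ 3) 5 (+ 1) ×
    Universal 9 (+ 7) 8 (+ 4) 2 (+ 0) ×
    Universal 9 (+ 1) 3 (+ 1) 3 (+ 1) × Universal 9 (+ 5) 3 (+ 1) 3 (+ 1) ×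
    Universal 9 (+ 7) 3 (+ 1) 3 (+ 1) ×
    Universal 10 (+ 6) 10 (+ 2) 6 (+ 4)
theorem2p2 =
    universal 8 3 2 _ _ _ (+ 4 , refl) (+ 1 , refl) (+ 1 , refl) (λ n → proj₁ (tuples-193 1 odd-1 3∤1 refl n))
  , universal 8 8 2 _ _ _ (+ 3 , refl) (+ 4 , refl) (+ 1 , refl) (λ n → represents-swap {9} {+ 1} {9} {+ 3} {3} {+ 1} {n} (proj₂ (tuples-193 1 odd-1 3∤1 refl n)))
  , universal 8 3 3 _ _ _ (+ 2 , refl) (+ 1 , refl) (+ 1 , refl) (λ n → proj₁ (tuples-squares 5 odd-5 3∤5 refl n))
  , universal 8 4 4 _ _ _ (+ 2 , refl) (+ 1 , refl) (+ 2 , refl) (λ n → proj₂ (proj₂ (tuples-squares 5 odd-5 3∤5 refl n)))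
  , universal 8 7 1 _ _ _ (+ 2 , refl) (+ 2 , refl) (+ 1 , refl) (λ n → proj₁ (proj₂ (tuples-squares 5 odd-5 3∤5 refl n)))
  , universal 8 8 2 _ _ _ (+ 2 , refl) (+ 3 , refl) (+ 1 , refl) (λ n → proj₂ (tuples-193 5 odd-5 3∤5 refl n))
  , universal 8 3 3 _ _ _ (+ 1 , refl) (+ 1 , refl) (+ 1 , refl) (λ n → proj₁ (tuples-squares 7 odd-7 3∤7 refl n))
  , universal 8 4 4 _ _ _ (+ 1 , refl) (+ 1 , refl) (+ 2 , refl) (λ n → proj₂ (proj₂ (tuples-squares 7 odd-7 3∤7 refl n)))
  , universal 8 7 1 _ _ _ (+ 1 , refl) (+ 2 , refl) (+ 1 , refl) (λ n → proj₁ (proj₂ (tuples-squares 7 odd-7 3∤7 refl n)))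
  , universal 8 2 2 _ _ _ (+ 4 , refl) (+ 1 , refl) (+ 1 , refl) (λ n → tuple-133 1 odd-1 3∤1 n (good-133 (72 ℕ.* n ℕ.+ 7) (residue-72 n 7)))
  , universal 8 2 2 _ _ _ (+ 2 , refl) (+ 1 , refl) (+ 1 , refl) (λ n → tuple-133 5 odd-5 3∤5 n (good-133 (72 ℕ.* n ℕ.+ 31) (residue-72 n 31)))
  , universal 8 2 2 _ _ _ (+ 1 , refl) (+ 1 , refl) (+ 1 , refl) (λ n → tuple-133 7 odd-7 3∤7 n (good-133 (72 ℕ.* n ℕ.+ 55) (residue-72 n 55)))
  , universal 9 9 5 _ _ _ (+ 2 , refl) (+ 4 , refl) (+ 1 , refl) tuple-10
  where
  3∤1 : ¬ + 3 ∣ + 1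
  3∤1 = from-no (+ 3 ℤᵈ.∣? + 1)
  3∤5 : ¬ + 3 ∣ + 5
  3∤5 = from-no (+ 3 ℤᵈ.∣? + 5)
  3∤7 : ¬ + 3 ∣ + 7
  3∤7 = from-no (+ 3 ℤᵈ.∣? + 7)
  odd-5 : Odd (+ 5)
  odd-5 = + 2 , refl
  odd-7 : Odd (+ 7)
  odd-7 = + 3 , refl
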